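{- Fix a root system $\Phi$ of finite or affine type and a Coxeter element $c$. The assignment $(\alpha,\beta)\mapsto(\alpha\|\beta)_c$ on $\Phi_c\times\Phi_c$ is the unique function $f$ satisfying: (P1) $f(-\alpha_i,\beta)=[\beta:\alpha_i]$ for every simple root $\alpha_i$ and $\beta\in\Phi_c$; (P2) $f(\beta,-\alpha_i)=[\beta^\vee:\alpha_i^\vee]$ for every simple root $\alpha_i$ and $\beta\in\Phi_c$; (P3) if $\Phi$ is affine, $f(\alpha,\beta)=(\alpha\|\beta)^\circ_c$ for all $\alpha,\beta\in\Phi_c^{T,\mathrm{re}}$; (P4) if $\Phi$ is affine, $f(\delta,\alpha)=f(\alpha,\delta)=0$ for all $\alpha\in\Phi_c^{T,\mathrm{re}}\cup\{\delta\}$; (P6) $f(\alpha,\beta)=f(\tau_c\alpha,\tau_c\beta)$ for all $\alpha,\beta\in\Phi_c$.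
   Context: Setup. $A=(a_{ij})$ is a symmetrizable Cartan matrix ($d_ia_{ij}=d_ja_{ji}$, $d_i>0$); $V$ real vector space with basis $\Pi=\{\alpha_1,\dots,\alpha_n\}$; $\alpha_i^\vee=d_i^{ -1}\alpha_i$; $[v:\alpha_i]$, $[v:\alpha_i^\vee]$ are coordinates in the bases of simple roots and simple co-roots; $[x]_+=\max(x,0)$. $K$ symmetric bilinear form with $K(\alpha_i^\vee,\alpha_j)=a_{ij}$; $s_i(v)=v-K(\alpha_i^\vee,v)\alpha_i$; $W=\langle s_i\rangle$; $\Phi$ root system, $\Phi^+$ positive roots; for real $\beta$, $\beta^\vee=2\beta/K(\beta,\beta)$. Finite type: $K$ positive definite. Affine type: $K$ positive semidefinite, not definite, positive definite on spans of proper subsets of $\Pi$; imaginary roots are nonzero multiples of $\delta$ (positive imaginary root closest to $0$, spanning $\ker K$, $W$-fixed); $\delta^\vee$ is the positive imaginary root closest to $0$ of the root system of $A^T$ realized in $V$ with simple roots $\alpha_i^\vee$. The Coxeter element is $c=s_1\cdots s_n$ (after reindexing). For a simple reflection $s$ with simple root $\alpha_s$, $\sigma_s$ is the map on $-\Pi\cup\Phi^+$ with $\sigma_s(\alpha)=\alpha$ if $\alpha\in-\Pi\setminus\{ -\alpha_s\}$ and $\sigma_s(\alpha)=s(\alpha)$ otherwise; $\tau_c=\sigma_{s_1}\sigma_{s_2}\cdots\sigma_{s_n}$. In finite type, $\Phi_c=\Phi^+\cup-\Pi$. In affine type: choose $\gamma$ with $(c-1)\gamma=\delta$, $U_c=\{v:K(\gamma,v)=0\}$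 (independent of choice); $\Upsilon_c=\Phi\cap U_c$; $\Pi_c$ the unique minimal subset of $\Upsilon_c\cap\Phi^+$ whose nonnegative span contains $\Upsilon_c\cap\Phi^+$. $\Upsilon_c$ is a union of irreducible components, each an affine type A root system with simple roots the elements of $\Pi_c$ in it; the tube support $\mathrm{Supp}_{\Pi_c}(\beta)$ of a real $\beta\in\Upsilon_c$ is the set of elements of $\Pi_c$ with nonzero coefficient in its unique expansion in its component's simple roots (union for sets); component-full means containing all simple roots of some component. $\Phi_c^{T,\mathrm{re}}$ = positive real roots of $\Upsilon_c$ with non-component-full tube support; $\Phi_c=-\Pi\cup(\Phi^+\setminus U_c)\cup\Phi_c^{T,\mathrm{re}}\cup\{\delta\}$. Compatibility degree. For real $\alpha\in\Upsilon_c$, $\beta_j\in\Pi_c$ is adjacent to $\alpha$ if $\beta_j\in\mathrm{Supp}_{\Pi_c}(c\alpha)\cup\mathrm{Supp}_{\Pi_c}(c^{ -1}\alpha)$ but $\beta_j\notin\mathrm{Supp}_{\Pi_c}(\alpha)$; $\mathrm{adj}(\alpha,\beta)$ is the number of elements of $\Pi_c$ adjacent to $\alpha$ and in $\mathrm{Supp}_{\Pi_c}(\beta)$. For $\alpha,\beta\in\Phi_c^{T,\mathrm{re}}$: $(\alpha\|\beta)^\circ_c=-1$ if $\alpha=\beta$; $0$ if one tube support properly contains the other; $\mathrm{adj}(\alpha,\beta)$ otherwise. For $\alpha,\beta\in\Phi_c$ (with $\delta^\vee$ used for $\alpha=\delta$), $(\alpha\|\beta)_c^{\to}=-\sum_i[\alpha^\vee:\alpha_i^\vee][\beta:\alpha_i]-\sum_{1\le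 j<i\le n}a_{ij}[\alpha^\vee:\alpha_i^\vee]_+[\beta:\alpha_j]_+$ and $(\alpha\|\beta)_c^{\leftarrow}$ the same with second sum over $1\le i<j\le n$. Then $(\alpha\|\beta)_c=\mathrm{adj}(\alpha,\beta)$ if (affine and) $\alpha,\beta\in\Phi_c^{T,\mathrm{re}}$ with $\mathrm{Supp}_{\Pi_c}(\{\alpha,\beta\})$ component-full, and $\max[(\alpha\|\beta)_c^{\to},(\alpha\|\beta)_c^{\leftarrow}]$ otherwise.
   Formalization: The vector space V, the symmetrizing numbers d_i, the vector γ and the values of the function f are taken to be rational instead of real. -}

module Defs where

open import Data.Nat as ℕ using (ℕ; zero; suc)
open import Data.Nat.Divisibility using (_∣_)
open import Data.Integer as ℤ using (ℤ; +_)
open import Data.Rational as ℚ using (ℚ; 0ℚ; 1ℚ; _+_; _*_; -_; _-_; _⊔_; _≤_; _<_; 1/_; ≢-nonZero)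
open import Data.Rational.Properties using (_≟_)
open import Data.Fin as Fin using (Fin; zero; suc; _<?_)
open import Data.Fin.Subset as Sub using (Subset; _∈_; _⊂_; _∪_; _∩_; ∁; ∣_∣)
open import Data.Vec using (Vec; lookup; tabulate; map; zipWith)
open import Data.Vec.Properties using (≡-dec)
open import Data.List using (List; foldr; reverse; allFin)
open import Data.Bool.ListAction using (any)
open import Data.Bool using (Bool; true; false; if_then_else_; _∧_; not)
open import Data.Product using (Σ; ∃; _×_; _,_)
open import Data.Sum using (_⊎_)
open import Data.Unit using (⊤)
open import Data.Empty using (⊥)
open import Relation.Nullary using (¬_; yes; no; Dec)
open import Relation.Nullary.Decidable using (⌊_⌋)
open import Relation.Binary.PropositionalEquality using (_≡_; _≢_)

ℤ→ℚ : ℤ → ℚ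
ℤ→ℚ k = k ℚ./ 1

ℕ→ℚ : ℕ → ℚ
ℕ→ℚ k = (+ k) ℚ./ 1

[_]₊ : ℚ → ℚ
[ x ]₊ = x ⊔ 0ℚ

-- total inverse (1/0 := 0); only ever applied to nonzero numbers
inv : ℚ → ℚ
inv q with q ≟ 0ℚ
... | yes _ = 0ℚ
... | no q≢0 = 1/_ q {{≢-nonZero q≢0}}

∑ : ∀ {n} → (Fin n → ℚ) → ℚ
∑ {zero} f = 0ℚ
∑ {suc n} f = f zero + ∑ (λ i → f (suc i))

-- The setup: n simple roots, Cartan matrix A, symmetrizer d.
-- Vectors of V are recorded by their coordinates in the basis Π of
-- simple roots, i.e. [v : α_i] = lookup v i.

module Setup (n : ℕ) (A : Fin n → Fin n → ℤ) (d : Fin n → ℚ) where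

  V : Set
  V = Vec ℚ n

  a : Fin n → Fin n → ℚ
  a i j = ℤ→ℚ (A i j)

  0V : V
  0V = tabulate (λ _ → 0ℚ)

  αs : Fin n → V
  αs i = tabulate (λ j → if ⌊ i Fin.≟ j ⌋ then 1ℚ else 0ℚ)

  infixl 6 _+V_
  infixl 7 _·V_

  _+V_ : V → V → V
  _+V_ = zipWith _+_

  _·V_ : ℚ → V → V
  q ·V v = map (q *_) v

  -V_ : V → V
  -V v = map -_ v

  -- symmetric bilinear form: K(α_i, α_j) = d_i a_ij  (so K(α_i^∨, α_j) = a_ij)
  K : V → V → ℚ
  K u v = ∑ (λ i → ∑ (λ j → lookup u i * lookup v j * d i * a i j))

  Kᵛ : Fin n → V → ℚ
  Kᵛ i v = ∑ (λ j → a i j * lookup v j)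

  s : Fin n → V → V
  s i v = v +V (- Kᵛ i v) ·V αs i

  cox : V → V
  cox v = foldr s v (allFin n)

  cox⁻¹ : V → V
  cox⁻¹ v = foldr s v (reverse (allFin n))

  _≟V_ : (u v : V) → Dec (u ≡ v)
  _≟V_ = ≡-dec _≟_

  -- σ_{s_i} on -Π ∪ Φ⁺ : fixes -α_j for j ≠ i, acts as s_i otherwise
  σ : Fin n → V → V
  σ i v =
    if any (λ j → not ⌊ i Fin.≟ j ⌋ ∧ ⌊ v ≟V (-V αs j) ⌋) (allFin n)
    then v else s i v

  τ : V → V
  τ v = foldr σ v (allFin n)

  Pos : V → Set
  Pos v = ∀ i → 0ℚ ≤ lookup v i

  data RealRoot : V → Set where
    simple : ∀ i → RealRoot (αs i)
    refl-s : ∀ i {v} → RealRoot v → RealRoot (s i v)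

  record IsSymmetrizableCartan : Set where
    field
      diag     : ∀ i → A i i ≡ + 2
      offdiag  : ∀ i j → i ≢ j → A i j ℤ.≤ + 0
      zero-sym : ∀ i j → A i j ≡ + 0 → A j i ≡ + 0
      d-pos    : ∀ i → 0ℚ < d i
      symm     : ∀ i j → d i * a i j ≡ d j * a j i

  IsFiniteType : Set
  IsFiniteType = ∀ v → v ≢ 0V → 0ℚ < K v v

  -- affine type: K positive semidefinite, not definite, and positive
  -- definite on the span of every proper subset of Π (equivalently on
  -- the span of Π ∖ {α_i} for each i)
  IsAffineType : Set
  IsAffineType =
    (∀ v → 0ℚ ≤ K v v) ×
    (∃ λ v → v ≢ 0V × K v v ≡ 0ℚ) ×
    (∀ i v → lookup v i ≡ 0ℚ → v ≢ 0V → 0ℚ < K v v)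

  -- Affine data: δ, δ^∨, a choice of γ, and Π_c = {Pc 0, …, Pc (m-1)}

  record AffineData : Set where
    field
      δN  : Fin n → ℕ
      δᵛN : Fin n → ℕ       -- coordinates of δ^∨ in the simple coroots α_i^∨
      γ   : V
      m   : ℕ
      Pc  : Fin m → V

  data Kind : Set where
    finite : Kind
    affine : AffineData → Kind

  module Aff (D : AffineData) where
    open AffineData D

    δ : V
    δ = tabulate (λ i → ℕ→ℚ (δN i))

    InΦ : V → Set
    InΦ v = RealRoot v ⊎ (∃ λ (k : ℤ) → k ≢ + 0 × v ≡ ℤ→ℚ k ·V δ)

    InU : V → Set
    InU v = K γ v ≡ 0ℚ

    Υ⁺ : V → Set
    Υ⁺ v = InΦ v × Pos v × InU v

    ∑V : ∀ {k} → (Fin k → V) → V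
    ∑V {zero} f = 0V
    ∑V {suc k} f = f zero +V ∑V (λ i → f (suc i))

    lincomb : (Fin m → ℚ) → V
    lincomb co = ∑V (λ k → co k ·V Pc k)

    SpansWithout : Fin m → Set
    SpansWithout j = ∀ β → Υ⁺ β →
      ∃ λ (co : Fin m → ℚ) → (∀ k → 0ℚ ≤ co k) × co j ≡ 0ℚ × β ≡ lincomb co

    Spans : Set
    Spans = ∀ β → Υ⁺ β →
      ∃ λ (co : Fin m → ℚ) → (∀ k → 0ℚ ≤ co k) × β ≡ lincomb co

    record IsValid : Set where
      field
        δ-pos      : ∀ i → 0 ℕ.< δN i
        δ-prim     : ∀ g → (∀ i → g ∣ δN i) → g ≡ 1
        δ-ker      : ∀ i → Kᵛ i δ ≡ 0ℚ
        δᵛ-pos     : ∀ i → 0 ℕ.< δᵛN i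
        δᵛ-prim    : ∀ g → (∀ i → g ∣ δᵛN i) → g ≡ 1
        δᵛ-ker     : ∀ i → ∑ (λ j → a j i * ℕ→ℚ (δᵛN j)) ≡ 0ℚ
        γ-eq       : cox γ ≡ γ +V δ
        Pc-inj     : ∀ j k → Pc j ≡ Pc k → j ≡ k
        Pc-Υ⁺      : ∀ j → Υ⁺ (Pc j)
        Pc-spans   : Spans
        Pc-minimal : ∀ j → ¬ SpansWithout j

    -- connectivity in Π_c (irreducible components of Υ_c)
    data Conn : Fin m → Fin m → Set where
      here : ∀ j → Conn j j
      step : ∀ {j k l} → Conn j k → K (Pc k) (Pc l) ≢ 0ℚ → Conn j l

    -- S is the tube support of v: the support of the (unique) expansion
    -- of v in the simple roots of one irreducible component of Υ_c
    TSupp : V → Subset m → Set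
    TSupp v S = Σ (Fin m) λ j₀ → Σ (Fin m → ℚ) λ co →
      (∀ k → co k ≢ 0ℚ → Conn j₀ k) ×
      v ≡ lincomb co ×
      (∀ k → (k ∈ S → co k ≢ 0ℚ) × (co k ≢ 0ℚ → k ∈ S))

    ComponentFull : Subset m → Set
    ComponentFull S = ∃ λ j₀ → ∀ k → Conn j₀ k → k ∈ S

    InT : V → Set
    InT v = RealRoot v × Pos v × InU v × ∃ λ S → TSupp v S × ¬ ComponentFull S

    -- adj(α, β), given Supp α, Supp(cα), Supp(c⁻¹α), Supp β
    adj : Subset m → Subset m → Subset m → Subset m → ℚ
    adj Sα Sc Sc' Sβ = ℕ→ℚ ∣ ((Sc ∪ Sc') ∩ ∁ Sα) ∩ Sβ ∣

    CompatCirc : V → V → ℚ → Set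
    CompatCirc α β q = ∃ λ Sα → ∃ λ Sβ → ∃ λ Sc → ∃ λ Sc' →
      TSupp α Sα × TSupp β Sβ × TSupp (cox α) Sc × TSupp (cox⁻¹ α) Sc' ×
      ((α ≡ β × q ≡ - 1ℚ) ⊎
       (α ≢ β × (Sα ⊂ Sβ ⊎ Sβ ⊂ Sα) × q ≡ 0ℚ) ⊎
       (α ≢ β × ¬ (Sα ⊂ Sβ ⊎ Sβ ⊂ Sα) × q ≡ adj Sα Sc Sc' Sβ))

  open AffineData

  Valid : Kind → Set
  Valid finite     = IsFiniteType
  Valid (affine D) = IsAffineType × Aff.IsValid D

  InΦ : Kind → V → Set
  InΦ finite     v = RealRoot v
  InΦ (affine D) v = Aff.InΦ D v

  InΦc : Kind → V → Set
  InΦc finite v = (RealRoot v × Pos v) ⊎ (∃ λ i → v ≡ -V αs i)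
  InΦc (affine D) v =
    (∃ λ i → v ≡ -V αs i) ⊎
    (Aff.InΦ D v × Pos v × ¬ Aff.InU D v) ⊎
    Aff.InT D v ⊎
    v ≡ Aff.δ D

  -- [α^∨ : α_i^∨], with δ^∨ used for α = δ;  α^∨ = 2α / K(α,α)
  corootC : Kind → V → Fin n → ℚ
  corootC finite α i = d i * (ℕ→ℚ 2 * lookup α i) * inv (K α α)
  corootC (affine D) α i with α ≟V Aff.δ D
  ... | yes _ = ℕ→ℚ (δᵛN D i)
  ... | no _  = d i * (ℕ→ℚ 2 * lookup α i) * inv (K α α)

  compat→ : Kind → V → V → ℚ
  compat→ κ α β =
    - ∑ (λ i → corootC κ α i * lookup β i)
    - ∑ (λ i → ∑ (λ j → if ⌊ j <? i ⌋
          then a i j * [ corootC κ α i ]₊ * [ lookup β j ]₊ else 0ℚ))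

  compat← : Kind → V → V → ℚ
  compat← κ α β =
    - ∑ (λ i → corootC κ α i * lookup β i)
    - ∑ (λ i → ∑ (λ j → if ⌊ i <? j ⌋
          then a i j * [ corootC κ α i ]₊ * [ lookup β j ]₊ else 0ℚ))

  compatMax : Kind → V → V → ℚ
  compatMax κ α β = compat→ κ α β ⊔ compat← κ α β

  Compat : Kind → V → V → ℚ → Set
  Compat finite α β q = q ≡ compatMax finite α β
  Compat (affine D) α β q =
    (∃ λ Sα → ∃ λ Sβ → ∃ λ Sc → ∃ λ Sc' →
       Aff.InT D α × Aff.InT D β ×
       Aff.TSupp D α Sα × Aff.TSupp D β Sβ ×
       Aff.TSupp D (cox α) Sc × Aff.TSupp D (cox⁻¹ α) Sc' ×
       Aff.ComponentFull D (Sα ∪ Sβ) × q ≡ Aff.adj D Sα Sc Sc' Sβ)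
    ⊎
    (¬ (Aff.InT D α × Aff.InT D β ×
        ∃ λ Sα → ∃ λ Sβ → Aff.TSupp D α Sα × Aff.TSupp D β Sβ ×
          Aff.ComponentFull D (Sα ∪ Sβ)) ×
     q ≡ compatMax (affine D) α β)

  P1 : Kind → (V → V → ℚ) → Set
  P1 κ f = ∀ i β → InΦc κ β → f (-V αs i) β ≡ lookup β i

  P2 : Kind → (V → V → ℚ) → Set
  P2 κ f = ∀ i β → InΦc κ β → f β (-V αs i) ≡ corootC κ β i

  P3 : Kind → (V → V → ℚ) → Set
  P3 finite     f = ⊤
  P3 (affine D) f = ∀ α β → Aff.InT D α → Aff.InT D β → Aff.CompatCirc D α β (f α β)

  P4 : Kind → (V → V → ℚ) → Set
  P4 finite     f = ⊤
  P4 (affine D) f = ∀ α → (Aff.InT D α ⊎ α ≡ Aff.δ D) →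
    f (Aff.δ D) α ≡ 0ℚ × f α (Aff.δ D) ≡ 0ℚ

  P6 : Kind → (V → V → ℚ) → Set
  P6 κ f = ∀ α β → InΦc κ α → InΦc κ β → f α β ≡ f (τ α) (τ β)

  Props : Kind → (V → V → ℚ) → Set
  Props κ f = P1 κ f × P2 κ f × P3 κ f × P4 κ f × P6 κ f

  AgreesWithCompat : Kind → (V → V → ℚ) → Set
  AgreesWithCompat κ f = ∀ α β → InΦc κ α → InΦc κ β → Compat κ α β (f α β)

{-# OPTIONS --safe #-}
-- Let E be the Euler form of c: it is triangular, K(u,v) = E(u,v) + E(v,u), and E(v, c u) = - E(u,v).
-- Writing p_k = s_1 ⋯ s_{k-1} α_k and q_k = s_n ⋯ s_{k+1} α_k, one has E(v,p_k) = d_k v_k = E(q_k,v),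
-- and τ_c acts by -α_k ↦ p_k, q_k ↦ -α_k, and by c otherwise. On positive roots the maximum of the two
-- compatibility forms is a positive multiple of max(-E(β,α), -E(α,β)), so τ_c-invariance reduces to that of E.
--
-- A root of nonzero defect K(γ,·) (in finite type, any root) reaches -Π under τ_c or its inverse, since
-- otherwise its c-orbit would stay positive forever; this gives uniqueness. For the roots of defect zero
-- the point is that E(b,b′) ≤ 0 for distinct b, b′ ∈ Π_c. If this fails, then E(c b,b) > 0 for some b, and
-- there is a root x of positive defect, minimal in a suitable sense, with E(b,x) = E(c b,x) ≠ 0. The
-- reflection of x in b is orthogonal to b and c b under E and has the form c^t p_k, so a power of c moves b
-- and c b into a proper parabolic subsystem. There one constructs a root ν of defect zero whose position
-- between 0 and a multiple of δ contradicts the minimality of x. Therefore E on Π_c is the Euler form of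
-- a union of oriented cycles, the roots in tubes are arcs of these cycles, and what remains is the
-- combinatorics of arcs.
module Submission where

open import Defs
open import Data.Nat as ℕ using (ℕ; zero; suc)
import Data.Nat.Properties as ℕₚ
open import Data.Nat.Divisibility using (_∣_; divides; 1∣_; ∣m∣n⇒∣m+n; ∣-refl; m∣m*n; n∣m*n; ∣⇒≤; 0∣⇒≡0; *-cancelʳ-∣)
import Data.Nat.Coprimality as Cop
import Data.Fin.Permutation as Perm
open import Data.Nat.LCM using (lcm; m∣lcm[m,n]; n∣lcm[m,n]; lcm-least)
import Data.Nat.GCD as GCD
open import Data.Integer as ℤ using (ℤ; -[1+_]) renaming (+_ to pos)
import Data.Integer.Properties as ℤₚ
open import Data.Rational as ℚ using (ℚ; 0ℚ; 1ℚ; _+_; _*_; -_; _-_; _⊔_; _≤_; _<_; 1/_; ≢-nonZero; mkℚ; toℚᵘ; ↥_; *≤*)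
import Data.Rational.Properties as ℚₚ
import Algebra.Properties.CommutativeMonoid.Sum ℚₚ.+-0-commutativeMonoid as CMSum
open import Data.Rational.Unnormalised as ℚᵘ using (mkℚᵘ; *≡*)
import Data.Rational.Unnormalised.Properties as ℚᵘₚ
open import Data.Rational.Solver
open +-*-Solver using (solve; _:=_; _:+_; _:*_; _:-_; :-_; con)
open import Data.Fin as Fin using (Fin; zero; suc; toℕ)
import Data.Fin.Properties as Finₚ
open import Data.Fin.Subset as Sub using (Subset; _∈_; _∉_; _⊂_; _⊆_; _∪_; _∩_; ∁; ∣_∣)
import Data.Fin.Subset.Properties as Subₚ
open import Data.Vec as Vec using (Vec; lookup; tabulate)
import Data.Vec.Properties as Vecₚ
open import Data.List as List using (List; []; _∷_; _++_; foldr; reverse; allFin)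
import Data.List.Properties as Listₚ
import Data.List.Relation.Unary.Any.Properties as Anyₚ
import Data.Bool.Properties as Boolₚ
import Data.List.Membership.Propositional.Properties as Memₚ
open import Data.Bool.ListAction using (any)
open import Data.List.Relation.Unary.All as All using (All; []; _∷_)
open import Data.List.Relation.Unary.AllPairs using (AllPairs; []; _∷_)
open import Data.List.Relation.Unary.Any as Any using (Any; here; there)
open import Data.Bool as Bool using (Bool; true; false; if_then_else_; _∧_; not)
open import Data.Product using (Σ; ∃; _×_; _,_; proj₁; proj₂)
open import Data.Sum using (_⊎_; inj₁; inj₂; [_,_]′)
open import Data.Unit using (⊤; tt)
open import Data.Empty using (⊥; ⊥-elim)
open import Relation.Nullary using (¬_; yes; no; Dec)
open import Relation.Nullary.Decidable using (⌊_⌋; toSum; ¬?; _×-dec_; _→-dec_)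
open import Relation.Binary.PropositionalEquality using (_≡_; _≢_; refl; sym; trans; cong; cong₂; subst; subst₂; module ≡-Reasoning)
open import Relation.Binary.Definitions using (tri<; tri≈; tri>)
open import Function using (_∘_; id)
open ≡-Reasoning

-- Real roots are handled as `Cand D v`: integral vectors with integral coroot and E(v,v) = D. This
-- numerical form is stable under reflections and under suitable translations by δ, and it makes
-- E(u,v) a multiple of both E(u,u) and E(v,v). The minimality of x is arithmetic and exploits this.
-- Given b with E(b,b) = D, let M be the least positive integer such that translation by Mδ
-- preserves candidates with E(v,v) = D. Then x is chosen so that Dℤ ∩ E(x,x)ℤ consists of multiples
-- of v = M E(δ,x). Since b and Mδ - b are both positive of defect zero, E(b,x) lies between 0 and
-- v, so it is 0 or v. Both values occur along the c-orbit of b, and the reflection is made just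
-- after a jump from 0 to v. Because roots have different lengths, defects have to be compared
-- through such lattices.
--
-- For existence, f must be a total function on vectors, while tube membership quantifies over
-- expansions. Since roots in tubes are 0/1 combinations of Π_c, a search through the finitely many
-- subsets of Π_c decides what is needed.

module Arithmetic where

  -- Ordered-field lemmas, integrality and finite sums over ℚ.

  private variable
    a b c x y z : ℚ

  c0 c1 c2 : ∀ {n} → +-*-Solver.Polynomial n
  c0 = con 0ℚ
  c1 = con 1ℚ
  c2 = con 1ℚ :+ con 1ℚ

  2ℚ : ℚ
  2ℚ = 1ℚ + 1ℚ

  ≡⇒≤ : a ≡ b → a ≤ b
  ≡⇒≤ refl = ℚₚ.≤-refl

  0≤1 : 0ℚ ≤ 1ℚ
  0≤1 = *≤* (ℤ.+≤+ ℕ.z≤n)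

  0<1 : 0ℚ < 1ℚ
  0<1 = ℚ.*<* (ℤ.+<+ (ℕ.s≤s ℕ.z≤n))

  0<2 : 0ℚ < 2ℚ
  0<2 = ℚ.*<* (ℤ.+<+ (ℕ.s≤s ℕ.z≤n))

  +≥0 : 0ℚ ≤ a → 0ℚ ≤ b → 0ℚ ≤ a + b
  +≥0 p q = ℚₚ.+-mono-≤ p q

  +>0 : 0ℚ < a → 0ℚ ≤ b → 0ℚ < a + b
  +>0 p q = ℚₚ.+-mono-<-≤ p q

  ≥+>0 : 0ℚ ≤ a → 0ℚ < b → 0ℚ < a + b
  ≥+>0 p q = ℚₚ.+-mono-≤-< p q

  *≥0 : 0ℚ ≤ a → 0ℚ ≤ b → 0ℚ ≤ a * b
  *≥0 {a} {b} p q = ℚₚ.nonNegative⁻¹ _ {{ℚₚ.nonNeg*nonNeg⇒nonNeg a {{ℚ.nonNegative p}} b {{ℚ.nonNegative q}}}}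

  *>0 : 0ℚ < a → 0ℚ < b → 0ℚ < a * b
  *>0 {a} {b} p q = ℚₚ.positive⁻¹ _ {{ℚₚ.pos*pos⇒pos a {{ℚ.positive p}} b {{ℚ.positive q}}}}

  >⇒≢ : 0ℚ < a → a ≢ 0ℚ
  >⇒≢ p e = ℚₚ.<⇒≢ p (sym e)

  ≥∧≢⇒> : 0ℚ ≤ a → a ≢ 0ℚ → 0ℚ < a
  ≥∧≢⇒> {a} p q with ℚₚ.<-cmp 0ℚ a
  ... | tri< r _ _ = r
  ... | tri≈ _ e _ = ⊥-elim (q (sym e))
  ... | tri> _ _ r = ⊥-elim (q (ℚₚ.≤-antisym (ℚₚ.<⇒≤ r) p))

  <-irr : a < a → ⊥
  <-irr = ℚₚ.<-irrefl refl

  ≤<⊥ : a ≤ b → b < a → ⊥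
  ≤<⊥ p q = <-irr (ℚₚ.≤-<-trans p q)

  -- Inequalities are proved by exhibiting the difference of the two sides.
  by≤ : 0ℚ ≤ c → b - a ≡ c → a ≤ b
  by≤ {c} {b} {a} p e = subst₂ _≤_ (ℚₚ.+-identityʳ a)
    (trans (cong (a +_) (sym e)) (solve 2 (λ a b → a :+ (b :- a) := b) refl a b)) (ℚₚ.+-monoʳ-≤ a p)

  by< : 0ℚ < c → b - a ≡ c → a < b
  by< {c} {b} {a} p e = subst₂ _<_ (ℚₚ.+-identityʳ a)
    (trans (cong (a +_) (sym e)) (solve 2 (λ a b → a :+ (b :- a) := b) refl a b)) (ℚₚ.+-monoʳ-< a p)

  ≤⇒0≤ : a ≤ b → 0ℚ ≤ b - a
  ≤⇒0≤ {a} {b} p = subst (_≤ b - a) (ℚₚ.+-inverseʳ a) (ℚₚ.+-monoˡ-≤ (- a) p)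

  <⇒0< : a < b → 0ℚ < b - a
  <⇒0< {a} {b} p = subst (_< b - a) (ℚₚ.+-inverseʳ a) (ℚₚ.+-monoˡ-< (- a) p)

  ≥0 : c ≡ a → 0ℚ ≤ a → 0ℚ ≤ c
  ≥0 refl p = p

  >0 : c ≡ a → 0ℚ < a → 0ℚ < c
  >0 refl p = p

  nn : 0ℚ ≤ a → c ≡ a → 0ℚ ≤ c
  nn p refl = p

  np : 0ℚ < a → c ≡ a → 0ℚ < c
  np p refl = p

  -≤0 : a ≤ 0ℚ → 0ℚ ≤ - a
  -≤0 = ℚₚ.neg-antimono-≤

  -<0 : a < 0ℚ → 0ℚ < - a
  -<0 = ℚₚ.neg-antimono-<

  -≥0 : 0ℚ ≤ a → - a ≤ 0ℚ
  -≥0 = ℚₚ.neg-antimono-≤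

  ->0 : 0ℚ < a → - a < 0ℚ
  ->0 = ℚₚ.neg-antimono-<

  0≤-⇒≤0 : 0ℚ ≤ - a → a ≤ 0ℚ
  0≤-⇒≤0 {a} p = by≤ p (ℚₚ.+-identityˡ (- a))

  0<-⇒<0 : 0ℚ < - a → a < 0ℚ
  0<-⇒<0 {a} p = by< p (ℚₚ.+-identityˡ (- a))

  *-cancel>0 : 0ℚ < a → 0ℚ < a * b → 0ℚ < b
  *-cancel>0 {a} {b} p q with ℚₚ.<-cmp 0ℚ b
  ... | tri< r _ _ = r
  ... | tri≈ _ refl _ = ⊥-elim (<-irr (subst (0ℚ <_) (ℚₚ.*-zeroʳ a) q))
  ... | tri> _ _ r = ⊥-elim (ℚₚ.<-asym q (0<-⇒<0 (>0 (ℚₚ.neg-distribʳ-* a b) (*>0 p (-<0 r)))))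

  ≥*-cancel>0 : 0ℚ ≤ a → 0ℚ < a * b → 0ℚ < b
  ≥*-cancel>0 {a} {b} p q = *-cancel>0 (≥∧≢⇒> p λ { refl → <-irr (subst (0ℚ <_) (ℚₚ.*-zeroˡ b) q) }) q

  *-cancel≥0 : 0ℚ < a → 0ℚ ≤ a * b → 0ℚ ≤ b
  *-cancel≥0 {a} {b} p q with ℚₚ.<-cmp 0ℚ b
  ... | tri< r _ _ = ℚₚ.<⇒≤ r
  ... | tri≈ _ refl _ = ℚₚ.≤-refl
  ... | tri> _ _ r = ⊥-elim (≤<⊥ q (0<-⇒<0 (>0 (ℚₚ.neg-distribʳ-* a b) (*>0 p (-<0 r)))))

  *-zero⊎ : a * b ≡ 0ℚ → a ≡ 0ℚ ⊎ b ≡ 0ℚ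
  *-zero⊎ {a} {b} e with a ℚₚ.≟ 0ℚ
  ... | yes p = inj₁ p
  ... | no p = inj₂ (begin
    b ≡⟨ sym (ℚₚ.*-identityˡ b) ⟩
    1ℚ * b ≡⟨ cong (_* b) (sym (ℚₚ.*-inverseˡ a {{≢-nonZero p}})) ⟩
    r * a * b ≡⟨ ℚₚ.*-assoc r a b ⟩
    r * (a * b) ≡⟨ cong (r *_) e ⟩
    r * 0ℚ ≡⟨ ℚₚ.*-zeroʳ r ⟩
    0ℚ ∎)
    where r = 1/_ a {{≢-nonZero p}}

  *-cancel0 : a ≢ 0ℚ → a * b ≡ 0ℚ → b ≡ 0ℚ
  *-cancel0 p e with *-zero⊎ e
  ... | inj₁ q = ⊥-elim (p q)
  ... | inj₂ q = q

  a-b≡0⇒a≡b : a - b ≡ 0ℚ → a ≡ b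
  a-b≡0⇒a≡b {a} {b} e = trans (solve 2 (λ a b → a := (a :- b) :+ b) refl a b) (trans (cong (_+ b) e) (ℚₚ.+-identityˡ b))

  a≡b⇒a-b≡0 : a ≡ b → a - b ≡ 0ℚ
  a≡b⇒a-b≡0 {a} refl = ℚₚ.+-inverseʳ a

  *-cancelˡ : a ≢ 0ℚ → a * b ≡ a * c → b ≡ c
  *-cancelˡ {a} {b} {c} p e = a-b≡0⇒a≡b (*-cancel0 p
    (trans (solve 3 (λ a b c → a :* (b :- c) := a :* b :- a :* c) refl a b c) (a≡b⇒a-b≡0 e)))

  sq≥0 : ∀ a → 0ℚ ≤ a * a
  sq≥0 a with ℚₚ.≤-total 0ℚ a
  ... | inj₁ p = *≥0 p p
  ... | inj₂ p = ≥0 (solve 1 (λ a → a :* a := (:- a) :* (:- a)) refl a) (*≥0 (-≤0 p) (-≤0 p))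

  double-cancel : 2ℚ * a ≡ 2ℚ * b → a ≡ b
  double-cancel = *-cancelˡ (>⇒≢ 0<2)

  double-≥0 : 0ℚ ≤ 2ℚ * a → 0ℚ ≤ a
  double-≥0 = *-cancel≥0 0<2

  inv-* : a ≢ 0ℚ → inv a * a ≡ 1ℚ
  inv-* {a} p with a ℚₚ.≟ 0ℚ
  ... | yes q = ⊥-elim (p q)
  ... | no q = ℚₚ.*-inverseˡ a {{≢-nonZero q}}

  inv>0 : 0ℚ < a → 0ℚ < inv a
  inv>0 {a} p = *-cancel>0 p (subst (0ℚ <_) (sym (trans (ℚₚ.*-comm a (inv a)) (inv-* (>⇒≢ p)))) 0<1)

  private
    ℤ→ℚᵘ : ∀ k → toℚᵘ (ℤ→ℚ k) ℚᵘ.≃ mkℚᵘ k 0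
    ℤ→ℚᵘ k = ℚₚ.toℚᵘ-fromℚᵘ (mkℚᵘ k 0)

  ℤ→ℚ-+ : ∀ j k → ℤ→ℚ (j ℤ.+ k) ≡ ℤ→ℚ j + ℤ→ℚ k
  ℤ→ℚ-+ j k = ℚₚ.toℚᵘ-injective (ℚᵘₚ.≃-trans (ℤ→ℚᵘ (j ℤ.+ k)) (ℚᵘₚ.≃-trans
    (*≡* (cong₂ ℤ._*_ (cong₂ ℤ._+_ (sym (ℤₚ.*-identityʳ j)) (sym (ℤₚ.*-identityʳ k))) refl))
    (ℚᵘₚ.≃-sym (ℚᵘₚ.≃-trans (ℚₚ.toℚᵘ-homo-+ (ℤ→ℚ j) (ℤ→ℚ k)) (ℚᵘₚ.+-cong (ℤ→ℚᵘ j) (ℤ→ℚᵘ k))))))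

  ℤ→ℚ-* : ∀ j k → ℤ→ℚ (j ℤ.* k) ≡ ℤ→ℚ j * ℤ→ℚ k
  ℤ→ℚ-* j k = ℚₚ.toℚᵘ-injective (ℚᵘₚ.≃-trans (ℤ→ℚᵘ (j ℤ.* k)) (ℚᵘₚ.≃-sym
    (ℚᵘₚ.≃-trans (ℚₚ.toℚᵘ-homo-* (ℤ→ℚ j) (ℤ→ℚ k)) (ℚᵘₚ.*-cong (ℤ→ℚᵘ j) (ℤ→ℚᵘ k)))))

  ℤ→ℚ-neg : ∀ k → ℤ→ℚ (ℤ.- k) ≡ - ℤ→ℚ k
  ℤ→ℚ-neg k = ℚₚ.toℚᵘ-injective (ℚᵘₚ.≃-trans (ℤ→ℚᵘ (ℤ.- k)) (ℚᵘₚ.≃-sym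
    (ℚᵘₚ.≃-trans (ℚₚ.toℚᵘ-homo‿- (ℤ→ℚ k)) (ℚᵘₚ.-‿cong (ℤ→ℚᵘ k)))))

  ℤ→ℚ-mono-≤ : ∀ {j k} → j ℤ.≤ k → ℤ→ℚ j ≤ ℤ→ℚ k
  ℤ→ℚ-mono-≤ {j} {k} p = ℚₚ.toℚᵘ-cancel-≤ (ℚᵘₚ.≤-respˡ-≃ (ℚᵘₚ.≃-sym (ℤ→ℚᵘ j))
    (ℚᵘₚ.≤-respʳ-≃ (ℚᵘₚ.≃-sym (ℤ→ℚᵘ k)) (ℚᵘ.*≤* (ℤₚ.*-monoʳ-≤-nonNeg (pos 1) p))))

  ℤ→ℚ-mono-< : ∀ {j k} → j ℤ.< k → ℤ→ℚ j < ℤ→ℚ k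
  ℤ→ℚ-mono-< {j} {k} p = ℚₚ.toℚᵘ-cancel-< (ℚᵘₚ.<-respˡ-≃ (ℚᵘₚ.≃-sym (ℤ→ℚᵘ j))
    (ℚᵘₚ.<-respʳ-≃ (ℚᵘₚ.≃-sym (ℤ→ℚᵘ k)) (ℚᵘ.*<* (ℤₚ.*-monoʳ-<-pos (pos 1) p))))

  ℤ→ℚ-cancel-≤ : ∀ {j k} → ℤ→ℚ j ≤ ℤ→ℚ k → j ℤ.≤ k
  ℤ→ℚ-cancel-≤ {j} {k} p with k ℤₚ.<? j
  ... | yes q = ⊥-elim (≤<⊥ p (ℤ→ℚ-mono-< q))
  ... | no q = ℤₚ.≮⇒≥ q

  ℤ→ℚ-cancel-< : ∀ {j k} → ℤ→ℚ j < ℤ→ℚ k → j ℤ.< k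
  ℤ→ℚ-cancel-< {j} {k} p with k ℤₚ.≤? j
  ... | yes q = ⊥-elim (≤<⊥ (ℤ→ℚ-mono-≤ q) p)
  ... | no q = ℤₚ.≰⇒> q

  ℤ→ℚ-inj : ∀ {j k} → ℤ→ℚ j ≡ ℤ→ℚ k → j ≡ k
  ℤ→ℚ-inj e = ℤₚ.≤-antisym (ℤ→ℚ-cancel-≤ (≡⇒≤ e)) (ℤ→ℚ-cancel-≤ (≡⇒≤ (sym e)))

  ℕ→ℚ-suc : ∀ k → ℕ→ℚ (suc k) ≡ 1ℚ + ℕ→ℚ k
  ℕ→ℚ-suc k = ℤ→ℚ-+ (pos 1) (pos k)

  ℕ→ℚ≥0 : ∀ k → 0ℚ ≤ ℕ→ℚ k
  ℕ→ℚ≥0 k = ℤ→ℚ-mono-≤ {pos 0} {pos k} (ℤ.+≤+ ℕ.z≤n)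

  -- The subgroup Dℤ of ℚ. Integrality of a coroot is expressed through it, as `d i * v ! i` ∈ Dℤ,
  -- so that no division by the norm occurs.
  Mul : ℚ → ℚ → Set
  Mul D x = ∃ λ k → x ≡ ℤ→ℚ k * D

  Int : ℚ → Set
  Int x = ∃ λ k → x ≡ ℤ→ℚ k

  private variable
    D D′ : ℚ

  mul-0 : Mul D 0ℚ
  mul-0 {D} = pos 0 , sym (ℚₚ.*-zeroˡ D)

  mul-self : Mul D D
  mul-self {D} = pos 1 , sym (ℚₚ.*-identityˡ D)

  mul-+ : Mul D x → Mul D y → Mul D (x + y)
  mul-+ {D} (j , refl) (k , refl) = j ℤ.+ k ,
    trans (sym (ℚₚ.*-distribʳ-+ D (ℤ→ℚ j) (ℤ→ℚ k))) (cong (_* D) (sym (ℤ→ℚ-+ j k)))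

  mul-neg : Mul D x → Mul D (- x)
  mul-neg {D} (j , refl) = ℤ.- j , trans (ℚₚ.neg-distribˡ-* (ℤ→ℚ j) D) (cong (_* D) (sym (ℤ→ℚ-neg j)))

  mul-- : Mul D x → Mul D y → Mul D (x - y)
  mul-- p q = mul-+ p (mul-neg q)

  int-* : Int x → Int y → Int (x * y)
  int-* (j , refl) (k , refl) = j ℤ.* k , sym (ℤ→ℚ-* j k)

  int-+ : Int x → Int y → Int (x + y)
  int-+ (j , refl) (k , refl) = j ℤ.+ k , sym (ℤ→ℚ-+ j k)

  int-neg : Int x → Int (- x)
  int-neg (j , refl) = ℤ.- j , sym (ℤ→ℚ-neg j)

  int-- : Int x → Int y → Int (x - y)
  int-- p q = int-+ p (int-neg q)

  int-0 : Int 0ℚ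
  int-0 = pos 0 , refl

  int-1 : Int 1ℚ
  int-1 = pos 1 , refl

  mul-*int : Mul D x → Int y → Mul D (x * y)
  mul-*int {D} (j , refl) (k , refl) = j ℤ.* k ,
    trans (solve 3 (λ j D k → (j :* D) :* k := (j :* k) :* D) refl (ℤ→ℚ j) D (ℤ→ℚ k)) (cong (_* D) (sym (ℤ→ℚ-* j k)))

  int*-mul : Int x → Mul D y → Mul D (x * y)
  int*-mul {x} {D} {y} p q = subst (Mul D) (ℚₚ.*-comm y x) (mul-*int q p)

  mul-trans : Mul D x → Mul D′ D → Mul D′ x
  mul-trans (j , refl) q = int*-mul (j , refl) q

  mul-scale : ∀ t → Mul D x → Mul (t * D) (t * x)
  mul-scale {D} t (j , refl) = j , solve 3 (λ t j D → t :* (j :* D) := j :* (t :* D)) refl t (ℤ→ℚ j) D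

  mul-quot : Mul D x → ∃ λ p → Int p × p * D ≡ x
  mul-quot (k , e) = ℤ→ℚ k , (k , refl) , sym e

  mul>0 : 0ℚ < D → Mul D x → 0ℚ < x → D ≤ x
  mul>0 {D} p (k , refl) q with ℤ→ℚ-cancel-< {pos 0} {k} (*-cancel>0 p (subst (0ℚ <_) (ℚₚ.*-comm (ℤ→ℚ k) D) q))
  ... | r = by≤ (*≥0 (≤⇒0≤ (ℤ→ℚ-mono-≤ (ℤₚ.i<j⇒suc[i]≤j r))) (ℚₚ.<⇒≤ p))
    (solve 2 (λ k D → k :* D :- D := (k :- con 1ℚ) :* D) refl (ℤ→ℚ k) D)

  int>0 : Int x → 0ℚ < x → 1ℚ ≤ x
  int>0 (k , refl) q = ℤ→ℚ-mono-≤ (ℤₚ.i<j⇒suc[i]≤j (ℤ→ℚ-cancel-< {pos 0} {k} q))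

  int≥0 : Int x → 0ℚ ≤ x → ∃ λ k → x ≡ ℕ→ℚ k
  int≥0 (pos k , refl) q = k , refl
  int≥0 (-[1+ k ] , refl) q with ℤ→ℚ-cancel-≤ {j = pos 0} {k = -[1+ k ]} q
  ... | ()

  arch : ∀ q → ∃ λ N → q ≤ ℕ→ℚ N
  arch (mkℚ m d-1 _) = N , ℚₚ.toℚᵘ-cancel-≤ (ℚᵘₚ.≤-respʳ-≃ (ℚᵘₚ.≃-sym (ℤ→ℚᵘ (pos N))) (ℚᵘ.*≤*
    (ℤₚ.≤-trans (ℤₚ.≤-reflexive (ℤₚ.*-identityʳ m))
    (ℤₚ.≤-trans (m≤∣m∣ m) (ℤₚ.≤-trans (ℤ.+≤+ (ℕₚ.m≤m*n N (suc d-1))) (ℤₚ.≤-reflexive (ℤₚ.pos-* N (suc d-1))))))))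
    where
    N = ℤ.∣ m ∣
    m≤∣m∣ : ∀ m → m ℤ.≤ pos ℤ.∣ m ∣
    m≤∣m∣ (pos m) = ℤₚ.≤-refl
    m≤∣m∣ -[1+ m ] = ℤ.-≤+

  private variable
    n : ℕ
    f g : Fin n → ℚ

  ∑-cong : (∀ i → f i ≡ g i) → ∑ f ≡ ∑ g
  ∑-cong {zero} h = refl
  ∑-cong {suc n} h = cong₂ _+_ (h zero) (∑-cong (λ i → h (suc i)))

  ∑-0 : ∀ n → ∑ {n} (λ _ → 0ℚ) ≡ 0ℚ
  ∑-0 zero = refl
  ∑-0 (suc n) = trans (ℚₚ.+-identityˡ _) (∑-0 n)

  ∑-+ : ∀ {n} (f g : Fin n → ℚ) → ∑ (λ i → f i + g i) ≡ ∑ f + ∑ g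
  ∑-+ {zero} f g = refl
  ∑-+ {suc n} f g = trans (cong (_+_ (f zero + g zero)) (∑-+ (λ i → f (suc i)) (λ i → g (suc i))))
    (solve 4 (λ a b c d → (a :+ b) :+ (c :+ d) := (a :+ c) :+ (b :+ d)) refl (f zero) (g zero) (∑ (λ i → f (suc i))) (∑ (λ i → g (suc i))))

  ∑-* : ∀ {n} q (f : Fin n → ℚ) → ∑ (λ i → q * f i) ≡ q * ∑ f
  ∑-* {zero} q f = sym (ℚₚ.*-zeroʳ q)
  ∑-* {suc n} q f = trans (cong (_+_ (q * f zero)) (∑-* q (λ i → f (suc i)))) (sym (ℚₚ.*-distribˡ-+ q (f zero) _))

  ∑-neg : ∀ {n} (f : Fin n → ℚ) → ∑ (λ i → - f i) ≡ - ∑ f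
  ∑-neg {zero} f = refl
  ∑-neg {suc n} f = trans (cong (_+_ (- f zero)) (∑-neg (λ i → f (suc i)))) (sym (ℚₚ.neg-distrib-+ (f zero) _))

  ∑-swap : ∀ {m n} (f : Fin m → Fin n → ℚ) → ∑ (λ i → ∑ (f i)) ≡ ∑ (λ j → ∑ (λ i → f i j))
  ∑-swap {zero} {n} f = sym (∑-0 n)
  ∑-swap {suc m} {n} f = trans (cong (∑ (f zero) +_) (∑-swap (λ i → f (suc i)))) (sym (∑-+ (f zero) _))

  ∑-≥0 : (∀ i → 0ℚ ≤ f i) → 0ℚ ≤ ∑ f
  ∑-≥0 {zero} h = ℚₚ.≤-refl
  ∑-≥0 {suc n} h = +≥0 (h zero) (∑-≥0 (λ i → h (suc i)))

  ∑-zero : (∀ i → f i ≡ 0ℚ) → ∑ f ≡ 0ℚ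
  ∑-zero {n} h = trans (∑-cong h) (∑-0 n)

  ∑-single : ∀ {n} (f : Fin n → ℚ) k → (∀ i → i ≢ k → f i ≡ 0ℚ) → ∑ f ≡ f k
  ∑-single f zero h = trans (cong (f zero +_) (∑-zero (λ i → h (suc i) λ ()))) (ℚₚ.+-identityʳ _)
  ∑-single f (suc k) h = trans (cong₂ _+_ (h zero λ ()) (∑-single (λ i → f (suc i)) k (λ i p → h (suc i) (λ e → p (Finₚ.suc-injective e)))))
    (ℚₚ.+-identityˡ _)

  ∑-term≤ : ∀ {n} (f : Fin n → ℚ) k → (∀ i → 0ℚ ≤ f i) → f k ≤ ∑ f
  ∑-term≤ f zero h = by≤ (∑-≥0 (λ i → h (suc i))) (solve 2 (λ a b → (a :+ b) :- a := b) refl (f zero) _)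
  ∑-term≤ f (suc k) h = ℚₚ.≤-trans (∑-term≤ (λ i → f (suc i)) k (λ i → h (suc i)))
    (by≤ (h zero) (solve 2 (λ a b → (a :+ b) :- b := a) refl (f zero) _))

  ∑-zero⁻¹ : ∀ {n} (f : Fin n → ℚ) → (∀ i → 0ℚ ≤ f i) → ∑ f ≡ 0ℚ → ∀ i → f i ≡ 0ℚ
  ∑-zero⁻¹ f h e i = ℚₚ.≤-antisym (subst (f i ≤_) e (∑-term≤ f i h)) (h i)

  ∑-pos : ∀ {n} (f : Fin n → ℚ) → 0ℚ < ∑ f → ∃ λ i → 0ℚ < f i
  ∑-pos {n} f p with Finₚ.any? (λ i → 0ℚ ℚₚ.<? f i)
  ... | yes q = q
  ... | no q = ⊥-elim (≤<⊥ (0≤-⇒≤0 (≥0 (sym (∑-neg f)) (∑-≥0 (λ i → -≤0 (ℚₚ.≮⇒≥ (λ r → q (i , r))))))) p)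

  ∑-int : (∀ i → Int (f i)) → Int (∑ f)
  ∑-int {zero} h = int-0
  ∑-int {suc n} h = int-+ (h zero) (∑-int (λ i → h (suc i)))

  ∑-mul : ∀ {D n} {f : Fin n → ℚ} → (∀ i → Mul D (f i)) → Mul D (∑ f)
  ∑-mul {n = zero} h = mul-0
  ∑-mul {n = suc n} h = mul-+ (h zero) (∑-mul (λ i → h (suc i)))

  ∑-lin : ∀ {n} (f : Fin n → ℚ) q (g : Fin n → ℚ) {h : Fin n → ℚ} → (∀ i → h i ≡ f i + q * g i) → ∑ h ≡ ∑ f + q * ∑ g
  ∑-lin f q g p = trans (∑-cong p) (trans (∑-+ f (λ i → q * g i)) (cong (∑ f +_) (∑-* q g)))

  ∑-scale : ∀ {n} q (g : Fin n → ℚ) {h : Fin n → ℚ} → (∀ i → h i ≡ q * g i) → ∑ h ≡ q * ∑ g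
  ∑-scale q g p = trans (∑-cong p) (∑-* q g)

  0ˡ : ∀ {x} y → x ≡ 0ℚ → x * y ≡ 0ℚ
  0ˡ y refl = ℚₚ.*-zeroˡ y

  0ʳ : ∀ x {y} → y ≡ 0ℚ → x * y ≡ 0ℚ
  0ʳ x refl = ℚₚ.*-zeroʳ x

  1ˡ : ∀ {x} y → x ≡ 1ℚ → x * y ≡ y
  1ˡ y refl = ℚₚ.*-identityˡ y

  1ʳ : ∀ x {y} → y ≡ 1ℚ → x * y ≡ x
  1ʳ x refl = ℚₚ.*-identityʳ x

  -- A copy of ℕ→ℚ that does not unfold, since ℕ→ℚ (suc k) normalises through a gcd computation.
  opaque
    ι : ℕ → ℚ
    ι = ℕ→ℚ

    ι≡ : ∀ k → ι k ≡ ℕ→ℚ k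
    ι≡ k = refl

    ι-0 : ι 0 ≡ 0ℚ
    ι-0 = refl

    ι-suc : ∀ k → ι (suc k) ≡ 1ℚ + ι k
    ι-suc k = ℕ→ℚ-suc k

    ι≥0 : ∀ k → 0ℚ ≤ ι k
    ι≥0 = ℕ→ℚ≥0

    archι : ∀ q → ∃ λ N → q ≤ ι N
    archι = arch

    ι-int : ∀ k → Int (ι k)
    ι-int k = pos k , refl

    int-ι : ∀ {x} → Int x → 0ℚ ≤ x → ∃ λ k → x ≡ ι k
    int-ι = int≥0

    ι-mono-< : ∀ {j k} → j ℕ.< k → ι j < ι k
    ι-mono-< {j} {k} p = ℤ→ℚ-mono-< {pos j} {pos k} (ℤ.+<+ p)

    ι-cancel-< : ∀ {j k} → ι j < ι k → j ℕ.< k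
    ι-cancel-< {j} {k} p = ℤₚ.drop‿+<+ (ℤ→ℚ-cancel-< {pos j} {pos k} p)

    ι-inj : ∀ {j k} → ι j ≡ ι k → j ≡ k
    ι-inj {j} {k} e = ℤₚ.+-injective (ℤ→ℚ-inj {pos j} {pos k} e)

    ι-+ : ∀ j k → ι (j ℕ.+ k) ≡ ι j + ι k
    ι-+ j k = ℤ→ℚ-+ (pos j) (pos k)

    ι-* : ∀ j k → ι (j ℕ.* k) ≡ ι j * ι k
    ι-* j k = trans (cong ℤ→ℚ (ℤₚ.pos-* j k)) (ℤ→ℚ-* (pos j) (pos k))

open Arithmetic

-- Denominators, intersections of cyclic subgroups of ℚ, and small numerical case splits.

inv-double : ∀ {D} → 0ℚ < D → 2ℚ * inv (2ℚ * D) ≡ inv D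
inv-double {D} p = *-cancelˡ (>⇒≢ p) (trans (solve 2 (λ D r → D :* (c2 :* r) := r :* (c2 :* D)) refl D (inv (2ℚ * D)))
  (trans (inv-* (>⇒≢ (*>0 0<2 p))) (sym (trans (ℚₚ.*-comm D (inv D)) (inv-* (>⇒≢ p))))))

private
  ∣-int : ∀ {N} k → N ∣ ℤ.∣ k ∣ → ∃ λ j → k ≡ j ℤ.* pos N
  ∣-int {N} (pos a) (divides q e) = pos q , trans (cong pos e) (ℤₚ.pos-* q N)
  ∣-int {N} -[1+ a ] (divides q e) = ℤ.- pos q , trans (cong (λ z → ℤ.- pos z) e) (trans (cong ℤ.-_ (ℤₚ.pos-* q N)) (ℤₚ.neg-distribˡ-* (pos q) (pos N)))

  cross : ∀ x → ι (ℚ.↧ₙ x) * x ≡ ℤ→ℚ (↥ x)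
  cross x = trans (cong (_* x) (ι≡ (ℚ.↧ₙ x))) (ℚₚ.toℚᵘ-injective (ℚᵘₚ.≃-trans (ℚₚ.toℚᵘ-homo-* (ℕ→ℚ (ℚ.↧ₙ x)) x) (ℚᵘₚ.≃-trans
    (ℚᵘₚ.*-congʳ {toℚᵘ x} (ℚₚ.toℚᵘ-fromℚᵘ (mkℚᵘ (pos (ℚ.↧ₙ x)) 0))) (ℚᵘₚ.≃-trans (eq x) (ℚᵘₚ.≃-sym (ℚₚ.toℚᵘ-fromℚᵘ (mkℚᵘ (↥ x) 0)))))))
    where
    eq : ∀ x → (mkℚᵘ (pos (ℚ.↧ₙ x)) 0 ℚᵘ.* toℚᵘ x) ℚᵘ.≃ mkℚᵘ (↥ x) 0
    eq (mkℚ a b-1 _) = *≡* (trans (ℤₚ.*-identityʳ (pos (suc b-1) ℤ.* a)) (trans (ℤₚ.*-comm (pos (suc b-1)) a) (cong (λ z → a ℤ.* pos z) (sym (ℕₚ.*-identityˡ (suc b-1))))))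

-- The least common denominator of a family. `least` is a divisibility, not an inequality, because
-- the minimal weight is later shown to be 1 by dividing it out of such an `N`.
record Denominator {k} (f : Fin k → ℚ) : Set where
  field
    N     : ℕ
    N>0   : 0 ℕ.< N
    clears : ∀ i → Int (ι N * f i)
    least : ∀ M → (∀ i → Int (ι M * f i)) → N ∣ M

abstract
  den : ∀ (x : ℚ) → ∃ λ N → 0 ℕ.< N × Int (ι N * x) × (∀ k → Int (ℤ→ℚ k * x) → N ∣ ℤ.∣ k ∣)
  den x@(mkℚ a b-1 cop) = suc b-1 , ℕ.s≤s ℕ.z≤n , (a , cross x) , λ k (j , e) → Cop.coprime-divisor (Cop.sym (Cop.recompute cop))
      (divides ℤ.∣ j ∣ (trans (ℕₚ.*-comm ℤ.∣ a ∣ ℤ.∣ k ∣) (trans (sym (ℤₚ.abs-* k a)) (trans (cong ℤ.∣_∣ (eq k j e)) (ℤₚ.abs-* j (pos (suc b-1)))))))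
    where
    eq : ∀ k j → ℤ→ℚ k * x ≡ ℤ→ℚ j → k ℤ.* a ≡ j ℤ.* pos (suc b-1)
    eq k j e = ℤ→ℚ-inj (trans (ℤ→ℚ-* k a) (trans (cong (ℤ→ℚ k *_) (sym (cross x))) (trans (solve 3 (λ k n x → k :* (n :* x) := (k :* x) :* n) refl (ℤ→ℚ k) (ι (suc b-1)) x)
      (trans (cong₂ _*_ e (ι≡ (suc b-1))) (sym (ℤ→ℚ-* j (pos (suc b-1))))))))

  denominator : ∀ {k} (f : Fin k → ℚ) → Denominator f
  denominator {zero} f = record { N = 1 ; N>0 = ℕ.s≤s ℕ.z≤n ; clears = λ () ; least = λ M _ → 1∣ M }
  denominator {suc k} f with den (f zero) | denominator (f ∘ suc)
  ... | N₀ , p₀ , c₀′ , l₀ | record { N = N₁ ; N>0 = p₁ ; clears = c₁′ ; least = l₁ } = record { N = lcm N₀ N₁ ; N>0 = lcm>0 ; clears = cl ; least = ls }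
    where
    lcm>0 : 0 ℕ.< lcm N₀ N₁
    lcm>0 with lcm N₀ N₁ in e
    ... | suc _ = ℕ.s≤s ℕ.z≤n
    ... | zero = ⊥-elim ([ (λ { refl → ℕₚ.<-irrefl refl p₀ }) , (λ { refl → ℕₚ.<-irrefl refl p₁ }) ]′
          (ℕₚ.m*n≡0⇒m≡0∨n≡0 N₀ (0∣⇒≡0 (subst (_∣ N₀ ℕ.* N₁) e (lcm-least {N₀} {N₁} (m∣m*n N₁) (n∣m*n N₀))))))
    scale : ∀ {N M} x → N ∣ M → Int (ι N * x) → Int (ι M * x)
    scale {N} x (divides q refl) i = subst Int (sym (trans (cong (_* x) (ι-* q N)) (ℚₚ.*-assoc (ι q) (ι N) x))) (int-* (ι-int q) i)
    cl : ∀ i → Int (ι (lcm N₀ N₁) * f i)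
    cl zero = scale (f zero) (m∣lcm[m,n] N₀ N₁) c₀′
    cl (suc i) = scale (f (suc i)) (n∣lcm[m,n] N₀ N₁) (c₁′ i)
    ls : ∀ M → (∀ i → Int (ι M * f i)) → lcm N₀ N₁ ∣ M
    ls M h = lcm-least (l₀ (pos M) (subst (λ z → Int (z * f zero)) (ι≡ M) (h zero))) (l₁ M (h ∘ suc))

-- `λ₀` is the positive generator of Dℤ ∩ D′ℤ, the group that contains E(u,v) when E(u,u) = D and
-- E(v,v) = D′ for candidates u and v.
record Generator (D D′ λ₀ : ℚ) : Set where
  field
    gen>0 : 0ℚ < λ₀
    genˡ  : Mul D λ₀
    genʳ  : Mul D′ λ₀
    gens  : ∀ {y} → Mul D y → Mul D′ y → Mul λ₀ y

abstract
  -- A multiple k D′ lies in Dℤ exactly when k D′/D is an integer, so N D′ generates the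
  -- intersection for N the denominator of D′/D.
  generator : ∀ {D D′} → 0ℚ < D → 0ℚ < D′ → ∃ λ λ₀ → Generator D D′ λ₀
  generator {D} {D′} p p′ = go (den (D′ * inv D))
    where
    intD : ∀ {k} → Int (k * (D′ * inv D)) → Mul D (k * D′)
    intD {k} (j , e) = j , trans (sym (1ʳ (k * D′) (inv-* (>⇒≢ p)))) (trans (solve 4 (λ k D′ r D → k :* D′ :* (r :* D) := k :* (D′ :* r) :* D) refl k D′ (inv D) D) (cong (_* D) e))
    Dint : ∀ {k} → Mul D (k * D′) → Int (k * (D′ * inv D))
    Dint {k} (j , e) = j , trans (sym (ℚₚ.*-assoc k D′ (inv D))) (trans (cong (_* inv D) e) (trans (solve 3 (λ j D r → j :* D :* r := j :* (r :* D)) refl (ℤ→ℚ j) D (inv D)) (1ʳ (ℤ→ℚ j) (inv-* (>⇒≢ p)))))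
    go : (∃ λ N → 0 ℕ.< N × Int (ι N * (D′ * inv D)) × (∀ k → Int (ℤ→ℚ k * (D′ * inv D)) → N ∣ ℤ.∣ k ∣)) → ∃ λ λ₀ → Generator D D′ λ₀
    go (N , N>0 , c , l) = ι N * D′ , record { gen>0 = *>0 (subst (_< ι N) ι-0 (ι-mono-< N>0)) p′ ; genˡ = intD {ι N} c ; genʳ = pos N , cong (_* D′) (ι≡ N) ; gens = g }
      where
      g : ∀ {y} → Mul D y → Mul D′ y → Mul (ι N * D′) y
      g {y} m (k , refl) = let j , e = ∣-int {N} k (l k (Dint {ℤ→ℚ k} m)) in
        j , trans (cong (λ z → ℤ→ℚ z * D′) e) (trans (cong (_* D′) (trans (ℤ→ℚ-* j (pos N)) (cong (ℤ→ℚ j *_) (sym (ι≡ N))))) (ℚₚ.*-assoc (ℤ→ℚ j) (ι N) D′))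

mul-pos : ∀ {D x} → 0ℚ < D → 0ℚ < x → Mul D x → ∃ λ j → 0 ℕ.< j × x ≡ ι j * D
mul-pos {D} {x} p q (k , e) = go (int-ι (k , refl) (ℚₚ.<⇒≤ k>0))
  where
  k>0 : 0ℚ < ℤ→ℚ k
  k>0 = *-cancel>0 p (np q (trans (ℚₚ.*-comm D (ℤ→ℚ k)) (sym e)))
  go : (∃ λ j → ℤ→ℚ k ≡ ι j) → ∃ λ j → 0 ℕ.< j × x ≡ ι j * D
  go (j , e′) = j , ι-cancel-< (subst₂ _<_ (sym ι-0) e′ k>0) , trans e (cong (_* D) e′)

-- For D′ = qD the intersections are nested both ways: D₀ℤ ∩ D′ℤ ⊆ D₀ℤ ∩ Dℤ with index j, and q (D₀ℤ
-- ∩ Dℤ) ⊆ D₀ℤ ∩ D′ℤ with index i. Composing the inclusions gives multiplication by q.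
generator-ratio : ∀ {D₀ D D′ l l′} q → 0 ℕ.< q → D′ ≡ ι q * D → Generator D₀ D l → Generator D₀ D′ l′ →
  ∃ λ i → ∃ λ j → i ℕ.* j ≡ q × l′ ≡ ι j * l × ι q * l ≡ ι i * l′
generator-ratio {D₀} {D} {D′} {l} {l′} q q>0 refl G G′ = go (mul-pos G.gen>0 G′.gen>0 (G.gens G′.genˡ (mul-trans G′.genʳ (pos q , cong (_* D) (ι≡ q)))))
     (mul-pos G′.gen>0 (*>0 ιq>0 G.gen>0) (G′.gens (int*-mul (ι-int q) G.genˡ) (mul-scale (ι q) G.genʳ)))
  where
  module G = Generator G
  module G′ = Generator G′
  ιq>0 : 0ℚ < ι q
  ιq>0 = subst (_< ι q) ι-0 (ι-mono-< q>0)
  go : (∃ λ j → 0 ℕ.< j × l′ ≡ ι j * l) → (∃ λ i → 0 ℕ.< i × ι q * l ≡ ι i * l′) → ∃ λ i → ∃ λ j → i ℕ.* j ≡ q × l′ ≡ ι j * l × ι q * l ≡ ι i * l′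
  go (j , _ , ej) (i , _ , ei) = i , j , ι-inj (*-cancelˡ (>⇒≢ G.gen>0) (trans (cong (l *_) (ι-* i j))
    (trans (solve 3 (λ l i j → l :* (i :* j) := i :* (j :* l)) refl l (ι i) (ι j)) (trans (cong (ι i *_) (sym ej)) (trans (sym ei) (ℚₚ.*-comm (ι q) l)))))) , ej , ei

private
  small-factor : ∀ i j q → 0 ℕ.< q → q ℕ.≤ 3 → i ℕ.* j ≡ q → i ≡ 1 ⊎ j ≡ 1
  small-factor zero j q p _ refl = ⊥-elim (ℕₚ.<-irrefl refl p)
  small-factor (suc zero) j q _ _ _ = inj₁ refl
  small-factor (suc (suc i)) zero q p _ e = ⊥-elim (ℕₚ.<-irrefl refl (subst (0 ℕ.<_) (trans (sym e) (ℕₚ.*-zeroʳ i)) p))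
  small-factor (suc (suc i)) (suc zero) q _ _ _ = inj₂ refl
  small-factor (suc (suc i)) (suc (suc j)) q _ h refl = ⊥-elim (ℕₚ.<-irrefl refl (ℕₚ.≤-trans (ℕₚ.*-mono-≤ {2} {suc (suc i)} {2} {suc (suc j)} (ℕ.s≤s (ℕ.s≤s ℕ.z≤n)) (ℕ.s≤s (ℕ.s≤s ℕ.z≤n))) h))

  factor-4 : ∀ i j → i ℕ.* j ≡ 4 → j ≡ 1 ⊎ j ≡ 2 ⊎ j ≡ 4
  factor-4 i j e = go i j e (∣⇒≤ (divides i (sym e)))
    where
    go : ∀ i j → i ℕ.* j ≡ 4 → j ℕ.≤ 4 → j ≡ 1 ⊎ j ≡ 2 ⊎ j ≡ 4
    go i 0 e _ = ⊥-elim (ℕₚ.<-irrefl (trans (sym (ℕₚ.*-zeroʳ i)) e) (ℕ.s≤s ℕ.z≤n))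
    go i 1 e _ = inj₁ refl
    go i 2 e _ = inj₂ (inj₁ refl)
    go 0 3 () _
    go 1 3 () _
    go (suc (suc i)) 3 () _
    go i 4 e _ = inj₂ (inj₂ refl)
    go i (suc (suc (suc (suc (suc j))))) e (ℕ.s≤s (ℕ.s≤s (ℕ.s≤s (ℕ.s≤s ()))))

  argmin : ∀ {k} (f : Fin k → ℕ) N i → f i ℕ.≤ N → ∃ λ κ → ∀ j → f κ ℕ.≤ f j
  argmin f N i le with Finₚ.any? (λ j → f j ℕₚ.<? f i)
  ... | no h = i , λ j → ℕₚ.≮⇒≥ (λ q → h (j , q))
  argmin f zero i le | yes (j , q) = ⊥-elim (ℕₚ.<-irrefl refl (ℕₚ.≤-trans (ℕₚ.≤-trans (ℕ.s≤s ℕ.z≤n) q) le))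
  argmin f (suc N) i le | yes (j , q) = argmin f N j (ℕₚ.≤-pred (ℕₚ.≤-trans q le))

  -- p and q will be the two Cartan integers of a pair of roots. For product below 4 one of them is
  -- 1; for product 4 the roots are parallel modulo the kernel of K.
  pq-cases : ∀ p q → 0 ℕ.< p → 0 ℕ.< q → p ℕ.* q ℕ.≤ 4 → (p ≡ 1 × q ℕ.≤ 3) ⊎ (q ≡ 1 × p ℕ.≤ 3) ⊎ (p ≡ 2 × q ≡ 2) ⊎ (p ≡ 1 × q ≡ 4) ⊎ (p ≡ 4 × q ≡ 1)
  pq-cases 1 q _ _ h with q ℕₚ.≤? 3
  ... | yes r = inj₁ (refl , r)
  ... | no r = inj₂ (inj₂ (inj₂ (inj₁ (refl , ℕₚ.≤-antisym (subst (ℕ._≤ 4) (ℕₚ.+-identityʳ q) h) (ℕₚ.≰⇒> r)))))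
  pq-cases p@(suc (suc _)) 1 _ _ h with p ℕₚ.≤? 3
  ... | yes r = inj₂ (inj₁ (refl , r))
  ... | no r = inj₂ (inj₂ (inj₂ (inj₂ (ℕₚ.≤-antisym (subst (ℕ._≤ 4) (ℕₚ.*-identityʳ p) h) (ℕₚ.≰⇒> r) , refl))))
  pq-cases 2 2 _ _ _ = inj₂ (inj₂ (inj₁ (refl , refl)))
  pq-cases 2 (suc (suc (suc q))) _ _ h = ⊥-elim (ℕₚ.<⇒≱ (ℕₚ.≤-trans (ℕₚ.n≤1+n 5) (ℕₚ.*-monoʳ-≤ 2 {3} {suc (suc (suc q))} (ℕ.s≤s (ℕ.s≤s (ℕ.s≤s ℕ.z≤n))))) h)
  pq-cases (suc (suc (suc p))) (suc (suc q)) _ _ h = ⊥-elim (ℕₚ.<⇒≱ (ℕₚ.≤-trans (ℕₚ.n≤1+n 5) (ℕₚ.*-mono-≤ {3} {suc (suc (suc p))} {2} {suc (suc q)} (ℕ.s≤s (ℕ.s≤s (ℕ.s≤s ℕ.z≤n))) (ℕ.s≤s (ℕ.s≤s ℕ.z≤n)))) h)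

  pq≤4 : ∀ p q {D} → 0ℚ < D → 0ℚ ≤ D * ((2ℚ + 2ℚ) - ι p * ι q) → p ℕ.* q ℕ.≤ 4
  pq≤4 p q {D} D>0 h with p ℕ.* q ℕₚ.≤? 4
  ... | yes r = r
  ... | no r = ⊥-elim (≤<⊥ (*-cancel≥0 D>0 h) (by< (<⇒0< (ι-mono-< (ℕₚ.≰⇒> r)))
      (trans (solve 3 (λ f p q → c0 :- (f :- p :* q) := p :* q :- f) refl (2ℚ + 2ℚ) (ι p) (ι q)) (cong₂ (λ x y → x - y) (sym (ι-* p q)) (sym four)))))
    where
    four : ι 4 ≡ 2ℚ + 2ℚ
    four = ι≡ 4

private
  ∑≡sum : ∀ {m} (f : Fin m → ℚ) → ∑ f ≡ CMSum.sum f
  ∑≡sum {zero} f = refl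
  ∑≡sum {suc m} f = cong (f zero +_) (∑≡sum (f ∘ suc))

∑-permute : ∀ {m} (f : Fin m → ℚ) (p q : Fin m → Fin m) → (∀ i → p (q i) ≡ i) → (∀ i → q (p i) ≡ i) → ∑ (λ i → f (p i)) ≡ ∑ f
∑-permute f p q pq qp = trans (∑≡sum (λ i → f (p i))) (trans (sym (CMSum.sum-permute f (Perm.permutation p q
  pq qp))) (sym (∑≡sum f)))

∑-remove : ∀ {m} (f : Fin m → ℚ) i → (∀ k → 0ℚ ≤ f k) → ∃ λ (g : Fin m → ℚ) → (∀ k → 0ℚ ≤ g k) × ∑ f ≡ f i + ∑ g × (∀ j → j ≢ i → g j ≡ f j)
∑-remove {suc m} f zero h = g , g≥0 , cong (f zero +_) (sym (ℚₚ.+-identityˡ (∑ (f ∘ suc)))) , same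
  where
  g : Fin (suc m) → ℚ
  g zero = 0ℚ
  g (suc k) = f (suc k)
  g≥0 : ∀ k → 0ℚ ≤ g k
  g≥0 zero = ℚₚ.≤-refl
  g≥0 (suc k) = h (suc k)
  same : ∀ j → j ≢ zero → g j ≡ f j
  same zero p = ⊥-elim (p refl)
  same (suc j) p = refl
∑-remove {suc m} f (suc i) h = go (∑-remove (f ∘ suc) i (h ∘ suc))
  where
  go : (∃ λ (g : Fin m → ℚ) → (∀ k → 0ℚ ≤ g k) × ∑ (f ∘ suc) ≡ f (suc i) + ∑ g × (∀ j → j ≢ i → g j ≡ f (suc j))) →
    ∃ λ (g : Fin (suc m) → ℚ) → (∀ k → 0ℚ ≤ g k) × ∑ f ≡ f (suc i) + ∑ g × (∀ j → j ≢ suc i → g j ≡ f j)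
  go (g , g≥0 , e , same) = g′ , g′≥0 , trans (cong (f zero +_) e) (solve 3 (λ a b c → a :+ (b :+ c) := b :+ (a :+ c)) refl (f zero) (f (suc i)) (∑ g)) , same′
    where
    g′ : Fin (suc m) → ℚ
    g′ zero = f zero
    g′ (suc k) = g k
    g′≥0 : ∀ k → 0ℚ ≤ g′ k
    g′≥0 zero = h zero
    g′≥0 (suc k) = g≥0 k
    same′ : ∀ j → j ≢ suc i → g′ j ≡ f j
    same′ zero p = refl
    same′ (suc j) p = same j (p ∘ cong suc)

∑-two : ∀ {m} (f : Fin m → ℚ) i j → i ≢ j → (∀ k → 0ℚ ≤ f k) → f i + f j ≤ ∑ f
∑-two f i j p h = go (∑-remove f i h)
  where
  go : (∃ λ g → (∀ k → 0ℚ ≤ g k) × ∑ f ≡ f i + ∑ g × (∀ j → j ≢ i → g j ≡ f j)) → f i + f j ≤ ∑ f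
  go (g , g≥0 , e , same) = subst (f i + f j ≤_) (sym e) (ℚₚ.+-monoʳ-≤ (f i) (subst (_≤ ∑ g) (same j (p ∘ sym)) (∑-term≤ g j g≥0)))

∑-three : ∀ {m} (f : Fin m → ℚ) i j k → i ≢ j → i ≢ k → j ≢ k → (∀ k → 0ℚ ≤ f k) → f i + (f j + f k) ≤ ∑ f
∑-three f i j k p q r h = go (∑-remove f i h)
  where
  go : (∃ λ g → (∀ k → 0ℚ ≤ g k) × ∑ f ≡ f i + ∑ g × (∀ j → j ≢ i → g j ≡ f j)) → f i + (f j + f k) ≤ ∑ f
  go (g , g≥0 , e , same) = subst (f i + (f j + f k) ≤_) (sym e) (ℚₚ.+-monoʳ-≤ (f i) (subst₂ (λ a b → a + b ≤ ∑ g) (same j (p ∘ sym)) (same k (q ∘ sym)) (∑-two g j k r g≥0)))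

-- Vectors, bilinear forms, the Euler form and Serre duality.

module Cartan (n : ℕ) (A : Fin n → Fin n → ℤ) (d : Fin n → ℚ)
              (IC : Setup.IsSymmetrizableCartan n A d) where

  open Setup n A d public
  open IsSymmetrizableCartan IC public

  infixl 9 _!_

  _!_ : V → Fin n → ℚ
  v ! i = lookup v i

  ext : {u v : V} → (∀ i → u ! i ≡ v ! i) → u ≡ v
  ext {u} {v} h = trans (sym (Vecₚ.tabulate∘lookup u)) (trans (Vecₚ.tabulate-cong h) (Vecₚ.tabulate∘lookup v))

  +V-! : ∀ u v i → (u +V v) ! i ≡ u ! i + v ! i
  +V-! u v i = Vecₚ.lookup-zipWith _+_ i u v

  ·V-! : ∀ q v i → (q ·V v) ! i ≡ q * v ! i
  ·V-! q v i = Vecₚ.lookup-map i (q *_) v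

  1·V : ∀ v → 1ℚ ·V v ≡ v
  1·V v = ext λ i → trans (·V-! 1ℚ v i) (ℚₚ.*-identityˡ (v ! i))

  -V-! : ∀ v i → (-V v) ! i ≡ - v ! i
  -V-! v i = Vecₚ.lookup-map i -_ v

  0V-! : ∀ i → 0V ! i ≡ 0ℚ
  0V-! i = Vecₚ.lookup∘tabulate _ i

  αs-same : ∀ i → αs i ! i ≡ 1ℚ
  αs-same i rewrite Vecₚ.lookup∘tabulate (λ j → if ⌊ i Fin.≟ j ⌋ then 1ℚ else 0ℚ) i with i Fin.≟ i
  ... | yes _ = refl
  ... | no p = ⊥-elim (p refl)

  αs-diff : ∀ {i j} → i ≢ j → αs i ! j ≡ 0ℚ
  αs-diff {i} {j} h rewrite Vecₚ.lookup∘tabulate (λ j → if ⌊ i Fin.≟ j ⌋ then 1ℚ else 0ℚ) j with i Fin.≟ j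
  ... | yes p = ⊥-elim (h p)
  ... | no _ = refl

  opaque
    -- The single linear operation u + q v. It is opaque so that terms keep this shape and every
    -- linear map needs only one compatibility lemma.
    axpy : V → ℚ → V → V
    axpy u q v = u +V q ·V v

    axpy-def : ∀ u q v → u +V q ·V v ≡ axpy u q v
    axpy-def u q v = refl

    axpy-! : ∀ u q v i → axpy u q v ! i ≡ u ! i + q * v ! i
    axpy-! u q v i = trans (+V-! u (q ·V v) i) (cong (u ! i +_) (·V-! q v i))

  axpy-inv : ∀ u q v → axpy (axpy u q v) (- q) v ≡ u
  axpy-inv u q v = ext λ i → trans (axpy-! (axpy u q v) (- q) v i) (trans (cong (_+ (- q) * v ! i) (axpy-! u q v i))
    (solve 3 (λ a q b → (a :+ q :* b) :+ (:- q) :* b := a) refl (u ! i) q (v ! i)))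

  -V-inv : ∀ v → -V (-V v) ≡ v
  -V-inv v = ext λ i → trans (-V-! (-V v) i) (trans (cong -_ (-V-! v i)) (solve 1 (λ a → :- (:- a) := a) refl (v ! i)))

  -V≡axpy : ∀ v → -V v ≡ axpy 0V (- 1ℚ) v
  -V≡axpy v = ext λ i → trans (-V-! v i) (sym (trans (axpy-! 0V (- 1ℚ) v i) (trans (cong (_+ (- 1ℚ) * v ! i) (0V-! i))
    (solve 1 (λ a → con 0ℚ :+ (:- con 1ℚ) :* a := :- a) refl (v ! i)))))

  ·V≡axpy : ∀ q v → q ·V v ≡ axpy 0V q v
  ·V≡axpy q v = ext λ i → trans (·V-! q v i) (sym (trans (axpy-! 0V q v i) (trans (cong (_+ q * v ! i) (0V-! i)) (ℚₚ.+-identityˡ (q * v ! i)))))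

  row : (Fin n → Fin n → ℚ) → Fin n → V → ℚ
  row e i v = ∑ λ j → e i j * v ! j

  row-axpy : ∀ e i u q v → row e i (axpy u q v) ≡ row e i u + q * row e i v
  row-axpy e i u q v = ∑-lin (λ j → e i j * u ! j) q (λ j → e i j * v ! j) λ j → trans (cong (e i j *_) (axpy-! u q v j))
    (solve 4 (λ e u q v → e :* (u :+ q :* v) := e :* u :+ q :* (e :* v)) refl (e i j) (u ! j) q (v ! j))

  row-α : ∀ e i j → row e i (αs j) ≡ e i j
  row-α e i j = trans (∑-single (λ k → e i k * αs j ! k) j (λ k p → 0ʳ (e i k) (αs-diff (p ∘ sym))))
    (1ʳ (e i j) (αs-same j))

  row-0 : ∀ e i {v} → (∀ j → v ! j ≡ 0ℚ) → row e i v ≡ 0ℚ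
  row-0 e i h = ∑-zero λ j → 0ʳ (e i j) (h j)

  opaque
    B : (Fin n → Fin n → ℚ) → V → V → ℚ
    B e u v = ∑ λ i → u ! i * row e i v

    B-def : ∀ e u v → B e u v ≡ ∑ λ i → u ! i * row e i v
    B-def e u v = refl

    B-axpyʳ : ∀ e w u q v → B e w (axpy u q v) ≡ B e w u + q * B e w v
    B-axpyʳ e w u q v = ∑-lin (λ i → w ! i * row e i u) q (λ i → w ! i * row e i v) λ i → trans (cong (w ! i *_) (row-axpy e i u q v))
      (solve 4 (λ e u q v → e :* (u :+ q :* v) := e :* u :+ q :* (e :* v)) refl (w ! i) (row e i u) q (row e i v))

    B-axpyˡ : ∀ e u q v w → B e (axpy u q v) w ≡ B e u w + q * B e v w
    B-axpyˡ e u q v w = ∑-lin (λ i → u ! i * row e i w) q (λ i → v ! i * row e i w) λ i → trans (cong (_* row e i w) (axpy-! u q v i))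
      (solve 4 (λ e u q v → (u :+ q :* v) :* e := u :* e :+ q :* (v :* e)) refl (row e i w) (u ! i) q (v ! i))

    B-0ˡ : ∀ e {u} v → (∀ i → u ! i ≡ 0ℚ) → B e u v ≡ 0ℚ
    B-0ˡ e v h = ∑-zero λ i → 0ˡ (row e i v) (h i)

    B-0ʳ : ∀ e u {v} → (∀ i → v ! i ≡ 0ℚ) → B e u v ≡ 0ℚ
    B-0ʳ e u {v} h = ∑-zero λ i → 0ʳ (u ! i) (row-0 e i {v} h)

    B-αˡ : ∀ e i v → B e (αs i) v ≡ row e i v
    B-αˡ e i v = trans (∑-single (λ j → αs i ! j * row e j v) i (λ j p → 0ˡ (row e j v) (αs-diff (p ∘ sym))))
      (1ˡ (row e i v) (αs-same i))

    B-transpose : ∀ e u v → B e u v ≡ B (λ i j → e j i) v u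
    B-transpose e u v = begin
      ∑ (λ i → u ! i * ∑ (λ j → e i j * v ! j)) ≡⟨ ∑-cong (λ i → sym (∑-* (u ! i) (λ j → e i j * v ! j))) ⟩
      ∑ (λ i → ∑ (λ j → u ! i * (e i j * v ! j))) ≡⟨ ∑-swap (λ i j → u ! i * (e i j * v ! j)) ⟩
      ∑ (λ j → ∑ (λ i → u ! i * (e i j * v ! j))) ≡⟨ ∑-cong (λ j → ∑-cong (λ i →
         solve 3 (λ u e v → u :* (e :* v) := v :* (e :* u)) refl (u ! i) (e i j) (v ! j))) ⟩
      ∑ (λ j → ∑ (λ i → v ! j * (e i j * u ! i))) ≡⟨ ∑-cong (λ j → ∑-* (v ! j) (λ i → e i j * u ! i)) ⟩
      ∑ (λ j → v ! j * ∑ (λ i → e i j * u ! i)) ∎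

    B-+ : ∀ e e′ u v → B (λ i j → e i j + e′ i j) u v ≡ B e u v + B e′ u v
    B-+ e e′ u v = trans (∑-cong λ i → trans (cong (u ! i *_) (trans (∑-cong λ j → ℚₚ.*-distribʳ-+ (v ! j) (e i j) (e′ i j))
        (∑-+ (λ j → e i j * v ! j) (λ j → e′ i j * v ! j))))
      (ℚₚ.*-distribˡ-+ (u ! i) (row e i v) (row e′ i v))) (∑-+ (λ i → u ! i * row e i v) (λ i → u ! i * row e′ i v))

    B-cong : ∀ {e e′} → (∀ i j → e i j ≡ e′ i j) → ∀ u v → B e u v ≡ B e′ u v
    B-cong h u v = ∑-cong λ i → cong (u ! i *_) (∑-cong λ j → cong (_* v ! j) (h i j))

  -- The Euler form of the Coxeter element: K(u,v) = E(u,v) + E(v,u), and E is triangular.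

  eul : Fin n → Fin n → ℚ
  eul i j with Finₚ.<-cmp i j
  ... | tri< _ _ _ = d i * a i j
  ... | tri≈ _ _ _ = d i
  ... | tri> _ _ _ = 0ℚ

  eul-< : ∀ {i j} → i Fin.< j → eul i j ≡ d i * a i j
  eul-< {i} {j} p with Finₚ.<-cmp i j
  ... | tri< _ _ _ = refl
  ... | tri≈ q _ _ = ⊥-elim (q p)
  ... | tri> q _ _ = ⊥-elim (q p)

  eul-same : ∀ i → eul i i ≡ d i
  eul-same i with Finₚ.<-cmp i i
  ... | tri< _ q _ = ⊥-elim (q refl)
  ... | tri≈ _ _ _ = refl
  ... | tri> _ q _ = ⊥-elim (q refl)

  eul-> : ∀ {i j} → j Fin.< i → eul i j ≡ 0ℚ
  eul-> {i} {j} p with Finₚ.<-cmp i j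
  ... | tri< _ _ q = ⊥-elim (q p)
  ... | tri≈ _ _ q = ⊥-elim (q p)
  ... | tri> _ _ _ = refl

  a-diag : ∀ i → a i i ≡ 2ℚ
  a-diag i = cong ℤ→ℚ (diag i)

  eul-sym : ∀ i j → d i * a i j ≡ eul i j + eul j i
  eul-sym i j with Finₚ.<-cmp i j
  ... | tri< p _ _ = sym (trans (cong (d i * a i j +_) (eul-> p)) (ℚₚ.+-identityʳ (d i * a i j)))
  ... | tri≈ _ refl _ = trans (cong (d i *_) (a-diag i)) (trans (solve 1 (λ x → x :* (con 1ℚ :+ con 1ℚ) := x :+ x) refl (d i)) (cong (d i +_) (sym (eul-same i))))
  ... | tri> _ _ p = sym (trans (ℚₚ.+-identityˡ (eul j i)) (trans (eul-< p) (symm j i)))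

  E : V → V → ℚ
  E = B eul

  Kmat : Fin n → Fin n → ℚ
  Kmat i j = d i * a i j

  -- K, kept from unfolding.
  opaque
    Q : V → V → ℚ
    Q u v = K u v

    Q≡K : ∀ u v → Q u v ≡ K u v
    Q≡K u v = refl

    Q≡B : ∀ u v → Q u v ≡ B Kmat u v
    Q≡B u v = trans (∑-cong λ i → ∑-scale (u ! i) (λ j → Kmat i j * v ! j) λ j →
      solve 4 (λ u v d a → u :* v :* d :* a := u :* (d :* a :* v)) refl (u ! i) (v ! j) (d i) (a i j)) (sym (B-def Kmat u v))

  E-axpyˡ : ∀ u q v w → E (axpy u q v) w ≡ E u w + q * E v w
  E-axpyˡ = B-axpyˡ eul

  E-axpyʳ : ∀ w u q v → E w (axpy u q v) ≡ E w u + q * E w v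
  E-axpyʳ = B-axpyʳ eul

  Q≡E+E : ∀ u v → Q u v ≡ E u v + E v u
  Q≡E+E u v = trans (Q≡B u v) (trans (B-cong eul-sym u v) (trans (B-+ eul (λ i j → eul j i) u v) (cong (E u v +_) (sym (B-transpose eul v u)))))

  Q-sym : ∀ u v → Q u v ≡ Q v u
  Q-sym u v = trans (Q≡E+E u v) (trans (ℚₚ.+-comm (E u v) (E v u)) (sym (Q≡E+E v u)))

  Q≡2E : ∀ v → Q v v ≡ 2ℚ * E v v
  Q≡2E v = trans (Q≡E+E v v) (solve 1 (λ x → x :+ x := (con 1ℚ :+ con 1ℚ) :* x) refl (E v v))

  Q-axpyˡ : ∀ u q v w → Q (axpy u q v) w ≡ Q u w + q * Q v w
  Q-axpyˡ u q v w = trans (Q≡B (axpy u q v) w) (trans (B-axpyˡ Kmat u q v w) (cong₂ (λ x y → x + q * y) (sym (Q≡B u w)) (sym (Q≡B v w))))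

  Q-axpyʳ : ∀ w u q v → Q w (axpy u q v) ≡ Q w u + q * Q w v
  Q-axpyʳ w u q v = trans (Q-sym w (axpy u q v)) (trans (Q-axpyˡ u q v w) (cong₂ (λ x y → x + q * y) (Q-sym u w) (Q-sym v w)))

  Q-α : ∀ i v → Q (αs i) v ≡ d i * Kᵛ i v
  Q-α i v = trans (Q≡B (αs i) v) (trans (B-αˡ Kmat i v) (∑-scale (d i) (λ j → a i j * v ! j) λ j → ℚₚ.*-assoc (d i) (a i j) (v ! j)))

  Q-exp : ∀ u v → Q u v ≡ ∑ λ i → u ! i * Q (αs i) v
  Q-exp u v = trans (Q≡B u v) (trans (B-def Kmat u v) (∑-cong λ i → cong (u ! i *_) (sym (trans (Q≡B (αs i) v) (B-αˡ Kmat i v)))))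

  Q-0ˡ : ∀ {u} v → (∀ i → u ! i ≡ 0ℚ) → Q u v ≡ 0ℚ
  Q-0ˡ {u} v h = trans (Q≡B u v) (B-0ˡ Kmat v h)

  Q-αα : ∀ i j → Q (αs i) (αs j) ≡ d i * a i j
  Q-αα i j = trans (Q≡B (αs i) (αs j)) (trans (B-αˡ Kmat i (αs j)) (row-α Kmat i j))

  E-αα : ∀ i → E (αs i) (αs i) ≡ d i
  E-αα i = trans (B-αˡ eul i (αs i)) (trans (row-α eul i i) (eul-same i))

  E-·ˡ : ∀ q u v → E (q ·V u) v ≡ q * E u v
  E-·ˡ q u v = trans (cong (λ w → E w v) (·V≡axpy q u)) (trans (E-axpyˡ 0V q u v)
    (trans (cong (_+ q * E u v) (B-0ˡ eul v 0V-!)) (ℚₚ.+-identityˡ (q * E u v))))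

  E-·ʳ : ∀ q u v → E u (q ·V v) ≡ q * E u v
  E-·ʳ q u v = trans (cong (E u) (·V≡axpy q v)) (trans (E-axpyʳ u 0V q v)
    (trans (cong (_+ q * E u v) (B-0ʳ eul u 0V-!)) (ℚₚ.+-identityˡ (q * E u v))))

  -V≡· : ∀ v → -V v ≡ (- 1ℚ) ·V v
  -V≡· v = trans (-V≡axpy v) (sym (·V≡axpy (- 1ℚ) v))

  neg1 : ∀ x → (- 1ℚ) * x ≡ - x
  neg1 = solve 1 (λ a → (:- con 1ℚ) :* a := :- a) refl

  E-negˡ : ∀ u v → E (-V u) v ≡ - E u v
  E-negˡ u v = trans (cong (λ w → E w v) (-V≡· u)) (trans (E-·ˡ (- 1ℚ) u v) (neg1 (E u v)))

  E-negʳ : ∀ u v → E u (-V v) ≡ - E u v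
  E-negʳ u v = trans (cong (E u) (-V≡· v)) (trans (E-·ʳ (- 1ℚ) u v) (neg1 (E u v)))

  Q-·ˡ : ∀ q u v → Q (q ·V u) v ≡ q * Q u v
  Q-·ˡ q u v = trans (Q≡E+E (q ·V u) v) (trans (cong₂ _+_ (E-·ˡ q u v) (E-·ʳ q v u)) (trans (sym (ℚₚ.*-distribˡ-+ q (E u v) (E v u))) (cong (q *_) (sym (Q≡E+E u v)))))

  Q-·ʳ : ∀ q u v → Q u (q ·V v) ≡ q * Q u v
  Q-·ʳ q u v = trans (Q-sym u (q ·V v)) (trans (Q-·ˡ q v u) (cong (q *_) (Q-sym v u)))

  Q-negˡ : ∀ u v → Q (-V u) v ≡ - Q u v
  Q-negˡ u v = trans (cong (λ w → Q w v) (-V≡· u)) (trans (Q-·ˡ (- 1ℚ) u v) (neg1 (Q u v)))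

  Q-negʳ : ∀ u v → Q u (-V v) ≡ - Q u v
  Q-negʳ u v = trans (Q-sym u (-V v)) (trans (Q-negˡ v u) (cong -_ (Q-sym v u)))

  Q-axpy² : ∀ u q v → Q (axpy u q v) (axpy u q v) ≡ Q u u + 2ℚ * q * Q u v + q * q * Q v v
  Q-axpy² u q v = trans (Q-axpyˡ u q v (axpy u q v)) (trans (cong₂ (λ x y → x + q * y) (Q-axpyʳ u u q v) (Q-axpyʳ v u q v))
    (trans (cong (λ z → Q u u + q * Q u v + q * (z + q * Q v v)) (Q-sym v u))
    (solve 4 (λ q a b c → a :+ q :* b :+ q :* (b :+ q :* c) := a :+ (con 1ℚ :+ con 1ℚ) :* q :* b :+ q :* q :* c) refl q (Q u u) (Q u v) (Q v v))))

  s-! : ∀ i v j → s i v ! j ≡ v ! j + (- Kᵛ i v) * αs i ! j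
  s-! i v j = trans (cong (_! j) (axpy-def v (- Kᵛ i v) (αs i))) (axpy-! v (- Kᵛ i v) (αs i) j)

  s-other : ∀ {i j} v → i ≢ j → s i v ! j ≡ v ! j
  s-other {i} {j} v p = trans (s-! i v j) (trans (cong (λ z → v ! j + (- Kᵛ i v) * z) (αs-diff p))
    (solve 2 (λ a b → a :+ b :* con 0ℚ := a) refl (v ! j) (- Kᵛ i v)))

  s-0 : ∀ i {v} → Kᵛ i v ≡ 0ℚ → s i v ≡ v
  s-0 i {v} e = ext λ j → trans (s-! i v j) (trans (cong (λ z → v ! j + (- z) * αs i ! j) e)
    (solve 2 (λ a b → a :+ (:- con 0ℚ) :* b := a) refl (v ! j) (αs i ! j)))

  Kᵛ-axpy : ∀ i u q v → Kᵛ i (axpy u q v) ≡ Kᵛ i u + q * Kᵛ i v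
  Kᵛ-axpy i u q v = row-axpy a i u q v

  Kᵛ-α : ∀ i j → Kᵛ i (αs j) ≡ a i j
  Kᵛ-α i j = row-α a i j

  s-axpy : ∀ i u q v → s i (axpy u q v) ≡ axpy (s i u) q (s i v)
  s-axpy i u q v = ext λ j → trans (s-! i (axpy u q v) j) (trans (cong₂ (λ x y → x + (- y) * αs i ! j) (axpy-! u q v j) (Kᵛ-axpy i u q v))
    (sym (trans (axpy-! (s i u) q (s i v) j) (trans (cong₂ (λ x y → x + q * y) (s-! i u j) (s-! i v j))
    (solve 6 (λ u q v k l α → u :+ (:- k) :* α :+ q :* (v :+ (:- l) :* α) := u :+ q :* v :+ (:- (k :+ q :* l)) :* α) refl
      (u ! j) q (v ! j) (Kᵛ i u) (Kᵛ i v) (αs i ! j))))))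

  s-invol : ∀ i v → s i (s i v) ≡ v
  s-invol i v = ext λ j → trans (s-! i (s i v) j) (trans (cong₂ (λ x y → x + (- y) * αs i ! j) (s-! i v j) k)
    (solve 3 (λ u k α → u :+ (:- k) :* α :+ (:- (:- k)) :* α := u) refl (v ! j) (Kᵛ i v) (αs i ! j)))
    where
    k : Kᵛ i (s i v) ≡ - Kᵛ i v
    k = trans (cong (Kᵛ i) (axpy-def v (- Kᵛ i v) (αs i))) (trans (Kᵛ-axpy i v (- Kᵛ i v) (αs i)) (trans (cong (λ z → Kᵛ i v + (- Kᵛ i v) * z) (trans (Kᵛ-α i i) (a-diag i)))
      (solve 1 (λ k → k :+ (:- k) :* (con 1ℚ :+ con 1ℚ) := :- k) refl (Kᵛ i v))))

  s-def : ∀ i v → s i v ≡ axpy v (- Kᵛ i v) (αs i)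
  s-def i v = axpy-def v (- Kᵛ i v) (αs i)

  Q-s : ∀ i u v → Q (s i u) v ≡ Q u (s i v)
  Q-s i u v = trans (cong (λ w → Q w v) (s-def i u)) (trans (Q-axpyˡ u (- Kᵛ i u) (αs i) v) (trans (cong (λ y → Q u v + (- Kᵛ i u) * y) (Q-α i v))
    (sym (trans (cong (Q u) (s-def i v)) (trans (Q-axpyʳ u v (- Kᵛ i v) (αs i)) (trans (cong (λ y → Q u v + (- Kᵛ i v) * y) (trans (Q-sym u (αs i)) (Q-α i u)))
    (solve 4 (λ x k l d → x :+ (:- l) :* (d :* k) := x :+ (:- k) :* (d :* l)) refl (Q u v) (Kᵛ i u) (Kᵛ i v) (d i))))))))

  Q-ss : ∀ i u v → Q (s i u) (s i v) ≡ Q u v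
  Q-ss i u v = trans (Q-s i u (s i v)) (cong (Q u) (s-invol i v))

  s-0V : ∀ i → s i 0V ≡ 0V
  s-0V i = s-0 i (row-0 a i {0V} 0V-!)

  cl : List (Fin n) → V → V
  cl l v = foldr s v l

  cl-++ : ∀ l l′ v → cl (l ++ l′) v ≡ cl l (cl l′ v)
  cl-++ l l′ v = Listₚ.foldr-++ s v l l′

  cl-rev : ∀ l v → cl l (cl (reverse l) v) ≡ v
  cl-rev [] v = refl
  cl-rev (k ∷ l) v = trans (cong (λ r → s k (cl l (cl r v))) (Listₚ.unfold-reverse k l))
    (trans (cong (λ w → s k (cl l w)) (cl-++ (reverse l) (k ∷ []) v))
    (trans (cong (s k) (cl-rev l (s k v))) (s-invol k v)))

  rev-cl : ∀ l v → cl (reverse l) (cl l v) ≡ v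
  rev-cl l v = trans (cong (λ r → cl (reverse l) (cl r v)) (sym (Listₚ.reverse-involutive l))) (cl-rev (reverse l) v)

  cl-axpy : ∀ l u q v → cl l (axpy u q v) ≡ axpy (cl l u) q (cl l v)
  cl-axpy [] u q v = refl
  cl-axpy (k ∷ l) u q v = trans (cong (s k) (cl-axpy l u q v)) (s-axpy k (cl l u) q (cl l v))

  cl-Q : ∀ l u v → Q (cl l u) (cl l v) ≡ Q u v
  cl-Q [] u v = refl
  cl-Q (k ∷ l) u v = trans (Q-ss k (cl l u) (cl l v)) (cl-Q l u v)

  cl-0V : ∀ l → cl l 0V ≡ 0V
  cl-0V [] = refl
  cl-0V (k ∷ l) = trans (cong (s k) (cl-0V l)) (s-0V k)

  cl-· : ∀ l q v → cl l (q ·V v) ≡ q ·V cl l v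
  cl-· l q v = trans (cong (cl l) (·V≡axpy q v)) (trans (cl-axpy l 0V q v) (trans (cong (λ w → axpy w q (cl l v)) (cl-0V l)) (sym (·V≡axpy q (cl l v)))))

  cl-neg : ∀ l v → cl l (-V v) ≡ -V cl l v
  cl-neg l v = trans (cong (cl l) (-V≡· v)) (trans (cl-· l (- 1ℚ) v) (sym (-V≡· (cl l v))))

  infix 4 _∈ˡ_ _∉ˡ_

  _∈ˡ_ _∉ˡ_ : Fin n → List (Fin n) → Set
  i ∈ˡ l = Any (i ≡_) l
  i ∉ˡ l = ¬ (i ∈ˡ l)

  Supp : List (Fin n) → V → Set
  Supp l v = ∀ i → i ∉ˡ l → v ! i ≡ 0ℚ

  Sorted : List (Fin n) → Set
  Sorted = AllPairs Fin._<_

  cl-fix : ∀ l v {i} → i ∉ˡ l → cl l v ! i ≡ v ! i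
  cl-fix [] v p = refl
  cl-fix (k ∷ l) v {i} p = trans (s-other (cl l v) (λ { refl → p (here refl) })) (cl-fix l v (p ∘ there))

  cl-supp : ∀ l {v} → Supp l v → Supp l (cl l v)
  cl-supp l {v} h i p = trans (cl-fix l v p) (h i p)

  axpy-supp : ∀ {l u v} q → Supp l u → Supp l v → Supp l (axpy u q v)
  axpy-supp {u = u} {v} q h h′ i p = trans (axpy-! u q v i) (trans (cong₂ (λ x y → x + q * y) (h i p) (h′ i p))
    (solve 1 (λ q → con 0ℚ :+ q :* con 0ℚ := con 0ℚ) refl q))

  α-supp : ∀ {l k} → k ∈ˡ l → Supp l (αs k)
  α-supp m i p = αs-diff λ { refl → p m }

  -- `eul i k` vanishes for i > k, so on vectors supported at k and above only the diagonal entry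
  -- survives.
  E-α-min : ∀ k v → (∀ i → i ≢ k → v ! i ≡ 0ℚ ⊎ k Fin.< i) → E v (αs k) ≡ d k * v ! k
  E-α-min k v h = trans (B-def eul v (αs k)) (trans (∑-cong λ i → cong (v ! i *_) (row-α eul i k)) (trans (∑-single (λ i → v ! i * eul i k) k off)
    (trans (cong (v ! k *_) (eul-same k)) (ℚₚ.*-comm (v ! k) (d k)))))
    where
    off : ∀ i → i ≢ k → v ! i * eul i k ≡ 0ℚ
    off i p with h i p
    ... | inj₁ e = 0ˡ (eul i k) e
    ... | inj₂ q = 0ʳ (v ! i) (eul-> q)

  min-head : ∀ {k l} → Sorted (k ∷ l) → ∀ {i} → i ∈ˡ l → k Fin.< i
  min-head (h ∷ _) m = All.lookup h m

  head∉ : ∀ {k l} → Sorted (k ∷ l) → k ∉ˡ l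
  head∉ S m = ℕₚ.<-irrefl refl (min-head S m)

  _∈ˡ?_ : ∀ i l → Dec (i ∈ˡ l)
  i ∈ˡ? l = Any.any? (i Fin.≟_) l

  E-head : ∀ {k l v} → Sorted (k ∷ l) → Supp (k ∷ l) v → E v (αs k) ≡ d k * v ! k
  E-head {k} {l} {v} S h = E-α-min k v off
    where
    off : ∀ i → i ≢ k → v ! i ≡ 0ℚ ⊎ k Fin.< i
    off i p with i ∈ˡ? l
    ... | yes m = inj₂ (min-head S m)
    ... | no m = inj₁ (h i λ { (here e) → p e ; (there q) → m q })

  E-tail : ∀ {k l v} → Sorted (k ∷ l) → Supp l v → E v (αs k) ≡ 0ℚ
  E-tail {k} {l} {v} S h = trans (E-head S (λ i p → h i (p ∘ there)))
    (trans (cong (d k *_) (h k (head∉ S))) (ℚₚ.*-zeroʳ (d k)))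

  drop-head : Fin n → V → V
  drop-head k v = axpy v (- v ! k) (αs k)

  drop-supp : ∀ {k l v} → Supp (k ∷ l) v → Supp l (drop-head k v)
  drop-supp {k} {l} {v} h i p = trans (axpy-! v (- v ! k) (αs k) i) (go (i Fin.≟ k))
    where
    go : Dec (i ≡ k) → v ! i + (- v ! k) * αs k ! i ≡ 0ℚ
    go (yes refl) = trans (cong (λ z → v ! i + (- v ! i) * z) (αs-same i)) (solve 1 (λ x → x :+ (:- x) :* con 1ℚ := con 0ℚ) refl (v ! i))
    go (no q) = trans (cong₂ (λ y z → y + (- v ! k) * z) (h i λ { (here e) → q e ; (there m) → p m }) (αs-diff (q ∘ sym)))
      (solve 1 (λ x → con 0ℚ :+ x :* con 0ℚ := con 0ℚ) refl (- v ! k))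

  E-drop : ∀ k v w → E v w ≡ v ! k * E (αs k) w + E (drop-head k v) w
  E-drop k v w = sym (trans (cong (v ! k * E (αs k) w +_) (E-axpyˡ v (- v ! k) (αs k) w))
    (solve 3 (λ x y z → x :* y :+ (z :+ (:- x) :* y) := z) refl (v ! k) (E (αs k) w) (E v w)))

  -- The inductive step for Serre duality and for `E-proj`. Expanding K(α_k,w) as E(α_k,w) +
  -- E(w,α_k) cancels the contribution of the head coordinate to E(v,w), and what remains lives on
  -- the shorter list.
  E-s-head : ∀ {k l v} w → Sorted (k ∷ l) → Supp (k ∷ l) v → E v (s k w) ≡ E (drop-head k v) w - v ! k * E w (αs k)
  E-s-head {k} {l} {v} w S h = begin
    E v (s k w) ≡⟨ trans (cong (E v) (s-def k w)) (E-axpyʳ v w (- Kᵛ k w) (αs k)) ⟩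
    E v w + (- Kᵛ k w) * E v (αs k) ≡⟨ cong₂ (λ x y → x + (- Kᵛ k w) * y) (E-drop k v w) (E-head S h) ⟩
    v ! k * E (αs k) w + E v′ w + (- Kᵛ k w) * (d k * v ! k)
      ≡⟨ solve 5 (λ x y z κ d → x :* y :+ z :+ (:- κ) :* (d :* x) := x :* y :+ z :- x :* (d :* κ)) refl (v ! k) (E (αs k) w) (E v′ w) (Kᵛ k w) (d k) ⟩
    v ! k * E (αs k) w + E v′ w - v ! k * (d k * Kᵛ k w) ≡⟨ cong (λ z → v ! k * E (αs k) w + E v′ w - v ! k * z) (trans (sym (Q-α k w)) (Q≡E+E (αs k) w)) ⟩
    v ! k * E (αs k) w + E v′ w - v ! k * (E (αs k) w + E w (αs k))
      ≡⟨ solve 4 (λ x y z t → x :* y :+ z :- x :* (y :+ t) := z :- x :* t) refl (v ! k) (E (αs k) w) (E v′ w) (E w (αs k)) ⟩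
    E v′ w - v ! k * E w (αs k) ∎
    where v′ = drop-head k v

  -- Serre duality: c_l acts as the Auslander–Reiten translate of E.
  E-cl : ∀ l → Sorted l → ∀ {v} → Supp l v → ∀ u → E v (cl l u) ≡ - E u v
  E-cl [] S {v} h u = trans (B-0ˡ eul u (λ i → h i λ ())) (sym (cong -_ (B-0ʳ eul u (λ i → h i λ ()))))
  E-cl (k ∷ l) S@(_ ∷ S′) {v} h u = begin
    E v (s k w) ≡⟨ E-s-head w S h ⟩
    E v′ w - v ! k * E w (αs k) ≡⟨ cong₂ (λ x y → x - v ! k * y) (E-cl l S′ (drop-supp h) u) same ⟩
    - E u v′ - v ! k * E u (αs k) ≡⟨ cong (λ x → - x - v ! k * E u (αs k)) (E-axpyʳ u v (- v ! k) (αs k)) ⟩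
    - (E u v + (- v ! k) * E u (αs k)) - v ! k * E u (αs k)
      ≡⟨ solve 3 (λ x y z → :- (x :+ (:- y) :* z) :- y :* z := :- x) refl (E u v) (v ! k) (E u (αs k)) ⟩
    - E u v ∎
    where
    w = cl l u
    v′ = drop-head k v
    -- `cl l u` differs from `u` by a vector supported on `l`, all of whose indices exceed `k`, and
    -- E(·,α_k) vanishes on such vectors.
    same : E w (αs k) ≡ E u (αs k)
    same = a-b≡0⇒a≡b (trans (trans (cong (E w (αs k) +_) (solve 1 (λ x → :- x := (:- con 1ℚ) :* x) refl (E u (αs k)))) (sym (E-axpyˡ w (- 1ℚ) u (αs k))))
      (E-tail S λ i p → trans (axpy-! w (- 1ℚ) u i) (trans (cong (λ x → x + (- 1ℚ) * u ! i) (cl-fix l u p))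
      (solve 1 (λ x → x :+ (:- con 1ℚ) :* x := con 0ℚ) refl (u ! i)))))

  E-cl-inv : ∀ l → Sorted l → ∀ {u v} → Supp l u → Supp l v → E (cl l u) (cl l v) ≡ E u v
  E-cl-inv l S {u} {v} h h′ = trans (E-cl l S (cl-supp l h) v) (trans (cong -_ (E-cl l S h′ u))
    (solve 1 (λ x → :- (:- x) := x) refl (E u v)))

  -- For l = l₁ ++ k ∷ l₂ these are the roots p_k (projective) and q_k (injective).
  proj : List (Fin n) → Fin n → V
  proj l₁ k = cl l₁ (αs k)

  inj : List (Fin n) → Fin n → V
  inj l₂ k = cl (reverse l₂) (αs k)

  -- Each s_j with j before k strips the coordinate j off v and leaves the coordinate k alone. The
  -- correction term E(w,α_j) is 0 because w is supported strictly above j.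
  E-proj : ∀ l₁ k l₂ → Sorted (l₁ ++ k ∷ l₂) → ∀ {v} → Supp (l₁ ++ k ∷ l₂) v → E v (proj l₁ k) ≡ d k * v ! k
  E-proj [] k l₂ S h = E-head S h
  E-proj (j ∷ l₁) k l₂ S@(_ ∷ S′) {v} h = begin
    E v (s j w) ≡⟨ E-s-head w S h ⟩
    E v′ w - v ! j * E w (αs j) ≡⟨ cong₂ (λ x y → x - v ! j * y) (E-proj l₁ k l₂ S′ (drop-supp h)) (E-tail S w-supp) ⟩
    d k * v′ ! k - v ! j * 0ℚ ≡⟨ cong (λ z → d k * z - v ! j * 0ℚ) (trans (axpy-! v (- v ! j) (αs j) k) (cong (λ z → v ! k + (- v ! j) * z) (αs-diff j≢k))) ⟩
    d k * (v ! k + (- v ! j) * 0ℚ) - v ! j * 0ℚ ≡⟨ solve 3 (λ d x y → d :* (x :+ (:- y) :* con 0ℚ) :- y :* con 0ℚ := d :* x) refl (d k) (v ! k) (v ! j) ⟩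
    d k * v ! k ∎
    where
    w = proj l₁ k
    v′ = drop-head j v
    j≢k : j ≢ k
    j≢k e = ℕₚ.<-irrefl (cong toℕ e) (min-head S (Memₚ.∈-insert l₁))
    w-supp : Supp (l₁ ++ k ∷ l₂) w
    w-supp i p = trans (cl-fix l₁ (αs k) (p ∘ Memₚ.∈-++⁺ˡ)) (αs-diff λ { refl → p (Memₚ.∈-insert l₁) })

  cl-inj : ∀ l₁ k l₂ → cl (l₁ ++ k ∷ l₂) (inj l₂ k) ≡ -V proj l₁ k
  cl-inj l₁ k l₂ = trans (cl-++ l₁ (k ∷ l₂) (inj l₂ k)) (trans (cong (λ w → cl l₁ (s k w)) (cl-rev l₂ (αs k)))
    (trans (cong (cl l₁) sα) (cl-neg l₁ (αs k))))
    where
    sα : s k (αs k) ≡ -V αs k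
    sα = ext λ j → trans (s-! k (αs k) j) (trans (cong (λ z → αs k ! j + (- z) * αs k ! j) (trans (Kᵛ-α k k) (a-diag k)))
      (trans (solve 1 (λ x → x :+ (:- (con 1ℚ :+ con 1ℚ)) :* x := :- x) refl (αs k ! j)) (sym (-V-! (αs k) j))))

  E-inj : ∀ l₁ k l₂ → Sorted (l₁ ++ k ∷ l₂) → ∀ {v} → Supp (l₁ ++ k ∷ l₂) v → E (inj l₂ k) v ≡ d k * v ! k
  E-inj l₁ k l₂ S {v} h = begin
    E q v ≡⟨ solve 1 (λ x → x := :- (:- x)) refl (E q v) ⟩
    - (- E q v) ≡⟨ cong -_ (sym (E-cl (l₁ ++ k ∷ l₂) S h q)) ⟩
    - E v (cl (l₁ ++ k ∷ l₂) q) ≡⟨ cong (λ w → - E v w) (cl-inj l₁ k l₂) ⟩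
    - E v (-V proj l₁ k) ≡⟨ cong -_ (E-negʳ v (proj l₁ k)) ⟩
    - (- E v (proj l₁ k)) ≡⟨ solve 1 (λ x → :- (:- x) := x) refl (E v (proj l₁ k)) ⟩
    E v (proj l₁ k) ≡⟨ E-proj l₁ k l₂ S h ⟩
    d k * v ! k ∎
    where q = inj l₂ k

  -- The common ground of finite and affine type. In affine type `nd` is definiteness on the span of
  -- a proper subset of Π. Sign coherence, the identification of candidates with real roots, and the
  -- behaviour of τ on -Π ∪ Φ⁺ are all derived from this record.
  record Semidefinite : Set where
    field
      psd : ∀ v → 0ℚ ≤ Q v v
      nd  : ∀ i v → v ! i ≡ 0ℚ → Q v v ≡ 0ℚ → ∀ j → v ! j ≡ 0ℚ

  -- Candidates: integral vectors with integral coroots.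

  IntV : V → Set
  IntV v = ∀ i → Int (v ! i)

  DMul : ℚ → V → Set
  DMul D v = ∀ i → Mul D (d i * v ! i)

  a-int : ∀ i j → Int (a i j)
  a-int i j = A i j , refl

  eul-intˡ : ∀ i j → ∃ λ t → Int t × eul i j ≡ d i * t
  eul-intˡ i j with Finₚ.<-cmp i j
  ... | tri< _ _ _ = a i j , a-int i j , refl
  ... | tri≈ _ _ _ = 1ℚ , int-1 , sym (ℚₚ.*-identityʳ (d i))
  ... | tri> _ _ _ = 0ℚ , int-0 , sym (ℚₚ.*-zeroʳ (d i))

  eul-intʳ : ∀ i j → ∃ λ t → Int t × eul i j ≡ d j * t
  eul-intʳ i j with Finₚ.<-cmp i j
  ... | tri< _ _ _ = a j i , a-int j i , symm i j
  ... | tri≈ _ refl _ = 1ℚ , int-1 , sym (ℚₚ.*-identityʳ (d i))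
  ... | tri> _ _ _ = 0ℚ , int-0 , sym (ℚₚ.*-zeroʳ (d j))

  mul-sum : ∀ {e D u v} → (∀ i j → Mul D (u ! i * (e i j * v ! j))) → Mul D (B e u v)
  mul-sum {e} {D} {u} {v} h = subst (Mul D) (sym (trans (B-def e u v) (∑-cong λ i → sym (∑-* (u ! i) (λ j → e i j * v ! j)))))
    (∑-mul λ i → ∑-mul (h i))

  -- Each entry of the Euler matrix is an integer multiple of `d i` and also of `d j`, so the factor
  -- d can be moved to whichever argument has the integral coroot.
  E-mulˡ : ∀ {D u v} → DMul D u → IntV v → Mul D (E u v)
  E-mulˡ {D} {u} {v} p q = mul-sum {eul} {D} {u} {v} λ i j → let t , ti , te = eul-intˡ i j in
    subst (Mul D) (trans (solve 4 (λ d u t v → d :* u :* (t :* v) := u :* (d :* t :* v)) refl (d i) (u ! i) t (v ! j))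
      (cong (λ z → u ! i * (z * v ! j)) (sym te)))
      (mul-*int (p i) (int-* ti (q j)))

  E-mulʳ : ∀ {D u v} → IntV u → DMul D v → Mul D (E u v)
  E-mulʳ {D} {u} {v} q p = mul-sum {eul} {D} {u} {v} λ i j → let t , ti , te = eul-intʳ i j in
    subst (Mul D) (trans (solve 4 (λ d u t v → d :* v :* (t :* u) := u :* (d :* t :* v)) refl (d j) (u ! i) t (v ! j))
      (cong (λ z → u ! i * (z * v ! j)) (sym te)))
      (mul-*int (p j) (int-* ti (q i)))

  Q-mulˡ : ∀ {D u v} → DMul D u → IntV v → Mul D (Q u v)
  Q-mulˡ {D} {u} {v} p q = subst (Mul D) (sym (Q≡E+E u v)) (mul-+ (E-mulˡ p q) (E-mulʳ q p))

  Q-mulʳ : ∀ {D u v} → IntV u → DMul D v → Mul D (Q u v)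
  Q-mulʳ {D} {u} {v} p q = subst (Mul D) (Q-sym v u) (Q-mulˡ q p)

  -- The vectors that turn out to be the real roots: integral roots and coroots, with E(v,v) = D.
  record Cand (D : ℚ) (v : V) : Set where
    field
      D>0 : 0ℚ < D
      int : IntV v
      dmul : DMul D v
      norm : E v v ≡ D

  open Cand public

  Q-norm : ∀ {D v} → Cand D v → Q v v ≡ 2ℚ * D
  Q-norm {D} {v} c = trans (Q≡2E v) (cong (2ℚ *_) (norm c))

  Q-pos : ∀ {D v} → Cand D v → 0ℚ < Q v v
  Q-pos c = >0 (Q-norm c) (*>0 0<2 (D>0 c))

  cand-α : ∀ i → Cand (d i) (αs i)
  cand-α i .D>0 = d-pos i
  cand-α i .int j with i Fin.≟ j
  ... | yes refl = subst Int (sym (αs-same i)) int-1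
  ... | no p = subst Int (sym (αs-diff p)) int-0
  cand-α i .dmul j with i Fin.≟ j
  ... | yes refl = subst (Mul (d i)) (sym (1ʳ (d i) (αs-same i))) mul-self
  ... | no p = subst (Mul (d i)) (sym (0ʳ (d j) (αs-diff p))) mul-0
  cand-α i .norm = E-αα i

  cand-neg : ∀ {D v} → Cand D v → Cand D (-V v)
  cand-neg c .D>0 = D>0 c
  cand-neg {D} {v} c .int j = subst Int (sym (-V-! v j)) (int-neg (int c j))
  cand-neg {D} {v} c .dmul j = subst (Mul D) (trans (ℚₚ.neg-distribʳ-* (d j) (v ! j)) (cong (d j *_) (sym (-V-! v j)))) (mul-neg (dmul c j))
  cand-neg {D} {v} c .norm = trans (E-negˡ v (-V v)) (trans (cong -_ (E-negʳ v v)) (trans (solve 1 (λ x → :- (:- x) := x) refl (E v v)) (norm c)))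

  -- p is K(b^∨,v), so the vector is the reflection of v in b. For its coroot, write d_j b_j = m D′;
  -- then p d_j b_j = m Q(b,v), which lies in Dℤ because v has an integral coroot.
  cand-refl : ∀ {D D′ v b} p → Cand D v → Cand D′ b → Int p → p * D′ ≡ Q b v → Cand D (axpy v (- p) b)
  cand-refl p cv cb pi e .D>0 = D>0 cv
  cand-refl {v = v} {b} p cv cb pi e .int j = subst Int (sym (axpy-! v (- p) b j)) (int-+ (int cv j) (int-* (int-neg pi) (int cb j)))
  cand-refl {D} {D′} {v} {b} p cv cb pi e .dmul j with dmul cb j
  ... | m , me = subst (Mul D) eq (mul-+ (dmul cv j) (mul-neg (int*-mul {y = Q b v} (m , refl) (Q-mulʳ (int cb) (dmul cv)))))
    where
    eq : d j * v ! j + - (ℤ→ℚ m * Q b v) ≡ d j * axpy v (- p) b ! j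
    eq = begin
      d j * v ! j + - (ℤ→ℚ m * Q b v) ≡⟨ cong (λ z → d j * v ! j + - (ℤ→ℚ m * z)) (sym e) ⟩
      d j * v ! j + - (ℤ→ℚ m * (p * D′)) ≡⟨ solve 4 (λ x m p D → x :+ :- (m :* (p :* D)) := x :+ :- (p :* (m :* D))) refl (d j * v ! j) (ℤ→ℚ m) p D′ ⟩
      d j * v ! j + - (p * (ℤ→ℚ m * D′)) ≡⟨ cong (λ z → d j * v ! j + - (p * z)) (sym me) ⟩
      d j * v ! j + - (p * (d j * b ! j)) ≡⟨ solve 4 (λ d v p b → d :* v :+ :- (p :* (d :* b)) := d :* (v :+ (:- p) :* b)) refl (d j) (v ! j) p (b ! j) ⟩
      d j * (v ! j + (- p) * b ! j) ≡⟨ cong (d j *_) (sym (axpy-! v (- p) b j)) ⟩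
      d j * axpy v (- p) b ! j ∎
  cand-refl {D} {D′} {v} {b} p cv cb pi e .norm = trans (double-cancel (begin
    2ℚ * E w w ≡⟨ sym (Q≡2E w) ⟩
    Q w w ≡⟨ Q-axpy² v (- p) b ⟩
    Q v v + 2ℚ * (- p) * Q v b + (- p) * (- p) * Q b b ≡⟨ cong₂ (λ x y → Q v v + 2ℚ * (- p) * x + (- p) * (- p) * y) (trans (Q-sym v b) (sym e)) (Q-norm cb) ⟩
    Q v v + 2ℚ * (- p) * (p * D′) + (- p) * (- p) * (2ℚ * D′) ≡⟨ solve 3 (λ x p D → x :+ (c2) :* (:- p) :* (p :* D) :+ (:- p) :* (:- p) :* ((c2) :* D) := x) refl (Q v v) p D′ ⟩
    Q v v ≡⟨ Q≡2E v ⟩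
    2ℚ * E v v ∎)) (norm cv)
    where w = axpy v (- p) b

  cand-shift : ∀ {D v w} → Cand D v → (∀ u → Q w u ≡ 0ℚ) → IntV w → DMul D w → Cand D (axpy v 1ℚ w)
  cand-shift c kw iw dw .D>0 = D>0 c
  cand-shift {v = v} {w} c kw iw dw .int j = subst Int (sym (trans (axpy-! v 1ℚ w j) (cong (v ! j +_) (ℚₚ.*-identityˡ (w ! j))))) (int-+ (int c j) (iw j))
  cand-shift {D} {v} {w} c kw iw dw .dmul j = subst (Mul D) (trans (solve 3 (λ d v w → d :* v :+ d :* w := d :* (v :+ c1 :* w)) refl (d j) (v ! j) (w ! j))
    (cong (d j *_) (sym (axpy-! v 1ℚ w j)))) (mul-+ (dmul c j) (dw j))
  cand-shift {D} {v} {w} c kw iw dw .norm = trans (double-cancel (begin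
    2ℚ * E (axpy v 1ℚ w) (axpy v 1ℚ w) ≡⟨ sym (Q≡2E _) ⟩
    Q (axpy v 1ℚ w) (axpy v 1ℚ w) ≡⟨ Q-axpy² v 1ℚ w ⟩
    Q v v + 2ℚ * 1ℚ * Q v w + 1ℚ * 1ℚ * Q w w ≡⟨ cong₂ (λ x y → Q v v + 2ℚ * 1ℚ * x + 1ℚ * 1ℚ * y) (trans (Q-sym v w) (kw v)) (kw w) ⟩
    Q v v + 2ℚ * 1ℚ * 0ℚ + 1ℚ * 1ℚ * 0ℚ ≡⟨ solve 1 (λ x → x :+ (c2) :* c1 :* c0 :+ c1 :* c1 :* c0 := x) refl (Q v v) ⟩
    Q v v ≡⟨ Q≡2E v ⟩
    2ℚ * E v v ∎)) (norm c)

  abstract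
    Q-quot : ∀ {D b w} → Cand D b → IntV w → ∃ λ p → Int p × p * D ≡ Q b w
    Q-quot c h = mul-quot (Q-mulˡ (dmul c) h)

  Kᵛ-int : ∀ i v → IntV v → Int (Kᵛ i v)
  Kᵛ-int i v h = ∑-int λ j → int-* (a-int i j) (h j)

  cand-s : ∀ {D v} i → Cand D v → Cand D (s i v)
  cand-s {D} {v} i c = subst (Cand D) (sym (s-def i v))
    (cand-refl (Kᵛ i v) c (cand-α i) (Kᵛ-int i v (int c)) (trans (ℚₚ.*-comm (Kᵛ i v) (d i)) (sym (Q-α i v))))

  cand-cl : ∀ {D v} l → Cand D v → Cand D (cl l v)
  cand-cl [] c = c
  cand-cl (k ∷ l) c = cand-s k (cand-cl l c)

  real⇒cand : ∀ {v} → RealRoot v → ∃ λ D → Cand D v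
  real⇒cand (simple i) = d i , cand-α i
  real⇒cand (refl-s i r) = let D , c = real⇒cand r in D , cand-s i c

  real-neg : ∀ {v} → RealRoot v → RealRoot (-V v)
  real-neg (simple i) = subst RealRoot (cl-inj [] i []) (refl-s i (simple i))
  real-neg (refl-s i {v} r) = subst RealRoot (cl-neg (i ∷ []) v) (refl-s i (real-neg r))

  -- Sign coherence.

  private
    ⁺ : ℚ → ℚ
    ⁺ x = x ⊔ 0ℚ

    pm : ∀ x → (0ℚ ≤ x × ⁺ x ≡ x × ⁺ (- x) ≡ 0ℚ) ⊎ (x ≤ 0ℚ × ⁺ x ≡ 0ℚ × ⁺ (- x) ≡ - x)
    pm x with ℚₚ.≤-total 0ℚ x
    ... | inj₁ p = inj₁ (p , ℚₚ.p≥q⇒p⊔q≡p p , ℚₚ.p≤q⇒p⊔q≡q (-≥0 p))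
    ... | inj₂ p = inj₂ (p , ℚₚ.p≤q⇒p⊔q≡q p , ℚₚ.p≥q⇒p⊔q≡p (-≤0 p))

    pos⁺ : ∀ x → 0ℚ ≤ ⁺ x
    pos⁺ x = ℚₚ.p≤q⊔p x 0ℚ

    pm-int : ∀ {x} → Int x → Int (⁺ x)
    pm-int {x} i with pm x
    ... | inj₁ (_ , e , _) = subst Int (sym e) i
    ... | inj₂ (_ , e , _) = subst Int (sym e) int-0

    pm-mul : ∀ {D x} t → Mul D (t * x) → Mul D (t * ⁺ x)
    pm-mul {D} {x} t i with pm x
    ... | inj₁ (_ , e , _) = subst (λ z → Mul D (t * z)) (sym e) i
    ... | inj₂ (_ , e , _) = subst (Mul D) (sym (0ʳ t e)) mul-0

  posPart : V → V
  posPart v = tabulate (λ i → ⁺ (v ! i))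

  posPart-! : ∀ v i → posPart v ! i ≡ ⁺ (v ! i)
  posPart-! v i = Vecₚ.lookup∘tabulate (λ i → ⁺ (v ! i)) i

  negPart-! : ∀ v i → posPart (-V v) ! i ≡ ⁺ (- (v ! i))
  negPart-! v i = trans (posPart-! (-V v) i) (cong ⁺ (-V-! v i))

  posPart≥0 : ∀ v → Pos (posPart v)
  posPart≥0 v i = subst (0ℚ ≤_) (sym (posPart-! v i)) (pos⁺ (v ! i))

  posPart-diff : ∀ v → axpy (posPart v) (- 1ℚ) (posPart (-V v)) ≡ v
  posPart-diff v = ext λ i → trans (axpy-! (posPart v) (- 1ℚ) (posPart (-V v)) i)
    (trans (cong₂ (λ x y → x + (- 1ℚ) * y) (posPart-! v i) (negPart-! v i)) (go (v ! i)))
    where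
    go : ∀ x → ⁺ x + (- 1ℚ) * ⁺ (- x) ≡ x
    go x with pm x
    ... | inj₁ (_ , e , e′) = trans (cong₂ (λ x y → x + (- 1ℚ) * y) e e′) (solve 1 (λ x → x :+ (:- c1) :* c0 := x) refl x)
    ... | inj₂ (_ , e , e′) = trans (cong₂ (λ x y → x + (- 1ℚ) * y) e e′) (solve 1 (λ x → c0 :+ (:- c1) :* (:- x) := x) refl x)

  posPart-int : ∀ v → IntV v → IntV (posPart v)
  posPart-int v h i = subst Int (sym (posPart-! v i)) (pm-int (h i))

  posPart-dmul : ∀ {D} v → DMul D v → DMul D (posPart v)
  posPart-dmul {D} v h i = subst (λ z → Mul D (d i * z)) (sym (posPart-! v i)) (pm-mul (d i) (h i))

  a-off : ∀ {i j} → i ≢ j → a i j ≤ 0ℚ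
  a-off {i} {j} p = ℤ→ℚ-mono-≤ {k = pos 0} (offdiag i j p)

  -Q-disjoint : ∀ {u v} → Pos u → Pos v → (∀ i → u ! i * v ! i ≡ 0ℚ) → 0ℚ ≤ - Q u v
  -Q-disjoint {u} {v} pu pv dis = ≥0 (trans (cong -_ (Q≡K u v)) (trans (sym (∑-neg (λ i → ∑ (λ j → u ! i * v ! j * d i * a i j))))
      (∑-cong λ i → sym (∑-neg (λ j → u ! i * v ! j * d i * a i j)))))
    (∑-≥0 λ i → ∑-≥0 λ j → term i j)
    where
    term : ∀ i j → 0ℚ ≤ - (u ! i * v ! j * d i * a i j)
    term i j with i Fin.≟ j
    ... | yes refl = ≡⇒≤ (sym (trans (cong (λ z → - (z * d i * a i i)) (dis i)) (solve 2 (λ x y → :- (c0 :* x :* y) := c0) refl (d i) (a i i))))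
    ... | no p = ≥0 (ℚₚ.neg-distribʳ-* (u ! i * v ! j * d i) (a i j)) (*≥0 (*≥0 (*≥0 (pu i) (pv j)) (ℚₚ.<⇒≤ (d-pos i))) (-≤0 (a-off p)))

  module Signs (SD : Semidefinite) where
    open Semidefinite SD

    E≥0 : ∀ v → 0ℚ ≤ E v v
    E≥0 v = double-≥0 (subst (0ℚ ≤_) (Q≡2E v) (psd v))

    am-gm : ∀ u v → 2ℚ * Q u v ≤ Q u u + Q v v
    am-gm u v = by≤ (psd (axpy u (- 1ℚ) v)) (trans
      (solve 3 (λ x y z → x :+ y :- (c2) :* z := x :+ (c2) :* (:- c1) :* z :+ (:- c1) :* (:- c1) :* y) refl (Q u u) (Q v v) (Q u v))
      (sym (Q-axpy² u (- 1ℚ) v)))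

    private
      E0-case : ∀ v → E (posPart v) (posPart v) ≡ 0ℚ → Pos v ⊎ Pos (-V v)
      E0-case v e with Finₚ.any? (λ i → posPart v ! i ℚₚ.≟ 0ℚ)
      ... | yes (i , z) = inj₂ λ j → subst (0ℚ ≤_) (sym (-V-! v j)) (neg (v ! j) (trans (sym (posPart-! v j))
              (nd i (posPart v) z (trans (Q≡2E (posPart v)) (0ʳ 2ℚ e)) j)))
        where
        neg : ∀ x → ⁺ x ≡ 0ℚ → 0ℚ ≤ - x
        neg x e = -≤0 (subst (x ≤_) e (ℚₚ.p≤p⊔q x 0ℚ))
      ... | no h = inj₁ λ j → go (v ! j) (λ z → h (j , trans (posPart-! v j) z))
        where
        go : ∀ x → ⁺ x ≢ 0ℚ → 0ℚ ≤ x
        go x h with pm x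
        ... | inj₁ (p , _) = p
        ... | inj₂ (_ , e , _) = ⊥-elim (h e)

    -- Let u and w be the positive and negative parts of v. E(u,u) and E(w,w) are nonnegative
    -- multiples of D, and Q(u,w) ≤ 0 since the supports are disjoint. If both were nonzero, 2D =
    -- Q(v,v) would be at least 4D. If one is zero, `nd` says that this part either vanishes or has
    -- no zero coordinate, and v has a sign in both cases.
    sign : ∀ {D v} → Cand D v → Pos v ⊎ Pos (-V v)
    sign {D} {v} c with E (posPart v) (posPart v) ℚₚ.≟ 0ℚ | E (posPart (-V v)) (posPart (-V v)) ℚₚ.≟ 0ℚ
    ... | yes e | _ = E0-case v e
    ... | no _ | yes e with E0-case (-V v) e
    ... | inj₁ p = inj₂ p
    ... | inj₂ p = inj₁ (subst Pos (-V-inv v) p)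
    sign {D} {v} c | no p | no q = ⊥-elim (≤<⊥ le (D>0 c))
      where
      u = posPart v
      w = posPart (-V v)
      cn = cand-neg c
      big : ∀ {v} → Cand D v → E (posPart v) (posPart v) ≢ 0ℚ → 0ℚ ≤ E (posPart v) (posPart v) - D
      big {v} c p = ≤⇒0≤ (mul>0 (D>0 c) (E-mulˡ (posPart-dmul v (dmul c)) (posPart-int v (int c))) (≥∧≢⇒> (E≥0 (posPart v)) p))
      2≥0 = ℚₚ.<⇒≤ 0<2
      dis : ∀ i → u ! i * w ! i ≡ 0ℚ
      dis i with pm (v ! i)
      ... | inj₁ (_ , _ , e) = 0ʳ (u ! i) (trans (negPart-! v i) e)
      ... | inj₂ (_ , e , _) = 0ˡ (w ! i) (trans (posPart-! v i) e)
      Deq : 2ℚ * D ≡ 2ℚ * E u u + 2ℚ * (- 1ℚ) * Q u w + (- 1ℚ) * (- 1ℚ) * (2ℚ * E w w)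
      Deq = trans (sym (Q-norm c)) (trans (cong (λ z → Q z z) (sym (posPart-diff v))) (trans (Q-axpy² u (- 1ℚ) w)
        (cong₂ (λ x y → x + 2ℚ * (- 1ℚ) * Q u w + (- 1ℚ) * (- 1ℚ) * y) (Q≡2E u) (Q≡2E w))))
      le : D ≤ 0ℚ
      le = 0≤-⇒≤0 (double-≥0 (nn (+≥0 (+≥0 (*≥0 2≥0 (big c p)) (*≥0 2≥0 (big cn q))) (*≥0 2≥0 (-Q-disjoint {u} {w} (posPart≥0 v) (posPart≥0 (-V v)) dis)))
        (trans (solve 1 (λ D → c2 :* (:- D) := c2 :* D :- (c2 :+ c2) :* D) refl D)
        (trans (cong (_- (2ℚ + 2ℚ) * D) Deq)
        (solve 4 (λ D x y z → c2 :* x :+ c2 :* (:- c1) :* z :+ (:- c1) :* (:- c1) :* (c2 :* y) :- (c2 :+ c2) :* D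
          := c2 :* (x :- D) :+ c2 :* (y :- D) :+ c2 :* (:- z)) refl D (E u u) (E w w) (Q u w))))))

  PosDefOn : List (Fin n) → Set
  PosDefOn l = ∀ v → Supp l v → Q v v ≡ 0ℚ → ∀ j → v ! j ≡ 0ℚ

  supp-there : ∀ {k l} v → Supp l v → Supp (k ∷ l) v
  supp-there v h i p = h i (p ∘ there)

  Q-solution : ∀ {l} v ω (ψ : Fin n → ℚ) → Supp l v → (∀ k → k ∈ˡ l → Q (αs k) ω ≡ ψ k) → Q v ω ≡ ∑ (λ k → v ! k * ψ k)
  Q-solution {l} v ω ψ h e = trans (Q-exp v ω) (∑-cong go)
    where
    go : ∀ k → v ! k * Q (αs k) ω ≡ v ! k * ψ k
    go k with k ∈ˡ? l
    ... | yes m = cong (v ! k *_) (e k m)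
    ... | no m = trans (0ˡ (Q (αs k) ω) (h k m)) (sym (0ˡ (ψ k) (h k m)))

  private
   -- Gram-Schmidt: η is α_k made orthogonal to the span of the remaining list. Its coordinate k is
   -- 1, so definiteness gives Q(η,η) ≠ 0, and a multiple of η corrects the value at k without
   -- disturbing the others.
   represent′ : ∀ l → PosDefOn l → ∀ (ψ : Fin n → ℚ) → ∃ λ ω → Supp l ω × (∀ k → k ∈ˡ l → Q (αs k) ω ≡ ψ k)
   represent′ [] pd ψ = 0V , (λ i _ → 0V-! i) , λ k ()
   represent′ (k ∷ l) pd ψ with k ∈ˡ? l | represent′ l (λ v h → pd v (supp-there v h))
   ... | yes m | rec = let ω , s , e = rec ψ in ω , supp-there ω s , λ { j (here refl) → e j m ; j (there m′) → e j m′ }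
   ... | no k∉ | rec = axpy ω t η , axpy-supp t (supp-there ω sω) η-supp , λ { j (here refl) → at-k ; j (there m) → at-l j m }
     where
     r₁ = rec ψ
     ω = proj₁ r₁
     sω = proj₁ (proj₂ r₁)
     eω = proj₂ (proj₂ r₁)
     r₂ = rec (λ j → - Q (αs j) (αs k))
     η′ = proj₁ r₂
     sη′ = proj₁ (proj₂ r₂)
     eη′ = proj₂ (proj₂ r₂)
     η = axpy (αs k) 1ℚ η′
     η-supp : Supp (k ∷ l) η
     η-supp = axpy-supp 1ℚ (α-supp {k ∷ l} (here refl)) (supp-there η′ sη′)
     orth : ∀ j → j ∈ˡ l → Q (αs j) η ≡ 0ℚ
     orth j m = trans (Q-axpyʳ (αs j) (αs k) 1ℚ η′) (trans (cong (λ z → Q (αs j) (αs k) + 1ℚ * z) (eη′ j m))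
       (solve 1 (λ x → x :+ c1 :* (:- x) := c0) refl (Q (αs j) (αs k))))
     Qη : Q η η ≡ Q (αs k) η
     Qη = trans (Q-axpyˡ (αs k) 1ℚ η′ η) (trans (cong (λ z → Q (αs k) η + 1ℚ * z) (trans (Q-solution η′ η (λ _ → 0ℚ) sη′ orth)
       (∑-zero λ j → ℚₚ.*-zeroʳ (η′ ! j)))) (solve 1 (λ x → x :+ c1 :* c0 := x) refl (Q (αs k) η)))
     η-k : η ! k ≡ 1ℚ
     η-k = trans (axpy-! (αs k) 1ℚ η′ k) (trans (cong₂ (λ x y → x + 1ℚ * y) (αs-same k) (sη′ k k∉)) refl)
     nz : Q (αs k) η ≢ 0ℚ
     nz e = ℚₚ.1≢0 (trans (sym η-k) (pd η η-supp (trans Qη e) k))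
     t = (ψ k - Q (αs k) ω) * inv (Q (αs k) η)
     at-l : ∀ j → j ∈ˡ l → Q (αs j) (axpy ω t η) ≡ ψ j
     at-l j m = trans (Q-axpyʳ (αs j) ω t η) (trans (cong₂ (λ x y → x + t * y) (eω j m) (orth j m))
       (solve 2 (λ x t → x :+ t :* c0 := x) refl (ψ j) t))
     at-k : Q (αs k) (axpy ω t η) ≡ ψ k
     at-k = trans (Q-axpyʳ (αs k) ω t η) (trans (cong (Q (αs k) ω +_) (trans (ℚₚ.*-assoc (ψ k - Q (αs k) ω) (inv (Q (αs k) η)) (Q (αs k) η))
       (1ʳ (ψ k - Q (αs k) ω) (inv-* nz)))) (solve 2 (λ x y → x :+ (y :- x) := y) refl (Q (αs k) ω) (ψ k)))

  abstract
    represent : ∀ l → PosDefOn l → ∀ (ψ : Fin n → ℚ) → ∃ λ ω → Supp l ω × (∀ k → k ∈ˡ l → Q (αs k) ω ≡ ψ k)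
    represent = represent′

  ht : V → ℚ
  ht v = ∑ (λ i → v ! i)

  ht-≥0 : ∀ v → Pos v → 0ℚ ≤ ht v
  ht-≥0 v p = ∑-≥0 p

  ht-axpy : ∀ u q v → ht (axpy u q v) ≡ ht u + q * ht v
  ht-axpy u q v = ∑-lin (u !_) q (v !_) (axpy-! u q v)

  ht-α : ∀ i → ht (αs i) ≡ 1ℚ
  ht-α i = trans (∑-single (αs i !_) i (λ j p → αs-diff (p ∘ sym))) (αs-same i)

  ht-s : ∀ i v → ht (s i v) ≡ ht v - Kᵛ i v
  ht-s i v = begin
    ht (s i v) ≡⟨ cong ht (s-def i v) ⟩
    ht (axpy v (- Kᵛ i v) (αs i)) ≡⟨ ht-axpy v (- Kᵛ i v) (αs i) ⟩
    ht v + (- Kᵛ i v) * ht (αs i) ≡⟨ cong (ht v +_) (1ʳ (- Kᵛ i v) (ht-α i)) ⟩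
    ht v - Kᵛ i v ∎

  cand-nonzero : ∀ {D v} → Cand D v → ¬ (∀ i → v ! i ≡ 0ℚ)
  cand-nonzero {D} {v} c z = >⇒≢ (Q-pos c) (Q-0ˡ v z)

  ht-≥1 : ∀ {D v} → Cand D v → Pos v → 1ℚ ≤ ht v
  ht-≥1 {D} {v} c p = int>0 (∑-int (int c)) (≥∧≢⇒> (ht-≥0 v p) λ e → cand-nonzero c (∑-zero⁻¹ (v !_) p e))

  -- The coefficient t and its inverse are both integers.
  cand-prop : ∀ {D D′ v w} t → Cand D v → Cand D′ w → 0ℚ < t → v ≡ t ·V w → v ≡ w
  cand-prop {D} {D′} {v} {w} t cv cw t>0 refl = trans (cong (_·V w) t≡1) (1·V w)
    where
    Evw : E v w ≡ t * D′
    Evw = trans (E-·ˡ t w w) (cong (t *_) (norm cw))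
    Dt : D ≡ t * (t * D′)
    Dt = trans (sym (norm cv)) (trans (E-·ˡ t w v) (cong (t *_) (trans (E-·ʳ t w w) (cong (t *_) (norm cw)))))
    m₁ : Mul D′ (t * D′)
    m₁ = subst (Mul D′) Evw (E-mulʳ {u = v} (int cv) (dmul cw))
    m₂ : Mul D (t * D′)
    m₂ = subst (Mul D) Evw (E-mulˡ {v = w} (dmul cv) (int cw))
    1≤t : 1ℚ ≤ t
    1≤t = by≤ {t - 1ℚ} (*-cancel≥0 (D>0 cw) (nn (≤⇒0≤ (mul>0 (D>0 cw) m₁ (*>0 t>0 (D>0 cw))))
      (solve 2 (λ t D → D :* (t :- c1) := t :* D :- D) refl t D′))) refl
    t≤1 : t ≤ 1ℚ
    t≤1 = by≤ {1ℚ - t} (*-cancel≥0 (*>0 t>0 (D>0 cw)) (nn (≤⇒0≤ (mul>0 (D>0 cv) m₂ (*>0 t>0 (D>0 cw))))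
      (trans (solve 2 (λ t D → (t :* D) :* (c1 :- t) := t :* D :- t :* (t :* D)) refl t D′) (cong (λ z → t * D′ - z) (sym Dt))))) refl
    t≡1 : t ≡ 1ℚ
    t≡1 = ℚₚ.≤-antisym t≤1 1≤t

  iter : (V → V) → ℕ → V → V
  iter f zero v = v
  iter f (suc t) v = iter f t (f v)

  iter-suc : ∀ f t v → iter f t (f v) ≡ f (iter f t v)
  iter-suc f zero v = refl
  iter-suc f (suc t) v = iter-suc f t (f v)

  module _ (SD : Semidefinite) where
    open Semidefinite SD
    open Signs SD

    -- s_i alters only the coordinate i. If the result is negative, all other coordinates of v are
    -- both nonnegative and nonpositive, so v is a multiple of α_i.
    pos-s : ∀ {D v} i → Cand D v → Pos v → Pos (s i v) ⊎ v ≡ αs i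
    pos-s {D} {v} i c p with sign (cand-s i c)
    ... | inj₁ q = inj₁ q
    ... | inj₂ q = inj₂ (cand-prop (v ! i) c (cand-α i) (≥∧≢⇒> (p i) nz) (ext eq))
      where
      off : ∀ j → i ≢ j → v ! j ≡ 0ℚ
      off j r = ℚₚ.≤-antisym (0≤-⇒≤0 (subst (0ℚ ≤_) (trans (-V-! (s i v) j) (cong -_ (s-other v r))) (q j))) (p j)
      eq : ∀ j → v ! j ≡ (v ! i ·V αs i) ! j
      eq j with i Fin.≟ j
      ... | yes refl = sym (trans (·V-! (v ! i) (αs i) i) (1ʳ (v ! i) (αs-same i)))
      ... | no r = trans (off j r) (sym (trans (·V-! (v ! i) (αs i) j) (0ʳ (v ! i) (αs-diff r))))
      nz : v ! i ≢ 0ℚ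
      nz e = cand-nonzero c z
        where
        z : ∀ j → v ! j ≡ 0ℚ
        z j with i Fin.≟ j
        ... | yes refl = e
        ... | no r = off j r

    private
      descend : ∀ {D v} → Cand D v → Pos v → ∃ λ i → 1ℚ ≤ Kᵛ i v
      descend {D} {v} c p = i , int>0 (Kᵛ-int i v (int c)) (*-cancel>0 {d i} {Kᵛ i v} (d-pos i)
          (subst (0ℚ <_) (Q-α i v) (≥*-cancel>0 {v ! i} {Q (αs i) v} (p i) (proj₂ r))))
        where
        r : ∃ λ i → 0ℚ < v ! i * Q (αs i) v
        r = ∑-pos (λ i → v ! i * Q (αs i) v) (subst (0ℚ <_) (Q-exp v v) (Q-pos c))
        i = proj₁ r

      real-of-pos : ∀ N {D v} → Cand D v → Pos v → ht v ≤ ι N → RealRoot v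
      real-of-pos zero {v = v} c p le = ⊥-elim (≤<⊥ (ℚₚ.≤-trans (ht-≥1 c p) (subst (ht v ≤_) ι-0 le)) 0<1)
      real-of-pos (suc N) {D} {v} c p le = aux (descend c p)
        where
        lower : ∀ i → 1ℚ ≤ Kᵛ i v → ht (s i v) ≤ ι N
        lower i k≥1 = by≤ (+≥0 (≤⇒0≤ (subst (ht v ≤_) (ι-suc N) le)) (≤⇒0≤ k≥1)) (trans (cong (λ z → ι N - z) (ht-s i v))
              (solve 3 (λ x h k → x :- (h :- k) := c1 :+ x :- h :+ (k :- c1)) refl (ι N) (ht v) (Kᵛ i v)))
        aux : (∃ λ i → 1ℚ ≤ Kᵛ i v) → RealRoot v
        aux (i , k≥1) with pos-s i c p
        ... | inj₂ e = subst RealRoot (sym e) (simple i)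
        ... | inj₁ ps = subst RealRoot (s-invol i v) (refl-s i (real-of-pos N (cand-s i c) ps (lower i k≥1)))

    -- For positive v, Q(v,v) = Σ v_i Q(α_i,v) > 0 supplies a simple reflection that lowers the
    -- height. The result is again a positive candidate unless v is simple, so induction on the
    -- height ends at a simple root.
    cand⇒real : ∀ {D v} → Cand D v → RealRoot v
    cand⇒real {D} {v} c with sign c
    ... | inj₁ p = let N , le = archι (ht v) in real-of-pos N c p le
    ... | inj₂ p = let N , le = archι (ht (-V v)) in subst RealRoot (-V-inv v) (real-neg (real-of-pos N (cand-neg c) p le))

    -- A partial product leaves the positive cone only where it has turned x into the simple root
    -- about to be reflected; undoing the earlier reflections identifies x with q_k.
    cl-step : ∀ l {D x} → Cand D x → Pos x → Pos (cl l x) ⊎ (∃ λ l₁ → ∃ λ k → ∃ λ l₂ → l ≡ l₁ ++ k ∷ l₂ × x ≡ inj l₂ k)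
    cl-step [] c p = inj₁ p
    cl-step (k ∷ l) {D} {x} c p with cl-step l c p
    ... | inj₂ (l₁ , k′ , l₂ , e , e′) = inj₂ (k ∷ l₁ , k′ , l₂ , cong (k ∷_) e , e′)
    ... | inj₁ q with pos-s k (cand-cl l c) q
    ... | inj₁ r = inj₁ r
    ... | inj₂ e = inj₂ ([] , k , l , refl , trans (sym (rev-cl l x)) (cong (cl (reverse l)) e))

    -- On a finite-type support the heights of x, c x, c² x, … telescope to a bounded quantity.
    finite-orbit : ∀ l → Sorted l → PosDefOn l → ∀ {D x} → Cand D x → Supp l x → Pos x →
      ∃ λ t → ∃ λ l₁ → ∃ λ k → ∃ λ l₂ → l ≡ l₁ ++ k ∷ l₂ × iter (cl l) t x ≡ inj l₂ k
    finite-orbit l S pd {D} {x} c sx px = go (proj₁ N) c sx px start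
      where
      -- `z` satisfies Q(y,z) = ht y on this support. By Serre duality E(c y,z) = E(y,z) + ht(c y),
      -- a gain of at least 1 as long as c y is positive, whereas E(·,z) = Q(·,ω) is bounded on
      -- vectors of fixed norm.
      rz = represent l pd (λ _ → 1ℚ)
      z = proj₁ rz
      rω = represent l pd (λ k → row eul k z)
      ω = proj₁ rω
      bound : ∀ {y} → Cand D y → Supp l y → 2ℚ * E y z ≤ 2ℚ * D + Q ω ω
      bound {y} cy sy = subst₂ _≤_ (cong (2ℚ *_) (trans (Q-solution y ω (λ k → row eul k z) sy (proj₂ (proj₂ rω))) (sym (B-def eul y z))))
        (cong (_+ Q ω ω) (Q-norm cy)) (am-gm y ω)
      ht-E : ∀ {y} → Supp l y → E (cl l y) z ≡ E y z + ht (cl l y)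
      ht-E {y} sy = trans (solve 2 (λ a b → a := b :+ (a :+ (:- b))) refl (E (cl l y) z) (E y z))
        (cong (E y z +_) (trans (cong (E (cl l y) z +_) (sym (E-cl l S (proj₁ (proj₂ rz)) y)))
        (trans (sym (Q≡E+E (cl l y) z)) (trans (Q-solution (cl l y) z (λ _ → 1ℚ) (cl-supp l sy) (proj₂ (proj₂ rz)))
        (∑-cong λ i → ℚₚ.*-identityʳ (cl l y ! i))))))
      N = archι (2ℚ * D + Q ω ω - 2ℚ * E x z + 1ℚ)
      start : 2ℚ * D + Q ω ω - 2ℚ * E x z < ι (proj₁ N)
      start = ℚₚ.<-≤-trans (by< 0<1 (solve 1 (λ x → x :+ c1 :- x := c1) refl (2ℚ * D + Q ω ω - 2ℚ * E x z))) (proj₂ N)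
      go : ∀ N {y} → Cand D y → Supp l y → Pos y → 2ℚ * D + Q ω ω - 2ℚ * E y z < ι N →
        ∃ λ t → ∃ λ l₁ → ∃ λ k → ∃ λ l₂ → l ≡ l₁ ++ k ∷ l₂ × iter (cl l) t y ≡ inj l₂ k
      go zero {y} cy sy py lt = ⊥-elim (≤<⊥ (≤⇒0≤ (bound cy sy)) (subst (2ℚ * D + Q ω ω - 2ℚ * E y z <_) ι-0 lt))
      go (suc N) {y} cy sy py lt with cl-step l cy py
      ... | inj₂ (l₁ , k , l₂ , e , e′) = 0 , l₁ , k , l₂ , e , e′
      ... | inj₁ q = let t , r = go N (cand-cl l cy) (cl-supp l sy) q
                           (by< (+>0 (<⇒0< lt) (+≥0 (≤⇒0≤ (ht-≥1 (cand-cl l cy) q)) (ht-≥0 (cl l y) q)))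
                             (trans (cong (λ w → ι N - (2ℚ * D + Q ω ω - 2ℚ * w)) (ht-E sy))
                             (trans (solve 4 (λ n b e h → n :- (b :- c2 :* (e :+ h)) := (c1 :+ n :- (b :- c2 :* e)) :+ ((h :- c1) :+ h)) refl
                               (ι N) (2ℚ * D + Q ω ω) (E y z) (ht (cl l y)))
                             (cong (λ w → w - (2ℚ * D + Q ω ω - 2ℚ * E y z) + ((ht (cl l y) - 1ℚ) + ht (cl l y))) (sym (ι-suc N))))))
                     in suc t , r

  -- The full Coxeter element, projective and injective roots, and the maps σ and τ.

  L : List (Fin n)
  L = allFin n

  private
    tabulate-sorted : ∀ {m} (f : Fin m → Fin n) → (∀ {i j} → i Fin.< j → f i Fin.< f j) → AllPairs Fin._<_ (List.tabulate f)
    tabulate-sorted {zero} f h = []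
    tabulate-sorted {suc m} f h = tail {m} (f ∘ suc) (λ i → h {zero} {suc i} (ℕ.s≤s ℕ.z≤n)) ∷ tabulate-sorted (f ∘ suc) (λ p → h (ℕ.s≤s p))
      where
      tail : ∀ {m} (g : Fin m → Fin n) → (∀ i → f zero Fin.< g i) → All (f zero Fin.<_) (List.tabulate g)
      tail {zero} g h = []
      tail {suc m} g h = h zero ∷ tail (g ∘ suc) (h ∘ suc)

    ∈-tabulate : ∀ {m} (f : Fin m → Fin n) i → f i ∈ˡ List.tabulate f
    ∈-tabulate f zero = here refl
    ∈-tabulate f (suc i) = there (∈-tabulate (f ∘ suc) i)

  L-sorted : Sorted L
  L-sorted = tabulate-sorted id id

  ∈L : ∀ i → i ∈ˡ L
  ∈L = ∈-tabulate id

  suppL : ∀ v → Supp L v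
  suppL v i p = ⊥-elim (p (∈L i))

  E-cox : ∀ u v → E v (cox u) ≡ - E u v
  E-cox u v = E-cl L L-sorted (suppL v) u

  E-cox-inv : ∀ u v → E (cox u) (cox v) ≡ E u v
  E-cox-inv u v = E-cl-inv L L-sorted (suppL u) (suppL v)

  -- Wrapped in a record so that k and the two halves can be inferred; they could not be recovered
  -- by unification from an equation with `++`.
  record Split (k : Fin n) (l₁ l₂ : List (Fin n)) : Set where
    constructor split
    field
      L≡ : L ≡ l₁ ++ k ∷ l₂

  split-at : ∀ k → ∃ λ l₁ → ∃ λ l₂ → Split k l₁ l₂
  split-at k = let l₁ , l₂ , e = go L (∈L k) in l₁ , l₂ , split e
    where
    go : ∀ l → k ∈ˡ l → ∃ λ l₁ → ∃ λ l₂ → l ≡ l₁ ++ k ∷ l₂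
    go (_ ∷ l) (here refl) = [] , l , refl
    go (j ∷ l) (there m) = let l₁ , l₂ , e = go l m in j ∷ l₁ , l₂ , cong (j ∷_) e

  E-p : ∀ {k l₁ l₂} → Split k l₁ l₂ → ∀ v → E v (proj l₁ k) ≡ d k * v ! k
  E-p {k} {l₁} {l₂} (split e) v = E-proj l₁ k l₂ (subst Sorted e L-sorted) (subst (λ l → Supp l v) e (suppL v))

  E-q : ∀ {k l₁ l₂} → Split k l₁ l₂ → ∀ v → E (inj l₂ k) v ≡ d k * v ! k
  E-q {k} {l₁} {l₂} (split e) v = E-inj l₁ k l₂ (subst Sorted e L-sorted) (subst (λ l → Supp l v) e (suppL v))

  cox-q : ∀ {k l₁ l₂} → Split k l₁ l₂ → cox (inj l₂ k) ≡ -V proj l₁ k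
  cox-q {k} {l₁} {l₂} (split e) = trans (cong (λ l → cl l (inj l₂ k)) e) (cl-inj l₁ k l₂)

  sorted-mid : ∀ l₁ {k l₂} → Sorted (l₁ ++ k ∷ l₂) → ∀ {j} → (j ∈ˡ l₁ → j Fin.< k) × (j ∈ˡ l₂ → k Fin.< j)
  sorted-mid [] S = (λ ()) , min-head S
  sorted-mid (i ∷ l₁) {k} {l₂} S@(_ ∷ S′) = (λ { (here refl) → min-head S (Memₚ.∈-insert l₁) ; (there m) → proj₁ (sorted-mid l₁ S′) m }) , proj₂ (sorted-mid l₁ S′)

  before : ∀ {k l₁ l₂} → Split k l₁ l₂ → ∀ {j} → j ∈ˡ l₁ → j Fin.< k
  before {l₁ = l₁} (split e) = proj₁ (sorted-mid l₁ (subst Sorted e L-sorted))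

  after : ∀ {k l₁ l₂} → Split k l₁ l₂ → ∀ {j} → j ∈ˡ l₂ → k Fin.< j
  after {l₁ = l₁} (split e) = proj₂ (sorted-mid l₁ (subst Sorted e L-sorted))

  p-self : ∀ {k l₁ l₂} → Split k l₁ l₂ → proj l₁ k ! k ≡ 1ℚ
  p-self {k} {l₁} sp = trans (cl-fix l₁ (αs k) (λ m → ℕₚ.<-irrefl refl (before sp m))) (αs-same k)

  p-after : ∀ {k l₁ l₂ j} → Split k l₁ l₂ → k Fin.< j → proj l₁ k ! j ≡ 0ℚ
  p-after {k} {l₁} sp lt = trans (cl-fix l₁ (αs k) (λ m → ℕₚ.<-asym (before sp m) lt)) (αs-diff λ { refl → ℕₚ.<-irrefl refl lt })

  ∈-reverse : ∀ {j} l → j ∈ˡ reverse l → j ∈ˡ l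
  ∈-reverse = λ l → Anyₚ.reverse⁻

  q-self : ∀ {k l₁ l₂} → Split k l₁ l₂ → inj l₂ k ! k ≡ 1ℚ
  q-self {k} {l₁} {l₂} sp = trans (cl-fix (reverse l₂) (αs k) (λ m → ℕₚ.<-irrefl refl (after sp (∈-reverse l₂ m)))) (αs-same k)

  q-before : ∀ {k l₁ l₂ j} → Split k l₁ l₂ → j Fin.< k → inj l₂ k ! j ≡ 0ℚ
  q-before {k} {l₁} {l₂} sp lt = trans (cl-fix (reverse l₂) (αs k) (λ m → ℕₚ.<-asym (after sp (∈-reverse l₂ m)) lt)) (αs-diff λ { refl → ℕₚ.<-irrefl refl lt })

  private
    any-true : ∀ {p : Fin n → Bool} {j} l → j ∈ˡ l → p j ≡ true → any p l ≡ true
    any-true (_ ∷ l) (here refl) e rewrite e = refl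
    any-true {p} (i ∷ l) (there m) e rewrite any-true {p} l m e = Boolₚ.∨-zeroʳ (p i)

    any-false : ∀ {p : Fin n → Bool} l → (∀ j → p j ≡ false) → any p l ≡ false
    any-false [] h = refl
    any-false (j ∷ l) h rewrite h j = any-false l h

    test : Fin n → V → Fin n → Bool
    test i v j = not ⌊ i Fin.≟ j ⌋ ∧ ⌊ v ≟V (-V αs j) ⌋

    σ-if : ∀ i v b → any (test i v) L ≡ b → σ i v ≡ (if b then v else s i v)
    σ-if i v b e = cong (if_then v else s i v) e

  α-injective : ∀ {i j} → αs i ≡ αs j → i ≡ j
  α-injective {i} {j} e with i Fin.≟ j
  ... | yes p = p
  ... | no p = ⊥-elim (ℚₚ.1≢0 (trans (sym (αs-same j)) (trans (cong (_! j) (sym e)) (αs-diff p))))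

  σ-move : ∀ {i v} → (∀ j → i ≢ j → v ≢ -V αs j) → σ i v ≡ s i v
  σ-move {i} {v} h = σ-if i v false (any-false L f)
    where
    f : ∀ j → test i v j ≡ false
    f j with i Fin.≟ j | v ≟V (-V αs j)
    ... | yes _ | _ = refl
    ... | no p | yes q = ⊥-elim (h j p q)
    ... | no _ | no _ = refl

  σ-fix : ∀ {i k} → i ≢ k → σ i (-V αs k) ≡ -V αs k
  σ-fix {i} {k} p = σ-if i (-V αs k) true (any-true L (∈L k) t)
    where
    t : test i (-V αs k) k ≡ true
    t with i Fin.≟ k | (-V αs k) ≟V (-V αs k)
    ... | yes e | _ = ⊥-elim (p e)
    ... | no _ | yes _ = refl
    ... | no _ | no q = ⊥-elim (q refl)

  pos≢neg : ∀ {v} → Pos v → ∀ j → v ≢ -V αs j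
  pos≢neg p j refl = ≤<⊥ (p j) (subst (_< 0ℚ) (sym (trans (-V-! (αs j) j) (cong -_ (αs-same j)))) (->0 0<1))

  σ-pos : ∀ {i v} → Pos v → σ i v ≡ s i v
  σ-pos p = σ-move (λ j _ → pos≢neg p j)

  s-α : ∀ k → s k (αs k) ≡ -V αs k
  s-α k = cl-inj [] k []

  s-negα : ∀ k → s k (-V αs k) ≡ αs k
  s-negα k = trans (cong (s k) (sym (s-α k))) (s-invol k (αs k))

  α-pos : ∀ k → Pos (αs k)
  α-pos k j with k Fin.≟ j
  ... | yes refl = subst (0ℚ ≤_) (sym (αs-same k)) 0≤1
  ... | no p = ≡⇒≤ (sym (αs-diff p))

  stay : ∀ l {k} → k ∉ˡ l → foldr σ (-V αs k) l ≡ -V αs k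
  stay [] p = refl
  stay (j ∷ l) p = trans (cong (σ j) (stay l (p ∘ there))) (σ-fix λ { refl → p (here refl) })

  module Tau (SD : Semidefinite) where

    -- The coordinate k stays equal to 1 under reflections in other indices, so none of these
    -- reflections ever meets its own simple root.
    p-pos : ∀ l {k} → k ∉ˡ l → Pos (cl l (αs k))
    p-pos [] {k} p = α-pos k
    p-pos (j ∷ l) {k} p with pos-s SD j (cand-cl l (cand-α k)) (p-pos l (p ∘ there))
    ... | inj₁ q = q
    ... | inj₂ e = ⊥-elim (ℚₚ.1≢0 (trans (sym (αs-same k)) (trans (sym (cl-fix l (αs k) (p ∘ there)))
           (trans (cong (_! k) e) (αs-diff λ { refl → p (here refl) })))))

    proj-pos : ∀ {k l₁ l₂} → Split k l₁ l₂ → Pos (proj l₁ k)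
    proj-pos {l₁ = l₁} sp = p-pos l₁ (λ m → ℕₚ.<-irrefl refl (before sp m))

    inj-pos : ∀ {k l₁ l₂} → Split k l₁ l₂ → Pos (inj l₂ k)
    inj-pos {l₂ = l₂} sp = p-pos (reverse l₂) (λ m → ℕₚ.<-irrefl refl (after sp (∈-reverse l₂ m)))

    τ-negα : ∀ {k l₁ l₂} → Split k l₁ l₂ → τ (-V αs k) ≡ proj l₁ k
    τ-negα {k} {l₁} {l₂} sp@(split e) = trans (cong (foldr σ (-V αs k)) e) (trans (Listₚ.foldr-++ σ (-V αs k) l₁ (k ∷ l₂))
      (trans (cong (λ w → foldr σ (σ k w) l₁) (stay l₂ (λ m → ℕₚ.<-irrefl refl (after sp m))))
      (trans (cong (λ w → foldr σ w l₁) (trans (σ-move {k} {v = -V αs k} (λ j p e → p (α-injective (trans (sym (-V-inv (αs k))) (trans (cong -V_ e) (-V-inv (αs j))))))) (s-negα k)))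
      (up l₁ (λ m → ℕₚ.<-irrefl refl (before sp m))))))
      where
      up : ∀ l → k ∉ˡ l → foldr σ (αs k) l ≡ cl l (αs k)
      up [] p = refl
      up (j ∷ l) p = trans (cong (σ j) (up l (p ∘ there))) (σ-pos (p-pos l (p ∘ there)))

    private
      -- On positive roots σ acts as the reflection. Once the partial product equals the simple root
      -- α_j of the next factor σ_j, it becomes -α_j, and every later factor fixes it.
      τ-gen : ∀ l → Sorted l → ∀ {D x} → Cand D x → Pos x → (foldr σ x l ≡ cl l x × Pos (cl l x)) ⊎
        (∃ λ l₁ → ∃ λ k → ∃ λ l₂ → l ≡ l₁ ++ k ∷ l₂ × x ≡ inj l₂ k × foldr σ x l ≡ -V αs k)
      τ-gen [] S c p = inj₁ (refl , p)
      τ-gen (j ∷ l) S@(_ ∷ S′) {D} {x} c p with τ-gen l S′ c p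
      ... | inj₂ (l₁ , k , l₂ , refl , e′ , e″) = inj₂ (j ∷ l₁ , k , l₂ , refl , e′ , trans (cong (σ j) e″) (σ-fix λ { refl → ℕₚ.<-irrefl refl (proj₁ (sorted-mid (j ∷ l₁) S) (here refl)) }))
      ... | inj₁ (e , q) with pos-s SD j (cand-cl l c) q
      ... | inj₁ r = inj₁ (trans (cong (σ j) e) (σ-pos q) , r)
      ... | inj₂ r = inj₂ ([] , j , l , refl , trans (sym (rev-cl l x)) (cong (cl (reverse l)) r) ,
              trans (cong (σ j) (trans e r)) (trans (σ-pos (α-pos j)) (s-α j)))

    τ-pos : ∀ {D x} → Cand D x → Pos x → (τ x ≡ cox x × Pos (cox x)) ⊎
      (∃ λ l₁ → ∃ λ k → ∃ λ l₂ → Split k l₁ l₂ × x ≡ inj l₂ k × τ x ≡ -V αs k)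
    τ-pos c p with τ-gen L L-sorted c p
    ... | inj₁ r = inj₁ r
    ... | inj₂ (l₁ , k , l₂ , e , r) = inj₂ (l₁ , k , l₂ , split e , r)

    -- Step w u v: one step of τ from u to v, where w is the factor with u^∨ = w d u in coordinates.
    data Step (w : ℚ) : V → V → Set where
      up   : ∀ {k l₁ l₂} → Split k l₁ l₂ → w * d k ≡ 1ℚ → Step w (-V αs k) (proj l₁ k)
      move : ∀ {u} → Pos u → Pos (cox u) → Step w u (cox u)
      down : ∀ {k l₁ l₂} → Split k l₁ l₂ → w * d k ≡ 1ℚ → Step w (inj l₂ k) (-V αs k)

  -- The compatibility forms through the Euler form, and their τ-invariance.

  module CompatFormula (κ : Kind) where

    -- Treats real roots and δ alike: w is 1/E(α,α) for a real root, and for δ it is the factor that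
    -- relates δ^∨ to δ.
    Wt : ℚ → V → Set
    Wt w α = ∀ i → corootC κ α i ≡ w * (d i * α ! i)

    private
      part : (r : Fin n → Fin n → Bool) → V → V → ℚ
      part r α β = - ∑ (λ i → corootC κ α i * lookup β i)
        - ∑ (λ i → ∑ (λ j → if r i j then a i j * [ corootC κ α i ]₊ * [ lookup β j ]₊ else 0ℚ))

      []₊-pos : ∀ {x} → 0ℚ ≤ x → [ x ]₊ ≡ x
      []₊-pos = ℚₚ.p≥q⇒p⊔q≡p

      []₊-neg : ∀ {x} → x ≤ 0ℚ → [ x ]₊ ≡ 0ℚ
      []₊-neg = ℚₚ.p≤q⇒p⊔q≡q

      -- On positive arguments the truncations disappear. The strict triangle selected by r together
      -- with the diagonal sum is then the Euler matrix or its transpose.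
      part-pos : ∀ r (e : Fin n → Fin n → ℚ) {w α β} → (∀ i j → e i j ≡ d i * (if r i j then a i j else 0ℚ) + d i * αs i ! j) →
        Wt w α → 0ℚ < w → Pos α → Pos β → part r α β ≡ - (w * B e α β)
      part-pos r e {w} {α} {β} he wt w>0 pα pβ = begin
        - X - Y ≡⟨ solve 2 (λ x y → :- x :- y := :- (x :+ y)) refl X Y ⟩
        - (X + Y) ≡⟨ cong -_ (sym (∑-+ x y)) ⟩
        - ∑ (λ i → x i + y i) ≡⟨ cong -_ (∑-scale w (λ i → α ! i * row e i β) term) ⟩
        - (w * ∑ (λ i → α ! i * row e i β)) ≡⟨ cong (λ z → - (w * z)) (sym (B-def e α β)) ⟩
        - (w * B e α β) ∎
        where
        x = λ i → corootC κ α i * lookup β i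
        y = λ i → ∑ (λ j → if r i j then a i j * [ corootC κ α i ]₊ * [ lookup β j ]₊ else 0ℚ)
        X = ∑ x
        Y = ∑ y
        c≥0 : ∀ i → 0ℚ ≤ corootC κ α i
        c≥0 i = subst (0ℚ ≤_) (sym (wt i)) (*≥0 (ℚₚ.<⇒≤ w>0) (*≥0 (ℚₚ.<⇒≤ (d-pos i)) (pα i)))
        t : Fin n → Fin n → ℚ
        t i j = if r i j then a i j else 0ℚ
        ifterm : ∀ i j → (if r i j then a i j * [ corootC κ α i ]₊ * [ lookup β j ]₊ else 0ℚ) ≡ (w * (d i * α ! i)) * (t i j * β ! j)
        ifterm i j with r i j
        ... | true = trans (cong₂ (λ p q → a i j * p * q) (trans ([]₊-pos (c≥0 i)) (wt i)) ([]₊-pos (pβ j)))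
          (solve 3 (λ a c b → a :* c :* b := c :* (a :* b)) refl (a i j) (w * (d i * α ! i)) (β ! j))
        ... | false = solve 2 (λ c b → c0 := c :* (c0 :* b)) refl (w * (d i * α ! i)) (β ! j)
        rowe : ∀ i → row e i β ≡ d i * ∑ (λ j → t i j * β ! j) + d i * β ! i
        rowe i = trans (∑-cong λ j → trans (cong (_* β ! j) (he i j))
            (solve 4 (λ d t α b → (d :* t :+ d :* α) :* b := d :* (t :* b) :+ d :* (α :* b)) refl (d i) (t i j) (αs i ! j) (β ! j)))
          (trans (∑-+ (λ j → d i * (t i j * β ! j)) (λ j → d i * (αs i ! j * β ! j)))
          (cong₂ _+_ (∑-* (d i) (λ j → t i j * β ! j)) (trans (∑-* (d i) (λ j → αs i ! j * β ! j)) (cong (d i *_)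
            (trans (∑-single (λ j → αs i ! j * β ! j) i (λ j p → 0ˡ (β ! j) (αs-diff (p ∘ sym)))) (1ˡ (β ! i) (αs-same i)))))))
        term : ∀ i → x i + y i ≡ w * (α ! i * row e i β)
        term i = trans (cong₂ (λ p q → p * β ! i + q) (wt i) (∑-scale (w * (d i * α ! i)) (λ j → t i j * β ! j) (ifterm i)))
          (trans (solve 5 (λ w d α b s → w :* (d :* α) :* b :+ (w :* (d :* α)) :* s := w :* (α :* (d :* s :+ d :* b))) refl w (d i) (α ! i) (β ! i) (∑ (λ j → t i j * β ! j)))
          (cong (λ z → w * (α ! i * z)) (sym (rowe i))))

      part-neg : ∀ r {α β} → (∀ i j → [ corootC κ α i ]₊ ≡ 0ℚ ⊎ [ β ! j ]₊ ≡ 0ℚ) → part r α β ≡ - ∑ (λ i → corootC κ α i * β ! i)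
      part-neg r {α} {β} h = trans (cong (λ z → - ∑ (λ i → corootC κ α i * lookup β i) - z) (∑-zero λ i → ∑-zero (z i)))
        (solve 1 (λ x → :- x :- c0 := :- x) refl (∑ (λ i → corootC κ α i * lookup β i)))
        where
        z : ∀ i j → (if r i j then a i j * [ corootC κ α i ]₊ * [ lookup β j ]₊ else 0ℚ) ≡ 0ℚ
        z i j with r i j
        ... | false = refl
        ... | true with h i j
        ... | inj₁ e = trans (cong (λ p → a i j * p * [ β ! j ]₊) e) (solve 2 (λ a b → a :* c0 :* b := c0) refl (a i j) [ β ! j ]₊)
        ... | inj₂ e = 0ʳ (a i j * [ corootC κ α i ]₊) e

      lt gt : Fin n → Fin n → Bool
      lt i j = ⌊ i Fin.<? j ⌋
      gt i j = ⌊ j Fin.<? i ⌋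

      e-lt : ∀ i j → eul i j ≡ d i * (if lt i j then a i j else 0ℚ) + d i * αs i ! j
      e-lt i j with Finₚ.<-cmp i j | i Fin.<? j
      ... | tri< p _ _ | no q = ⊥-elim (q p)
      ... | tri≈ q _ _ | yes p = ⊥-elim (q p)
      ... | tri> q _ _ | yes p = ⊥-elim (q p)
      ... | tri< _ p _ | yes _ = sym (trans (cong (λ z → d i * a i j + d i * z) (αs-diff p)) (solve 2 (λ d a → d :* a :+ d :* c0 := d :* a) refl (d i) (a i j)))
      ... | tri≈ _ refl _ | no _ = sym (trans (cong (λ z → d i * 0ℚ + d i * z) (αs-same i)) (solve 1 (λ d → d :* c0 :+ d :* c1 := d) refl (d i)))
      ... | tri> _ p _ | no _ = sym (trans (cong (λ z → d i * 0ℚ + d i * z) (αs-diff p)) (solve 1 (λ d → d :* c0 :+ d :* c0 := c0) refl (d i)))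

      e-gt : ∀ i j → eul j i ≡ d i * (if gt i j then a i j else 0ℚ) + d i * αs i ! j
      e-gt i j with Finₚ.<-cmp j i | j Fin.<? i
      ... | tri< p _ _ | no q = ⊥-elim (q p)
      ... | tri≈ q _ _ | yes p = ⊥-elim (q p)
      ... | tri> q _ _ | yes p = ⊥-elim (q p)
      ... | tri< _ p _ | yes _ = sym (trans (cong (λ z → d i * a i j + d i * z) (αs-diff (p ∘ sym))) (trans (solve 2 (λ d a → d :* a :+ d :* c0 := d :* a) refl (d i) (a i j)) (symm i j)))
      ... | tri≈ _ refl _ | no _ = sym (trans (cong (λ z → d i * 0ℚ + d i * z) (αs-same i)) (solve 1 (λ d → d :* c0 :+ d :* c1 := d) refl (d i)))
      ... | tri> _ p _ | no _ = sym (trans (cong (λ z → d i * 0ℚ + d i * z) (αs-diff (p ∘ sym))) (solve 1 (λ d → d :* c0 :+ d :* c0 := c0) refl (d i)))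

    cm-pos : ∀ {w α β} → Wt w α → 0ℚ < w → Pos α → Pos β → compatMax κ α β ≡ (w * (- E β α)) ⊔ (w * (- E α β))
    cm-pos {w} {α} {β} wt w>0 pα pβ = cong₂ _⊔_
      (trans (part-pos gt (λ i j → eul j i) {w} {α} {β} e-gt wt w>0 pα pβ) (trans (ℚₚ.neg-distribʳ-* w (B (λ i j → eul j i) α β)) (cong (λ z → w * (- z)) (sym (B-transpose eul β α)))))
      (trans (part-pos lt eul {w} {α} {β} e-lt wt w>0 pα pβ) (ℚₚ.neg-distribʳ-* w (E α β)))

    private
      cm-neg-gen : ∀ α β → (∀ i j → [ corootC κ α i ]₊ ≡ 0ℚ ⊎ [ β ! j ]₊ ≡ 0ℚ) → compatMax κ α β ≡ - ∑ (λ i → corootC κ α i * β ! i)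
      cm-neg-gen α β h = trans (cong₂ _⊔_ (part-neg gt {α} {β} h) (part-neg lt {α} {β} h)) (ℚₚ.⊔-idem (- ∑ (λ i → corootC κ α i * β ! i)))

      neg-coord : ∀ k j → (-V αs k) ! j ≤ 0ℚ
      neg-coord k j = subst (_≤ 0ℚ) (sym (-V-! (αs k) j)) (-≥0 (α-pos k j))

      negα-at : ∀ k → (-V αs k) ! k ≡ - 1ℚ
      negα-at k = trans (-V-! (αs k) k) (cong -_ (αs-same k))

      negα-off : ∀ {k j} → k ≢ j → (-V αs k) ! j ≡ 0ℚ
      negα-off {k} {j} p = trans (-V-! (αs k) j) (cong -_ (αs-diff p))

    cm-neg : ∀ {w k} β → Wt w (-V αs k) → w * d k ≡ 1ℚ → compatMax κ (-V αs k) β ≡ β ! k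
    cm-neg {w} {k} β wt e = trans (cm-neg-gen (-V αs k) β (λ i j → inj₁ ([]₊-neg (subst (_≤ 0ℚ) (sym (co i)) (neg-coord k i)))))
      (trans (cong -_ (trans (∑-single (λ i → corootC κ (-V αs k) i * β ! i) k (λ i p → 0ˡ (β ! i) (trans (co i) (negα-off (p ∘ sym)))))
        (cong (_* β ! k) (trans (co k) (negα-at k)))))
      (solve 1 (λ b → :- ((:- c1) :* b) := b) refl (β ! k)))
      where
      co : ∀ i → corootC κ (-V αs k) i ≡ (-V αs k) ! i
      co i with k Fin.≟ i
      ... | yes refl = trans (wt i) (trans (sym (ℚₚ.*-assoc w (d i) ((-V αs i) ! i))) (1ˡ ((-V αs i) ! i) e))
      ... | no p = trans (wt i) (trans (0ʳ w (0ʳ (d i) (negα-off p))) (sym (negα-off p)))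

    cm-negʳ : ∀ k α → compatMax κ α (-V αs k) ≡ corootC κ α k
    cm-negʳ k α = trans (cm-neg-gen α (-V αs k) (λ i j → inj₂ ([]₊-neg (neg-coord k j))))
      (trans (cong -_ (trans (∑-single (λ i → corootC κ α i * (-V αs k) ! i) k (λ i p → 0ʳ (corootC κ α i) (negα-off (p ∘ sym))))
        (cong (corootC κ α k *_) (negα-at k))))
      (solve 1 (λ b → :- (b :* (:- c1)) := b) refl (corootC κ α k)))

    module Invariance (SD : Semidefinite) where

      open Tau SD

      private
        max₁ : ∀ {x y} → y ≤ x → x ⊔ y ≡ x
        max₁ = ℚₚ.p≥q⇒p⊔q≡p
        max₂ : ∀ {x y} → x ≤ y → x ⊔ y ≡ y
        max₂ = ℚₚ.p≤q⇒p⊔q≡q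

        w-neg : ∀ {w x} → 0ℚ < w → 0ℚ ≤ x → w * (- x) ≤ 0ℚ
        w-neg {w} {x} p q = subst (_≤ 0ℚ) (ℚₚ.neg-distribʳ-* w x) (-≥0 (*≥0 (ℚₚ.<⇒≤ p) q))

        w-pos : ∀ {w x} → 0ℚ < w → 0ℚ ≤ x → 0ℚ ≤ w * x
        w-pos p q = *≥0 (ℚₚ.<⇒≤ p) q

        dk : ∀ {v} k → Pos v → 0ℚ ≤ d k * v ! k
        dk k p = *≥0 (ℚₚ.<⇒≤ (d-pos k)) (p k)

        w-cancel : ∀ {w k} x → w * d k ≡ 1ℚ → w * (d k * x) ≡ x
        w-cancel {w} {k} x e = trans (sym (ℚₚ.*-assoc w (d k) x)) (1ˡ x e)

        -- -[j = k] = w max(-E(p_j,p_k), -E(p_k,p_j)), and likewise for the injectives.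
        both : ∀ {w j k X Y} u v → 0ℚ < w → w * d k ≡ 1ℚ → X ≡ d k * v ! k → Y ≡ d j * u ! j → Pos u → Pos v → u ! k ≡ 1ℚ →
          (j ≡ k → v ! k ≡ 1ℚ) → (j ≢ k → u ! j ≡ 0ℚ ⊎ v ! k ≡ 0ℚ) →
          (-V αs j) ! k ≡ (w * (- X)) ⊔ (w * (- Y))
        both {w} {j} {k} {X} {Y} u v w>0 e evu euv pu pv uk same diff with j Fin.≟ k
        ... | yes refl = trans (negα-at j) (sym (trans (cong₂ (λ x y → (w * (- x)) ⊔ (w * (- y)))
                (trans evu (cong (d j *_) (same refl))) (trans euv (cong (d j *_) uk))) (trans (ℚₚ.⊔-idem (w * (- (d j * 1ℚ))))
                (trans (solve 2 (λ w d → w :* (:- (d :* c1)) := :- (w :* d)) refl w (d j)) (cong -_ e)))))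
        ... | no p with diff p
        ... | inj₁ z = trans (negα-off p) (sym (trans (max₂ (ℚₚ.≤-trans (w-neg {w} {X} w>0 (subst (0ℚ ≤_) (sym evu) (dk {v} k pv))) (≡⇒≤ (sym Z)))) Z))
          where
          Z : w * (- Y) ≡ 0ℚ
          Z = trans (cong (λ x → w * (- x)) (trans euv (0ʳ (d j) z))) (solve 1 (λ w → w :* (:- c0) := c0) refl w)
        ... | inj₂ z = trans (negα-off p) (sym (trans (max₁ (ℚₚ.≤-trans (w-neg {w} {Y} w>0 (subst (0ℚ ≤_) (sym euv) (dk {u} j pu))) (≡⇒≤ (sym Z)))) Z))
          where
          Z : w * (- X) ≡ 0ℚ
          Z = trans (cong (λ x → w * (- x)) (trans evu (0ʳ (d k) z))) (solve 1 (λ w → w :* (:- c0) := c0) refl w)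

        cox-flip : ∀ u v → - E u v ≡ E v (cox u)
        cox-flip u v = sym (E-cox u v)

        tri-off : ∀ {j k : Fin n} {P Q : Set} → j ≢ k → (j Fin.< k → P) → (k Fin.< j → Q) → P ⊎ Q
        tri-off {j} {k} p f g with Finₚ.<-cmp j k
        ... | tri< r _ _ = inj₁ (f r)
        ... | tri≈ _ r _ = ⊥-elim (p r)
        ... | tri> _ _ r = inj₂ (g r)

      -- By E(v, p_k) = d_k v_k = E(q_k, v) and Serre duality.
      invariant : ∀ {w w′ α α′ β β′} → 0ℚ < w → Wt w α → Wt w α′ → Step w α α′ → Step w′ β β′ →
        compatMax κ α β ≡ compatMax κ α′ β′
      invariant {w} w>0 wt wt′ (up {k} {l₁} sp e) (up {j} {l₁′} sp′ e′) = trans (cm-neg {w} (-V αs j) wt e) (trans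
        (both {w} (proj l₁ k) (proj l₁′ j) w>0 e (E-p sp (proj l₁′ j)) (E-p sp′ (proj l₁ k)) (proj-pos sp) (proj-pos sp′) (p-self sp) (λ { refl → p-self sp′ })
          (λ p → [ inj₂ , inj₁ ]′ (tri-off p (p-after sp′) (p-after sp))))
        (sym (cm-pos wt′ w>0 (proj-pos sp) (proj-pos sp′))))
      -- In every case that pairs `move` with `up` or `down`, one entry of the maximum is minus a
      -- nonnegative multiple of a coordinate of a positive root. The other entry is the coordinate
      -- to be matched, and it is nonnegative.
      invariant {w} w>0 wt wt′ (up {k} {l₁} sp e) (move {β} pβ pcβ) = trans (cm-neg {w} β wt e) (sym (trans (cm-pos wt′ w>0 (proj-pos sp) pcβ)
        (trans (max₂ (ℚₚ.≤-trans (w-neg {w} {E (cox β) p} w>0 (subst (0ℚ ≤_) (sym (E-p sp (cox β))) (dk {cox β} k pcβ))) (nn (pβ k) Z))) Z)))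
        where
        p = proj l₁ k
        Z : w * (- E p (cox β)) ≡ β ! k
        Z = trans (cong (λ x → w * (- x)) (E-cox β p)) (trans (solve 2 (λ w x → w :* (:- (:- x)) := w :* x) refl w (E β p)) (trans (cong (w *_) (E-p sp β)) (w-cancel {w} {k} (β ! k) e)))
      invariant {w} w>0 wt wt′ (up {k} {l₁} sp e) (down {j} {l₁′} {l₂} sp′ e′) = trans (cm-neg {w} q wt e) (sym (trans (cm-negʳ j p) (trans (wt′ j)
        (trans (cong (w *_) (trans (sym (E-q sp′ p)) (E-p sp q))) (w-cancel {w} {k} (q ! k) e)))))
        where
        p = proj l₁ k
        q = inj l₂ j
      invariant {w} w>0 wt wt′ (move {α} pα pcα) (up {k} {l₁} sp e) = trans (cm-negʳ k α) (trans (wt k) (sym (trans (cm-pos wt′ w>0 pcα (proj-pos sp))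
        (trans (max₁ (ℚₚ.≤-trans (w-neg {w} {E (cox α) p} w>0 (subst (0ℚ ≤_) (sym (E-p sp (cox α))) (dk {cox α} k pcα))) (nn (w-pos {w} w>0 (dk {α} k pα)) Z))) Z))))
        where
        p = proj l₁ k
        Z : w * (- E p (cox α)) ≡ w * (d k * α ! k)
        Z = trans (cong (λ x → w * (- x)) (E-cox α p)) (trans (solve 2 (λ w x → w :* (:- (:- x)) := w :* x) refl w (E α p)) (cong (w *_) (E-p sp α)))
      invariant {w} w>0 wt wt′ (move {α} pα pcα) (move {β} pβ pcβ) = trans (cm-pos wt w>0 pα pβ) (trans
        (cong₂ (λ x y → (w * (- x)) ⊔ (w * (- y))) (sym (E-cox-inv β α)) (sym (E-cox-inv α β))) (sym (cm-pos wt′ w>0 pcα pcβ)))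
      invariant {w} w>0 wt wt′ (move {α} pα pcα) (down {k} {l₁} {l₂} sp e) = trans (cm-pos wt w>0 pα (inj-pos sp)) (trans
        (trans (max₂ (ℚₚ.≤-trans (w-neg {w} {E q α} w>0 (subst (0ℚ ≤_) (sym (E-q sp α)) (dk {α} k pα))) (nn (w-pos {w} w>0 (dk {cox α} k pcα)) Z))) Z)
        (sym (trans (cm-negʳ k (cox α)) (wt′ k))))
        where
        q = inj l₂ k
        Z : w * (- E α q) ≡ w * (d k * cox α ! k)
        Z = cong (w *_) (trans (cox-flip α q) (E-q sp (cox α)))
      invariant {w} w>0 wt wt′ (down {k} {l₁} {l₂} sp e) (up {j} {l₁′} sp′ e′) = trans (cm-negʳ j q) (trans (wt j)
        (trans (cong (w *_) (trans (sym (E-p sp′ q)) (E-q sp p))) (trans (w-cancel {w} {k} (p ! k) e) (sym (cm-neg {w} p wt′ e)))))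
        where
        q = inj l₂ k
        p = proj l₁′ j
      invariant {w} w>0 wt wt′ (down {k} {l₁} {l₂} sp e) (move {β} pβ pcβ) = trans (cm-pos wt w>0 (inj-pos sp) pβ) (trans
        (trans (max₁ (ℚₚ.≤-trans (w-neg {w} {E q β} w>0 (subst (0ℚ ≤_) (sym (E-q sp β)) (dk {β} k pβ))) (nn (pcβ k) Z))) Z)
        (sym (cm-neg {w} (cox β) wt′ e)))
        where
        q = inj l₂ k
        Z : w * (- E β q) ≡ cox β ! k
        Z = trans (cong (w *_) (trans (cox-flip β q) (E-q sp (cox β)))) (w-cancel {w} {k} (cox β ! k) e)
      invariant {w} w>0 wt wt′ (down {k} {l₁} {l₂} sp e) (down {j} {l₁′} {l₂′} sp′ e′) = trans (cm-pos wt w>0 (inj-pos sp) (inj-pos sp′))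
        (trans (ℚₚ.⊔-comm (w * (- E (inj l₂′ j) (inj l₂ k))) (w * (- E (inj l₂ k) (inj l₂′ j)))) (sym (trans (cm-neg {w} (-V αs j) wt′ e)
        (both {w} (inj l₂ k) (inj l₂′ j) w>0 e (E-q sp (inj l₂′ j)) (E-q sp′ (inj l₂ k)) (inj-pos sp) (inj-pos sp′) (q-self sp) (λ { refl → q-self sp′ })
          (λ p → tri-off p (q-before sp) (q-before sp′))))))

  -- τ as a bijection of -Π ∪ Φ⁺ and uniqueness along its orbits.

  data El : ℚ → V → Set where
    neg : ∀ k → El (d k) (-V αs k)
    pos : ∀ {D v} → Cand D v → Pos v → El D v

  el-cand : ∀ {D v} → El D v → Cand D v
  el-cand (neg k) = cand-neg (cand-α k)
  el-cand (pos c _) = c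

  NotImaginary : Kind → V → Set
  NotImaginary finite v = ⊤
  NotImaginary (affine D) v = v ≢ Aff.δ D

  coroot-real : ∀ κ v i → NotImaginary κ v → corootC κ v i ≡ d i * (ℕ→ℚ 2 * lookup v i) * inv (K v v)
  coroot-real finite v i _ = refl
  coroot-real (affine D) v i h with v ≟V Aff.δ D
  ... | yes e = ⊥-elim (h e)
  ... | no _ = refl

  cand-wt : ∀ κ {D v} → Cand D v → NotImaginary κ v → ∀ i → corootC κ v i ≡ inv D * (d i * v ! i)
  cand-wt κ {D} {v} c h i = begin
    corootC κ v i ≡⟨ coroot-real κ v i h ⟩
    d i * (2ℚ * v ! i) * inv (K v v) ≡⟨ cong (λ z → d i * (2ℚ * v ! i) * inv z) (trans (sym (Q≡K v v)) (Q-norm c)) ⟩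
    d i * (2ℚ * v ! i) * inv (2ℚ * D) ≡⟨ solve 3 (λ d v r → d :* (c2 :* v) :* r := (c2 :* r) :* (d :* v)) refl (d i) (v ! i) (inv (2ℚ * D)) ⟩
    2ℚ * inv (2ℚ * D) * (d i * v ! i) ≡⟨ cong (_* (d i * v ! i)) (inv-double (D>0 c)) ⟩
    inv D * (d i * v ! i) ∎

  module Elements′ (SD : Semidefinite) where
    open Tau SD
    open Signs SD

    cand-D : ∀ {D D′ v} → Cand D v → Cand D′ v → D ≡ D′
    cand-D c c′ = trans (sym (norm c)) (norm c′)

    inv-d : ∀ k → inv (d k) * d k ≡ 1ℚ
    inv-d k = inv-* (>⇒≢ (d-pos k))

    next : ∀ {D v} → El D v → ∃ λ v′ → Step (inv D) v v′ × τ v ≡ v′ × El D v′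
    next (neg k) = let l₁ , l₂ , sp = split-at k in
      proj l₁ k , up sp (inv-d k) , τ-negα sp , pos (cand-cl l₁ (cand-α k)) (proj-pos sp)
    next (pos {D} {v} c p) with τ-pos c p
    ... | inj₁ (e , q) = cox v , move p q , e , pos (cand-cl L c) q
    ... | inj₂ (l₁ , k , l₂ , sp , refl , e) with cand-D c (cand-cl (reverse l₂) (cand-α k))
    ... | refl = -V αs k , down sp (inv-d k) , e , neg k

    not-pos-neg : ∀ {D v} → Cand D v → Pos v → Pos (-V v) → ⊥
    not-pos-neg {v = v} c p q = cand-nonzero c λ i → ℚₚ.≤-antisym (0≤-⇒≤0 (subst (0ℚ ≤_) (-V-! v i) (q i))) (p i)

    -- If c⁻¹ v is positive it is the preimage. If it is negative, then -c⁻¹ v is sent by c to a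
    -- negative root, so it is some q_k and v = p_k = τ(-α_k).
    prev : ∀ {D v} → El D v → ∃ λ u → El D u × τ u ≡ v
    prev (neg k) = let l₁ , l₂ , sp = split-at k in inj l₂ k , pos (cand-cl (reverse l₂) (cand-α k)) (inj-pos sp) , back sp
      where
      back : ∀ {l₁ l₂} → Split k l₁ l₂ → τ (inj l₂ k) ≡ -V αs k
      back {l₁} {l₂} sp with τ-pos (cand-cl (reverse l₂) (cand-α k)) (inj-pos sp)
      ... | inj₁ (e , q) = ⊥-elim (not-pos-neg (cand-cl l₁ (cand-α k)) (proj-pos sp) (subst Pos (cox-q sp) q))
      ... | inj₂ (m₁ , j , m₂ , sp′ , e , e′) = trans e′ (cong (λ i → -V αs i) (sym k≡j))
        where
        k≡j : k ≡ j
        k≡j with Finₚ.<-cmp k j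
        ... | tri≈ _ r _ = r
        ... | tri< r _ _ = ⊥-elim (ℚₚ.1≢0 (trans (sym (q-self sp)) (trans (cong (_! k) e) (q-before sp′ r))))
        ... | tri> _ _ r = ⊥-elim (ℚₚ.1≢0 (trans (sym (q-self sp′)) (trans (cong (_! j) (sym e)) (q-before sp r))))
    prev (pos {D} {v} c p) with sign (cand-cl (reverse L) c)
    ... | inj₁ q with τ-pos (cand-cl (reverse L) c) q
    ... | inj₁ (e , _) = cl (reverse L) v , pos (cand-cl (reverse L) c) q , trans e (cl-rev L v)
    ... | inj₂ (l₁ , k , l₂ , sp , e , _) = ⊥-elim (not-pos-neg (cand-cl l₁ (cand-α k)) (proj-pos sp)
            (subst Pos (trans (sym (cl-rev L v)) (trans (cong cox e) (cox-q sp))) p))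
    prev (pos {D} {v} c p) | inj₂ q with τ-pos (cand-neg (cand-cl (reverse L) c)) q
    ... | inj₁ (_ , r) = ⊥-elim (not-pos-neg c p (subst Pos (trans (cl-neg L (cl (reverse L) v)) (cong -V_ (cl-rev L v))) r))
    ... | inj₂ (l₁ , k , l₂ , sp , e , _) = fin (trans (sym (-V-inv v)) (trans (cong -V_ (trans (cong -V_ (sym (cl-rev L v))) (trans (sym (cl-neg L (cl (reverse L) v))) (trans (cong cox e) (cox-q sp))))) (-V-inv (proj l₁ k))))
      where
      fin : v ≡ proj l₁ k → ∃ λ u → El D u × τ u ≡ v
      fin refl with cand-D c (cand-cl l₁ (cand-α k))
      ... | refl = -V αs k , neg k , τ-negα sp

    -- Connection to -Π by τ-steps in either direction. `bwd` records `Φ u` because the invariance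
    -- of the functions compared is only given on Φ; for `fwd` this follows from closure under τ.
    data Reach (Φ : V → Set) : V → Set where
      base : ∀ k → Reach Φ (-V αs k)
      fwd  : ∀ {v} → Reach Φ (τ v) → Reach Φ v
      bwd  : ∀ {v u} → Φ u → Reach Φ u → τ u ≡ v → Reach Φ v

    reach-fwd : ∀ {Φ} t {D v} → Cand D v → Pos v → ¬ Pos (iter cox t v) → Reach Φ v
    reach-fwd zero c p h = ⊥-elim (h p)
    reach-fwd {Φ} (suc t) {D} {v} c p h with τ-pos c p
    ... | inj₁ (e , q) = fwd (subst (Reach Φ) (sym e) (reach-fwd t (cand-cl L c) q h))
    ... | inj₂ (_ , k , _ , _ , _ , e) = fwd (subst (Reach Φ) (sym e) (base k))

    -- `S` is a property inherited by the backward orbit that guarantees membership in Φ; it is used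
    -- with positive defect.
    reach-bwd : ∀ {Φ} (S : V → Set) → (∀ k → Φ (-V αs k)) → (∀ {D v} → Cand D v → Pos v → S v → Φ v) → (∀ v → S (cox v) → S v) →
      ∀ t {D v} → Cand D v → Pos v → S v → ¬ Pos (iter cox⁻¹ t v) → Reach Φ v
    reach-bwd S φn φp sb zero c p s h = ⊥-elim (h p)
    reach-bwd {Φ} S φn φp sb (suc t) {D} {v} c p s h with prev (pos c p)
    ... | _ , neg k , e = bwd (φn k) (base k) e
    ... | u , pos cu pu , e with τ-pos cu pu
    ... | inj₂ (_ , k , _ , _ , _ , e′) = ⊥-elim (pos≢neg p k (trans (sym e) e′))
    ... | inj₁ (e′ , q) = bwd (φp cu pu su) (reach-bwd S φn φp sb t cu pu su (subst (λ w → ¬ Pos (iter cox⁻¹ t w)) (trans (cong cox⁻¹ (trans (sym e) e′)) (rev-cl L u)) h)) e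
      where
      su : S u
      su = sb u (subst S (trans (sym e) e′) s)

    -- Only one argument has to reach -Π. Surjectivity of τ on Φ allows the other one to be moved
    -- backwards alongside it.
    module Unique (Φ : V → Set) (closed : ∀ {v} → Φ v → Φ (τ v)) (surj : ∀ {v} → Φ v → ∃ λ u → Φ u × τ u ≡ v)
                  (f g : V → V → ℚ) (agree : ∀ k v → Φ v → f (-V αs k) v ≡ g (-V αs k) v)
                  (f-inv : ∀ u v → Φ u → Φ v → f u v ≡ f (τ u) (τ v)) (g-inv : ∀ u v → Φ u → Φ v → g u v ≡ g (τ u) (τ v)) where

      reach-agree : ∀ {u} → Reach Φ u → Φ u → ∀ v → Φ v → f u v ≡ g u v
      reach-agree (base k) φu v φv = agree k v φv
      reach-agree {u} (fwd r) φu v φv = trans (f-inv u v φu φv) (trans (reach-agree r (closed φu) (τ v) (closed φv)) (sym (g-inv u v φu φv)))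
      reach-agree (bwd {u = u′} φu′ r refl) φu v φv with surj φv
      ... | v′ , φv′ , refl = trans (sym (f-inv u′ v′ φu′ φv′)) (trans (reach-agree r φu′ v′ φv′) (g-inv u′ v′ φu′ φv′))

  -- The finite case.

  module FiniteType (FT : IsFiniteType) where

    open CompatFormula finite

    Q0 : ∀ v → Q v v ≡ 0ℚ → ∀ j → v ! j ≡ 0ℚ
    Q0 v e j with v ≟V 0V
    ... | yes refl = 0V-! j
    ... | no p = ⊥-elim (>⇒≢ (FT v p) (trans (sym (Q≡K v v)) e))

    SD : Semidefinite
    SD .Semidefinite.psd v with v ≟V 0V
    ... | yes refl = ≡⇒≤ (sym (Q-0ˡ 0V 0V-!))
    ... | no p = subst (0ℚ ≤_) (sym (Q≡K v v)) (ℚₚ.<⇒≤ (FT v p))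
    SD .Semidefinite.nd i v _ e j = Q0 v e j

    open Elements′ SD
    open Invariance SD
    open Signs SD
    open Tau SD

    el : ∀ {v} → InΦc finite v → ∃ λ D → El D v
    el (inj₁ (r , p)) = let D , c = real⇒cand r in D , pos c p
    el (inj₂ (i , refl)) = d i , neg i

    el⁻¹ : ∀ {D v} → El D v → InΦc finite v
    el⁻¹ (neg k) = inj₂ (k , refl)
    el⁻¹ (pos c p) = inj₁ (cand⇒real SD c , p)

    wt : ∀ {D v} → El D v → Wt (inv D) v
    wt e = cand-wt finite (el-cand e) tt

    closed : ∀ {v} → InΦc finite v → InΦc finite (τ v)
    closed φ = let _ , _ , e , e′ = next (proj₂ (el φ)) in subst (InΦc finite) (sym e) (el⁻¹ e′)

    surj : ∀ {v} → InΦc finite v → ∃ λ u → InΦc finite u × τ u ≡ v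
    surj φ = let u , e , q = prev (proj₂ (el φ)) in u , el⁻¹ e , q

    compat-P1 : P1 finite (compatMax finite)
    compat-P1 i β _ = cm-neg {inv (d i)} β (wt (neg i)) (inv-d i)

    compat-P2 : P2 finite (compatMax finite)
    compat-P2 i β _ = cm-negʳ i β

    compat-P6 : P6 finite (compatMax finite)
    compat-P6 α β φα φβ with el φα | el φβ
    ... | D , eα | D′ , eβ with next eα | next eβ
    ... | α′ , sα , tα , eα′ | β′ , sβ , tβ , _ = trans (invariant (inv>0 (D>0 (el-cand eα))) (wt eα) (wt eα′) sα sβ)
      (sym (cong₂ (compatMax finite) tα tβ))

    reach : ∀ {v} → InΦc finite v → Reach (InΦc finite) v
    reach (inj₂ (i , refl)) = base i
    reach {v} (inj₁ (r , p)) = go (finite-orbit SD L L-sorted (λ v _ → Q0 v) c (suppL v) p)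
      where
      c = proj₂ (real⇒cand r)
      go : (∃ λ t → ∃ λ l₁ → ∃ λ k → ∃ λ l₂ → L ≡ l₁ ++ k ∷ l₂ × iter (cl L) t v ≡ inj l₂ k) → Reach (InΦc finite) v
      go (t , l₁ , k , l₂ , e , e′) = reach-fwd (suc t) c p λ q → not-pos-neg (cand-cl l₁ (cand-α k)) (proj-pos (split e))
        (subst Pos (trans (iter-suc cox t v) (trans (cong cox e′) (cox-q (split e)))) q)

    unique : ∀ f → Props finite f → AgreesWithCompat finite f
    unique f (p1 , p2 , _ , _ , p6) α β φα φβ = reach-agree (reach φα) φα β φβ
      where
      open Unique (InΦc finite) closed surj f (compatMax finite) (λ k v φ → trans (p1 k v φ) (sym (compat-P1 k v φ))) p6 compat-P6

    result : (∃ λ f → Props finite f × AgreesWithCompat finite f) × (∀ f → Props finite f → AgreesWithCompat finite f)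
    result = (compatMax finite , (compat-P1 , compat-P2 , tt , tt , compat-P6) , λ _ _ _ _ → refl) , unique

  -- The affine case: δ, defect, and growth along c-orbits.

  module AffineType (AD : AffineData) (AT : IsAffineType) (val : Aff.IsValid AD) where

    open AffineData AD using (Pc; m; γ; δN; δᵛN)
    open Aff AD using (CompatCirc; ComponentFull; Conn; InT; SpansWithout; TSupp; adj; lincomb; Υ⁺; δ; ∑V)

    open Aff.IsValid val

    private
      inhabited : ∀ n → (∃ λ (v : Vec ℚ n) → v ≢ tabulate (λ _ → 0ℚ)) → Fin n
      inhabited zero (Vec.[] , h) = ⊥-elim (h refl)
      inhabited (suc n) _ = zero

    i₀ : Fin n
    i₀ = inhabited n (let v , h , _ = proj₁ (proj₂ AT) in v , h)

    SD : Semidefinite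
    SD .Semidefinite.psd v = subst (0ℚ ≤_) (sym (Q≡K v v)) (proj₁ AT v)
    SD .Semidefinite.nd i v z e j with v ≟V 0V
    ... | yes refl = 0V-! j
    ... | no p = ⊥-elim (>⇒≢ (proj₂ (proj₂ AT) i v z p) (trans (sym (Q≡K v v)) e))

    open Semidefinite SD
    open Signs SD
    open Tau SD
    open Elements′ SD

    proper-posdef : ∀ {l i} → i ∉ˡ l → PosDefOn l
    proper-posdef {l} {i} p v h e j = nd i v (h i p) e j

    δ-! : ∀ i → δ ! i ≡ ℕ→ℚ (AffineData.δN AD i)
    δ-! i = Vecₚ.lookup∘tabulate (λ i → ℕ→ℚ (AffineData.δN AD i)) i

    δ>0 : ∀ i → 0ℚ < δ ! i
    δ>0 i = subst (0ℚ <_) (sym (δ-! i)) (ℤ→ℚ-mono-< {pos 0} {pos (AffineData.δN AD i)} (ℤ.+<+ (δ-pos i)))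

    δ-Pos : Pos δ
    δ-Pos i = ℚₚ.<⇒≤ (δ>0 i)

    δ-int : IntV δ
    δ-int i = pos (AffineData.δN AD i) , δ-! i

    Q-δʳ : ∀ v → Q v δ ≡ 0ℚ
    Q-δʳ v = trans (Q-exp v δ) (∑-zero λ i → 0ʳ (v ! i) (trans (Q-α i δ) (0ʳ (d i) (δ-ker i))))

    Q-δˡ : ∀ v → Q δ v ≡ 0ℚ
    Q-δˡ v = trans (Q-sym δ v) (Q-δʳ v)

    cl-δ : ∀ l → cl l δ ≡ δ
    cl-δ [] = refl
    cl-δ (k ∷ l) = trans (cong (s k) (cl-δ l)) (s-0 k (δ-ker k))

    -- The defect. It equals K(γ,v), as `def≡Qγ` shows, so defect zero means membership in U_c; in
    -- this form invariance under c is immediate.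
    def : V → ℚ
    def v = E δ v

    E-δʳ : ∀ v → E v δ ≡ - def v
    E-δʳ v = trans (sym (trans (cong (E v) (cl-δ L)) refl)) (E-cox δ v)

    def-δ : def δ ≡ 0ℚ
    def-δ = double-cancel (trans (sym (Q≡2E δ)) (trans (Q-δʳ δ) refl))

    def-axpy : ∀ u q v → def (axpy u q v) ≡ def u + q * def v
    def-axpy u q v = E-axpyʳ δ u q v

    def-neg : ∀ v → def (-V v) ≡ - def v
    def-neg v = E-negʳ δ v

    def-cox : ∀ v → def (cox v) ≡ def v
    def-cox v = trans (cong (λ w → E w (cox v)) (sym (cl-δ L))) (E-cox-inv δ v)

    shift : V → ℚ → V
    shift v t = axpy v t δ

    Q-shift : ∀ u t v → Q (shift u t) v ≡ Q u v
    Q-shift u t v = trans (Q-axpyˡ u t δ v) (trans (cong (λ z → Q u v + t * z) (Q-δˡ v)) (solve 2 (λ x t → x :+ t :* c0 := x) refl (Q u v) t))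

    Q-shiftʳ : ∀ u t v → Q u (shift v t) ≡ Q u v
    Q-shiftʳ u t v = trans (Q-sym u (shift v t)) (trans (Q-shift v t u) (Q-sym v u))

    -- The representative modulo δ whose coordinate at `i₀` is zero; on such vectors K is definite.
    red : V → V
    red v = shift v (- (v ! i₀ * inv (δ ! i₀)))

    red-i₀ : ∀ v → red v ! i₀ ≡ 0ℚ
    red-i₀ v = trans (axpy-! v (- (v ! i₀ * inv (δ ! i₀))) δ i₀) (trans (solve 3 (λ x r δ → x :+ (:- (x :* r)) :* δ := x :- x :* (r :* δ)) refl (v ! i₀) (inv (δ ! i₀)) (δ ! i₀))
      (trans (cong (λ z → v ! i₀ - v ! i₀ * z) (inv-* (>⇒≢ (δ>0 i₀)))) (solve 1 (λ x → x :- x :* c1 := c0) refl (v ! i₀))))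

    unred : ∀ v → v ≡ axpy (red v) (v ! i₀ * inv (δ ! i₀)) δ
    unred v = sym (trans (cong (λ z → axpy (red v) z δ) (solve 1 (λ x → x := :- (:- x)) refl (v ! i₀ * inv (δ ! i₀)))) (axpy-inv v (- (v ! i₀ * inv (δ ! i₀))) δ))

    kernel : ∀ v → Q v v ≡ 0ℚ → v ≡ (v ! i₀ * inv (δ ! i₀)) ·V δ
    kernel v e = trans (unred v) (trans (cong (λ w → axpy w t δ) z) (sym (·V≡axpy t δ)))
      where
      t = v ! i₀ * inv (δ ! i₀)
      z : red v ≡ 0V
      z = ext λ j → trans (nd i₀ (red v) (red-i₀ v) (trans (Q-shift v (- t) (red v)) (trans (Q-shiftʳ v (- t) v) e)) j) (sym (0V-! j))

    cox-fixed : ∀ v → cox v ≡ v → Q v v ≡ 0ℚ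
    cox-fixed v e = trans (Q≡E+E v v) (trans (cong (λ w → E v v + E v w) (sym e)) (trans (cong (E v v +_) (E-cox v v)) (ℚₚ.+-inverseʳ (E v v))))

    γ-cox : cox γ ≡ axpy γ 1ℚ δ
    γ-cox = trans γ-eq (ext λ i → trans (+V-! γ δ i) (sym (trans (axpy-! γ 1ℚ δ i) (cong (γ ! i +_) (ℚₚ.*-identityˡ (δ ! i))))))

    -- A clock along c-orbits: since cγ = γ + δ, one application of c increases φ by exactly the
    -- defect.
    φ : V → ℚ
    φ v = - E γ v

    φ-cox : ∀ v → φ (cox v) ≡ φ v + def v
    φ-cox v = sym (trans (cong (λ z → - z + def v) (sym (E-cox-inv γ v))) (trans (cong (λ w → - E w (cox v) + def v) γ-cox)
      (trans (cong₂ (λ x y → - x + y) (E-axpyˡ γ 1ℚ δ (cox v)) (sym (def-cox v)))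
      (solve 2 (λ x y → :- (x :+ c1 :* y) :+ y := :- x) refl (E γ (cox v)) (def (cox v))))))

    def≡Qγ : ∀ v → def v ≡ Q γ v
    def≡Qγ v = trans (solve 2 (λ x y → y := (x :+ y) :- x) refl (φ v) (def v)) (trans (cong (_- φ v) (sym (φ-cox v)))
      (trans (cong (λ z → - z - φ v) (E-cox γ′ v′)) (trans (solve 2 (λ x y → :- (:- x) :- (:- y) := y :+ x) refl (E v γ) (E γ v)) (sym (Q≡E+E γ v)))))
      where
      γ′ = v
      v′ = γ

    InU⇒def : ∀ {v} → K γ v ≡ 0ℚ → def v ≡ 0ℚ
    InU⇒def {v} e = trans (def≡Qγ v) (trans (Q≡K γ v) e)

    def⇒InU : ∀ {v} → def v ≡ 0ℚ → K γ v ≡ 0ℚ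
    def⇒InU {v} e = trans (sym (Q≡K γ v)) (trans (sym (def≡Qγ v)) e)

    -- φ(δ) = K(γ,γ). If this were 0, γ would be a multiple of δ and hence fixed by c, against cγ =
    -- γ + δ with δ ≠ 0.
    φδ>0 : 0ℚ < φ δ
    φδ>0 = subst (0ℚ <_) (trans (sym (def≡Qγ γ)) (trans (solve 1 (λ x → x := :- (:- x)) refl (def γ)) (cong -_ (sym (E-δʳ γ)))))
      (≥∧≢⇒> (psd γ) λ e → >⇒≢ (δ>0 i₀) (δ-zero {γ ! i₀ * inv (δ ! i₀)} (kernel γ e)))
      where
      δ-zero : ∀ {t} → γ ≡ t ·V δ → δ ! i₀ ≡ 0ℚ
      δ-zero {t} e = begin
        δ ! i₀ ≡⟨ solve 2 (λ g x → x := (g :+ c1 :* x) :- g) refl (γ ! i₀) (δ ! i₀) ⟩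
        γ ! i₀ + 1ℚ * δ ! i₀ - γ ! i₀ ≡⟨ cong (_- γ ! i₀) (trans (sym (axpy-! γ 1ℚ δ i₀)) (cong (_! i₀) (sym γ-cox))) ⟩
        cox γ ! i₀ - γ ! i₀ ≡⟨ cong (λ w → w ! i₀ - γ ! i₀) (trans (cong cox e) (trans (cl-· L t δ) (trans (cong (t ·V_) (cl-δ L)) (sym e)))) ⟩
        γ ! i₀ - γ ! i₀ ≡⟨ ℚₚ.+-inverseʳ (γ ! i₀) ⟩
        0ℚ ∎

    Lin : (V → ℚ) → Set
    Lin ℓ = ∃ λ (ψ : Fin n → ℚ) → ∀ v → ℓ v ≡ ∑ (λ i → v ! i * ψ i)

    lin-ht : Lin ht
    lin-ht = (λ _ → 1ℚ) , λ v → ∑-cong λ i → sym (ℚₚ.*-identityʳ (v ! i))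

    lin-E : ∀ z → Lin (λ v → E v z)
    lin-E z = (λ i → row eul i z) , λ v → B-def eul v z

    lin-φ : Lin φ
    lin-φ = (λ i → - row (λ i j → eul j i) i γ) , λ v → trans (cong -_ (trans (B-transpose eul γ v) (B-def (λ i j → eul j i) v γ)))
      (trans (sym (∑-neg (λ i → v ! i * row (λ i j → eul j i) i γ))) (∑-cong λ i → ℚₚ.neg-distribʳ-* (v ! i) (row (λ i j → eul j i) i γ)))

    lin-comb : ∀ {ℓ ℓ′} p q → Lin ℓ → Lin ℓ′ → Lin (λ v → p * ℓ v - q * ℓ′ v)
    lin-comb {ℓ} {ℓ′} p q (ψ , e) (ψ′ , e′) = (λ i → p * ψ i - q * ψ′ i) , λ v → sym (trans
      (∑-lin (λ i → p * (v ! i * ψ i)) (- q) (λ i → v ! i * ψ′ i) λ i → solve 5 (λ v p x q y → v :* (p :* x :- q :* y) := p :* (v :* x) :+ (:- q) :* (v :* y)) refl (v ! i) p (ψ i) q (ψ′ i))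
      (trans (cong₂ (λ x y → x + (- q) * y) (trans (∑-* p (λ i → v ! i * ψ i)) (cong (p *_) (sym (e v)))) (sym (e′ v)))
      (solve 3 (λ x q y → x :+ (:- q) :* y := x :- q :* y) refl (p * ℓ v) q (ℓ′ v))))

    lin-axpy : ∀ {ℓ} → Lin ℓ → ∀ u q v → ℓ (axpy u q v) ≡ ℓ u + q * ℓ v
    lin-axpy {ℓ} (ψ , e) u q v = trans (e (axpy u q v)) (trans (∑-lin (λ i → u ! i * ψ i) q (λ i → v ! i * ψ i)
      (λ i → trans (cong (_* ψ i) (axpy-! u q v i)) (solve 4 (λ u q v ψ → (u :+ q :* v) :* ψ := u :* ψ :+ q :* (v :* ψ)) refl (u ! i) q (v ! i) (ψ i))))
      (cong₂ (λ x y → x + q * y) (sym (e u)) (sym (e v))))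

    private
      L∖i₀ : List (Fin n)
      L∖i₀ = List.filter (λ i → ¬? (i Fin.≟ i₀)) L

      i₀∉rest : i₀ ∉ˡ L∖i₀
      i₀∉rest m = proj₂ (Memₚ.∈-filter⁻ (λ i → ¬? (i Fin.≟ i₀)) {xs = L} m) refl

      supp-rest : ∀ v → v ! i₀ ≡ 0ℚ → Supp L∖i₀ v
      supp-rest v e i p with i Fin.≟ i₀
      ... | yes refl = e
      ... | no q = ⊥-elim (p (Memₚ.∈-filter⁺ (λ i → ¬? (i Fin.≟ i₀)) (∈L i) q))

    -- ℓ factors through the quotient by δ, where K is definite. There it is Q(·,ω) for some ω, and
    -- the arithmetic-geometric inequality gives the bound.
    bounded : ∀ {ℓ} → Lin ℓ → ℓ δ ≡ 0ℚ → ∃ λ C → ∀ v → 2ℚ * ℓ v ≤ Q v v + C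
    bounded {ℓ} lin@(ψ , e) z = Q ω ω , bnd
      where
      r = represent L∖i₀ (proper-posdef i₀∉rest) ψ
      ω = proj₁ r
      eq : ∀ v → Q (red v) ω ≡ ℓ v
      eq v = trans (Q-solution (red v) ω ψ (supp-rest (red v) (red-i₀ v)) (proj₂ (proj₂ r))) (trans (sym (e (red v)))
        (trans (lin-axpy {ℓ} lin v t δ) (trans (cong (λ x → ℓ v + t * x) z) (solve 2 (λ x t → x :+ t :* c0 := x) refl (ℓ v) t))))
        where t = - (v ! i₀ * inv (δ ! i₀))
      bnd : ∀ v → 2ℚ * ℓ v ≤ Q v v + Q ω ω
      bnd v = subst₂ _≤_ (cong (2ℚ *_) (eq v)) (cong (_+ Q ω ω) (trans (Q-shift v t (red v)) (Q-shiftʳ v t v))) (am-gm (red v) ω)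
        where t = - (v ! i₀ * inv (δ ! i₀))

    private
      φ-iter : ∀ (T : V → V) e (S : V → Set) → (∀ v → S v → S (T v)) → (∀ v → S v → φ (T v) ≡ φ v + e) → ∀ t v → S v → φ (iter T t v) ≡ φ v + ι t * e
      φ-iter T e S cl h zero v sv = sym (trans (cong (λ z → φ v + z * e) ι-0) (solve 2 (λ x e → x :+ c0 :* e := x) refl (φ v) e))
      φ-iter T e S cl h (suc t) v sv = trans (φ-iter T e S cl h t (T v) (cl v sv)) (trans (cong (_+ ι t * e) (h v sv)) (sym (trans (cong (λ z → φ v + z * e) (ι-suc t))
        (solve 3 (λ x t e → x :+ (c1 :+ t) :* e := x :+ e :+ t :* e) refl (φ v) (ι t) e))))

      div : ∀ {a} b → 0ℚ < a → ∃ λ N → b ≤ ι N * a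
      div {a} b p = let N , le = archι (b * inv a) in N , by≤ (*≥0 (≤⇒0≤ le) (ℚₚ.<⇒≤ p))
        (trans (cong (λ z → ι N * a - z) (sym (trans (ℚₚ.*-assoc b (inv a) a) (1ʳ b (inv-* (>⇒≢ p)))))) (solve 3 (λ n a b → n :* a :- b :* a := (n :- b) :* a) refl (ι N) a (b * inv a)))

    -- The functional φ(δ) ht - ht(δ) φ kills δ, so it is bounded above on vectors of fixed norm.
    -- Along the orbit φ tends to -∞, so the height must eventually be negative.
    escape : ∀ (T : V → V) e (S : V → Set) → (∀ v → S v → S (T v)) → (∀ v → S v → φ (T v) ≡ φ v - e) → (∀ v → Q (T v) (T v) ≡ Q v v) →
      0ℚ < e → ∀ v → S v → ∃ λ t → ¬ Pos (iter T t v)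
    escape T e S cl h hQ e>0 v sv = N , λ p → ≤<⊥ (≤⇒0≤ (bound (iter T N v))) (0<-⇒<0 (np (≥+>0 (≤⇒0≤ (proj₂ D′)) (+>0 0<1 (*≥0 (ℚₚ.<⇒≤ 0<2) (*≥0 (ℚₚ.<⇒≤ φδ>0) (ht-≥0 (iter T N v) p)))))
        (trans (cong₂ (λ x y → - (x + C - 2ℚ * (φ δ * ht (iter T N v) - ht δ * y))) (Qi N v) (φ-iter T (- e) S cl h N v sv))
        (solve 7 (λ q c fh hδ ph n e → :- (q :+ c :- c2 :* (fh :- hδ :* (ph :+ n :* (:- e)))) := (n :* (c2 :* (hδ :* e)) :- (q :+ c :+ c2 :* (hδ :* ph) :+ c1)) :+ (c1 :+ c2 :* fh)) refl
          (Q v v) C (φ δ * ht (iter T N v)) (ht δ) (φ v) (ι N) e))))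
      where
      b = bounded (lin-comb {ht} {φ} (φ δ) (ht δ) lin-ht lin-φ) (solve 2 (λ x y → x :* y :- y :* x := c0) refl (φ δ) (ht δ))
      C = proj₁ b
      bound = proj₂ b
      htδ>0 : 0ℚ < ht δ
      htδ>0 = ℚₚ.<-≤-trans (δ>0 i₀) (∑-term≤ (δ !_) i₀ δ-Pos)
      D′ = div (Q v v + C + 2ℚ * (ht δ * φ v) + 1ℚ) (*>0 0<2 (*>0 htδ>0 e>0))
      N = proj₁ D′
      Qi : ∀ t v → Q (iter T t v) (iter T t v) ≡ Q v v
      Qi zero v = refl
      Qi (suc t) v = trans (Qi t (T v)) (hQ v)

    escape-cox : ∀ v → def v < 0ℚ → ∃ λ t → ¬ Pos (iter cox t v)
    escape-cox v h = escape cox (- def v) (λ u → def u ≡ def v) (λ u e → trans (def-cox u) e)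
      (λ u e → trans (φ-cox u) (trans (cong (φ u +_) e) (solve 2 (λ x y → x :+ y := x :- (:- y)) refl (φ u) (def v)))) (λ u → cl-Q L u u) (-<0 h) v refl

    cox-cox⁻¹ : ∀ v → cox (cox⁻¹ v) ≡ v
    cox-cox⁻¹ v = cl-rev L v

    cox⁻¹-cox : ∀ v → cox⁻¹ (cox v) ≡ v
    cox⁻¹-cox v = rev-cl L v

    def-cox⁻¹ : ∀ v → def (cox⁻¹ v) ≡ def v
    def-cox⁻¹ v = trans (sym (def-cox (cox⁻¹ v))) (cong def (cox-cox⁻¹ v))

    escape-cox⁻¹ : ∀ v → 0ℚ < def v → ∃ λ t → ¬ Pos (iter cox⁻¹ t v)
    escape-cox⁻¹ v h = escape cox⁻¹ (def v) (λ u → def u ≡ def v) (λ u e → trans (def-cox⁻¹ u) e)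
      (λ u e → trans (solve 2 (λ x y → x := x :+ y :- y) refl (φ (cox⁻¹ u)) (def (cox⁻¹ u))) (trans (cong (_- def (cox⁻¹ u)) (trans (sym (φ-cox (cox⁻¹ u))) (cong φ (cox-cox⁻¹ u))))
        (cong (λ z → φ u - z) (trans (def-cox⁻¹ u) e)))) (λ u → cl-Q (reverse L) u u) h v refl

    -- `bounded` applied to E(δ,z) φ - φ(δ) E(·,z), which kills δ: φ increases without bound along
    -- the orbit and E(·,z) has to keep up.
    E-grows : ∀ v z → 0ℚ < def v → 0ℚ < def z → ∀ B → ∃ λ t → B < E (iter cox t v) z
    E-grows v z hv hz B = N , by< {Ei - B} (*-cancel>0 (*>0 0<2 φδ>0) (np (+>0 0<1 (+≥0 (≤⇒0≤ (proj₂ D′)) (≤⇒0≤ (bound (iter cox N v)))))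
        (sym (trans (cong₂ (λ x y → 1ℚ + (ι N * (2ℚ * (def z * def v)) - (Q v v + C - 2ℚ * (def z * φ v) + 2ℚ * (φ δ * B) + 1ℚ) + (x + C - 2ℚ * (Eδ * y - φ δ * Ei))))
           (Qi N v) (φ-iter cox (def v) (λ u → def u ≡ def v) (λ u e → trans (def-cox u) e) (λ u e → trans (φ-cox u) (cong (φ u +_) e)) N v refl))
          (solve 9 (λ q c dz dv ph n f e b → c1 :+ (n :* (c2 :* (dz :* dv)) :- (q :+ c :- c2 :* (dz :* ph) :+ c2 :* (f :* b) :+ c1) :+ (q :+ c :- c2 :* (dz :* (ph :+ n :* dv) :- f :* e)))
              := c2 :* f :* (e :- b)) refl (Q v v) C (def z) (def v) (φ v) (ι N) (φ δ) Ei B))))) refl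
      where
      Eδ = E δ z
      b = bounded (lin-comb {φ} {λ v → E v z} (E δ z) (φ δ) lin-φ (lin-E z)) (solve 2 (λ x y → x :* y :- y :* x := c0) refl (E δ z) (φ δ))
      C = proj₁ b
      bound = proj₂ b
      D′ = div (Q v v + C - 2ℚ * (def z * φ v) + 2ℚ * (φ δ * B) + 1ℚ) (*>0 0<2 (*>0 hz hv))
      N = proj₁ D′
      Ei = E (iter cox N v) z
      Qi : ∀ t v → Q (iter cox t v) (iter cox t v) ≡ Q v v
      Qi zero v = refl
      Qi (suc t) v = trans (Qi t (cox v)) (cl-Q L v v)

    -- The positive real roots of Υ_c.
    record Reg (D : ℚ) (v : V) : Set where
      constructor reg
      field
        cand : Cand D v
        posv : Pos v
        def0 : def v ≡ 0ℚ

    open Reg public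

    def-p : ∀ {k l₁ l₂} → Split k l₁ l₂ → 0ℚ < def (proj l₁ k)
    def-p {k} sp = subst (0ℚ <_) (sym (E-p sp δ)) (*>0 (d-pos k) (δ>0 k))

    def-q : ∀ {k l₁ l₂} → Split k l₁ l₂ → def (inj l₂ k) < 0ℚ
    def-q {k} {l₁} {l₂} sp = 0<-⇒<0 (subst (0ℚ <_) (trans (sym (E-q sp δ)) (E-δʳ (inj l₂ k))) (*>0 (d-pos k) (δ>0 k)))

    -- The only positive roots that c makes negative are the q_k, and they have negative defect.
    cox-pos : ∀ {D v} → Cand D v → Pos v → 0ℚ ≤ def v → Pos (cox v)
    cox-pos c p e with τ-pos c p
    ... | inj₁ (_ , q) = q
    ... | inj₂ (_ , _ , _ , sp , refl , _) = ⊥-elim (≤<⊥ e (def-q sp))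

    τ-regular : ∀ {D v} → Cand D v → Pos v → 0ℚ ≤ def v → τ v ≡ cox v
    τ-regular c p e with τ-pos c p
    ... | inj₁ (q , _) = q
    ... | inj₂ (_ , _ , _ , sp , refl , _) = ⊥-elim (≤<⊥ e (def-q sp))

    cand-cox : ∀ {D v} → Cand D v → Cand D (cox v)
    cand-cox = cand-cl L

    cand-cox⁻¹ : ∀ {D v} → Cand D v → Cand D (cox⁻¹ v)
    cand-cox⁻¹ = cand-cl (reverse L)

    back : ∀ {D v} → Cand D v → Pos v → Pos (cox⁻¹ v) ⊎ (∃ λ l₁ → ∃ λ k → ∃ λ l₂ → Split k l₁ l₂ × v ≡ proj l₁ k)
    back {D} {v} c p with prev (pos c p)
    ... | _ , neg k , e = let l₁ , l₂ , sp = split-at k in inj₂ (l₁ , k , l₂ , sp , trans (sym e) (τ-negα sp))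
    ... | u , pos cu pu , e with τ-pos cu pu
    ... | inj₂ (_ , k , _ , _ , _ , e′) = ⊥-elim (pos≢neg p k (trans (sym e) e′))
    ... | inj₁ (e′ , q) = inj₁ (subst Pos (trans (sym (cox⁻¹-cox u)) (cong cox⁻¹ (trans (sym e′) e))) pu)

    reg-cox : ∀ {D v} → Reg D v → Reg D (cox v)
    reg-cox {v = v} (reg c p e) = reg (cand-cox c) (cox-pos c p (≡⇒≤ (sym e))) (trans (def-cox v) e)

    reg-cox⁻¹ : ∀ {D v} → Reg D v → Reg D (cox⁻¹ v)
    reg-cox⁻¹ {v = v} (reg c p e) with back c p
    ... | inj₁ q = reg (cand-cox⁻¹ c) q (trans (def-cox⁻¹ v) e)
    ... | inj₂ (_ , _ , _ , sp , refl) = ⊥-elim (>⇒≢ (def-p sp) e)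

    -- Roots of positive defect are the vectors c^t p_k, t ∈ ℤ.
    orbit-ind : (P : V → Set) → (∀ v → P v → P (cox v)) → (∀ v → P (cox v) → P v) → (∀ {k l₁ l₂} → Split k l₁ l₂ → P (proj l₁ k)) →
      ∀ {D x} → Cand D x → 0ℚ < def x → P x
    orbit-ind P hu hd hb {D} {x} c h with sign c
    ... | inj₁ p = let t , np = escape-cox⁻¹ x h in go t x c h p np
      where
      go : ∀ t x → Cand D x → 0ℚ < def x → Pos x → ¬ Pos (iter cox⁻¹ t x) → P x
      go zero x c h p np = ⊥-elim (np p)
      go (suc t) x c h p np with back c p
      ... | inj₁ q = subst P (cox-cox⁻¹ x) (hu (cox⁻¹ x) (go t (cox⁻¹ x) (cand-cox⁻¹ c) (subst (0ℚ <_) (sym (def-cox⁻¹ x)) h) q np))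
      ... | inj₂ (_ , _ , _ , sp , refl) = hb sp
    ... | inj₂ p = let t , np = escape-cox (-V x) (subst (_< 0ℚ) (sym (def-neg x)) (->0 h)) in
      subst P (-V-inv x) (go t (-V x) (cand-neg c) p np)
      where
      go : ∀ t z → Cand D z → Pos z → ¬ Pos (iter cox t z) → P (-V z)
      go zero z c p np = ⊥-elim (np p)
      go (suc t) z c p np with τ-pos c p
      ... | inj₁ (_ , q) = hd (-V z) (subst P (sym (cl-neg L z)) (go t (cox z) (cand-cox c) q np))
      ... | inj₂ (l₁ , k , l₂ , sp , refl , _) = hd (-V inj l₂ k) (subst P (sym (trans (cl-neg L (inj l₂ k)) (trans (cong -V_ (cox-q sp)) (-V-inv (proj l₁ k))))) (hb sp))

    E-shift : ∀ u v → E u (cox v) ≡ E (cox⁻¹ u) v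
    E-shift u v = trans (cong (λ w → E w (cox v)) (sym (cox-cox⁻¹ u))) (E-cox-inv (cox⁻¹ u) v)

    -- With x = c^t p_k, the value is d_k times the coordinate k of c^(-t) β, and roots of defect
    -- zero stay positive under all powers of c.
    regular-pairing : ∀ {D D′ β x} → Reg D′ β → Cand D x → 0ℚ < def x → 0ℚ ≤ E β x
    regular-pairing {D} {D′} {β} {x} r c h = orbit-ind (λ x → ∀ β → Reg D′ β → 0ℚ ≤ E β x)
      (λ v ih β r → subst (0ℚ ≤_) (sym (E-shift β v)) (ih (cox⁻¹ β) (reg-cox⁻¹ r)))
      (λ v ih β r → subst (0ℚ ≤_) (E-cox-inv β v) (ih (cox β) (reg-cox r)))
      (λ {k} sp β r → subst (0ℚ ≤_) (sym (E-p sp β)) (*≥0 (ℚₚ.<⇒≤ (d-pos k)) (posv r k))) c h β r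

    Q-telescope : ∀ u v → Q (cox u) v ≡ E (cox u) v - E u v
    Q-telescope u v = trans (Q≡E+E (cox u) v) (cong (E (cox u) v +_) (E-cox u v))

    -- By `Q-telescope` the numbers Q(c^t x,z) sum up to the growth of E(c^t x,z), which is
    -- unbounded, so one of them is positive.
    meet : ∀ x z → 0ℚ < def x → 0ℚ < def z → ∃ λ t → 0ℚ < Q (iter cox t x) z
    meet x z hx hz = go (proj₁ g) x (proj₂ g)
      where
      g = E-grows x z hx hz (E x z)
      go : ∀ t y → E y z < E (iter cox t y) z → ∃ λ t → 0ℚ < Q (iter cox t y) z
      go zero y lt = ⊥-elim (<-irr lt)
      go (suc t) y lt with 0ℚ ℚₚ.<? Q (cox y) z
      ... | yes p = 1 , p
      ... | no p = let t′ , r = go t (cox y) (ℚₚ.≤-<-trans (by≤ (-≤0 (ℚₚ.≮⇒≥ p)) (trans (solve 2 (λ a b → a :- b := :- (b :- a)) refl (E y z) (E (cox y) z)) (cong -_ (sym (Q-telescope y z))))) lt) in suc t′ , r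

    -- The cone of Π_c and the permutation of Π_c induced by c.

    ∑V-! : ∀ {k} (f : Fin k → V) i → ∑V f ! i ≡ ∑ (λ j → f j ! i)
    ∑V-! {zero} f i = 0V-! i
    ∑V-! {suc k} f i = trans (+V-! (f zero) (∑V (λ j → f (suc j))) i) (cong (f zero ! i +_) (∑V-! (λ j → f (suc j)) i))

    lincomb-! : ∀ co i → lincomb co ! i ≡ ∑ (λ k → co k * Pc k ! i)
    lincomb-! co i = trans (∑V-! (λ k → co k ·V Pc k) i) (∑-cong λ k → ·V-! (co k) (Pc k) i)

    lincomb-cong : ∀ {co co′} → (∀ k → co k ≡ co′ k) → lincomb co ≡ lincomb co′
    lincomb-cong {co} {co′} h = ext λ i → trans (lincomb-! co i) (trans (∑-cong λ k → cong (_* Pc k ! i) (h k)) (sym (lincomb-! co′ i)))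

    lincomb-axpy : ∀ co q co′ → lincomb (λ k → co k + q * co′ k) ≡ axpy (lincomb co) q (lincomb co′)
    lincomb-axpy co q co′ = ext λ i → trans (lincomb-! (λ k → co k + q * co′ k) i) (trans (∑-lin (λ k → co k * Pc k ! i) q (λ k → co′ k * Pc k ! i)
      (λ k → solve 4 (λ a q b p → (a :+ q :* b) :* p := a :* p :+ q :* (b :* p)) refl (co k) q (co′ k) (Pc k ! i)))
      (sym (trans (axpy-! (lincomb co) q (lincomb co′) i) (cong₂ (λ x y → x + q * y) (lincomb-! co i) (lincomb-! co′ i)))))

    unit : Fin m → Fin m → ℚ
    unit j k = if ⌊ j Fin.≟ k ⌋ then 1ℚ else 0ℚ

    unit-same : ∀ j → unit j j ≡ 1ℚ
    unit-same j with j Fin.≟ j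
    ... | yes _ = refl
    ... | no p = ⊥-elim (p refl)

    unit-diff : ∀ {j k} → j ≢ k → unit j k ≡ 0ℚ
    unit-diff {j} {k} p with j Fin.≟ k
    ... | yes q = ⊥-elim (p q)
    ... | no _ = refl

    unit≥0 : ∀ j k → 0ℚ ≤ unit j k
    unit≥0 j k with j Fin.≟ k
    ... | yes _ = 0≤1
    ... | no _ = ℚₚ.≤-refl

    lincomb-unit : ∀ j → lincomb (unit j) ≡ Pc j
    lincomb-unit j = ext λ i → trans (lincomb-! (unit j) i) (trans (∑-single (λ k → unit j k * Pc k ! i) j (λ k p → 0ˡ (Pc k ! i) (unit-diff (p ∘ sym))))
      (1ˡ (Pc j ! i) (unit-same j)))

    Cone : V → Set
    Cone v = ∃ λ (co : Fin m → ℚ) → (∀ k → 0ℚ ≤ co k) × v ≡ lincomb co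

    Υ-cone : ∀ {v} → Υ⁺ v → Cone v
    Υ-cone {v} = Pc-spans v

    cone-axpy : ∀ {u q v} → Cone u → 0ℚ ≤ q → Cone v → Cone (axpy u q v)
    cone-axpy {q = q} (co , h , refl) p (co′ , h′ , refl) = (λ k → co k + q * co′ k) , (λ k → +≥0 (h k) (*≥0 p (h′ k))) , sym (lincomb-axpy co q co′)

    cone-0 : Cone 0V
    cone-0 = (λ _ → 0ℚ) , (λ _ → ℚₚ.≤-refl) , ext λ i → trans (0V-! i) (sym (trans (lincomb-! (λ _ → 0ℚ) i) (∑-zero λ k → ℚₚ.*-zeroˡ (Pc k ! i))))

    Pc-Pos : ∀ j → Pos (Pc j)
    Pc-Pos j = proj₁ (proj₂ (Pc-Υ⁺ j))

    Pc-def : ∀ j → def (Pc j) ≡ 0ℚ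
    Pc-def j = InU⇒def (proj₂ (proj₂ (Pc-Υ⁺ j)))

    infΦ-pos : ∀ {v} → Aff.InΦ AD v → Pos v → ∃ λ i → 0ℚ < v ! i
    infΦ-pos {v} (inj₁ r) p with Finₚ.any? (λ i → 0ℚ ℚₚ.<? v ! i)
    ... | yes q = q
    ... | no q = ⊥-elim (cand-nonzero (proj₂ (real⇒cand r)) λ i → ℚₚ.≤-antisym (ℚₚ.≮⇒≥ λ s → q (i , s)) (p i))
    infΦ-pos {v} (inj₂ (k , k≢0 , refl)) p = i₀ , ≥∧≢⇒> (p i₀) λ e → k≢0 (ℤ→ℚ-inj ([ id , (λ z → ⊥-elim (>⇒≢ (δ>0 i₀) z)) ]′ (*-zero⊎ (trans (sym (·V-! (ℤ→ℚ k) δ i₀)) e))))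

    Pc-pos-coord : ∀ j → ∃ λ i → 0ℚ < Pc j ! i
    Pc-pos-coord j = infΦ-pos (proj₁ (Pc-Υ⁺ j)) (Pc-Pos j)

    nonneg-lincomb-zero : ∀ co → (∀ k → 0ℚ ≤ co k) → (∀ i → lincomb co ! i ≡ 0ℚ) → ∀ k → co k ≡ 0ℚ
    nonneg-lincomb-zero co h z k = let i , p = Pc-pos-coord k in
      [ id , (λ e → ⊥-elim (>⇒≢ p e)) ]′ (*-zero⊎ (∑-zero⁻¹ (λ k → co k * Pc k ! i) (λ k → *≥0 (h k) (Pc-Pos k i)) (trans (sym (lincomb-! co i)) (z i)) k))

    private
      spans-without : ∀ j z → (∀ k → 0ℚ ≤ z k) → Pc j ≡ lincomb z → z j < 1ℚ → SpansWithout j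
      spans-without j z hz e lt β υ = co′ , co′≥0 , co′j , trans eβ (ext eq)
        where
        co = proj₁ (Pc-spans β υ)
        hco = proj₁ (proj₂ (Pc-spans β υ))
        eβ = proj₂ (proj₂ (Pc-spans β υ))
        r = inv (1ℚ - z j)
        1-z>0 : 0ℚ < 1ℚ - z j
        1-z>0 = <⇒0< lt
        t = co j * r
        co′ : Fin m → ℚ
        co′ k = co k + t * (z k + (- 1ℚ) * unit j k)
        co′j : co′ j ≡ 0ℚ
        co′j = trans (cong (λ x → co j + t * (z j + (- 1ℚ) * x)) (unit-same j)) (trans (solve 3 (λ c r z → c :+ c :* r :* (z :+ (:- c1) :* c1) := c :- c :* (r :* (c1 :- z))) refl (co j) r (z j))
          (trans (cong (λ x → co j - co j * x) (inv-* (>⇒≢ 1-z>0))) (solve 1 (λ c → c :- c :* c1 := c0) refl (co j))))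
        co′≥0 : ∀ k → 0ℚ ≤ co′ k
        co′≥0 k with j Fin.≟ k
        ... | yes refl = ≡⇒≤ (sym (trans (cong (λ x → co j + t * (z j + (- 1ℚ) * x)) (sym (unit-same j))) co′j))
        ... | no _ = +≥0 (hco k) (*≥0 (*≥0 (hco j) (ℚₚ.<⇒≤ (inv>0 1-z>0))) (nn (hz k) (solve 1 (λ z → z :+ (:- c1) :* c0 := z) refl (z k))))
        eq : ∀ i → lincomb co ! i ≡ lincomb co′ ! i
        eq i = sym (trans (cong (_! i) (lincomb-axpy co t (λ k → z k + (- 1ℚ) * unit j k))) (trans (axpy-! (lincomb co) t (lincomb (λ k → z k + (- 1ℚ) * unit j k)) i)
          (trans (cong (λ x → lincomb co ! i + t * x) (trans (cong (_! i) (lincomb-axpy z (- 1ℚ) (unit j))) (trans (axpy-! (lincomb z) (- 1ℚ) (lincomb (unit j)) i)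
            (trans (cong₂ (λ x y → x + (- 1ℚ) * y) (cong (_! i) (sym e)) (cong (_! i) (lincomb-unit j))) (solve 1 (λ x → x :+ (:- c1) :* x := c0) refl (Pc j ! i))))))
          (solve 2 (λ x t → x :+ t :* c0 := x) refl (lincomb co ! i) t))))

    -- Elements of Π_c span extremal rays. If the total coefficient of `Pc j` in x + y were below 1,
    -- `Pc j` could be expressed by the others, against minimality. So it is at least 1, and the
    -- remainder is a nonnegative combination equal to zero, whose coefficients all vanish.
    extremal : ∀ j {x y} → Cone x → Cone y → Pc j ≡ axpy x 1ℚ y → ∃ λ t → 0ℚ ≤ t × x ≡ t ·V Pc j
    extremal j {x} {y} (p , hp , refl) (q , hq , refl) e with (p j + 1ℚ * q j) ℚₚ.<? 1ℚ
    ... | yes lt = ⊥-elim (Pc-minimal j (spans-without j (λ k → p k + 1ℚ * q k) (λ k → +≥0 (hp k) (*≥0 0≤1 (hq k))) (trans e (sym (lincomb-axpy p 1ℚ q))) lt))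
    ... | no ge = p j , hp j , ext λ i → trans (lincomb-! p i) (trans (∑-single (λ k → p k * Pc k ! i) j (λ k k≢j → 0ˡ (Pc k ! i) (p0 k k≢j))) (sym (·V-! (p j) (Pc j) i)))
      where
      z : Fin m → ℚ
      z k = p k + 1ℚ * q k
      u : Fin m → ℚ
      u k = z k + (- 1ℚ) * unit j k
      z≥0 : ∀ k → 0ℚ ≤ z k
      z≥0 k = +≥0 (hp k) (*≥0 0≤1 (hq k))
      u≥0 : ∀ k → 0ℚ ≤ u k
      u≥0 k with j Fin.≟ k
      ... | yes refl = nn (≤⇒0≤ (ℚₚ.≮⇒≥ ge)) (solve 1 (λ z → z :+ (:- c1) :* c1 := z :- c1) refl (z j))
      ... | no _ = nn (z≥0 k) (solve 1 (λ z → z :+ (:- c1) :* c0 := z) refl (z k))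
      u0 : ∀ k → u k ≡ 0ℚ
      u0 = nonneg-lincomb-zero u u≥0 λ i → trans (cong (_! i) (lincomb-axpy z (- 1ℚ) (unit j))) (trans (axpy-! (lincomb z) (- 1ℚ) (lincomb (unit j)) i)
        (trans (cong₂ (λ x y → x + (- 1ℚ) * y) (cong (_! i) (trans (lincomb-axpy p 1ℚ q) (sym e))) (cong (_! i) (lincomb-unit j))) (solve 1 (λ x → x :+ (:- c1) :* x := c0) refl (Pc j ! i))))
      z0 : ∀ k → k ≢ j → z k ≡ 0ℚ
      z0 k k≢j = trans (sym (trans (cong (λ x → z k + (- 1ℚ) * x) (unit-diff (k≢j ∘ sym))) (solve 1 (λ z → z :+ (:- c1) :* c0 := z) refl (z k)))) (u0 k)
      p0 : ∀ k → k ≢ j → p k ≡ 0ℚ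
      p0 k k≢j = ℚₚ.≤-antisym (by≤ (*≥0 0≤1 (hq k)) (trans (cong (_- p k) (sym (z0 k k≢j))) (solve 2 (λ p q → p :+ q :- p := q) refl (p k) (1ℚ * q k)))) (hp k)

    reg-Υ : ∀ {D v} → Reg D v → Υ⁺ v
    reg-Υ (reg c p e) = inj₁ (cand⇒real SD c) , p , def⇒InU e

    reg-cone : ∀ {D v} → Reg D v → Cone v
    reg-cone r = Υ-cone (reg-Υ r)

    ·V-inj0 : ∀ {t v} → t ≡ 0ℚ → ∀ i → (t ·V v) ! i ≡ 0ℚ
    ·V-inj0 {t} {v} e i = trans (·V-! t v i) (0ˡ (v ! i) e)

    ·V-· : ∀ p q v → p ·V (q ·V v) ≡ (p * q) ·V v
    ·V-· p q v = ext λ i → trans (·V-! p (q ·V v) i) (trans (cong (p *_) (·V-! q v i)) (sym (trans (·V-! (p * q) v i) (ℚₚ.*-assoc p q (v ! i)))))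

    Q-scaled : ∀ t v → Q (t ·V v) (t ·V v) ≡ t * (t * Q v v)
    Q-scaled t v = trans (Q-·ˡ t v (t ·V v)) (cong (t *_) (Q-·ʳ t v v))

    Q-null : ∀ t → Q (t ·V δ) (t ·V δ) ≡ 0ℚ
    Q-null t = trans (Q-scaled t δ) (0ʳ t (0ʳ t (Q-δʳ δ)))

    scale-div : ∀ {s t u w} → 0ℚ < s → s ·V u ≡ t ·V w → u ≡ (inv s * t) ·V w
    scale-div {s} {t} {u} {w} p e = trans (sym (1·V u)) (trans (cong (_·V u) (sym (inv-* (>⇒≢ p)))) (trans (sym (·V-· (inv s) s u)) (trans (cong (inv s ·V_) e) (·V-· (inv s) t w))))

    cand-not-null : ∀ {D v t} → Cand D v → v ≢ t ·V δ
    cand-not-null {t = t} c refl = >⇒≢ (Q-pos c) (Q-null t)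

    -- Υ_c contains imaginary roots, so an element of Π_c may be a multiple of δ; this happens in
    -- rank two, where U_c is the line through δ.
    real-or-null : ∀ j → (∃ λ D → Cand D (Pc j)) ⊎ (∃ λ t → Pc j ≡ t ·V δ)
    real-or-null j with proj₁ (Pc-Υ⁺ j)
    ... | inj₁ r = inj₁ (real⇒cand r)
    ... | inj₂ (k , _ , e) = inj₂ (ℤ→ℚ k , e)

    -- Indecomposability in the cone, stated for vectors instead of indices so that its invariance
    -- under c can be seen before c is known to permute Π_c.
    Simple : V → Set
    Simple b = ∀ {D w y} s → 0ℚ < s → Reg D w → Cone y → b ≡ axpy (s ·V w) 1ℚ y → w ≡ b

    cone-· : ∀ {v q} → 0ℚ ≤ q → Cone v → Cone (q ·V v)
    cone-· {v} {q} p c = subst Cone (sym (·V≡axpy q v)) (cone-axpy cone-0 p c)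

    Pc-simple : ∀ j → Simple (Pc j)
    Pc-simple j {D} {w} {y} s p r cy e = aux (extremal j (cone-· (ℚₚ.<⇒≤ p) (reg-cone r)) cy e) (real-or-null j)
      where
      aux : (∃ λ t → 0ℚ ≤ t × s ·V w ≡ t ·V Pc j) → (∃ λ D → Cand D (Pc j)) ⊎ (∃ λ t → Pc j ≡ t ·V δ) → w ≡ Pc j
      aux (t , t≥0 , e′) (inj₁ (_ , c)) = cand-prop (inv s * t) (cand r) c (*>0 (inv>0 p) (≥∧≢⇒> t≥0 t≢0)) (scale-div p e′)
        where
        t≢0 : t ≢ 0ℚ
        t≢0 t0 = cand-nonzero (cand r) λ i → trans (cong (_! i) (scale-div p e′)) (·V-inj0 {v = Pc j} (0ʳ (inv s) t0) i)
      aux (t , t≥0 , e′) (inj₂ (k , e″)) = ⊥-elim (cand-not-null {t = inv s * t * k} (cand r) (trans (scale-div p e′) (trans (cong ((inv s * t) ·V_) e″) (·V-· (inv s * t) k δ))))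

    private
      cone-map : (T : V → V) → (∀ u q v → T (axpy u q v) ≡ axpy (T u) q (T v)) → T 0V ≡ 0V →
        ∀ {k} (f : Fin k → V) (co : Fin k → ℚ) → (∀ j → 0ℚ ≤ co j) → (∀ j → Cone (T (f j))) → Cone (T (∑V (λ j → co j ·V f j)))
      cone-map T lin z {zero} f co h cf = subst Cone (sym z) cone-0
      cone-map T lin z {suc k} f co h cf = subst Cone (sym eq) (cone-axpy (cone-map T lin z (f ∘ suc) (co ∘ suc) (h ∘ suc) (cf ∘ suc)) (h zero) (cf zero))
        where
        rest = ∑V (λ j → co (suc j) ·V f (suc j))
        eq : T (co zero ·V f zero +V rest) ≡ axpy (T rest) (co zero) (T (f zero))
        eq = trans (cong T (ext λ i → trans (+V-! (co zero ·V f zero) rest i) (trans (cong (_+ rest ! i) (·V-! (co zero) (f zero) i))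
          (trans (ℚₚ.+-comm (co zero * f zero ! i) (rest ! i)) (sym (axpy-! rest (co zero) (f zero) i)))))) (lin rest (co zero) (f zero))

    Pc-reg : ∀ {D j} → Cand D (Pc j) → Reg D (Pc j)
    Pc-reg {j = j} c = reg c (Pc-Pos j) (Pc-def j)

    cl-null : ∀ l t → cl l (t ·V δ) ≡ t ·V δ
    cl-null l t = trans (cl-· l t δ) (cong (t ·V_) (cl-δ l))

    cone-cox : ∀ {v} → Cone v → Cone (cox v)
    cone-cox (co , h , refl) = cone-map cox (cl-axpy L) (cl-0V L) Pc co h λ j → one j (real-or-null j)
      where
      one : ∀ j → (∃ λ D → Cand D (Pc j)) ⊎ (∃ λ t → Pc j ≡ t ·V δ) → Cone (cox (Pc j))
      one j (inj₁ (_ , c)) = reg-cone (reg-cox (Pc-reg {j = j} c))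
      one j (inj₂ (t , e)) = subst Cone (trans e (sym (trans (cong cox e) (cl-null L t)))) (Υ-cone (Pc-Υ⁺ j))

    cone-cox⁻¹ : ∀ {v} → Cone v → Cone (cox⁻¹ v)
    cone-cox⁻¹ (co , h , refl) = cone-map cox⁻¹ (cl-axpy (reverse L)) (cl-0V (reverse L)) Pc co h λ j → one j (real-or-null j)
      where
      one : ∀ j → (∃ λ D → Cand D (Pc j)) ⊎ (∃ λ t → Pc j ≡ t ·V δ) → Cone (cox⁻¹ (Pc j))
      one j (inj₁ (_ , c)) = reg-cone (reg-cox⁻¹ (Pc-reg {j = j} c))
      one j (inj₂ (t , e)) = subst Cone (trans e (sym (trans (cong cox⁻¹ e) (cl-null (reverse L) t)))) (Υ-cone (Pc-Υ⁺ j))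

    simple-cox : ∀ {b} → Simple b → Simple (cox b)
    simple-cox {b} S {w = w} {y} s p r cy e = trans (sym (cox-cox⁻¹ w)) (cong cox (S s p (reg-cox⁻¹ r) (cone-cox⁻¹ cy)
      (trans (sym (cox⁻¹-cox b)) (trans (cong cox⁻¹ e) (trans (cl-axpy (reverse L) (s ·V w) 1ℚ y) (cong (λ u → axpy u 1ℚ (cox⁻¹ y)) (cl-· (reverse L) s w)))))))

    simple-cox⁻¹ : ∀ {b} → Simple b → Simple (cox⁻¹ b)
    simple-cox⁻¹ {b} S {w = w} {y} s p r cy e = trans (sym (cox⁻¹-cox w)) (cong cox⁻¹ (S s p (reg-cox r) (cone-cox cy)
      (trans (sym (cox-cox⁻¹ b)) (trans (cong cox e) (trans (cl-axpy L (s ·V w) 1ℚ y) (cong (λ u → axpy u 1ℚ (cox y)) (cl-· L s w)))))))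

    -- If the reflection w - p b were negative, then p b = w + (p b - w) would decompose b along the
    -- positive root w, and indecomposability would give w = b.
    reflect-pos : ∀ {D D′ b w} p → Reg D b → Simple b → Reg D′ w → Int p → p * D ≡ Q b w → 0ℚ < p → w ≢ b → Reg D′ (axpy w (- p) b)
    reflect-pos {D} {D′} {b} {w} p rb S rw pi e p>0 w≢b with sign (cand-refl p (cand rw) (cand rb) pi e)
    ... | inj₁ q = reg (cand-refl p (cand rw) (cand rb) pi e) q (trans (def-axpy w (- p) b) (trans (cong₂ (λ x y → x + (- p) * y) (def0 rw) (def0 rb)) (solve 1 (λ p → c0 :+ p :* c0 := c0) refl (- p))))
    ... | inj₂ q = ⊥-elim (w≢b (S (inv p) (inv>0 p>0) rw (cone-· (ℚₚ.<⇒≤ (inv>0 p>0)) (reg-cone rz)) (ext λ i → sym (trans (axpy-! (inv p ·V w) 1ℚ (inv p ·V z) i)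
        (trans (cong₂ (λ x y → x + 1ℚ * y) (·V-! (inv p) w i) (trans (·V-! (inv p) z i) (cong (inv p *_) (trans (-V-! (axpy w (- p) b) i) (cong -_ (axpy-! w (- p) b i))))))
        (trans (solve 4 (λ r w p b → r :* w :+ c1 :* (r :* (:- (w :+ (:- p) :* b))) := r :* p :* b) refl (inv p) (w ! i) p (b ! i)) (1ˡ (b ! i) (inv-* (>⇒≢ p>0)))))))))
      where
      z = -V axpy w (- p) b
      rz : Reg D′ z
      rz = reg (cand-neg (cand-refl p (cand rw) (cand rb) pi e)) q (trans (def-neg (axpy w (- p) b)) (cong -_ (trans (def-axpy w (- p) b) (trans (cong₂ (λ x y → x + (- p) * y) (def0 rw) (def0 rb)) (solve 1 (λ p → c0 :+ p :* c0 := c0) refl (- p))))))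

    simple-nonpos : ∀ {D D′ b b′} → Reg D b → Simple b → Reg D′ b′ → Simple b′ → b ≢ b′ → Q b b′ ≤ 0ℚ
    simple-nonpos {D} {D′} {b} {b′} r S r′ S′ ne = ℚₚ.≮⇒≥ (aux (Q-quot (cand r) (int (cand r′))))
      where
      aux : (∃ λ p → Int p × p * D ≡ Q b b′) → ¬ (0ℚ < Q b b′)
      aux (p , pi , e) h = ne (S′ p p>0 r (reg-cone (reflect-pos p r S r′ pi e p>0 (ne ∘ sym))) (ext λ i → sym (trans (axpy-! (p ·V b) 1ℚ (axpy b′ (- p) b) i)
         (trans (cong₂ (λ x y → x + 1ℚ * y) (·V-! p b i) (axpy-! b′ (- p) b i)) (solve 3 (λ p b c → p :* b :+ c1 :* (c :+ (:- p) :* b) := c) refl p (b ! i) (b′ ! i))))))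
        where
        p>0 : 0ℚ < p
        p>0 = *-cancel>0 (D>0 (cand r)) (np h (trans (ℚₚ.*-comm D p) e))

    private
      -- Expand c(`Pc j`) in the cone and take k with positive coefficient. Applying c⁻¹ exhibits a
      -- positive multiple of c⁻¹(`Pc k`) inside `Pc j`, so indecomposability identifies the two.
      perm′ : ∀ j → ∃ λ k → cox (Pc j) ≡ Pc k
      perm′ j = go (real-or-null j)
        where
        fin : ∀ {Db} k → Cand Db (Pc j) → ∀ s y → 0ℚ < s → Cone y → Pc j ≡ axpy (s ·V cox⁻¹ (Pc k)) 1ℚ y →
          (∃ λ D → Cand D (Pc k)) ⊎ (∃ λ t → Pc k ≡ t ·V δ) → cox⁻¹ (Pc k) ≡ Pc j
        fin k c s y s>0 cy dec (inj₁ (_ , ck)) = Pc-simple j s s>0 (reg-cox⁻¹ (Pc-reg {j = k} ck)) cy dec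
        fin k c s y s>0 cy dec (inj₂ (t , e)) = ⊥-elim (contra (extremal j (cone-· (ℚₚ.<⇒≤ s>0) (subst Cone (sym fixk) (Υ-cone (Pc-Υ⁺ k)))) cy dec))
          where
          fixk : cox⁻¹ (Pc k) ≡ Pc k
          fixk = trans (cong cox⁻¹ e) (trans (cl-null (reverse L) t) (sym e))
          contra : (∃ λ r → 0ℚ ≤ r × s ·V cox⁻¹ (Pc k) ≡ r ·V Pc j) → ⊥
          contra (r , r≥0 , e′) with r ℚₚ.≟ 0ℚ
          ... | yes r0 = let i , p = Pc-pos-coord k in
                >⇒≢ (*>0 s>0 p) (trans (sym (·V-! s (Pc k) i)) (trans (cong (λ u → (s ·V u) ! i) (sym fixk)) (trans (cong (_! i) e′) (·V-inj0 {v = Pc j} r0 i))))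
          ... | no r≢0 = cand-not-null {t = inv r * (s * t)} c (scale-div (≥∧≢⇒> r≥0 r≢0) (trans (sym e′) (trans (cong (λ u → s ·V u) (trans fixk e)) (·V-· s t δ))))
        real-case : ∀ {Db} → Reg Db (cox (Pc j)) → Cand Db (Pc j) → Cone (cox (Pc j)) → ∃ λ k → cox (Pc j) ≡ Pc k
        real-case {Db} r c (z , hz , ez) = aux (infΦ-pos (inj₁ (cand⇒real SD (cand r))) (posv r))
          where
          aux′ : ∀ k → 0ℚ < z k → cox (Pc j) ≡ Pc k
          aux′ k zk>0 = trans (cong cox (sym (fin k c (z k) y zk>0 (cone-cox⁻¹ (z′ , z′≥0 , refl)) dec (real-or-null k)))) (cox-cox⁻¹ (Pc k))
            where
            z′ : Fin m → ℚ
            z′ l = z l + (- z k) * unit k l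
            z′≥0 : ∀ l → 0ℚ ≤ z′ l
            z′≥0 l with k Fin.≟ l
            ... | yes refl = ≡⇒≤ (solve 1 (λ z → c0 := z :+ (:- z) :* c1) refl (z k))
            ... | no _ = nn (hz l) (solve 2 (λ z y → z :+ y :* c0 := z) refl (z l) (- z k))
            y : V
            y = cox⁻¹ (lincomb z′)
            eq : cox (Pc j) ≡ axpy (z k ·V Pc k) 1ℚ (lincomb z′)
            eq = trans ez (ext λ i → trans (solve 2 (λ x w → x := w :+ (x :- w)) refl (lincomb z ! i) (z k * Pc k ! i))
              (sym (trans (axpy-! (z k ·V Pc k) 1ℚ (lincomb z′) i) (cong₂ _+_ (·V-! (z k) (Pc k) i)
              (trans (cong (1ℚ *_) (trans (cong (_! i) (lincomb-axpy z (- z k) (unit k))) (trans (axpy-! (lincomb z) (- z k) (lincomb (unit k)) i) (cong (λ u → lincomb z ! i + (- z k) * u ! i) (lincomb-unit k)))))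
              (solve 3 (λ x z p → c1 :* (x :+ (:- z) :* p) := x :- z :* p) refl (lincomb z ! i) (z k) (Pc k ! i)))))))
            dec : Pc j ≡ axpy (z k ·V cox⁻¹ (Pc k)) 1ℚ y
            dec = trans (sym (cox⁻¹-cox (Pc j))) (trans (cong cox⁻¹ eq)
              (trans (cl-axpy (reverse L) (z k ·V Pc k) 1ℚ (lincomb z′)) (cong (λ u → axpy u 1ℚ y) (cl-· (reverse L) (z k) (Pc k)))))
          aux : (∃ λ i → 0ℚ < cox (Pc j) ! i) → ∃ λ k → cox (Pc j) ≡ Pc k
          aux (i , p) = aux″ (∑-pos (λ k → z k * Pc k ! i) (subst (0ℚ <_) (trans (cong (_! i) ez) (lincomb-! z i)) p))
            where
            aux″ : (∃ λ k → 0ℚ < z k * Pc k ! i) → ∃ λ k → cox (Pc j) ≡ Pc k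
            aux″ (k , q) = k , aux′ k (*-cancel>0 {Pc k ! i} {z k} (≥∧≢⇒> (Pc-Pos k i) λ e → >⇒≢ q (0ʳ (z k) e)) (subst (0ℚ <_) (ℚₚ.*-comm (z k) (Pc k ! i)) q))
        go : (∃ λ D → Cand D (Pc j)) ⊎ (∃ λ t → Pc j ≡ t ·V δ) → ∃ λ k → cox (Pc j) ≡ Pc k
        go (inj₂ (t , e)) = j , trans (cong cox e) (trans (cl-null L t) (sym e))
        go (inj₁ (Db , c)) = real-case (reg-cox (Pc-reg {j = j} c)) c (reg-cone (reg-cox (Pc-reg {j = j} c)))

    abstract
      perm : ∀ j → ∃ λ k → cox (Pc j) ≡ Pc k
      perm = perm′

    π : Fin m → Fin m
    π j = proj₁ (perm j)

    cox-Pc : ∀ j → cox (Pc j) ≡ Pc (π j)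
    cox-Pc j = proj₂ (perm j)

    π-inj : ∀ {j k} → π j ≡ π k → j ≡ k
    π-inj {j} {k} e = Pc-inj j k (trans (sym (cox⁻¹-cox (Pc j))) (trans (cong cox⁻¹ (trans (cox-Pc j) (trans (cong Pc e) (sym (cox-Pc k))))) (cox⁻¹-cox (Pc k))))

    iterF : ℕ → Fin m → Fin m
    iterF zero j = j
    iterF (suc t) j = iterF t (π j)

    iterF-Pc : ∀ t j → iter cox t (Pc j) ≡ Pc (iterF t j)
    iterF-Pc zero j = refl
    iterF-Pc (suc t) j = trans (cong (iter cox t) (cox-Pc j)) (iterF-Pc t (π j))

    iterF-suc : ∀ t j → iterF t (π j) ≡ π (iterF t j)
    iterF-suc zero j = refl
    iterF-suc (suc t) j = iterF-suc t (π j)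

    iterF-inj : ∀ t {j k} → iterF t j ≡ iterF t k → j ≡ k
    iterF-inj zero e = e
    iterF-inj (suc t) e = π-inj (iterF-inj t e)

    iterF-+ : ∀ s t j → iterF (s ℕ.+ t) j ≡ iterF t (iterF s j)
    iterF-+ zero t j = refl
    iterF-+ (suc s) t j = iterF-+ s t (π j)

    abstract
      period : ∀ j → ∃ λ r → iterF (suc r) j ≡ j
      period j with Finₚ.pigeonhole (ℕₚ.n<1+n m) (λ (t : Fin (suc m)) → iterF (toℕ t) j)
      ... | s , t , s<t , e = ℕ.pred (toℕ t ℕ.∸ toℕ s) , trans (cong (λ r → iterF r j) (ℕₚ.suc-pred (toℕ t ℕ.∸ toℕ s) {{ℕ.>-nonZero (ℕₚ.m<n⇒0<n∸m s<t)}}))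
            (iterF-inj (toℕ s) (trans (sym (iterF-+ (toℕ t ℕ.∸ toℕ s) (toℕ s) j)) (trans (cong (λ r → iterF r j) (ℕₚ.m∸n+n≡m (ℕₚ.<⇒≤ s<t))) (sym e))))

    orbsum : ℕ → V → V
    orbsum zero v = 0V
    orbsum (suc r) v = axpy (orbsum r (cox v)) 1ℚ v

    private
      cox-orbsum : ∀ r v → axpy (cox (orbsum r v)) 1ℚ v ≡ axpy (orbsum r v) 1ℚ (iter cox r v)
      cox-orbsum zero v = cong (λ u → axpy u 1ℚ v) (cl-0V L)
      cox-orbsum (suc r) v = ext λ i → trans (axpy-! (cox (axpy o 1ℚ v)) 1ℚ v i) (trans (cong (λ u → u ! i + 1ℚ * v ! i) (cl-axpy L o 1ℚ v)) (trans (cong (_+ 1ℚ * v ! i) (axpy-! (cox o) 1ℚ (cox v) i))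
        (trans (cong (_+ 1ℚ * v ! i) (trans (sym (axpy-! (cox o) 1ℚ (cox v) i)) (trans (cong (_! i) (cox-orbsum r (cox v))) (axpy-! o 1ℚ (iter cox r (cox v)) i))))
        (trans (solve 3 (λ o w v → o :+ c1 :* w :+ c1 :* v := o :+ c1 :* v :+ c1 :* w) refl (o ! i) (iter cox r (cox v) ! i) (v ! i))
        (sym (trans (axpy-! (axpy o 1ℚ v) 1ℚ (iter cox r (cox v)) i) (cong (_+ 1ℚ * iter cox r (cox v) ! i) (axpy-! o 1ℚ v i))))))))
        where o = orbsum r (cox v)

    -- The sum over a full orbit is fixed by c, and a fixed vector is null because E(v,v) = E(v,c v)
    -- = -E(v,v).
    orbsum-null : ∀ r v → iter cox r v ≡ v → ∃ λ q → orbsum r v ≡ q ·V δ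
    orbsum-null r v e = orbsum r v ! i₀ * inv (δ ! i₀) , kernel (orbsum r v) (cox-fixed (orbsum r v) (ext λ i → cancel i))
      where
      cancel : ∀ i → cox (orbsum r v) ! i ≡ orbsum r v ! i
      cancel i = trans (solve 2 (λ x v → x := (x :+ c1 :* v) :- v) refl (cox (orbsum r v) ! i) (v ! i)) (trans (cong (_- v ! i) (trans (sym (axpy-! (cox (orbsum r v)) 1ℚ v i))
        (trans (cong (_! i) (trans (cox-orbsum r v) (cong (axpy (orbsum r v) 1ℚ) e))) (axpy-! (orbsum r v) 1ℚ v i)))) (solve 2 (λ x v → (x :+ c1 :* v) :- v := x) refl (orbsum r v ! i) (v ! i)))

    E-null : ∀ {v} q → def v ≡ 0ℚ → E v (q ·V δ) ≡ 0ℚ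
    E-null {v} q e = trans (E-·ʳ q v δ) (0ʳ q (trans (E-δʳ v) (cong -_ e)))

    E-step : ∀ u v → E u (cox v) ≡ E u v - Q u v
    E-step u v = trans (E-cox v u) (trans (solve 2 (λ x y → :- x := y :- (y :+ x)) refl (E v u) (E u v)) (cong (λ z → E u v - z) (sym (Q≡E+E u v))))

    -- E(μ, c^t b) is nondecreasing while c^t b ≠ μ and sums to 0 over the orbit.
    adjacent-positive : ∀ {D D′ μ} j → Reg D μ → Simple μ → Reg D′ (Pc j) → μ ≢ Pc j → 0ℚ < E μ (Pc j) → 0ℚ < E (cox μ) μ
    adjacent-positive {D} {D′} {μ} j rμ Sμ rj ne h = top (period j)
      where
      go : ∀ r j → Reg D′ (Pc j) → μ ≢ Pc j → 0ℚ < E μ (Pc j) → 0ℚ < E (cox μ) μ ⊎ 0ℚ < E μ (orbsum (suc r) (Pc j))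
      go zero j rj ne h = inj₂ (np h (trans (E-axpyʳ μ 0V 1ℚ (Pc j)) (trans (cong (_+ 1ℚ * E μ (Pc j)) (B-0ʳ eul μ 0V-!)) (solve 1 (λ x → c0 :+ c1 :* x := x) refl (E μ (Pc j))))))
      go (suc r) j rj ne h = split-case (Pc (π j) ≟V μ)
        where
        grow : 0ℚ < E μ (Pc (π j))
        grow = subst (λ w → 0ℚ < E μ w) (cox-Pc j) (np (+>0 h (-≤0 (simple-nonpos rμ Sμ rj (Pc-simple j) ne))) (E-step μ (Pc j)))
        add : 0ℚ < E μ (orbsum (suc r) (Pc (π j))) → 0ℚ < E μ (orbsum (suc (suc r)) (Pc j))
        add q = np (+>0 (subst (λ w → 0ℚ < E μ (orbsum (suc r) w)) (sym (cox-Pc j)) q) (ℚₚ.<⇒≤ h))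
          (trans (E-axpyʳ μ (orbsum (suc r) (cox (Pc j))) 1ℚ (Pc j)) (cong (E μ (orbsum (suc r) (cox (Pc j))) +_) (ℚₚ.*-identityˡ (E μ (Pc j)))))
        split-case : Dec (Pc (π j) ≡ μ) → 0ℚ < E (cox μ) μ ⊎ 0ℚ < E μ (orbsum (suc (suc r)) (Pc j))
        split-case (yes e) = inj₁ (np h (trans (cong (E (cox μ)) (sym (trans (cox-Pc j) e))) (E-cox-inv μ (Pc j))))
        split-case (no ne′) = [ inj₁ , inj₂ ∘ add ]′ (go r (π j) (subst (Reg D′) (cox-Pc j) (reg-cox rj)) (ne′ ∘ sym) grow)
      null : ∀ r → iterF (suc r) j ≡ j → (∃ λ q → orbsum (suc r) (Pc j) ≡ q ·V δ) → ¬ (0ℚ < E μ (orbsum (suc r) (Pc j)))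
      null r e (q , e′) p = >⇒≢ p (trans (cong (E μ) e′) (E-null q (def0 rμ)))
      top : (∃ λ r → iterF (suc r) j ≡ j) → 0ℚ < E (cox μ) μ
      top (r , e) = [ id , (λ p → ⊥-elim (null r e (orbsum-null (suc r) (Pc j) (trans (iterF-Pc (suc r) j) (cong Pc e))) p)) ]′ (go r j rj ne h)

    -- A root of positive defect that is minimal relative to D.

    module Minimal {D : ℚ} (D>0 : 0ℚ < D) where

      private
        module DN = Denominator (denominator (λ j → d j * δ ! j * inv D))

      -- The least positive integer such that D divides M d_j δ_j for all j, that is, such that
      -- translation by Mδ preserves coroot integrality relative to D.
      M : ℕ
      M = DN.N

      private
        to-mul : ∀ {k j} → Int (k * (d j * δ ! j * inv D)) → Mul D (k * (d j * δ ! j))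
        to-mul {k} {j} (z , e) = z , trans (sym (1ʳ (k * (d j * δ ! j)) (inv-* (>⇒≢ D>0)))) (trans (solve 4 (λ k x r D → k :* x :* (r :* D) := k :* (x :* r) :* D) refl k (d j * δ ! j) (inv D) D) (cong (_* D) e))

        from-mul : ∀ {k j} → Mul D (k * (d j * δ ! j)) → Int (k * (d j * δ ! j * inv D))
        from-mul {k} {j} (z , e) = z , trans (sym (ℚₚ.*-assoc k (d j * δ ! j) (inv D))) (trans (cong (_* inv D) e) (trans (solve 3 (λ j D r → j :* D :* r := j :* (r :* D)) refl (ℤ→ℚ z) D (inv D)) (1ʳ (ℤ→ℚ z) (inv-* (>⇒≢ D>0)))))

      M>0 : 0ℚ < ι M
      M>0 = subst (_< ι M) ι-0 (ι-mono-< DN.N>0)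

      M-mul : ∀ j → Mul D (ι M * (d j * δ ! j))
      M-mul j = to-mul {ι M} {j} (DN.clears j)

      M-least : ∀ M′ → (∀ j → Mul D (ι M′ * (d j * δ ! j))) → M ∣ M′
      M-least M′ h = DN.least M′ (λ j → from-mul {ι M′} {j} (h j))

      gen : ∀ k → ∃ λ l → Generator D (d k) l
      gen k = generator D>0 (d-pos k)

      abstract
        omega : ∀ k → ∃ λ w → 0 ℕ.< w × ι M * (d k * δ ! k) ≡ ι w * proj₁ (gen k)
        omega k = mul-pos (Generator.gen>0 (proj₂ (gen k))) (*>0 M>0 (*>0 (d-pos k) (δ>0 k)))
          (Generator.gens (proj₂ (gen k)) (M-mul k) (subst (Mul (d k)) (solve 3 (λ m δ d → m :* δ :* d := m :* (d :* δ)) refl (ι M) (δ ! k) (d k)) (int*-mul (int-* (ι-int M) (δ-int k)) mul-self)))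

      -- The weight of p_k: M def(p_k) = M d_k δ_k, measured in units of the generator of Dℤ ∩ d_k
      -- ℤ. The goal is that the minimal weight is 1.
      ω : Fin n → ℕ
      ω k = proj₁ (omega k)

      ω>0 : ∀ k → 0 ℕ.< ω k
      ω>0 k = proj₁ (proj₂ (omega k))

      ω-eq : ∀ k → ι M * (d k * δ ! k) ≡ ι (ω k) * proj₁ (gen k)
      ω-eq k = proj₂ (proj₂ (omega k))

      abstract
        least : ∃ λ κ → ∀ j → ω κ ℕ.≤ ω j
        least = argmin ω (ω i₀) i₀ ℕₚ.≤-refl

      κ : Fin n
      κ = proj₁ least

      ω₀ : ℕ
      ω₀ = ω κ

      record X (w : ℕ) (z : V) : Set where
        field
          {Dz l} : ℚ
          cz  : Cand Dz z
          hz  : 0ℚ < def z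
          gz  : Generator D Dz l
          eqz : ι M * def z ≡ ι w * l

      gen-unique : ∀ {D′ l l′} → Generator D D′ l → Generator D D′ l′ → l ≡ l′
      gen-unique {D′} {l} {l′} G G′ = go (generator-ratio 1 (ℕ.s≤s ℕ.z≤n) (sym (1ˡ D′ (ι≡ 1))) G G′)
        where
        go : (∃ λ i → ∃ λ j → i ℕ.* j ≡ 1 × l′ ≡ ι j * l × ι 1 * l ≡ ι i * l′) → l ≡ l′
        go (i , j , e , e′ , _) = sym (trans e′ (1ˡ l (trans (cong ι (ℕₚ.m*n≡1⇒n≡1 i j e)) (ι≡ 1))))

      ι-cancel : ∀ {w w′ l} → 0ℚ < l → ι w * l ≡ ι w′ * l → w ≡ w′
      ι-cancel {w} {w′} {l} p e = ι-inj (*-cancelˡ (>⇒≢ p) (trans (ℚₚ.*-comm l (ι w)) (trans e (ℚₚ.*-comm (ι w′) l))))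

      -- E(z,z) and the defect are constant on c-orbits, and an orbit of positive defect contains
      -- some p_k, so the weight of z is one of the `ω k`.
      ω₀-least : ∀ {w z} → X w z → ω₀ ℕ.≤ w
      ω₀-least {w} {z} x = go (orbit-ind (λ z → ∃ λ k → E z z ≡ d k × def z ≡ d k * δ ! k)
          (λ v (k , e , e′) → k , trans (E-cox-inv v v) e , trans (def-cox v) e′) (λ v (k , e , e′) → k , trans (sym (E-cox-inv v v)) e , trans (sym (def-cox v)) e′)
          (λ {k} {l₁} sp → k , norm (cand-cl l₁ (cand-α k)) , E-p sp δ) cz hz)
        where
        open X x
        go : (∃ λ k → E z z ≡ d k × def z ≡ d k * δ ! k) → ω₀ ℕ.≤ w
        go (k , e , e′) = subst (ω₀ ℕ.≤_) (ι-cancel (Generator.gen>0 gz) (trans (cong (ι (ω k) *_) (gen-unique (subst (λ D′ → Generator D D′ l) (trans (sym (norm cz)) e) gz) (proj₂ (gen k))))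
          (trans (sym (ω-eq k)) (trans (cong (ι M *_) (sym e′)) eqz)))) (proj₂ least k)

      -- Two roots with Q(u,v) = D_u = q D_v, q ≤ 3, differ by a root r with ω(r) = ω(v) - ω(u).
      record Diff (y : ℚ) : Set where
        field
          {Dr l} : ℚ
          {r} : V
          cr  : Cand Dr r
          gr  : Generator D Dr l
          eqr : ι M * def r ≡ y * l

      diff : ∀ {u v Du Dv lu lv wu wv} q → 0 ℕ.< q → q ℕ.≤ 3 → Cand Du u → Cand Dv v → Du ≡ ι q * Dv → Q u v ≡ Du → Generator D Du lu → Generator D Dv lv →
        ι M * def u ≡ wu * lu → ι M * def v ≡ wv * lv → Diff (wv - wu)
      diff {u} {v} {Du} {Dv} {lu} {lv} {wu} {wv} q q>0 q≤3 cu cv eD eQ gu gv eu ev = go (generator-ratio q q>0 eD gv gu)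
        where
        go′ : ∀ {i j} → i ≡ 1 ⊎ j ≡ 1 → lu ≡ ι j * lv → ι q * lv ≡ ι i * lu → Diff (wv - wu)
        -- For i = 1 the generators satisfy `lu` = q `lv`, and the root is q v - u, the negative of
        -- the reflection of u in v. For j = 1 they are equal, and the reflection v - u serves.
        go′ (inj₁ refl) _ ei = record { cr = cand-neg (cand-refl (ι q) cu cv (ι-int q) (trans (sym eD) (trans (sym eQ) (Q-sym u v)))) ; gr = gu ; eqr = begin
          ι M * def (-V axpy u (- ι q) v) ≡⟨ cong (ι M *_) (trans (def-neg (axpy u (- ι q) v)) (cong -_ (def-axpy u (- ι q) v))) ⟩
          ι M * (- (def u + (- ι q) * def v)) ≡⟨ solve 4 (λ m x q y → m :* (:- (x :+ (:- q) :* y)) := q :* (m :* y) :- m :* x) refl (ι M) (def u) (ι q) (def v) ⟩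
          ι q * (ι M * def v) - ι M * def u ≡⟨ cong₂ (λ x y → ι q * x - y) ev eu ⟩
          ι q * (wv * lv) - wu * lu ≡⟨ solve 5 (λ q w l u k → q :* (w :* l) :- u :* k := w :* (q :* l) :- u :* k) refl (ι q) wv lv wu lu ⟩
          wv * (ι q * lv) - wu * lu ≡⟨ cong (λ x → wv * x - wu * lu) (trans ei (1ˡ lu (ι≡ 1))) ⟩
          wv * lu - wu * lu ≡⟨ solve 3 (λ w u l → w :* l :- u :* l := (w :- u) :* l) refl wv wu lu ⟩
          (wv - wu) * lu ∎ }
        go′ (inj₂ refl) ej _ = record { cr = cand-refl 1ℚ cv cu int-1 (trans (ℚₚ.*-identityˡ Du) (sym eQ)) ; gr = gv ; eqr = begin
          ι M * def (axpy v (- 1ℚ) u) ≡⟨ cong (ι M *_) (def-axpy v (- 1ℚ) u) ⟩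
          ι M * (def v + (- 1ℚ) * def u) ≡⟨ solve 3 (λ m x y → m :* (x :+ (:- c1) :* y) := m :* x :- m :* y) refl (ι M) (def v) (def u) ⟩
          ι M * def v - ι M * def u ≡⟨ cong₂ (λ x y → x - y) ev (trans eu (cong (wu *_) (trans ej (1ˡ lv (ι≡ 1))))) ⟩
          wv * lv - wu * lv ≡⟨ solve 3 (λ w u l → w :* l :- u :* l := (w :- u) :* l) refl wv wu lv ⟩
          (wv - wu) * lv ∎ }
        go : (∃ λ i → ∃ λ j → i ℕ.* j ≡ q × lu ≡ ι j * lv × ι q * lv ≡ ι i * lu) → Diff (wv - wu)
        go (i , j , e , ej , ei) = go′ (small-factor i j q q>0 q≤3 e) ej ei

      diff-neg : ∀ {y} → Diff y → Diff (- y)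
      diff-neg {y} R = record { cr = cand-neg cr ; gr = gr ; eqr = trans (cong (ι M *_) (def-neg r)) (trans (solve 2 (λ m x → m :* (:- x) := :- (m :* x)) refl (ι M) (def r)) (trans (cong -_ eqr) (ℚₚ.neg-distribˡ-* y l))) }
        where open Diff R

      private
        ι-2 : ι 2 ≡ 2ℚ
        ι-2 = ι≡ 2
        ι-4 : ι 4 ≡ 2ℚ + 2ℚ
        ι-4 = ι≡ 4

        2w≢ : ∀ w → 0 ℕ.< w → ω₀ ℕ.≤ w → 2 ℕ.* w ≢ ω₀
        2w≢ w p h e = ℕₚ.<-irrefl refl (ℕₚ.<-≤-trans (ℕₚ.m<m+n w (ℕₚ.≤-trans p (ℕₚ.m≤m+n w 0))) (subst (ℕ._≤ w) (sym e) h))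

      -- Strong induction on the weight: subtracting a translate of the minimal root lowers the
      -- weight by `ω₀`, as in the Euclidean algorithm.
      module Descend {w z} (x : X w z) (IH : ∀ w′ {z′} → w′ ℕ.< w → X w′ z′ → ω₀ ∣ w′) where
        open X x

        w>0 : 0 ℕ.< w
        w>0 = ι-cancel-< (subst (_< ι w) (sym ι-0) (*-cancel>0 (Generator.gen>0 gz) (subst (0ℚ <_) (trans eqz (ℚₚ.*-comm (ι w) l)) (*>0 M>0 hz))))

        finish : Diff (ι w - ι ω₀) → ω₀ ∣ w
        finish R with w ℕₚ.≟ ω₀
        ... | yes refl = ∣-refl
        ... | no w≢ = subst (ω₀ ∣_) (ℕₚ.m∸n+n≡m le) (∣m∣n⇒∣m+n (IH (w ℕ.∸ ω₀) (ℕₚ.∸-monoʳ-< (ω>0 κ) le)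
            record { cz = cr ; hz = *-cancel>0 M>0 (subst (0ℚ <_) (sym eqr) (*>0 (<⇒0< (ι-mono-< lt)) (Generator.gen>0 gr))) ; gz = gr ; eqz = trans eqr (cong (_* Diff.l R) sub) }) ∣-refl)
          where
          open Diff R
          le = ω₀-least x
          lt = ℕₚ.≤∧≢⇒< le (w≢ ∘ sym)
          sub : ι w - ι ω₀ ≡ ι (w ℕ.∸ ω₀)
          sub = trans (cong (λ m → ι m - ι ω₀) (sym (ℕₚ.m∸n+n≡m le))) (trans (cong (_- ι ω₀) (ι-+ (w ℕ.∸ ω₀) ω₀)) (solve 2 (λ x y → x :+ y :- y := x) refl (ι (w ℕ.∸ ω₀)) (ι ω₀)))

        module Pair (u : V) (cu : Cand (d κ) u) (eu : ι M * def u ≡ ι ω₀ * proj₁ (gen κ)) where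
          λ₀ = proj₁ (gen κ)
          g₀ = proj₂ (gen κ)

          comb : ℕ → V
          comb p = axpy (2ℚ ·V z) (- ι p) u

          Q-comb : ∀ p q → Q u z ≡ ι p * d κ → Q u z ≡ ι q * Dz → Q (comb p) (comb p) ≡ (2ℚ * Dz) * ((2ℚ + 2ℚ) - ι p * ι q)
          Q-comb p q ep eq = begin
            Q (comb p) (comb p) ≡⟨ Q-axpy² (2ℚ ·V z) (- ι p) u ⟩
            Q (2ℚ ·V z) (2ℚ ·V z) + 2ℚ * (- ι p) * Q (2ℚ ·V z) u + (- ι p) * (- ι p) * Q u u
              ≡⟨ cong₂ (λ x y → x + 2ℚ * (- ι p) * y + (- ι p) * (- ι p) * Q u u) (trans (Q-·ˡ 2ℚ z (2ℚ ·V z)) (cong (2ℚ *_) (trans (Q-·ʳ 2ℚ z z) (cong (2ℚ *_) (Q-norm cz)))))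
                 (trans (Q-·ˡ 2ℚ z u) (cong (2ℚ *_) (trans (Q-sym z u) eq))) ⟩
            2ℚ * (2ℚ * (2ℚ * Dz)) + 2ℚ * (- ι p) * (2ℚ * (ι q * Dz)) + (- ι p) * (- ι p) * Q u u ≡⟨ cong (λ y → 2ℚ * (2ℚ * (2ℚ * Dz)) + 2ℚ * (- ι p) * (2ℚ * (ι q * Dz)) + (- ι p) * (- ι p) * y) (Q-norm cu) ⟩
            2ℚ * (2ℚ * (2ℚ * Dz)) + 2ℚ * (- ι p) * (2ℚ * (ι q * Dz)) + (- ι p) * (- ι p) * (2ℚ * d κ)
              ≡⟨ solve 4 (λ p q D k → c2 :* (c2 :* (c2 :* D)) :+ c2 :* (:- p) :* (c2 :* (q :* D)) :+ (:- p) :* (:- p) :* (c2 :* k) := c2 :* (c2 :* (c2 :* D)) :+ c2 :* (:- p) :* (c2 :* (q :* D)) :+ c2 :* p :* (p :* k)) refl (ι p) (ι q) Dz (d κ) ⟩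
            2ℚ * (2ℚ * (2ℚ * Dz)) + 2ℚ * (- ι p) * (2ℚ * (ι q * Dz)) + 2ℚ * ι p * (ι p * d κ) ≡⟨ cong (λ y → 2ℚ * (2ℚ * (2ℚ * Dz)) + 2ℚ * (- ι p) * (2ℚ * (ι q * Dz)) + 2ℚ * ι p * y) (trans (sym ep) eq) ⟩
            2ℚ * (2ℚ * (2ℚ * Dz)) + 2ℚ * (- ι p) * (2ℚ * (ι q * Dz)) + 2ℚ * ι p * (ι q * Dz)
              ≡⟨ solve 3 (λ p q D → c2 :* (c2 :* (c2 :* D)) :+ c2 :* (:- p) :* (c2 :* (q :* D)) :+ c2 :* p :* (q :* D) := (c2 :* D) :* ((c2 :+ c2) :- p :* q)) refl (ι p) (ι q) Dz ⟩
            (2ℚ * Dz) * ((2ℚ + 2ℚ) - ι p * ι q) ∎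

          parallel : ∀ p q → p ℕ.* q ≡ 4 → Q u z ≡ ι p * d κ → Q u z ≡ ι q * Dz → 2ℚ * def z ≡ ι p * def u
          parallel p q e ep eq = a-b≡0⇒a≡b (trans (trans (solve 3 (λ z p u → c2 :* z :- p :* u := c2 :* z :+ (:- p) :* u) refl (def z) (ι p) (def u))
            (cong (_+ (- ι p) * def u) (sym (E-·ʳ 2ℚ δ z)))) (trans (sym (def-axpy (2ℚ ·V z) (- ι p) u))
            (trans (cong def (kernel (comb p) (trans (Q-comb p q ep eq) (0ʳ (2ℚ * Dz) (trans (cong (λ y → (2ℚ + 2ℚ) - y) (trans (sym (ι-* p q)) (trans (cong ι e) ι-4))) (ℚₚ.+-inverseʳ (2ℚ + 2ℚ)))))))
            (trans (E-·ʳ (comb p ! i₀ * inv (δ ! i₀)) δ δ) (0ʳ (comb p ! i₀ * inv (δ ! i₀)) def-δ)))))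

          par-eq : ∀ p q → p ℕ.* q ≡ 4 → Q u z ≡ ι p * d κ → Q u z ≡ ι q * Dz → 2ℚ * (ι w * l) ≡ ι p * (ι ω₀ * λ₀)
          par-eq p q e ep eq = trans (cong (2ℚ *_) (sym eqz)) (trans (solve 2 (λ m z → c2 :* (m :* z) := m :* (c2 :* z)) refl (ι M) (def z)) (trans (cong (ι M *_) (parallel p q e ep eq))
            (trans (solve 3 (λ m p u → m :* (p :* u) := p :* (m :* u)) refl (ι M) (ι p) (def u)) (cong (ι p *_) eu))))

          l>0 = Generator.gen>0 gz

          -- Semidefiniteness bounds the product of the Cartan integers p and q by 4. Below 4,
          -- `diff` produces a root of weight w - `ω₀`. At 4, 2z - p u is null, so 2 def z = p def
          -- u, and the weights are compared directly through the ratio of the generators; the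
          -- ratios that would put w below `ω₀` contradict minimality.
          conclude : 0ℚ < Q u z → ω₀ ∣ w
          conclude h = go (mul-pos (d-pos κ) h (Q-mulˡ (dmul cu) (int cz))) (mul-pos (Cand.D>0 cz) h (Q-mulʳ (int cu) (dmul cz)))
            where
            go : (∃ λ p → 0 ℕ.< p × Q u z ≡ ι p * d κ) → (∃ λ q → 0 ℕ.< q × Q u z ≡ ι q * Dz) → ω₀ ∣ w
            go (p , p>0 , ep) (q , q>0 , eq) = cases (pq-cases p q p>0 q>0 (pq≤4 p q (*>0 0<2 (Cand.D>0 cz)) (subst (0ℚ ≤_) (Q-comb p q ep eq) (psd (comb p)))))
              where
              j-case : ∀ j → j ≡ 1 ⊎ j ≡ 2 ⊎ j ≡ 4 → 2 ℕ.* w ≡ ω₀ ℕ.* j → ω₀ ∣ w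
              j-case j (inj₁ refl) e = ⊥-elim (2w≢ w w>0 (ω₀-least x) (trans e (ℕₚ.*-identityʳ ω₀)))
              j-case j (inj₂ (inj₁ refl)) e = divides 1 (trans (ℕₚ.*-cancelˡ-≡ w ω₀ 2 (trans e (ℕₚ.*-comm ω₀ 2))) (sym (ℕₚ.*-identityˡ ω₀)))
              j-case j (inj₂ (inj₂ refl)) e = divides 2 (ℕₚ.*-cancelˡ-≡ w (2 ℕ.* ω₀) 2 (trans e (trans (ℕₚ.*-comm ω₀ 4) (ℕₚ.*-assoc 2 2 ω₀))))
              j-case′ : ∀ j → j ≡ 1 ⊎ j ≡ 2 ⊎ j ≡ 4 → w ℕ.* j ≡ 2 ℕ.* ω₀ → ω₀ ∣ w
              j-case′ j (inj₁ refl) e = divides 2 (trans (sym (ℕₚ.*-identityʳ w)) e)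
              j-case′ j (inj₂ (inj₁ refl)) e = divides 1 (trans (ℕₚ.*-cancelˡ-≡ w ω₀ 2 (trans (ℕₚ.*-comm 2 w) e)) (sym (ℕₚ.*-identityˡ ω₀)))
              j-case′ j (inj₂ (inj₂ refl)) e = ⊥-elim (2w≢ w w>0 (ω₀-least x) (ℕₚ.*-cancelˡ-≡ (2 ℕ.* w) ω₀ 2 (trans (sym (ℕₚ.*-assoc 2 2 w)) (trans (ℕₚ.*-comm 4 w) e))))
              cases : (p ≡ 1 × q ℕ.≤ 3) ⊎ (q ≡ 1 × p ℕ.≤ 3) ⊎ (p ≡ 2 × q ≡ 2) ⊎ (p ≡ 1 × q ≡ 4) ⊎ (p ≡ 4 × q ≡ 1) → ω₀ ∣ w
              cases (inj₁ (refl , q≤3)) = finish (diff {wu = ι ω₀} {wv = ι w} q q>0 q≤3 cu cz (trans (sym (1ˡ (d κ) (ι≡ 1))) (trans (sym ep) eq)) (trans ep (1ˡ (d κ) (ι≡ 1))) g₀ gz eu eqz)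
              cases (inj₂ (inj₁ (refl , p≤3))) = finish (subst Diff (solve 2 (λ x y → :- (x :- y) := y :- x) refl (ι ω₀) (ι w)) (diff-neg (diff {wu = ι w} {wv = ι ω₀} p p>0 p≤3 cz cu (trans (sym (1ˡ Dz (ι≡ 1))) (trans (sym eq) ep)) (trans (Q-sym z u) (trans eq (1ˡ Dz (ι≡ 1)))) gz g₀ eqz eu)))
              cases (inj₂ (inj₂ (inj₁ (refl , refl)))) = divides 1 (trans (ι-cancel l>0 (double-cancel (trans (par-eq 2 2 refl ep eq) (cong₂ (λ x y → x * (ι ω₀ * y)) ι-2
                  (gen-unique (subst (λ D′ → Generator D D′ λ₀) (*-cancelˡ (>⇒≢ (subst (0ℚ <_) (sym ι-2) 0<2)) (trans (sym ep) eq)) g₀) gz))))) (sym (ℕₚ.*-identityˡ ω₀)))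
              cases (inj₂ (inj₂ (inj₂ (inj₁ (refl , refl))))) = k (generator-ratio 4 (ℕ.s≤s ℕ.z≤n) (trans (sym (1ˡ (d κ) (ι≡ 1))) (trans (sym ep) eq)) gz g₀)
                where
                k : (∃ λ i → ∃ λ j → i ℕ.* j ≡ 4 × λ₀ ≡ ι j * l × ι 4 * l ≡ ι i * λ₀) → ω₀ ∣ w
                k (i , j , e , ej , _) = j-case j (factor-4 i j e) (ι-cancel l>0 (trans (cong (_* l) (trans (ι-* 2 w) (cong (_* ι w) ι-2))) (trans (ℚₚ.*-assoc 2ℚ (ι w) l) (trans (par-eq 1 4 refl ep eq)
                  (trans (1ˡ (ι ω₀ * λ₀) (ι≡ 1)) (trans (cong (ι ω₀ *_) ej) (trans (sym (ℚₚ.*-assoc (ι ω₀) (ι j) l)) (cong (_* l) (sym (ι-* ω₀ j))))))))))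
              cases (inj₂ (inj₂ (inj₂ (inj₂ (refl , refl))))) = k (generator-ratio 4 (ℕ.s≤s ℕ.z≤n) (trans (sym (1ˡ Dz (ι≡ 1))) (trans (sym eq) ep)) g₀ gz)
                where
                k : (∃ λ i → ∃ λ j → i ℕ.* j ≡ 4 × l ≡ ι j * λ₀ × ι 4 * λ₀ ≡ ι i * l) → ω₀ ∣ w
                k (i , j , e , ej , _) = j-case′ j (factor-4 i j e) (ι-cancel (Generator.gen>0 g₀) (double-cancel (trans (cong (2ℚ *_) (trans (cong (_* λ₀) (ι-* w j)) (trans (ℚₚ.*-assoc (ι w) (ι j) λ₀) (cong (ι w *_) (sym ej)))))
                  (trans (par-eq 4 1 refl ep eq) (trans (cong (_* (ι ω₀ * λ₀)) ι-4) (trans (solve 2 (λ w l → (c2 :+ c2) :* (w :* l) := c2 :* (c2 :* w :* l)) refl (ι ω₀) λ₀)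
                  (cong (λ y → 2ℚ * (y * λ₀)) (trans (cong (_* ι ω₀) (sym ι-2)) (sym (ι-* 2 ω₀))))))))))

      private
        abstract
          x₀ : ∃ λ l₁ → ∃ λ l₂ → Split κ l₁ l₂
          x₀ = split-at κ

      x₁ : V
      x₁ = proj (proj₁ x₀) κ

      cand-x₁ : Cand (d κ) x₁
      cand-x₁ = cand-cl (proj₁ x₀) (cand-α κ)

      def-x₁ : def x₁ ≡ d κ * δ ! κ
      def-x₁ = E-p (proj₂ (proj₂ x₀)) δ

      iter-def : ∀ t v → def (iter cox t v) ≡ def v
      iter-def zero v = refl
      iter-def (suc t) v = trans (iter-def t (cox v)) (def-cox v)

      iter-cand : ∀ {D′} t {v} → Cand D′ v → Cand D′ (iter cox t v)
      iter-cand zero c = c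
      iter-cand (suc t) c = iter-cand t (cand-cox c)

      ω₀-divides : ∀ N w {z} → w ℕ.< N → X w z → ω₀ ∣ w
      ω₀-divides zero w ()
      ω₀-divides (suc N) w {z} lt x = go (meet x₁ z (subst (0ℚ <_) (sym def-x₁) (*>0 (d-pos κ) (δ>0 κ))) (X.hz x))
        where
        go : (∃ λ t → 0ℚ < Q (iter cox t x₁) z) → ω₀ ∣ w
        go (t , h) = Descend.Pair.conclude x (λ w′ lt′ x′ → ω₀-divides N w′ (ℕₚ.≤-trans lt′ (ℕₚ.≤-pred lt)) x′) (iter cox t x₁) (iter-cand t cand-x₁)
          (trans (cong (ι M *_) (trans (iter-def t x₁) def-x₁)) (ω-eq κ)) h

      ω₀∣ω : ∀ k → ω₀ ∣ ω k
      ω₀∣ω k = go (split-at k)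
        where
        go : (∃ λ l₁ → ∃ λ l₂ → Split k l₁ l₂) → ω₀ ∣ ω k
        go (l₁ , l₂ , sp) = ω₀-divides (suc (ω k)) (ω k) (ℕₚ.n<1+n (ω k)) record { cz = cand-cl l₁ (cand-α k) ; hz = def-p sp ; gz = proj₂ (gen k) ; eqz = trans (cong (ι M *_) (E-p sp δ)) (ω-eq k) }

      private
        quot : ∀ {k} w → ω k ≡ w ℕ.* ω₀ → ι M * (d k * δ ! k) ≡ ι ω₀ * (ι w * proj₁ (gen k))
        quot {k} w e = trans (ω-eq k) (trans (cong (_* proj₁ (gen k)) (trans (cong ι e) (ι-* w ω₀))) (solve 3 (λ w o l → w :* o :* l := o :* (w :* l)) refl (ι w) (ι ω₀) (proj₁ (gen k))))

        ιω₀>0 : 0ℚ < ι ω₀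
        ιω₀>0 = subst (_< ι ω₀) ι-0 (ι-mono-< (ω>0 κ))

        ω₀∣Mδ : ∀ k → ω₀ ∣ M ℕ.* δN k
        ω₀∣Mδ k = go (ω₀∣ω k) (Generator.genʳ (proj₂ (gen k)))
          where
          go : ω₀ ∣ ω k → Mul (d k) (proj₁ (gen k)) → ω₀ ∣ M ℕ.* δN k
          go (divides w e) (c , e′) = divides ℤ.∣ pos w ℤ.* c ∣ (trans (cong ℤ.∣_∣ (ℤ→ℚ-inj {pos (M ℕ.* δN k)} {pos w ℤ.* c ℤ.* pos ω₀} eq)) (ℤₚ.abs-* (pos w ℤ.* c) (pos ω₀)))
            where
            eq : ℤ→ℚ (pos (M ℕ.* δN k)) ≡ ℤ→ℚ (pos w ℤ.* c ℤ.* pos ω₀)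
            eq = *-cancelˡ (>⇒≢ (d-pos k)) (begin
              d k * ℤ→ℚ (pos (M ℕ.* δN k)) ≡⟨ cong (d k *_) (trans (sym (ι≡ (M ℕ.* δN k))) (trans (ι-* M (δN k)) (cong (ι M *_) (trans (ι≡ (δN k)) (sym (δ-! k)))))) ⟩
              d k * (ι M * δ ! k) ≡⟨ solve 3 (λ d m δ → d :* (m :* δ) := m :* (d :* δ)) refl (d k) (ι M) (δ ! k) ⟩
              ι M * (d k * δ ! k) ≡⟨ quot w e ⟩
              ι ω₀ * (ι w * proj₁ (gen k)) ≡⟨ cong (λ z → ι ω₀ * (ι w * z)) e′ ⟩
              ι ω₀ * (ι w * (ℤ→ℚ c * d k)) ≡⟨ solve 4 (λ o w c d → o :* (w :* (c :* d)) := d :* (w :* c :* o)) refl (ι ω₀) (ι w) (ℤ→ℚ c) (d k) ⟩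
              d k * (ι w * ℤ→ℚ c * ι ω₀) ≡⟨ cong (d k *_) (trans (cong₂ (λ x y → x * ℤ→ℚ c * y) (ι≡ w) (ι≡ ω₀)) (trans (cong (_* ℤ→ℚ (pos ω₀)) (sym (ℤ→ℚ-* (pos w) c))) (sym (ℤ→ℚ-* (pos w ℤ.* c) (pos ω₀))))) ⟩
              d k * ℤ→ℚ (pos w ℤ.* c ℤ.* pos ω₀) ∎)

        instance
          ω₀≢0 : ℕ.NonZero ω₀
          ω₀≢0 = ℕ.>-nonZero (ω>0 κ)

        -- With h = gcd(ω₀,M) and ω₀ = a h, the divisibility of each M δ_k by ω₀ shows that a
        -- divides every δ_k, and δ is primitive.
        ω₀∣M : ω₀ ∣ M
        ω₀∣M = go (GCD.gcd[m,n]∣m ω₀ M)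
          where
          h = GCD.gcd ω₀ M
          h≢0 : ℕ.NonZero h
          h≢0 = ℕ.≢-nonZero (GCD.gcd[m,n]≢0 ω₀ M (inj₁ (ℕₚ.>⇒≢ (ω>0 κ))))
          go : h ∣ ω₀ → ω₀ ∣ M
          go (divides a e) = subst (_∣ M) (trans (sym (ℕₚ.*-identityˡ h)) (trans (cong (ℕ._* h) (sym a≡1)) (sym e))) (GCD.gcd[m,n]∣n ω₀ M)
            where
            a∣δ : ∀ k → a ∣ δN k
            a∣δ k = *-cancelʳ-∣ h {{h≢0}} (subst₂ _∣_ e (sym (GCD.c*gcd[m,n]≡gcd[cm,cn] (δN k) ω₀ M)) (GCD.gcd-greatest (n∣m*n (δN k)) (subst (ω₀ ∣_) (ℕₚ.*-comm M (δN k)) (ω₀∣Mδ k))))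
            a≡1 : a ≡ 1
            a≡1 = δ-prim a a∣δ

        -- ω₀ divides every weight, so M/ω₀ already satisfies the divisibility that defines M;
        -- minimality makes M divide M/ω₀.
        ω₀≡1 : ω₀ ≡ 1
        ω₀≡1 = go ω₀∣M
          where
          go : ω₀ ∣ M → ω₀ ≡ 1
          go (divides M′ e) = fin (M-least M′ λ j → mulM j (ω₀∣ω j))
            where
            mulM : ∀ j → ω₀ ∣ ω j → Mul D (ι M′ * (d j * δ ! j))
            mulM j (divides w e′) = subst (Mul D) (*-cancelˡ (>⇒≢ ιω₀>0) (trans (sym (quot w e′)) (trans (cong (_* (d j * δ ! j)) (trans (cong ι e) (trans (ι-* M′ ω₀) (ℚₚ.*-comm (ι M′) (ι ω₀))))) (ℚₚ.*-assoc (ι ω₀) (ι M′) (d j * δ ! j)))))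
              (int*-mul (ι-int w) (Generator.genˡ (proj₂ (gen j))))
            fin : M ∣ M′ → ω₀ ≡ 1
            fin (divides c e″) = ℕₚ.m*n≡1⇒n≡1 c ω₀ (ℕₚ.*-cancelʳ-≡ (c ℕ.* ω₀) 1 M {{ℕ.>-nonZero DN.N>0}} (trans (ℕₚ.*-assoc c ω₀ M) (trans (cong (c ℕ.*_) (ℕₚ.*-comm ω₀ M)) (trans (sym (ℕₚ.*-assoc c M ω₀))
              (trans (cong (ℕ._* ω₀) (sym e″)) (trans (sym e) (sym (ℕₚ.*-identityˡ M))))))))

      abstract
        -- The last component is what the choice is for: E(b,x) with E(b,b) = D lies in both groups,
        -- so it is a multiple of M def x.
        minimal-root : ∃ λ Dx → ∃ λ x → Cand Dx x × 0ℚ < def x × (∀ {y} → Mul D y → Mul Dx y → Mul (ι M * def x) y)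
        minimal-root = d κ , x₁ , cand-x₁ , subst (0ℚ <_) (sym def-x₁) (*>0 (d-pos κ) (δ>0 κ)) ,
          λ {y} p q → subst (λ z → Mul z y) (sym (trans (cong (ι M *_) def-x₁) (trans (ω-eq κ) (1ˡ (proj₁ (gen κ)) (trans (cong ι ω₀≡1) (ι≡ 1)))))) (Generator.gens (proj₂ (gen κ)) p q)

    -- Excluding indecomposable roots b of defect zero with E(c b,b) = E(b,b).

    record Bad (D : ℚ) (b : V) : Set where
      constructor mkBad
      field
        breg : Reg D b
        bsim : Simple b
        bad  : E (cox b) b ≡ D

    open Bad

    bad-cox : ∀ {D b} → Bad D b → Bad D (cox b)
    bad-cox {b = b} B = mkBad (reg-cox (breg B)) (simple-cox (bsim B)) (trans (E-cox-inv (cox b) b) (bad B))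

    bad-cox⁻¹ : ∀ {D b} → Bad D b → Bad D (cox⁻¹ b)
    bad-cox⁻¹ {b = b} B = mkBad (reg-cox⁻¹ (breg B)) (simple-cox⁻¹ (bsim B))
      (trans (sym (E-cox-inv (cox (cox⁻¹ b)) (cox⁻¹ b))) (trans (cong (λ w → E (cox w) w) (cox-cox⁻¹ b)) (bad B)))

    E-bμ : ∀ {D b} → Bad D b → E b (cox b) ≡ - D
    E-bμ {b = b} B = trans (E-cox b b) (cong -_ (norm (cand (breg B))))

    Q-bμ : ∀ {D b} → Bad D b → Q b (cox b) ≡ 0ℚ
    Q-bμ {D} {b} B = trans (Q≡E+E b (cox b)) (trans (cong₂ _+_ (E-bμ B) (bad B)) (ℚₚ.+-inverseˡ D))

    null-cone : ∀ {N} → 0 ℕ.< N → Cone (ι N ·V δ)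
    null-cone {N} p = Υ-cone (inj₂ (pos N , (λ { refl → ℕₚ.<-irrefl refl p }) , cong (_·V δ) (ι≡ N)) ,
      (λ i → subst (0ℚ ≤_) (sym (·V-! (ι N) δ i)) (*≥0 (ι≥0 N) (δ-Pos i))) , def⇒InU (trans (E-·ʳ (ι N) δ δ) (0ʳ (ι N) def-δ)))

    reg-neg : ∀ {D v} → Cand D v → def v ≡ 0ℚ → Pos (-V v) → Reg D (-V v)
    reg-neg {v = v} c e p = reg (cand-neg c) p (trans (def-neg v) (cong -_ e))

    Q-tδ : ∀ t u → Q (t ·V δ) u ≡ 0ℚ
    Q-tδ t u = trans (Q-·ˡ t δ u) (0ʳ t (Q-δˡ u))

    def-shift : ∀ v t → def (shift v t) ≡ def v
    def-shift v t = trans (def-axpy v t δ) (trans (cong (λ z → def v + t * z) def-δ) (solve 2 (λ x t → x :+ t :* c0 := x) refl (def v) t))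

    shift-· : ∀ v t → axpy v 1ℚ (t ·V δ) ≡ shift v t
    shift-· v t = ext λ i → trans (axpy-! v 1ℚ (t ·V δ) i) (trans (cong (v ! i +_) (trans (ℚₚ.*-identityˡ ((t ·V δ) ! i)) (·V-! t δ i))) (sym (axpy-! v t δ i)))

    shift-cand : ∀ {D v} t → Cand D v → Int t → (∀ j → Mul D (t * (d j * δ ! j))) → Cand D (shift v t)
    shift-cand {D} {v} t c ti h = subst (Cand D) (shift-· v t) (cand-shift c (Q-tδ t) (λ i → subst Int (sym (·V-! t δ i)) (int-* ti (δ-int i)))
      (λ i → subst (Mul D) (trans (solve 3 (λ t d x → t :* (d :* x) := d :* (t :* x)) refl t (d i) (δ ! i)) (cong (d i *_) (sym (·V-! t δ i)))) (h i)))

    E-shiftˡ : ∀ v t x → E (shift v t) x ≡ E v x + t * def x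
    E-shiftˡ v t x = E-axpyˡ v t δ x

    -- A root x′ = p_κ with E(b,x′) = E(c b,x′) = 0 puts b and c b in a finite parabolic subsystem,
    -- where b is moved to a simple root; there one finds a root ν with the pairings below.
    record Nu (D : ℚ) (b : V) : Set where
      field
        {Dν} : ℚ
        ν  : V
        cν : Cand Dν ν
        Eμ : E (cox b) ν ≡ 0ℚ
        Qμ : Q ν (cox b) < 0ℚ
        Qb : 0ℚ < Q ν b

    private
      iter-Q : ∀ l t u v → Q (iter (cl l) t u) (iter (cl l) t v) ≡ Q u v
      iter-Q l zero u v = refl
      iter-Q l (suc t) u v = trans (iter-Q l t (cl l u) (cl l v)) (cl-Q l u v)

      iter-supp : ∀ l t {v} → Supp l v → Supp l (iter (cl l) t v)
      iter-supp l zero h = h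
      iter-supp l (suc t) h = iter-supp l t (cl-supp l h)

      iter-E : ∀ l → Sorted l → ∀ t {u v} → Supp l u → Supp l v → E (iter (cl l) t u) (iter (cl l) t v) ≡ E u v
      iter-E l S zero h h′ = refl
      iter-E l S (suc t) h h′ = trans (iter-E l S t (cl-supp l h) (cl-supp l h′)) (E-cl-inv l S h h′)

      iter-cand′ : ∀ l t {D v} → Cand D v → Cand D (iter (cl l) t v)
      iter-cand′ l zero c = c
      iter-cand′ l (suc t) c = iter-cand′ l t (cand-cl l c)

      back-iter : ∀ l t v → Supp l v → ∃ λ u → Supp l u × iter (cl l) t u ≡ v × (∀ {D} → Cand D v → Cand D u)
      back-iter l zero v h = v , h , refl , id
      back-iter l (suc t) v h = go (back-iter l t v h)
        where
        go : (∃ λ u → Supp l u × iter (cl l) t u ≡ v × (∀ {D} → Cand D v → Cand D u)) → ∃ λ u → Supp l u × iter (cl l) (suc t) u ≡ v × (∀ {D} → Cand D v → Cand D u)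
        go (u , hu , e , f) = cl (reverse l) u , rev-supp , trans (cong (iter (cl l) t) (cl-rev l u)) e , λ c → cand-cl (reverse l) (f c)
          where
          rev-supp : Supp l (cl (reverse l) u)
          rev-supp i p = trans (cl-fix (reverse l) u (p ∘ ∈-reverse l)) (hu i p)

    a-zero : ∀ {i k} → i ≢ k → 0ℚ ≤ Q (αs i) (αs k) → a i k ≡ 0ℚ
    a-zero {i} {k} p h = ℚₚ.≤-antisym (a-off p) (*-cancel≥0 (d-pos i) (subst (0ℚ ≤_) (Q-αα i k) h))

    -- Removing α_k from η leaves a vector ζ with Q(ζ,η) = Q(η,η) > 0, so some i ≠ k has Q(α_i,η) >
    -- 0. If α_i is not orthogonal to α_k, it is the required root. Otherwise s_i fixes α_k and
    -- lowers η, and the root found for s_i η is carried back by s_i.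
    inner-root : ∀ l k N {D η} → Cand D η → Pos η → Supp l η → ht η ≤ ι N → Q η (αs k) ≡ 0ℚ → η ! k ≡ 1ℚ →
      ∃ λ D′ → ∃ λ ν → Cand D′ ν × Supp l ν × ν ! k ≡ 0ℚ × Q ν (αs k) < 0ℚ × 0ℚ < Q ν η
    inner-root l k N {D} {η} c p h le q e = go (∑-pos (λ i → ζ ! i * Q (αs i) η) (subst (0ℚ <_) (Q-exp ζ η) Qζ>0))
      where
      ζ = drop-head k η
      Qζ>0 : 0ℚ < Q ζ η
      Qζ>0 = np (Q-pos c) (trans (Q-axpyˡ η (- η ! k) (αs k) η) (trans (cong (λ z → Q η η + (- η ! k) * z) (trans (Q-sym (αs k) η) q)) (solve 2 (λ x y → x :+ y :* c0 := x) refl (Q η η) (- η ! k))))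
      ζ-k : ζ ! k ≡ 0ℚ
      ζ-k = trans (axpy-! η (- η ! k) (αs k) k) (trans (cong (λ z → η ! k + (- η ! k) * z) (αs-same k)) (solve 1 (λ x → x :+ (:- x) :* c1 := c0) refl (η ! k)))
      ζ-off : ∀ {i} → i ≢ k → ζ ! i ≡ η ! i
      ζ-off {i} r = trans (axpy-! η (- η ! k) (αs k) i) (trans (cong (λ z → η ! i + (- η ! k) * z) (αs-diff (r ∘ sym))) (solve 2 (λ x y → x :+ y :* c0 := x) refl (η ! i) (- η ! k)))
      go : (∃ λ i → 0ℚ < ζ ! i * Q (αs i) η) → ∃ λ D′ → ∃ λ ν → Cand D′ ν × Supp l ν × ν ! k ≡ 0ℚ × Q ν (αs k) < 0ℚ × 0ℚ < Q ν η
      go (i , r) = fin (Q (αs i) (αs k) ℚₚ.<? 0ℚ)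
        where
        i≢k : i ≢ k
        i≢k refl = >⇒≢ r (0ˡ (Q (αs i) η) ζ-k)
        Qi>0 : 0ℚ < Q (αs i) η
        Qi>0 = ≥*-cancel>0 {ζ ! i} {Q (αs i) η} (subst (0ℚ ≤_) (sym (ζ-off i≢k)) (p i)) r
        i∈l : i ∈ˡ l
        i∈l with i ∈ˡ? l
        ... | yes m = m
        ... | no m = ⊥-elim (>⇒≢ r (0ˡ (Q (αs i) η) (trans (ζ-off i≢k) (h i m))))
        sα : 0ℚ ≤ Q (αs i) (αs k) → s i (αs k) ≡ αs k
        sα z = s-0 i (trans (Kᵛ-α i k) (a-zero i≢k z))
        sη-supp : ∀ v → Supp l v → Supp l (s i v)
        sη-supp v hv j m = trans (s-other v (λ { refl → m i∈l })) (hv j m)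
        fin : Dec (Q (αs i) (αs k) < 0ℚ) → ∃ λ D′ → ∃ λ ν → Cand D′ ν × Supp l ν × ν ! k ≡ 0ℚ × Q ν (αs k) < 0ℚ × 0ℚ < Q ν η
        fin (yes z) = d i , αs i , cand-α i , α-supp i∈l , αs-diff i≢k , z , Qi>0
        fin (no z) = rec N le (pos-s SD i c p)
          where
          z′ = ℚₚ.≮⇒≥ z
          rec : ∀ N → ht η ≤ ι N → Pos (s i η) ⊎ η ≡ αs i → ∃ λ D′ → ∃ λ ν → Cand D′ ν × Supp l ν × ν ! k ≡ 0ℚ × Q ν (αs k) < 0ℚ × 0ℚ < Q ν η
          rec _ _ (inj₂ e′) = ⊥-elim (ℚₚ.1≢0 (trans (sym e) (trans (cong (_! k) e′) (αs-diff i≢k))))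
          rec zero le′ (inj₁ ps) = ⊥-elim (≤<⊥ (ℚₚ.≤-trans (ht-≥1 c p) (subst (ht η ≤_) ι-0 le′)) 0<1)
          rec (suc N) le′ (inj₁ ps) = up′ (inner-root l k N (cand-s i c) ps (sη-supp η h) lower (trans (Q-s i η (αs k)) (trans (cong (Q η) (sα z′)) q)) (trans (s-other η i≢k) e))
            where
            k≥1 : 1ℚ ≤ Kᵛ i η
            k≥1 = int>0 (Kᵛ-int i η (int c)) (*-cancel>0 {d i} {Kᵛ i η} (d-pos i) (subst (0ℚ <_) (Q-α i η) Qi>0))
            lower : ht (s i η) ≤ ι N
            lower = by≤ (+≥0 (≤⇒0≤ (subst (ht η ≤_) (ι-suc N) le′)) (≤⇒0≤ k≥1)) (trans (cong (λ z → ι N - z) (ht-s i η))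
              (solve 3 (λ x h k → x :- (h :- k) := c1 :+ x :- h :+ (k :- c1)) refl (ι N) (ht η) (Kᵛ i η)))
            up′ : (∃ λ D′ → ∃ λ ν → Cand D′ ν × Supp l ν × ν ! k ≡ 0ℚ × Q ν (αs k) < 0ℚ × 0ℚ < Q ν (s i η)) →
              ∃ λ D′ → ∃ λ ν → Cand D′ ν × Supp l ν × ν ! k ≡ 0ℚ × Q ν (αs k) < 0ℚ × 0ℚ < Q ν η
            up′ (D′ , ν , cν , hν , eν , q₁ , q₂) = D′ , s i ν , cand-s i cν , sη-supp ν hν , trans (s-other ν i≢k) eν ,
              subst (_< 0ℚ) (sym (trans (Q-s i ν (αs k)) (cong (Q ν) (sα z′)))) q₁ , subst (0ℚ <_) (sym (Q-s i ν η)) q₂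

    private
      sorted-drop : ∀ l₁ {k : Fin n} {l₂} → Sorted (l₁ ++ k ∷ l₂) → Sorted (l₁ ++ l₂)
      sorted-drop [] (_ ∷ S) = S
      sorted-drop (j ∷ l₁) (h ∷ S) = all-drop l₁ h ∷ sorted-drop l₁ S
        where
        all-drop : ∀ {j : Fin n} l₁ {k l₂} → All (j Fin.<_) (l₁ ++ k ∷ l₂) → All (j Fin.<_) (l₁ ++ l₂)
        all-drop [] (_ ∷ h) = h
        all-drop (_ ∷ l) (p ∷ h) = p ∷ all-drop l h

      drop-∈ : ∀ l₁ {i k : Fin n} {l₂} → i ∈ˡ (l₁ ++ k ∷ l₂) → i ≡ k ⊎ i ∈ˡ (l₁ ++ l₂)
      drop-∈ [] (here e) = inj₁ e
      drop-∈ [] (there m) = inj₂ m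
      drop-∈ (_ ∷ l) (here e) = inj₂ (here e)
      drop-∈ (_ ∷ l) (there m) = [ inj₁ , inj₂ ∘ there ]′ (drop-∈ l m)

      drop-∉ : ∀ l₁ {k : Fin n} {l₂} → Sorted (l₁ ++ k ∷ l₂) → k ∉ˡ (l₁ ++ l₂)
      drop-∉ [] S m = head∉ S m
      drop-∉ (j ∷ l₁) {k} {l₂} S (here refl) = ℕₚ.<-irrefl refl (proj₁ (sorted-mid (j ∷ l₁) S) (here refl))
      drop-∉ (j ∷ l₁) (_ ∷ S) (there m) = drop-∉ l₁ S m

    module Parabolic (l : List (Fin n)) (S : Sorted l) (pd : PosDefOn l) {D b} (B : Bad D b) (hb : Supp l b) (hμ : Supp l (cox b)) where

      -- Both c_l and c satisfy Serre duality against vectors supported on `l`. The difference z of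
      -- the two sides is such a vector, so E(z,z) = 0 and definiteness applies.
      cb : cl l b ≡ cox b
      cb = ext λ i → trans (solve 2 (λ x y → x := y :+ (x :+ (:- c1) :* y)) refl (cl l b ! i) (cox b ! i)) (trans (cong (cox b ! i +_) (trans (sym (axpy-! (cl l b) (- 1ℚ) (cox b) i)) (z0 i))) (ℚₚ.+-identityʳ (cox b ! i)))
        where
        z = axpy (cl l b) (- 1ℚ) (cox b)
        hz : Supp l z
        hz = axpy-supp (- 1ℚ) (cl-supp l hb) hμ
        z0 : ∀ i → z ! i ≡ 0ℚ
        z0 = pd z hz (trans (Q≡2E z) (0ʳ 2ℚ (trans (E-axpyʳ z (cl l b) (- 1ℚ) (cox b)) (trans (cong₂ (λ x y → x + (- 1ℚ) * y) (E-cl l S hz b) (E-cox b z)) (solve 1 (λ x → (:- x) :+ (:- c1) :* (:- x) := c0) refl (E b z))))))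

      nu : Nu D b
      nu = start (finite-orbit SD l S pd (cand (breg B)) hb (posv (breg B)))
        where
        start : (∃ λ t → ∃ λ l₁ → ∃ λ k → ∃ λ l₂ → l ≡ l₁ ++ k ∷ l₂ × iter (cl l) t b ≡ inj l₂ k) → Nu D b
        start (zero , l₁ , k , l₂ , e , e′) = ⊥-elim (not-pos-neg (cand-cl l₁ (cand-α k)) (p-pos l₁ (λ m → ℕₚ.<-irrefl refl (proj₁ (sorted-mid l₁ (subst Sorted e S)) m)))
          (subst Pos (trans (sym cb) (trans (cong (cl l) e′) (trans (cong (λ l → cl l (inj l₂ k)) e) (cl-inj l₁ k l₂)))) (posv (reg-cox (breg B)))))
        -- Let β′ = c^t b and β = c^(t+1) b = q_k. Then E(β,β′) = E(c b,b) = D = d_k says that β′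
        -- has coordinate 1 at k. The reflections of `l₂` turn β into α_k and β′ into η, so the
        -- orthogonality of b and c b becomes that of η and α_k.
        start (suc t , l₁ , k , l₂ , e , e′) = finish (inner-root l k (proj₁ N) cη posη hη (proj₂ N) Qη η-k)
          where
          β′ = iter (cl l) t b
          β = inj l₂ k
          S′ = subst Sorted e S
          β-eq : iter (cl l) t (cox b) ≡ β
          β-eq = trans (cong (iter (cl l) t) (sym cb)) e′
          D≡ : D ≡ d k
          D≡ = cand-D (subst (Cand D) e′ (iter-cand′ l (suc t) (cand (breg B)))) (cand-cl (reverse l₂) (cand-α k))
          hβ′ : Supp l β′
          hβ′ = iter-supp l t hb
          Eβ : ∀ v → Supp l v → E β v ≡ d k * v ! k
          Eβ v hv = E-inj l₁ k l₂ S′ (subst (λ l → Supp l v) e hv)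
          β′-k : β′ ! k ≡ 1ℚ
          β′-k = *-cancelˡ (>⇒≢ (d-pos k)) (trans (sym (Eβ β′ hβ′)) (trans (cong (λ w → E w β′) (sym β-eq)) (trans (iter-E l S t hμ hb) (trans (bad B) (trans D≡ (sym (ℚₚ.*-identityʳ (d k))))))))
          η = cl l₂ β′
          k∉l₂ : k ∉ˡ l₂
          k∉l₂ m = ℕₚ.<-irrefl refl (proj₂ (sorted-mid l₁ S′) m)
          η-k : η ! k ≡ 1ℚ
          η-k = trans (cl-fix l₂ β′ k∉l₂) β′-k
          cη : Cand D η
          cη = cand-cl l₂ (iter-cand′ l t (cand (breg B)))
          posη : Pos η
          posη = [ id , (λ p → ⊥-elim (≤<⊥ (subst (0ℚ ≤_) (trans (-V-! η k) (cong -_ η-k)) (p k)) (->0 0<1))) ]′ (sign cη)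
          l₂⊆l : ∀ {i} → i ∈ˡ l₂ → i ∈ˡ l
          l₂⊆l {i} m = subst (i ∈ˡ_) (sym e) (Memₚ.∈-++⁺ʳ l₁ (there m))
          hη : Supp l η
          hη i p = trans (cl-fix l₂ β′ (p ∘ l₂⊆l)) (hβ′ i p)
          α≡ : αs k ≡ cl l₂ β
          α≡ = sym (cl-rev l₂ (αs k))
          Qη : Q η (αs k) ≡ 0ℚ
          Qη = trans (cong (Q η) α≡) (trans (cl-Q l₂ β′ β) (trans (cong (Q β′) (sym β-eq)) (trans (iter-Q l t b (cox b)) (Q-bμ B))))
          N = archι (ht η)
          finish : (∃ λ D′ → ∃ λ ν → Cand D′ ν × Supp l ν × ν ! k ≡ 0ℚ × Q ν (αs k) < 0ℚ × 0ℚ < Q ν η) → Nu D b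
          finish (D′ , ν′ , cν′ , hν′ , eν′ , q₁ , q₂) = pull (back-iter l t ν₁ hν₁)
            where
            ν₁ = cl (reverse l₂) ν′
            hν₁ : Supp l ν₁
            hν₁ i p = trans (cl-fix (reverse l₂) ν′ (p ∘ l₂⊆l ∘ ∈-reverse l₂)) (hν′ i p)
            ν₁-k : ν₁ ! k ≡ 0ℚ
            ν₁-k = trans (cl-fix (reverse l₂) ν′ (k∉l₂ ∘ ∈-reverse l₂)) eν′
            Q-ν₁ : ∀ v → Q ν₁ v ≡ Q ν′ (cl l₂ v)
            Q-ν₁ v = trans (sym (cl-Q l₂ ν₁ v)) (cong (λ w → Q w (cl l₂ v)) (cl-rev l₂ ν′))
            pull : (∃ λ u → Supp l u × iter (cl l) t u ≡ ν₁ × (∀ {D} → Cand D ν₁ → Cand D u)) → Nu D b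
            pull (ν , hν , eν , f) = record { ν = ν ; cν = f (cand-cl (reverse l₂) cν′)
              ; Eμ = trans (sym (iter-E l S t hμ hν)) (trans (cong₂ E β-eq eν) (trans (Eβ ν₁ hν₁) (0ʳ (d k) ν₁-k)))
              ; Qμ = subst (_< 0ℚ) (trans (cong (Q ν′) α≡) (trans (sym (Q-ν₁ β)) (trans (cong₂ Q (sym eν) (sym β-eq)) (iter-Q l t ν (cox b))))) q₁
              ; Qb = subst (0ℚ <_) (trans (sym (Q-ν₁ β′)) (trans (cong (λ w → Q w β′) (sym eν)) (iter-Q l t ν b))) q₂ }

    -- Since E(v,p_k) = d_k v_k, the two vanishing pairings say that b and c b do not involve α_k.
    nu-at-p : ∀ {k l₁ l₂} → Split k l₁ l₂ → ∀ {D b} → Bad D b → E b (proj l₁ k) ≡ 0ℚ → E (cox b) (proj l₁ k) ≡ 0ℚ → Nu D b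
    nu-at-p {k} {l₁} {l₂} sp@(split e) {D} {b} B e₁ e₂ = Parabolic.nu (l₁ ++ l₂) (sorted-drop l₁ S) (proper-posdef (drop-∉ l₁ S)) B (supp b e₁) (supp (cox b) e₂)
      where
      S = subst Sorted e L-sorted
      supp : ∀ v → E v (proj l₁ k) ≡ 0ℚ → Supp (l₁ ++ l₂) v
      supp v z i p = go (drop-∈ l₁ (subst (i ∈ˡ_) e (∈L i)))
        where
        go : i ≡ k ⊎ i ∈ˡ (l₁ ++ l₂) → v ! i ≡ 0ℚ
        go (inj₁ refl) = *-cancel0 (>⇒≢ (d-pos k)) (trans (sym (E-p sp v)) z)
        go (inj₂ m) = ⊥-elim (p m)

    -- ν has defect 0, and a translate of ν by a multiple of δ splits n M δ into two positive roots
    -- whose pairings with x add up to more than that of n M δ.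
    module Split′ {D b} (B : Bad D b) (M : ℕ) (M>0 : 0ℚ < ι M) (M-mul : ∀ j → Mul D (ι M * (d j * δ ! j))) {Dx x} (cx : Cand Dx x) (hx : 0ℚ < def x)
                  (eb : E b x ≡ ι M * def x) (eμ : E (cox b) x ≡ ι M * def x) (NU : Nu D b) where

      open Nu NU

      private
        μ = cox b
        rb = breg B
        rμ = reg-cox rb
        v = ι M * def x
        D>0′ = Cand.D>0 (cand rb)

        v>0 : 0ℚ < v
        v>0 = *>0 M>0 hx

        module Main (n′ : ℚ) (ni : Int n′) (en : n′ * D ≡ - Q μ ν) (N′ : ℚ) (Ni : Int N′) (eN : N′ * D ≡ Q b ν) where

          n>0 : 0ℚ < n′
          n>0 = *-cancel>0 D>0′ (np (-<0 (subst (_< 0ℚ) (Q-sym ν μ) Qμ)) (trans (ℚₚ.*-comm D n′) en))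

          N>0 : 0ℚ < N′
          N>0 = *-cancel>0 D>0′ (np (subst (0ℚ <_) (Q-sym ν b) Qb) (trans (ℚₚ.*-comm D N′) eN))

          Ebν : E b ν ≡ n′ * D
          Ebν = trans (solve 1 (λ x → x := :- (:- x)) refl (E b ν)) (trans (cong -_ (sym (E-cox b ν))) (trans (cong -_ (trans (solve 2 (λ x y → y := (x :+ y) :- x) refl (E μ ν) (E ν μ))
            (trans (cong₂ (λ x y → x - y) (sym (Q≡E+E μ ν)) Eμ) (solve 1 (λ x → x :- c0 := x) refl (Q μ ν))))) (sym en)))

          -- Otherwise -ν would have positive defect, yet its pairing E(b,-ν) = -n′ D is negative.
          def≥0 : ¬ (def ν < 0ℚ)
          def≥0 h = ≤<⊥ (regular-pairing rb (cand-neg cν) (subst (0ℚ <_) (sym (def-neg ν)) (-<0 h))) (subst (_< 0ℚ) (sym (trans (E-negʳ b ν) (cong -_ Ebν))) (->0 (*>0 n>0 D>0′)))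

          w₁ = axpy ν (- (- n′)) μ
          w₂ = axpy w₁ (- N′) b

          cw₁ : Cand Dν w₁
          cw₁ = cand-refl (- n′) cν (cand rμ) (int-neg ni) (trans (sym (ℚₚ.neg-distribˡ-* n′ D)) (trans (cong -_ en) (solve 1 (λ x → :- (:- x) := x) refl (Q μ ν))))

          cw₂ : Cand Dν w₂
          cw₂ = cand-refl N′ cw₁ (cand rb) Ni (trans eN (sym (trans (Q-axpyʳ b ν (- (- n′)) μ) (trans (cong (λ z → Q b ν + (- (- n′)) * z) (Q-bμ B)) (solve 2 (λ x n → x :+ n :* c0 := x) refl (Q b ν) (- (- n′)))))))

          -- `w₂` is the reflection of ν in μ and then in b. It has the same defect as ν, but
          -- E(b,w₂) = -N′ D.
          def≤0 : ¬ (0ℚ < def ν)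
          def≤0 h = ≤<⊥ (regular-pairing rb cw₂ (np h dw)) (subst (_< 0ℚ) (sym Ew) (->0 (*>0 N>0 D>0′)))
            where
            dw : def w₂ ≡ def ν
            dw = trans (def-axpy w₁ (- N′) b) (trans (cong₂ (λ x y → x + (- N′) * y) (trans (def-axpy ν (- (- n′)) μ) (cong (λ z → def ν + (- (- n′)) * z) (def0 rμ))) (def0 rb))
              (solve 3 (λ x n m → x :+ n :* c0 :+ m :* c0 := x) refl (def ν) (- (- n′)) (- N′)))
            Ew : E b w₂ ≡ - (N′ * D)
            Ew = trans (E-axpyʳ b w₁ (- N′) b) (trans (cong₂ (λ x y → x + (- N′) * y) (trans (E-axpyʳ b ν (- (- n′)) μ) (cong₂ (λ x y → x + (- (- n′)) * y) Ebν (E-bμ B))) (norm (cand rb)))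
              (solve 3 (λ n N D → n :* D :+ (:- (:- n)) :* (:- D) :+ (:- N) :* D := :- (N :* D)) refl n′ N′ D))

          def-ν : def ν ≡ 0ℚ
          def-ν = ℚₚ.≤-antisym (ℚₚ.≮⇒≥ def≤0) (ℚₚ.≮⇒≥ def≥0)

          -- D divides M d_j δ_j, and n′ D = -Q(μ,ν) is a multiple of `Dν`. Hence translation by n′
          -- M δ preserves coroot integrality at the length of ν.
          step = n′ * ι M

          step>0 : 0ℚ < step
          step>0 = *>0 n>0 M>0

          Good : ℚ → Set
          Good s = Int s × (∀ j → Mul Dν (s * (d j * δ ! j)))

          good-step : Good step
          good-step = int-* ni (ι-int M) , λ j → let e , me = M-mul j in subst (Mul Dν) (trans (cong (ℤ→ℚ e *_) (sym en)) (trans (solve 3 (λ e n D → e :* (n :* D) := n :* (e :* D)) refl (ℤ→ℚ e) n′ D)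
            (trans (cong (n′ *_) (sym me)) (sym (ℚₚ.*-assoc n′ (ι M) (d j * δ ! j)))))) (int*-mul (e , refl) (mul-neg (Q-mulʳ (int (cand rμ)) (dmul cν))))

          good-+ : ∀ {s t} → Good s → Good t → Good (s + t)
          good-+ {s} {t} (i , h) (i′ , h′) = int-+ i i′ , λ j → subst (Mul Dν) (sym (ℚₚ.*-distribʳ-+ (d j * δ ! j) s t)) (mul-+ (h j) (h′ j))

          good-ι : ∀ k → Good (ι k * step)
          good-ι k = int-* (ι-int k) (proj₁ good-step) , λ j → subst (Mul Dν) (sym (ℚₚ.*-assoc (ι k) step (d j * δ ! j))) (int*-mul (ι-int k) (proj₂ good-step j))

          good-neg : ∀ {s} → Good s → Good (- s)
          good-neg {s} (i , h) = int-neg i , λ j → subst (Mul Dν) (ℚₚ.neg-distribˡ-* s (d j * δ ! j)) (mul-neg (h j))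

          good-cand : ∀ {s} → Good s → Cand Dν (shift ν s)
          good-cand {s} (i , h) = shift-cand s cν i h

          Good⁻ : ℚ → Set
          Good⁻ s = Good s × Pos (-V shift ν s)

          scan : ∀ t s → Good⁻ s → Pos (shift ν (s + ι t * step)) → ∃ λ s → Good⁻ s × Pos (shift ν (s + step))
          scan zero s (g , p) q = ⊥-elim (not-pos-neg (good-cand g) (subst (λ z → Pos (shift ν z)) (trans (cong (λ z → s + z * step) ι-0) (solve 2 (λ s t → s :+ c0 :* t := s) refl s step)) q) p)
          scan (suc t) s (g , p) q = [ (λ r → s , (g , p) , r) , (λ r → scan t (s + step) (good-+ g good-step , r)
              (subst (λ z → Pos (shift ν z)) (trans (cong (λ z → s + z * step) (ι-suc t)) (solve 3 (λ s t x → s :+ (c1 :+ t) :* x := s :+ x :+ t :* x) refl s (ι t) step)) q)) ]′ (sign (good-cand (good-+ g good-step)))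

          a₀ = step * δ ! i₀
          a₀>0 : 0ℚ < a₀
          a₀>0 = *>0 step>0 (δ>0 i₀)

          large : ∀ q → ∃ λ K → q < ι K * a₀
          large q = go (archι ((q + 1ℚ) * inv a₀))
            where
            go : (∃ λ K → (q + 1ℚ) * inv a₀ ≤ ι K) → ∃ λ K → q < ι K * a₀
            go (K , h) = K , by< (+>0 0<1 (*≥0 (≤⇒0≤ h) (ℚₚ.<⇒≤ a₀>0))) (sym (trans (solve 4 (λ q r a k → c1 :+ (k :- (q :+ c1) :* r) :* a := c1 :+ k :* a :- (q :+ c1) :* (r :* a)) refl q (inv a₀) a₀ (ι K))
              (trans (cong (λ z → 1ℚ + ι K * a₀ - (q + 1ℚ) * z) (inv-* (>⇒≢ a₀>0))) (solve 2 (λ x q → c1 :+ x :- (q :+ c1) :* c1 := x :- q) refl (ι K * a₀) q))))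

          sh-i₀ : ∀ s → shift ν s ! i₀ ≡ ν ! i₀ + s * δ ! i₀
          sh-i₀ s = axpy-! ν s δ i₀

          place : ∃ λ s → Good⁻ s × Pos (shift ν (s + step))
          place = go (large (ν ! i₀)) (large (- ν ! i₀))
            where
            go : (∃ λ K → ν ! i₀ < ι K * a₀) → (∃ λ K → - ν ! i₀ < ι K * a₀) → ∃ λ s → Good⁻ s × Pos (shift ν (s + step))
            go (K , h) (K′ , h′) = scan (K ℕ.+ K′) (- (ι K * step)) (g₁ , [ (λ p → ⊥-elim (≤<⊥ (p i₀) low)) , id ]′ (sign (good-cand g₁)))
                (subst (λ z → Pos (shift ν z)) eq ([ id , (λ p → ⊥-elim (≤<⊥ (p i₀) high)) ]′ (sign (good-cand (good-ι K′)))))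
              where
              g₁ = good-neg (good-ι K)
              low : shift ν (- (ι K * step)) ! i₀ < 0ℚ
              low = 0<-⇒<0 (np (<⇒0< h) (trans (cong -_ (sh-i₀ (- (ι K * step)))) (solve 4 (λ v k s δ → :- (v :+ (:- (k :* s)) :* δ) := k :* (s :* δ) :- v) refl (ν ! i₀) (ι K) step (δ ! i₀))))
              high : (-V shift ν (ι K′ * step)) ! i₀ < 0ℚ
              high = 0<-⇒<0 (np (<⇒0< h′) (trans (cong -_ (trans (-V-! (shift ν (ι K′ * step)) i₀) (cong -_ (sh-i₀ (ι K′ * step)))))
                (solve 4 (λ v k s δ → :- (:- (v :+ (k :* s) :* δ)) := k :* (s :* δ) :- (:- v)) refl (ν ! i₀) (ι K′) step (δ ! i₀))))
              eq : ι K′ * step ≡ - (ι K * step) + ι (K ℕ.+ K′) * step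
              eq = sym (trans (cong (λ z → - (ι K * step) + z * step) (ι-+ K K′)) (solve 3 (λ k k′ s → :- (k :* s) :+ (k :+ k′) :* s := k′ :* s) refl (ι K) (ι K′) step))

          final : (∃ λ s → Good⁻ s × Pos (shift ν (s + step))) → ⊥
          final (s , (g , pu) , p̃) = ≤<⊥ total (->0 (*>0 N>0 v>0))
            where
            g̃ = good-+ g good-step
            ν̃ = shift ν (s + step)
            u = shift ν s
            rν̃ : Reg Dν ν̃
            rν̃ = reg (good-cand g̃) p̃ (trans (def-shift ν (s + step)) def-ν)
            ru : Reg Dν (-V u)
            ru = reg-neg (good-cand g) (trans (def-shift ν s) def-ν) pu
            r₁ : Reg Dν (axpy ν̃ (- N′) b)
            r₁ = reflect-pos N′ rb (bsim B) rν̃ Ni (trans eN (sym (Q-shiftʳ b (s + step) ν))) N>0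
              λ e → <-irr (subst (_< 0ℚ) (trans (sym (Q-shift ν (s + step) μ)) (trans (cong (λ w → Q w μ) e) (Q-bμ B))) Qμ)
            r₂ : Reg Dν (axpy (-V u) (- n′) μ)
            r₂ = reflect-pos n′ rμ (simple-cox (bsim B)) ru ni (trans en (sym (trans (Q-negʳ μ u) (cong -_ (Q-shiftʳ μ s ν))))) n>0
              λ e → <-irr (subst (0ℚ <_) (trans (sym (Q-shift ν s b)) (trans (solve 1 (λ x → x := :- (:- x)) refl (Q u b)) (trans (cong -_ (sym (Q-negˡ u b))) (cong -_ (trans (cong (λ w → Q w b) e) (trans (Q-sym μ b) (Q-bμ B))))))) Qb)
            -- The positive roots ν̃ and -u sum to n′ M δ, which pairs to n′ v with x. Reflecting ν̃
            -- in b and -u in μ keeps them positive and subtracts N′ b and n′ μ, which pair to N′ v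
            -- and n′ v.
            total : 0ℚ ≤ - (N′ * v)
            total = nn (+≥0 (regular-pairing r₁ cx hx) (regular-pairing r₂ cx hx)) (sym (trans (cong₂ _+_
              (trans (E-axpyˡ ν̃ (- N′) b x) (cong₂ (λ y z → y + (- N′) * z) (E-shiftˡ ν (s + step) x) eb))
              (trans (E-axpyˡ (-V u) (- n′) μ x) (cong₂ (λ y z → y + (- n′) * z) (trans (E-negˡ u x) (cong -_ (E-shiftˡ ν s x))) eμ)))
              (solve 6 (λ e s n m f N → (e :+ (s :+ n :* m) :* f) :+ (:- N) :* (m :* f) :+ (:- (e :+ s :* f) :+ (:- n) :* (m :* f)) := :- (N :* (m :* f))) refl (E ν x) s n′ (ι M) (def x) N′)))

      absurd : ⊥
      absurd = go (Q-quot (cand rμ) (int cν)) (Q-quot (cand rb) (int cν))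
        where
        go : (∃ λ p → Int p × p * D ≡ Q μ ν) → (∃ λ p → Int p × p * D ≡ Q b ν) → ⊥
        go (n , ni , en) (N , Ni , eN) = Main.final (- n) (int-neg ni) en′ N Ni eN (Main.place (- n) (int-neg ni) en′ N Ni eN)
          where
          en′ : - n * D ≡ - Q μ ν
          en′ = trans (sym (ℚₚ.neg-distribˡ-* n D)) (cong -_ en)

    -- All data are equivariant under c, so x′ may be moved to some p_k while b and x are carried
    -- along; there `nu-at-p` and `Split′` apply.
    no-pair : ∀ {D} (M : ℕ) → 0ℚ < ι M → (∀ j → Mul D (ι M * (d j * δ ! j))) → ∀ {Dx x′} → Cand Dx x′ → 0ℚ < def x′ →
      ∀ b x → Bad D b → Cand Dx x → 0ℚ < def x → E b x ≡ ι M * def x → E (cox b) x ≡ ι M * def x → E b x′ ≡ 0ℚ → E (cox b) x′ ≡ 0ℚ → ⊥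
    no-pair {D} M M>0 Mm {Dx} cx′ hx′ = orbit-ind P
        (λ v ih b x B c h e₁ e₂ z₁ z₂ → ih (cox⁻¹ b) (cox⁻¹ x) (bad-cox⁻¹ B) (cand-cox⁻¹ c) (np h (def-cox⁻¹ x))
          (trans (back′ b x) (trans e₁ (cong (ι M *_) (sym (def-cox⁻¹ x))))) (trans (cong (λ w → E w (cox⁻¹ x)) (trans (cox-cox⁻¹ b) (sym (cox⁻¹-cox b)))) (trans (back′ (cox b) x) (trans e₂ (cong (ι M *_) (sym (def-cox⁻¹ x))))))
          (trans (sym (E-shift b v)) z₁) (trans (cong (λ w → E w v) (trans (cox-cox⁻¹ b) (sym (cox⁻¹-cox b)))) (trans (sym (E-shift (cox b) v)) z₂)))
        (λ v ih b x B c h e₁ e₂ z₁ z₂ → ih (cox b) (cox x) (bad-cox B) (cand-cox c) (np h (def-cox x)) (trans (E-cox-inv b x) (trans e₁ (cong (ι M *_) (sym (def-cox x)))))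
          (trans (E-cox-inv (cox b) x) (trans e₂ (cong (ι M *_) (sym (def-cox x))))) (trans (E-cox-inv b v) z₁) (trans (E-cox-inv (cox b) v) z₂))
        (λ sp b x B c h e₁ e₂ z₁ z₂ → Split′.absurd B M M>0 Mm c h e₁ e₂ (nu-at-p sp B z₁ z₂)) cx′ hx′
      where
      P : V → Set
      P x′ = ∀ b x → Bad D b → Cand Dx x → 0ℚ < def x → E b x ≡ ι M * def x → E (cox b) x ≡ ι M * def x → E b x′ ≡ 0ℚ → E (cox b) x′ ≡ 0ℚ → ⊥
      back′ : ∀ u v → E (cox⁻¹ u) (cox⁻¹ v) ≡ E u v
      back′ u v = trans (sym (E-shift u (cox⁻¹ v))) (cong (E u) (cox-cox⁻¹ v))

    orbsum-Pos : ∀ {D} r {v} → Reg D v → Pos (orbsum r v)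
    orbsum-Pos zero _ i = ≡⇒≤ (sym (0V-! i))
    orbsum-Pos (suc r) {v} rv i = nn (+≥0 (orbsum-Pos r (reg-cox rv) i) (*≥0 0≤1 (posv rv i))) (axpy-! (orbsum r (cox v)) 1ℚ v i)

    -- A periodic orbit of regular roots sums to a positive multiple of δ, so a root of positive defect does not vanish on it.
    nonvanishing : ∀ {D Dx x v} r → Reg D v → iter cox (suc r) v ≡ v → Cand Dx x → 0ℚ < def x → ∃ λ t → 0ℚ < E (iter cox t v) x
    nonvanishing {D} {Dx} {x} {v} r rv e cx hx = [ id , (λ z → ⊥-elim (none z (orbsum-null (suc r) v e))) ]′ (search (suc r) v rv)
      where
      search : ∀ r v → Reg D v → (∃ λ t → 0ℚ < E (iter cox t v) x) ⊎ E (orbsum r v) x ≡ 0ℚ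
      search zero v _ = inj₂ (B-0ˡ eul x 0V-!)
      search (suc r) v rv with 0ℚ ℚₚ.<? E v x
      ... | yes p = inj₁ (0 , p)
      ... | no p = [ (λ (t , q) → inj₁ (suc t , q)) , (λ z → inj₂ (trans (E-axpyˡ (orbsum r (cox v)) 1ℚ v x) (trans (cong₂ (λ a b → a + 1ℚ * b) z (ℚₚ.≤-antisym (ℚₚ.≮⇒≥ p) (regular-pairing rv cx hx))) refl))) ]′ (search r (cox v) (reg-cox rv))
      none : E (orbsum (suc r) v) x ≡ 0ℚ → (∃ λ q → orbsum (suc r) v ≡ q ·V δ) → ⊥
      none z (q , eq) = pos-coord (infΦ-pos (inj₁ (cand⇒real SD (cand rv))) (posv rv))
        where
        q0 : q ≡ 0ℚ
        q0 = [ id , (λ h → ⊥-elim (>⇒≢ hx h)) ]′ (*-zero⊎ (trans (sym (E-·ˡ q δ x)) (trans (cong (λ w → E w x) (sym eq)) z)))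
        pos-coord : (∃ λ i → 0ℚ < v ! i) → ⊥
        pos-coord (i , p) = >⇒≢ (np (≥+>0 (orbsum-Pos r (reg-cox rv) i) (*>0 0<1 p)) (axpy-! (orbsum r (cox v)) 1ℚ v i)) (trans (cong (_! i) eq) (·V-inj0 {v = δ} q0 i))

    module StepE {D} (j₀ : Fin m) (B₀ : Bad D (Pc j₀)) where

      open Bad
      D>0′ = Cand.D>0 (cand (breg B₀))
      open Minimal D>0′ using (M; M>0; M-mul; minimal-root)

      -- Mδ - b is a root by the choice of M. If it were negative, b = (b - Mδ) + Mδ would be a
      -- decomposition in the cone and force b = b - Mδ.
      co-reg : ∀ {b} → Bad D b → Reg D (shift (-V b) (ι M))
      co-reg {b} B = [ (λ p → reg c p (trans (def-shift (-V b) (ι M)) (trans (def-neg b) (cong -_ (def0 (breg B)))))) , (λ p → ⊥-elim (bad-case p)) ]′ (sign c)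
        where
        c = shift-cand (ι M) (cand-neg (cand (breg B))) (ι-int M) M-mul
        bad-case : ¬ Pos (-V shift (-V b) (ι M))
        bad-case p = >⇒≢ (*>0 M>0 (δ>0 i₀)) (trans (solve 2 (λ x b → x := b :- (:- (:- b :+ x))) refl (ι M * δ ! i₀) (b ! i₀)) (trans (cong (λ z → b ! i₀ - z) (trans (sym (eq i₀)) (cong (_! i₀) w≡b))) (ℚₚ.+-inverseʳ (b ! i₀))))
          where
          w = -V shift (-V b) (ι M)
          eq : ∀ i → w ! i ≡ - (- b ! i + ι M * δ ! i)
          eq i = trans (-V-! (shift (-V b) (ι M)) i) (cong -_ (trans (axpy-! (-V b) (ι M) δ i) (cong (_+ ι M * δ ! i) (-V-! b i))))
          w≡b : w ≡ b
          w≡b = bsim B 1ℚ 0<1 (reg-neg c (trans (def-shift (-V b) (ι M)) (trans (def-neg b) (cong -_ (def0 (breg B))))) p) (null-cone {M} (ι-cancel-< (subst (_< ι M) (sym ι-0) M>0)))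
            (ext λ i → sym (trans (axpy-! (1ℚ ·V w) 1ℚ (ι M ·V δ) i) (trans (cong₂ (λ x y → x + 1ℚ * y) (trans (·V-! 1ℚ w i) (cong (1ℚ *_) (eq i))) (·V-! (ι M) δ i))
              (solve 2 (λ b x → c1 :* (:- (:- b :+ x)) :+ c1 :* x := b) refl (b ! i) (ι M * δ ! i)))))

      iter-bad : ∀ t {b} → Bad D b → Bad D (iter cox t b)
      iter-bad zero B = B
      iter-bad (suc t) B = iter-bad t (bad-cox B)

      iter-neg-shift : ∀ t v s → iter cox t (shift v s) ≡ shift (iter cox t v) s
      iter-neg-shift zero v s = refl
      iter-neg-shift (suc t) v s = trans (cong (iter cox t) (trans (cl-axpy L v s δ) (cong (axpy (cox v) s) (cl-δ L)))) (iter-neg-shift t (cox v) s)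

      iter-neg : ∀ t v → iter cox t (-V v) ≡ -V iter cox t v
      iter-neg zero v = refl
      iter-neg (suc t) v = trans (cong (iter cox t) (cl-neg L v)) (iter-neg t (cox v))

      iter-+ : ∀ s t v → iter cox (s ℕ.+ t) v ≡ iter cox t (iter cox s v)
      iter-+ zero t v = refl
      iter-+ (suc s) t v = iter-+ s t (cox v)

      contradiction-at : ∀ {Dx x} → Cand Dx x → 0ℚ < def x → (∀ {y} → Mul D y → Mul Dx y → Mul (ι M * def x) y) → ⊥
      contradiction-at {Dx} {x} cx hx hgen = top (period j₀)
        where
        v = ι M * def x
        v>0 : 0ℚ < v
        v>0 = *>0 M>0 hx

        E-co : ∀ b → E (shift (-V b) (ι M)) x ≡ v - E b x
        E-co b = trans (E-shiftˡ (-V b) (ι M) x) (trans (cong (_+ ι M * def x) (E-negˡ b x)) (ℚₚ.+-comm (- E b x) v))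

        -- The pairings of b and of Mδ - b with x are nonnegative and add up to v, and by the choice
        -- of x the first is a multiple of v.
        two : ∀ {b} → Bad D b → E b x ≡ 0ℚ ⊎ E b x ≡ v
        two {b} B with E b x ℚₚ.≟ 0ℚ
        ... | yes e = inj₁ e
        ... | no e = inj₂ (ℚₚ.≤-antisym (by≤ (regular-pairing (co-reg B) cx hx) (sym (E-co b)))
          (mul>0 v>0 (hgen (E-mulˡ (dmul (cand (breg B))) (int cx)) (E-mulʳ (int (cand (breg B))) (dmul cx))) (≥∧≢⇒> (regular-pairing (breg B) cx hx) e)))

        -- For b with E(c⁻¹ b,x) = 0 and E(b,x) = v, Serre duality gives Q(b,x) = v, so x′, the
        -- reflection of x in b, has E(b,x′) = 0. Also E(c b,x′) = E(c b,x) - v must be nonnegative,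
        -- which forces E(c b,x) = v and E(c b,x′) = 0.
        at-end : ∀ {b} → Bad D b → E b x ≡ 0ℚ → E (cox b) x ≡ v → ⊥
        at-end {b″} B″ e₀ e₁ = go (Q-quot (cand (breg B₂)) (int cx))
          where
          b = cox b″
          B₂ = bad-cox B″
          Qbx : Q b x ≡ v
          Qbx = trans (Q≡E+E b x) (trans (cong₂ _+_ e₁ (trans (E-cox b″ x) (cong -_ e₀))) (ℚₚ.+-identityʳ v))
          go : (∃ λ p → Int p × p * D ≡ Q b x) → ⊥
          go (p , pi , ep) = no-pair M M>0 M-mul cx′ hx′ b x B₂ cx hx e₁ eμ z₁ z₂
            where
            x′ = axpy x (- p) b
            cx′ = cand-refl p cx (cand (breg B₂)) pi ep
            dx′ : def x′ ≡ def x
            dx′ = trans (def-axpy x (- p) b) (trans (cong (λ z → def x + (- p) * z) (def0 (breg B₂))) (solve 2 (λ x p → x :+ p :* c0 := x) refl (def x) (- p)))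
            hx′ = subst (0ℚ <_) (sym dx′) hx
            pD : p * D ≡ v
            pD = trans ep Qbx
            z₁ : E b x′ ≡ 0ℚ
            z₁ = trans (E-axpyʳ b x (- p) b) (trans (cong₂ (λ y z → y + (- p) * z) e₁ (norm (cand (breg B₂)))) (trans (solve 3 (λ v p D → v :+ (:- p) :* D := v :- p :* D) refl v p D) (trans (cong (λ z → v - z) pD) (ℚₚ.+-inverseʳ v))))
            Eμ′ : E (cox b) x′ ≡ E (cox b) x - v
            Eμ′ = trans (E-axpyʳ (cox b) x (- p) b) (trans (cong (λ z → E (cox b) x + (- p) * z) (bad B₂)) (trans (solve 3 (λ v p D → v :+ (:- p) :* D := v :- p :* D) refl (E (cox b) x) p D) (cong (λ z → E (cox b) x - z) pD)))
            eμ : E (cox b) x ≡ v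
            eμ = [ (λ z → ⊥-elim (≤<⊥ (regular-pairing (reg-cox (breg B₂)) cx′ hx′) (subst (_< 0ℚ) (sym (trans Eμ′ (trans (cong (_- v) z) (ℚₚ.+-identityˡ (- v))))) (->0 v>0)))) , id ]′ (two (bad-cox B₂))
            z₂ : E (cox b) x′ ≡ 0ℚ
            z₂ = trans Eμ′ (trans (cong (_- v) eμ) (ℚₚ.+-inverseʳ v))

        scan : ∀ t {b} → Bad D b → E b x ≡ 0ℚ → 0ℚ < E (iter cox t b) x → ⊥
        scan zero B e h = >⇒≢ h e
        scan (suc t) {b} B e h = [ (λ e′ → scan t (bad-cox B) e′ h) , at-end B e ]′ (two (bad-cox B))

        -- `nonvanishing` for the orbit of Mδ - b yields a point where E(·,x) is 0 on the orbit of
        -- b. Applied to b from that point on, it yields a later nonzero value, so a jump lies in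
        -- between.
        top : (∃ λ r → iterF (suc r) j₀ ≡ j₀) → ⊥
        top (r , er) = with-zero (nonvanishing r (co-reg B₀) perW cx hx)
          where
          perB : iter cox (suc r) (Pc j₀) ≡ Pc j₀
          perB = trans (iterF-Pc (suc r) j₀) (cong Pc er)
          perW : iter cox (suc r) (shift (-V Pc j₀) (ι M)) ≡ shift (-V Pc j₀) (ι M)
          perW = trans (iter-neg-shift (suc r) (-V Pc j₀) (ι M)) (cong (λ w → shift w (ι M)) (trans (iter-neg (suc r) (Pc j₀)) (cong -V_ perB)))
          with-zero : (∃ λ t → 0ℚ < E (iter cox t (shift (-V Pc j₀) (ι M))) x) → ⊥
          with-zero (t , h) = with-v (nonvanishing r (breg B₁) per₁ cx hx)
            where
            b₁ = iter cox t (Pc j₀)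
            B₁ = iter-bad t B₀
            per₁ : iter cox (suc r) b₁ ≡ b₁
            per₁ = trans (sym (iter-+ t (suc r) (Pc j₀))) (trans (cong (λ s → iter cox s (Pc j₀)) (ℕₚ.+-comm t (suc r))) (trans (iter-+ (suc r) t (Pc j₀)) (cong (iter cox t) perB)))
            zero₁ : E b₁ x ≡ 0ℚ
            zero₁ = [ id , (λ e → ⊥-elim (>⇒≢ h (trans (cong (λ w → E w x) (trans (iter-neg-shift t (-V Pc j₀) (ι M)) (cong (λ w → shift w (ι M)) (iter-neg t (Pc j₀)))))
              (trans (E-co b₁) (trans (cong (λ z → v - z) e) (ℚₚ.+-inverseʳ v)))))) ]′ (two B₁)
            with-v : (∃ λ s → 0ℚ < E (iter cox s b₁) x) → ⊥
            with-v (s , h′) = scan s B₁ zero₁ h′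

      absurd : ⊥
      absurd = let _ , _ , cx , hx , g = minimal-root in contradiction-at cx hx g

    -- A positive value would give E(c b,b) > 0 for b = `Pc i`, by `adjacent-positive`. This number
    -- is a multiple of D, and Q(b,c b) ≤ 0 bounds it by D, so b would be `Bad`.
    simples-nonpos : ∀ {D D′ i j} → Cand D (Pc i) → Cand D′ (Pc j) → i ≢ j → E (Pc i) (Pc j) ≤ 0ℚ
    simples-nonpos {D} {D′} {i} {j} ci cj ne = ℚₚ.≮⇒≥ λ h → StepE.absurd i (mkBad ri (Pc-simple i) (bad-eq (adjacent-positive j ri (Pc-simple i) (Pc-reg {j = j} cj) (ne ∘ Pc-inj i j) h)))
      where
      ri = Pc-reg {j = i} ci
      bad-eq : 0ℚ < E (cox (Pc i)) (Pc i) → E (cox (Pc i)) (Pc i) ≡ D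
      bad-eq h = ℚₚ.≤-antisym (by≤ (-≤0 (simple-nonpos ri (Pc-simple i) (reg-cox ri) (simple-cox (Pc-simple i)) ne′))
          (sym (trans (cong -_ (trans (Q≡E+E (Pc i) (cox (Pc i))) (cong (_+ E (cox (Pc i)) (Pc i)) Eb))) (solve 2 (λ D x → :- (:- D :+ x) := D :- x) refl D (E (cox (Pc i)) (Pc i))))))
        (mul>0 (Cand.D>0 ci) (E-mulˡ (dmul (cand (reg-cox ri))) (int ci)) h)
        where
        Eb : E (Pc i) (cox (Pc i)) ≡ - D
        Eb = trans (E-cox (Pc i) (Pc i)) (cong -_ (norm ci))
        ne′ : Pc i ≢ cox (Pc i)
        ne′ e = <-irr (ℚₚ.<-trans h (subst (_< 0ℚ) (trans (sym Eb) (cong₂ E e (sym e))) (->0 (Cand.D>0 ci))) )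

    -- Π_c as a union of oriented cycles, components, and tube supports.

    [_≈_] : Fin m → Fin m → ℚ
    [ i ≈ j ] = unit i j

    D_ : Fin m → ℚ
    D i = E (Pc i) (Pc i)

    null-Eˡ : ∀ {i v} → (∃ λ t → Pc i ≡ t ·V δ) → def v ≡ 0ℚ → E (Pc i) v ≡ 0ℚ
    null-Eˡ {v = v} (t , e) h = trans (cong (λ w → E w v) e) (trans (E-·ˡ t δ v) (0ʳ t h))

    null-Eʳ : ∀ {i v} → (∃ λ t → Pc i ≡ t ·V δ) → def v ≡ 0ℚ → E v (Pc i) ≡ 0ℚ
    null-Eʳ {v = v} (t , e) h = trans (cong (E v) e) (E-null t h)

    E-same-next : ∀ i → E (Pc i) (Pc (π i)) ≡ - D i
    E-same-next i = trans (cong (E (Pc i)) (sym (cox-Pc i))) (E-cox (Pc i) (Pc i))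

    -- On Π_c the Euler form is that of oriented cycles.
    E-simples : ∀ i j → E (Pc i) (Pc j) ≡ D i * ([ i ≈ j ] - [ π i ≈ j ])
    E-simples i j = by-type (real-or-null i) (real-or-null j)
      where
      by-type : (∃ λ D → Cand D (Pc i)) ⊎ (∃ λ t → Pc i ≡ t ·V δ) → (∃ λ D → Cand D (Pc j)) ⊎ (∃ λ t → Pc j ≡ t ·V δ) → E (Pc i) (Pc j) ≡ D i * ([ i ≈ j ] - [ π i ≈ j ])
      by-type (inj₂ z) _ = trans (null-Eˡ {i} z (Pc-def j)) (sym (0ˡ ([ i ≈ j ] - [ π i ≈ j ]) (null-Eˡ {i} z (Pc-def i))))
      by-type (inj₁ (Di , ci)) (inj₂ z@(t , e)) = trans (null-Eʳ {j} z (Pc-def i)) (sym (trans (cong₂ (λ x y → D i * (x - y)) (unit-diff i≢j) (unit-diff πi≢j)) (solve 1 (λ d → d :* (c0 :- c0) := c0) refl (D i))))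
        where
        i≢j : i ≢ j
        i≢j refl = cand-not-null {t = t} ci e
        πi≢j : π i ≢ j
        πi≢j refl = cand-not-null {t = t} (subst (Cand Di) (cox-Pc i) (cand-cox ci)) e
      by-type (inj₁ (Di , ci)) (inj₁ (Dj , cj)) = eq (i Fin.≟ j) (π i Fin.≟ j)
        where
        Di>0 : 0ℚ < D i
        Di>0 = subst (0ℚ <_) (sym (norm ci)) (Cand.D>0 ci)
        eq : Dec (i ≡ j) → Dec (π i ≡ j) → E (Pc i) (Pc j) ≡ D i * ([ i ≈ j ] - [ π i ≈ j ])
        eq (yes refl) (yes e) = ⊥-elim (<-irr (ℚₚ.<-trans Di>0 (subst (_< 0ℚ) (trans (sym (E-same-next i)) (cong (λ k → E (Pc i) (Pc k)) e)) (->0 Di>0))))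
        eq (yes refl) (no p) = sym (trans (cong₂ (λ x y → D i * (x - y)) (unit-same i) (unit-diff p)) (solve 1 (λ d → d :* (c1 :- c0) := d) refl (D i)))
        eq (no p) (yes refl) = trans (E-same-next i) (sym (trans (cong₂ (λ x y → D i * (x - y)) (unit-diff p) (unit-same (π i))) (solve 1 (λ d → d :* (c0 :- c1) := :- d) refl (D i))))
        -- Both E(b_i,b_j) and E(b_j,c b_i) = -E(b_i,b_j) are nonpositive.
        eq (no p) (no q) = trans (ℚₚ.≤-antisym (simples-nonpos ci cj p)
            (nn (-≤0 (simples-nonpos cj (subst (Cand Di) (cox-Pc i) (cand-cox ci)) (q ∘ sym))) (trans (solve 1 (λ x → x := :- (:- x)) refl (E (Pc i) (Pc j))) (cong -_ (trans (sym (E-cox (Pc i) (Pc j))) (cong (E (Pc j)) (cox-Pc i)))))))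
          (sym (trans (cong₂ (λ x y → D i * (x - y)) (unit-diff p) (unit-diff q)) (solve 1 (λ d → d :* (c0 :- c0) := c0) refl (D i))))

    π⁻¹ : Fin m → Fin m
    π⁻¹ j = iterF (proj₁ (period j)) j

    π-π⁻¹ : ∀ j → π (π⁻¹ j) ≡ j
    π-π⁻¹ j = trans (sym (iterF-suc (proj₁ (period j)) j)) (proj₂ (period j))

    π⁻¹-π : ∀ j → π⁻¹ (π j) ≡ j
    π⁻¹-π j = π-inj (π-π⁻¹ (π j))

    cox⁻¹-Pc : ∀ j → cox⁻¹ (Pc j) ≡ Pc (π⁻¹ j)
    cox⁻¹-Pc j = trans (cong (cox⁻¹ ∘ Pc) (sym (π-π⁻¹ j))) (trans (cong cox⁻¹ (sym (cox-Pc (π⁻¹ j)))) (cox⁻¹-cox (Pc (π⁻¹ j))))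

    infix 4 _~_

    -- Orbits of π. They are the connected components of Π_c, by `Conn⇒~` and `Conn-~`, and in this
    -- form the relation is decidable because the orbits are finite.
    _~_ : Fin m → Fin m → Set
    i ~ k = ∃ λ t → iterF t i ≡ k

    ~-refl : ∀ {i} → i ~ i
    ~-refl = 0 , refl

    ~-π : ∀ {i} → i ~ π i
    ~-π = 1 , refl

    ~-trans : ∀ {i j k} → i ~ j → j ~ k → i ~ k
    ~-trans {i} (s , refl) (t , refl) = s ℕ.+ t , iterF-+ s t i

    π-~ : ∀ {i} → π i ~ i
    π-~ {i} = period i

    ~-sym : ∀ {i k} → i ~ k → k ~ i
    ~-sym {i} (t , e) = go t i e
      where
      go : ∀ t i {k} → iterF t i ≡ k → k ~ i
      go zero i refl = ~-refl
      go (suc t) i e = ~-trans (go t (π i) e) π-~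

    private
      reduce : ∀ i r → iterF (suc r) i ≡ i → ∀ t → ∃ λ (s : Fin (suc r)) → iterF t i ≡ iterF (toℕ s) i
      reduce i r e zero = zero , refl
      reduce i r e (suc t) = next′ (reduce i r e t)
        where
        next′ : (∃ λ (s : Fin (suc r)) → iterF t i ≡ iterF (toℕ s) i) → ∃ λ (s : Fin (suc r)) → iterF (suc t) i ≡ iterF (toℕ s) i
        next′ (s , eq) with toℕ s ℕₚ.<? r
        ... | yes lt = Fin.fromℕ< (ℕ.s≤s lt) , trans eq′ (cong (λ k → iterF k i) (sym (Finₚ.toℕ-fromℕ< (ℕ.s≤s lt))))
          where
          eq′ : iterF (suc t) i ≡ iterF (suc (toℕ s)) i
          eq′ = trans (iterF-suc t i) (trans (cong π eq) (sym (iterF-suc (toℕ s) i)))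
        ... | no ge = zero , trans (iterF-suc t i) (trans (cong π eq) (trans (sym (iterF-suc (toℕ s) i)) (trans (cong (λ k → iterF (suc k) i) (ℕₚ.≤-antisym (ℕₚ.≤-pred (Finₚ.toℕ<n s)) (ℕₚ.≮⇒≥ ge))) e)))

    abstract
      _~?_ : ∀ i k → Dec (i ~ k)
      i ~? k = go (period i)
        where
        go : (∃ λ r → iterF (suc r) i ≡ i) → Dec (i ~ k)
        go (r , e) with Finₚ.any? (λ (s : Fin (suc r)) → iterF (toℕ s) i Fin.≟ k)
        ... | yes (s , p) = yes (toℕ s , p)
        ... | no h = no λ (t , p) → let s , q = reduce i r e t in h (s , trans (sym q) p)

    D-π : ∀ i → D (π i) ≡ D i
    D-π i = trans (cong₂ E (sym (cox-Pc i)) (sym (cox-Pc i))) (E-cox-inv (Pc i) (Pc i))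

    D-~ : ∀ {i k} → i ~ k → D k ≡ D i
    D-~ {i} (t , e) = go t i e
      where
      go : ∀ t i {k} → iterF t i ≡ k → D k ≡ D i
      go zero i refl = refl
      go (suc t) i e = trans (go t (π i) e) (D-π i)

    D≥0 : ∀ i → 0ℚ ≤ D i
    D≥0 i = E≥0 (Pc i)

    D-real : ∀ {i} → 0ℚ < D i → Cand (D i) (Pc i)
    D-real {i} p = [ (λ (D′ , c) → subst (λ z → Cand z (Pc i)) (sym (norm c)) c) , (λ z → ⊥-elim (>⇒≢ p (null-Eˡ {i} z (Pc-def i)))) ]′ (real-or-null i)

    π-null : ∀ {i} → D i ≡ 0ℚ → π i ≡ i
    π-null {i} e = [ (λ (D′ , c) → ⊥-elim (>⇒≢ (Cand.D>0 c) (trans (sym (norm c)) e))) , (λ (t , q) → Pc-inj (π i) i (trans (sym (cox-Pc i)) (trans (cong cox q) (trans (cl-null L t) (sym q))))) ]′ (real-or-null i)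

    π≢ : ∀ {i} → 0ℚ < D i → π i ≢ i
    π≢ {i} p e = <-irr (ℚₚ.<-trans p (subst (_< 0ℚ) (trans (sym (E-same-next i)) (cong (λ k → E (Pc i) (Pc k)) e)) (->0 p)))

    Q-off : ∀ {k l} → k ≢ l → π k ≢ l → π l ≢ k → Q (Pc k) (Pc l) ≡ 0ℚ
    Q-off {k} {l} p q r = trans (Q≡E+E (Pc k) (Pc l)) (trans (cong₂ _+_
      (trans (E-simples k l) (trans (cong₂ (λ x y → D k * (x - y)) (unit-diff p) (unit-diff q)) (solve 1 (λ d → d :* (c0 :- c0) := c0) refl (D k))))
      (trans (E-simples l k) (trans (cong₂ (λ x y → D l * (x - y)) (unit-diff (p ∘ sym)) (unit-diff r)) (solve 1 (λ d → d :* (c0 :- c0) := c0) refl (D l))))) refl)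

    Conn⇒~ : ∀ {i k} → Conn i k → i ~ k
    Conn⇒~ (Aff.here j) = ~-refl
    Conn⇒~ (Aff.step {k = k} {l} c h) = ~-trans (Conn⇒~ c) (linked (k Fin.≟ l) (π k Fin.≟ l) (π l Fin.≟ k))
      where
      linked : Dec (k ≡ l) → Dec (π k ≡ l) → Dec (π l ≡ k) → k ~ l
      linked (yes refl) _ _ = ~-refl
      linked (no _) (yes refl) _ = ~-π
      linked (no _) (no _) (yes refl) = π-~
      linked (no p) (no q) (no r) = ⊥-elim (h (trans (sym (Q≡K (Pc k) (Pc l))) (Q-off p q r)))

    Q-next : ∀ {i} → 0ℚ < D i → Q (Pc i) (Pc (π i)) < 0ℚ
    Q-next {i} p = 0<-⇒<0 (np (+>0 p (*≥0 (D≥0 i) (unit≥0 (π (π i)) i))) (trans (cong -_ (trans (Q≡E+E (Pc i) (Pc (π i))) (cong₂ _+_ (E-same-next i)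
      (trans (E-simples (π i) i) (cong₂ (λ x y → x * (y - unit (π (π i)) i)) (D-π i) (unit-diff (π≢ p)))))))
      (solve 2 (λ d u → :- (:- d :+ d :* (c0 :- u)) := d :+ d :* u) refl (D i) (unit (π (π i)) i))))

    ~⇒Conn : ∀ {i k} → 0ℚ < D i → i ~ k → Conn i k
    ~⇒Conn {i} p (t , refl) = go t
      where
      go : ∀ t → Conn i (iterF t i)
      go zero = Aff.here i
      go (suc t) = subst (Conn i) (sym (iterF-suc t i)) (Aff.step (go t) λ e → ℚₚ.<⇒≢ (Q-next (subst (0ℚ <_) (sym (D-~ {i} (t , refl))) p)) (trans (Q≡K (Pc (iterF t i)) (Pc (π (iterF t i)))) e))

    null-~ : ∀ {i k} → D i ≡ 0ℚ → i ~ k → i ≡ k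
    null-~ {i} e (t , q) = go t q
      where
      go : ∀ t {k} → iterF t i ≡ k → i ≡ k
      go zero q = q
      go (suc t) q = go t (trans (cong (iterF t) (sym (π-null e))) q)

    Conn-~ : ∀ {i k} → i ~ k → Conn i k
    Conn-~ {i} {k} h = go (D i ℚₚ.≟ 0ℚ)
      where
      go : Dec (D i ≡ 0ℚ) → Conn i k
      go (yes e) = subst (Conn i) (null-~ e h) (Aff.here i)
      go (no p) = ~⇒Conn (≥∧≢⇒> (D≥0 i) p) h

    E-∑Vʳ : ∀ {k} u (co : Fin k → ℚ) (f : Fin k → V) → E u (∑V (λ j → co j ·V f j)) ≡ ∑ (λ j → co j * E u (f j))
    E-∑Vʳ {zero} u co f = B-0ʳ eul u 0V-!
    E-∑Vʳ {suc k} u co f = trans (cong (E u) (ext λ i → trans (+V-! (co zero ·V f zero) rest i) (trans (ℚₚ.+-comm ((co zero ·V f zero) ! i) (rest ! i)) (trans (cong (rest ! i +_) (·V-! (co zero) (f zero) i)) (sym (axpy-! rest (co zero) (f zero) i))))))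
      (trans (E-axpyʳ u rest (co zero) (f zero)) (trans (ℚₚ.+-comm (E u rest) (co zero * E u (f zero))) (cong (co zero * E u (f zero) +_) (E-∑Vʳ u (co ∘ suc) (f ∘ suc)))))
      where rest = ∑V (λ j → co (suc j) ·V f (suc j))

    E-∑Vˡ : ∀ {k} u (co : Fin k → ℚ) (f : Fin k → V) → E (∑V (λ j → co j ·V f j)) u ≡ ∑ (λ j → co j * E (f j) u)
    E-∑Vˡ {zero} u co f = B-0ˡ eul u 0V-!
    E-∑Vˡ {suc k} u co f = trans (cong (λ w → E w u) (ext λ i → trans (+V-! (co zero ·V f zero) rest i) (trans (ℚₚ.+-comm ((co zero ·V f zero) ! i) (rest ! i)) (trans (cong (rest ! i +_) (·V-! (co zero) (f zero) i)) (sym (axpy-! rest (co zero) (f zero) i))))))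
      (trans (E-axpyˡ rest (co zero) (f zero) u) (trans (ℚₚ.+-comm (E rest u) (co zero * E (f zero) u)) (cong (co zero * E (f zero) u +_) (E-∑Vˡ u (co ∘ suc) (f ∘ suc)))))
      where rest = ∑V (λ j → co (suc j) ·V f (suc j))

    ∑-unit : ∀ (co : Fin m → ℚ) i → ∑ (λ k → co k * unit i k) ≡ co i
    ∑-unit co i = trans (∑-single (λ k → co k * unit i k) i (λ k p → 0ʳ (co k) (unit-diff (p ∘ sym)))) (1ʳ (co i) (unit-same i))

    E-Pc : ∀ i co → E (Pc i) (lincomb co) ≡ D i * (co i - co (π i))
    E-Pc i co = trans (E-∑Vʳ (Pc i) co Pc) (trans (∑-lin (λ k → D i * (co k * unit i k)) (- D i) (λ k → co k * unit (π i) k)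
      (λ k → trans (cong (co k *_) (E-simples i k)) (solve 4 (λ c d u v → c :* (d :* (u :- v)) := d :* (c :* u) :+ (:- d) :* (c :* v)) refl (co k) (D i) (unit i k) (unit (π i) k))))
      (trans (cong₂ (λ x y → x + (- D i) * y) (trans (∑-* (D i) (λ k → co k * unit i k)) (cong (D i *_) (∑-unit co i))) (∑-unit co (π i)))
      (solve 3 (λ d x y → d :* x :+ (:- d) :* y := d :* (x :- y)) refl (D i) (co i) (co (π i)))))

    E-lincombˡ : ∀ co v → E (lincomb co) v ≡ ∑ (λ k → co k * E (Pc k) v)
    E-lincombˡ co v = E-∑Vˡ v co Pc

    record Expansion (v : V) (S : Subset m) : Set where
      field
        j₀   : Fin m
        co   : Fin m → ℚ
        orb  : ∀ k → co k ≢ 0ℚ → j₀ ~ k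
        eqv  : v ≡ lincomb co
        supp : ∀ k → (k ∈ S → co k ≢ 0ℚ) × (co k ≢ 0ℚ → k ∈ S)

    expansion : ∀ {v S} → TSupp v S → Expansion v S
    expansion (j₀ , co , h , e , s) = record { j₀ = j₀ ; co = co ; orb = λ k p → Conn⇒~ (h k p) ; eqv = e ; supp = s }

    tsupp : ∀ {v S} → Expansion v S → TSupp v S
    tsupp X = j₀ , co , (λ k p → Conn-~ (orb k p)) , eqv , supp
      where open Expansion X

    expansion-real : ∀ {D′ v S} (X : Expansion v S) → Cand D′ v → 0ℚ < D (Expansion.j₀ X)
    expansion-real {D′} {v} X c = ≥∧≢⇒> (D≥0 j₀) λ e → >⇒≢ (Cand.D>0 c) (trans (sym (norm c)) (trans (cong (λ w → E w v) eqv) (trans (E-lincombˡ co v)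
        (∑-zero λ k → term e k (co k ℚₚ.≟ 0ℚ)))))
      where
      open Expansion X
      term : D j₀ ≡ 0ℚ → ∀ k → Dec (co k ≡ 0ℚ) → co k * E (Pc k) v ≡ 0ℚ
      term e k (yes z) = 0ˡ (E (Pc k) v) z
      term e k (no p) = 0ʳ (co k) (trans (cong (E (Pc k)) eqv) (trans (E-Pc k co) (0ˡ (co k - co (π k)) (trans (D-~ (orb k p)) e))))

    orbit-const : ∀ (e : Fin m → ℚ) → (∀ i → D i * (e i - e (π i)) ≡ 0ℚ) → ∀ {i k} → i ~ k → e k ≡ e i
    orbit-const e h {i} (t , q) = go t i q
      where
      one : ∀ i → Dec (D i ≡ 0ℚ) → e (π i) ≡ e i
      one i (yes z) = cong e (π-null z)
      one i (no p) = sym (a-b≡0⇒a≡b (*-cancel0 p (h i)))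
      go : ∀ t i {k} → iterF t i ≡ k → e k ≡ e i
      go zero i refl = refl
      go (suc t) i q = trans (go t (π i) q) (one i (D i ℚₚ.≟ 0ℚ))

    lincomb-diff : ∀ {co co′} → lincomb co ≡ lincomb co′ → ∀ i → lincomb (λ k → co k + (- 1ℚ) * co′ k) ! i ≡ 0ℚ
    lincomb-diff {co} {co′} e i = trans (cong (_! i) (lincomb-axpy co (- 1ℚ) co′)) (trans (axpy-! (lincomb co) (- 1ℚ) (lincomb co′) i)
      (trans (cong (λ w → w ! i + (- 1ℚ) * lincomb co′ ! i) e) (solve 1 (λ x → x :+ (:- c1) :* x := c0) refl (lincomb co′ ! i))))

    diff-const : ∀ {co co′} → lincomb co ≡ lincomb co′ → ∀ {i k} → i ~ k → co k + (- 1ℚ) * co′ k ≡ co i + (- 1ℚ) * co′ i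
    diff-const {co} {co′} e = orbit-const (λ k → co k + (- 1ℚ) * co′ k) λ i → trans (sym (E-Pc i (λ k → co k + (- 1ℚ) * co′ k))) (B-0ʳ eul (Pc i) (lincomb-diff {co} {co′} e))

    -- Π_c may be linearly dependent, since each cycle sums to a multiple of δ, but the difference
    -- of two expansions is constant on every orbit. Over a common orbit it has one sign, and a
    -- nonnegative relation is trivial. Over different orbits each expansion would be constant on
    -- its own orbit, which makes E(v,v) = 0.
    expansion-unique : ∀ {D′ v S S′} → Cand D′ v → (X : Expansion v S) (Y : Expansion v S′) → ∀ k → Expansion.co X k ≡ Expansion.co Y k
    expansion-unique {D′} {v} c X Y = go (X.j₀ ~? Y.j₀)
      where
      module X = Expansion X
      module Y = Expansion Y
      e : Fin m → ℚ
      e k = X.co k + (- 1ℚ) * Y.co k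
      e′ : Fin m → ℚ
      e′ k = Y.co k + (- 1ℚ) * X.co k
      eq : lincomb X.co ≡ lincomb Y.co
      eq = trans (sym X.eqv) Y.eqv
      co-off : ∀ {S} (Z : Expansion v S) k → ¬ (Expansion.j₀ Z ~ k) → Expansion.co Z k ≡ 0ℚ
      co-off Z k h with Expansion.co Z k ℚₚ.≟ 0ℚ
      ... | yes z = z
      ... | no p = ⊥-elim (h (Expansion.orb Z k p))
      zero-diff : ∀ {x y} → x + (- 1ℚ) * y ≡ 0ℚ → x ≡ y
      zero-diff {x} {y} z = a-b≡0⇒a≡b (trans (solve 2 (λ x y → x :- y := x :+ (:- c1) :* y) refl x y) z)
      off-term : ∀ {x y} → x ≡ 0ℚ → y ≡ 0ℚ → x + (- 1ℚ) * y ≡ 0ℚ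
      off-term refl refl = refl
      go : Dec (X.j₀ ~ Y.j₀) → ∀ k → X.co k ≡ Y.co k
      go (yes s) = [ (λ p k → zero-diff (nonneg-lincomb-zero e (λ k → sgn e (diff-const {X.co} {Y.co} eq) p k (λ h → off-term (co-off X k h) (co-off Y k (λ h′ → h (~-trans s h′))))) (lincomb-diff {X.co} {Y.co} eq) k))
                   , (λ p k → sym (zero-diff (nonneg-lincomb-zero e′ (λ k → sgn e′ (diff-const {Y.co} {X.co} (sym eq)) (flip p) k (λ h → off-term (co-off Y k (λ h′ → h (~-trans s h′))) (co-off X k h))) (lincomb-diff {Y.co} {X.co} (sym eq)) k))) ]′
                   (ℚₚ.≤-total 0ℚ (e X.j₀))
        where
        flip : e X.j₀ ≤ 0ℚ → 0ℚ ≤ e′ X.j₀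
        flip p = nn (-≤0 p) (solve 2 (λ x y → y :+ (:- c1) :* x := :- (x :+ (:- c1) :* y)) refl (X.co X.j₀) (Y.co X.j₀))
        sgn : ∀ (f : Fin m → ℚ) → (∀ {i k} → i ~ k → f k ≡ f i) → 0ℚ ≤ f X.j₀ → ∀ k → (¬ (X.j₀ ~ k) → f k ≡ 0ℚ) → 0ℚ ≤ f k
        sgn f cst p k z with X.j₀ ~? k
        ... | yes h = subst (0ℚ ≤_) (sym (cst h)) p
        ... | no h = ≡⇒≤ (sym (z h))
      go (no s) = ⊥-elim (>⇒≢ (Cand.D>0 c) (trans (sym (norm c)) (trans (cong (λ w → E w v) X.eqv) (trans (E-lincombˡ X.co v) (∑-zero λ k → term k (X.j₀ ~? k))))))
        where
        Yoff : ∀ {k} → X.j₀ ~ k → Y.co k ≡ 0ℚ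
        Yoff {k} h = co-off Y k λ h′ → s (~-trans h (~-sym h′))
        X≡ : ∀ {k} → X.j₀ ~ k → X.co k ≡ e k
        X≡ {k} h = sym (trans (cong (λ z → X.co k + (- 1ℚ) * z) (Yoff h)) (solve 1 (λ x → x :+ (:- c1) :* c0 := x) refl (X.co k)))
        term : ∀ k → Dec (X.j₀ ~ k) → X.co k * E (Pc k) v ≡ 0ℚ
        term k (no h) = 0ˡ (E (Pc k) v) (co-off X k h)
        term k (yes h) = 0ʳ (X.co k) (trans (cong (E (Pc k)) X.eqv) (trans (E-Pc k X.co) (0ʳ (D k) (a≡b⇒a-b≡0 (trans (X≡ h) (trans (diff-const {X.co} {Y.co} eq h)
          (sym (trans (X≡ (~-trans h ~-π)) (diff-const {X.co} {Y.co} eq (~-trans h ~-π)))))))))) 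

    supp-unique : ∀ {D′ v S S′} → Cand D′ v → Expansion v S → Expansion v S′ → S ≡ S′
    supp-unique c X Y = Subₚ.⊆-antisym (λ {k} p → proj₂ (Expansion.supp Y k) (subst (_≢ 0ℚ) (expansion-unique c X Y k) (proj₁ (Expansion.supp X k) p)))
      (λ {k} p → proj₂ (Expansion.supp X k) (subst (_≢ 0ℚ) (sym (expansion-unique c X Y k)) (proj₁ (Expansion.supp Y k) p)))

    pull : (Fin m → Fin m) → Subset m → Subset m
    pull p S = tabulate (λ k → lookup S (p k))

    ∈-pull : ∀ {p S k} → k ∈ pull p S → p k ∈ S
    ∈-pull {p} {S} {k} h = Vecₚ.lookup⇒[]= (p k) S (trans (sym (Vecₚ.lookup∘tabulate (λ k → lookup S (p k)) k)) (Vecₚ.[]=⇒lookup h))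

    pull-∈ : ∀ {p S k} → p k ∈ S → k ∈ pull p S
    pull-∈ {p} {S} {k} h = Vecₚ.lookup⇒[]= k (pull p S) (trans (Vecₚ.lookup∘tabulate (λ k → lookup S (p k)) k) (Vecₚ.[]=⇒lookup h))

    private
      map-∑V : (T : V → V) → (∀ u q v → T (axpy u q v) ≡ axpy (T u) q (T v)) → T 0V ≡ 0V → ∀ {k} (co : Fin k → ℚ) (f : Fin k → V) → T (∑V (λ j → co j ·V f j)) ≡ ∑V (λ j → co j ·V T (f j))
      map-∑V T lin z {zero} co f = z
      map-∑V T lin z {suc k} co f = trans (cong T (flipped f)) (trans (lin rest (co zero) (f zero)) (trans (cong (λ w → axpy w (co zero) (T (f zero))) (map-∑V T lin z (co ∘ suc) (f ∘ suc))) (sym (flipped (T ∘ f)))))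
        where
        rest = ∑V (λ j → co (suc j) ·V f (suc j))
        flipped : ∀ (f : Fin (suc k) → V) → ∑V (λ j → co j ·V f j) ≡ axpy (∑V (λ j → co (suc j) ·V f (suc j))) (co zero) (f zero)
        flipped f = ext λ i → trans (+V-! (co zero ·V f zero) (∑V (λ j → co (suc j) ·V f (suc j))) i) (trans (ℚₚ.+-comm ((co zero ·V f zero) ! i) (∑V (λ j → co (suc j) ·V f (suc j)) ! i))
          (trans (cong (∑V (λ j → co (suc j) ·V f (suc j)) ! i +_) (·V-! (co zero) (f zero) i)) (sym (axpy-! (∑V (λ j → co (suc j) ·V f (suc j))) (co zero) (f zero) i))))

      transport : (T : V → V) → (∀ u q v → T (axpy u q v) ≡ axpy (T u) q (T v)) → T 0V ≡ 0V → (p q : Fin m → Fin m) → (∀ k → p (q k) ≡ k) → (∀ k → q (p k) ≡ k) →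
        (∀ j → T (Pc j) ≡ Pc (p j)) → (∀ {k} → q k ~ k) → ∀ {v S} → Expansion v S → Expansion (T v) (pull q S)
      transport T lin z p q pq qp TPc q~ {v} {S} X = record { j₀ = j₀ ; co = co ∘ q ; orb = λ k h → ~-trans (orb (q k) h) q~
        ; eqv = trans (cong T eqv) (trans (map-∑V T lin z co Pc) (ext λ i → trans (∑V-! (λ k → co k ·V T (Pc k)) i) (trans (∑-cong λ k → trans (·V-! (co k) (T (Pc k)) i) (cong₂ (λ a w → co a * w ! i) (sym (qp k)) (TPc k)))
            (trans (∑-permute (λ k → co (q k) * Pc k ! i) p q pq qp) (sym (lincomb-! (co ∘ q) i))))))
        ; supp = λ k → (λ h → proj₁ (supp (q k)) (∈-pull {q} {S} h)) , (λ h → pull-∈ {q} {S} (proj₂ (supp (q k)) h)) }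
        where open Expansion X

    expansion-cox : ∀ {v S} → Expansion v S → Expansion (cox v) (pull π⁻¹ S)
    expansion-cox = transport cox (cl-axpy L) (cl-0V L) π π⁻¹ π-π⁻¹ π⁻¹-π cox-Pc (λ {k} → subst (π⁻¹ k ~_) (π-π⁻¹ k) ~-π)

    expansion-cox⁻¹ : ∀ {v S} → Expansion v S → Expansion (cox⁻¹ v) (pull π S)
    expansion-cox⁻¹ = transport cox⁻¹ (cl-axpy (reverse L)) (cl-0V (reverse L)) π⁻¹ π π⁻¹-π π-π⁻¹ cox⁻¹-Pc π-~

    full-pull⁻¹ : ∀ {S} → ComponentFull (pull π⁻¹ S) → ComponentFull S
    full-pull⁻¹ {S} (j , h) = j , λ k c → subst (_∈ S) (π⁻¹-π k) (∈-pull {π⁻¹} {S} (h (π k) (Conn-~ (~-trans (Conn⇒~ c) ~-π))))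

    full-pull : ∀ {S} → ComponentFull (pull π S) → ComponentFull S
    full-pull {S} (j , h) = j , λ k c → subst (_∈ S) (π-π⁻¹ k) (∈-pull {π} {S} (h (π⁻¹ k) (Conn-~ (~-trans (Conn⇒~ c) (~-sym (subst (π⁻¹ k ~_) (π-π⁻¹ k) ~-π))))))

    -- A discrete intermediate value principle along the cycle.
    exit : ∀ {P : Fin m → Set} → (∀ k → Dec (P k)) → ∀ {i k} → i ~ k → P i → ¬ P k → ∃ λ j → i ~ j × P j × ¬ P (π j)
    exit {P} P? {i} {k} (t , e) p q = go t i e p
      where
      go : ∀ t i → iterF t i ≡ k → P i → ∃ λ j → i ~ j × P j × ¬ P (π j)
      go zero i e p = ⊥-elim (q (subst P e p))
      go (suc t) i e p = [ (λ r → let j , s , h = go t (π i) e r in j , ~-trans ~-π s , h) , (λ r → i , ~-refl , p , r) ]′ (toSum (P? (π i)))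

    -- The coefficients are the indicator of an arc: `last` is its final vertex and `prior` the
    -- vertex just before its first one.
    record Arc {v S} (X : Expansion v S) : Set where
      open Expansion X
      field
        last prior : Fin m
        last≢prior : last ≢ prior
        bit  : ∀ k → co k ≡ 0ℚ ⊎ co k ≡ 1ℚ
        jump : ∀ k → co k - co (π k) ≡ unit last k - unit prior k
        D-v  : E v v ≡ D j₀

    nonfull-witness : ∀ {S j} → ¬ ComponentFull S → ∃ λ k → j ~ k × k ∉ S
    nonfull-witness {S} {j} h with Finₚ.any? (λ k → (j ~? k) ×-dec ¬? (k Subₚ.∈? S))
    ... | yes p = p
    ... | no q = ⊥-elim (h (j , λ k c → [ id , (λ k∉ → ⊥-elim (q (k , Conn⇒~ c , k∉))) ]′ (toSum (k Subₚ.∈? S))))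

    -- The jumps δc of the coefficients are integers, because E(`Pc k`,v) = D_k δc k is a multiple
    -- of D_k, and 2D′ = Δ Σ δc². A gap in the support forces a rise and a fall; comparing lengths
    -- then leaves exactly one of each, of size 1.
    module ToArc {D′ v S} (r : Reg D′ v) (X : Expansion v S) (nf : ¬ ComponentFull S) where
      open Expansion X

      Δ = D j₀

      Δ>0 : 0ℚ < Δ
      Δ>0 = expansion-real X (cand r)

      D′>0 : 0ℚ < D′
      D′>0 = Cand.D>0 (cand r)

      off : ∀ {k} → ¬ (j₀ ~ k) → co k ≡ 0ℚ
      off {k} h with co k ℚₚ.≟ 0ℚ
      ... | yes e = e
      ... | no p = ⊥-elim (h (orb k p))

      δc : Fin m → ℚ
      δc k = co k - co (π k)

      Eδ : ∀ k → E (Pc k) v ≡ D k * δc k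
      Eδ k = trans (cong (E (Pc k)) eqv) (E-Pc k co)

      -- A cone expansion differs from `co` by a constant on the orbit. If this constant were
      -- positive, the difference would be a nontrivial nonnegative relation. So it is at most 0,
      -- and `co` dominates nonnegative coefficients.
      co≥0 : ∀ k → 0ℚ ≤ co k
      co≥0 = go (reg-cone r)
        where
        go : Cone v → ∀ k → 0ℚ ≤ co k
        go (co′ , h′ , e′) k = by-orbit (j₀ ~? k)
          where
          ed : Fin m → ℚ
          ed k = co′ k + (- 1ℚ) * co k
          eq : lincomb co′ ≡ lincomb co
          eq = trans (sym e′) eqv
          e₀≤0 : ed j₀ ≤ 0ℚ
          e₀≤0 = ℚₚ.≮⇒≥ λ p → >⇒≢ p (nonneg-lincomb-zero ed (pos-all p) (lincomb-diff {co′} {co} eq) j₀)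
            where
            pos-all : 0ℚ < ed j₀ → ∀ k → 0ℚ ≤ ed k
            pos-all p k with j₀ ~? k
            ... | yes h = subst (0ℚ ≤_) (sym (diff-const {co′} {co} eq h)) (ℚₚ.<⇒≤ p)
            ... | no h = nn (h′ k) (trans (cong (λ z → co′ k + (- 1ℚ) * z) (off h)) (solve 1 (λ x → x :+ (:- c1) :* c0 := x) refl (co′ k)))
          by-orbit : Dec (j₀ ~ k) → 0ℚ ≤ co k
          by-orbit (no h) = ≡⇒≤ (sym (off h))
          by-orbit (yes h) = nn (+≥0 (h′ k) (-≤0 (subst (_≤ 0ℚ) (sym (diff-const {co′} {co} eq h)) e₀≤0))) (solve 2 (λ x y → y := x :+ :- (x :+ (:- c1) :* y)) refl (co′ k) (co k))

      off-π : ∀ {k} → ¬ (j₀ ~ k) → ¬ (j₀ ~ π k)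
      off-π h p = h (~-trans p π-~)

      δ-off : ∀ {k} → ¬ (j₀ ~ k) → δc k ≡ 0ℚ
      δ-off h = a≡b⇒a-b≡0 (trans (off h) (sym (off (off-π h))))

      Δδ : ∀ {k} → j₀ ~ k → E (Pc k) v ≡ Δ * δc k
      Δδ {k} h = trans (Eδ k) (cong (_* δc k) (D-~ h))

      δ-int′ : ∀ k → Int (δc k)
      δ-int′ k with j₀ ~? k
      ... | no h = subst Int (sym (δ-off h)) int-0
      ... | yes h = go (subst (Mul (D k)) (Eδ k) (E-mulˡ (dmul (D-real Dk>0)) (int (cand r))))
        where
        Dk>0 : 0ℚ < D k
        Dk>0 = subst (0ℚ <_) (sym (D-~ h)) Δ>0
        go : Mul (D k) (D k * δc k) → Int (δc k)
        go (z , e) = z , *-cancelˡ (>⇒≢ Dk>0) (trans e (ℚₚ.*-comm (ℤ→ℚ z) (D k)))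

      δ-mul : ∀ {k} → j₀ ~ k → Mul D′ (Δ * δc k)
      δ-mul {k} h = subst (Mul D′) (Δδ h) (E-mulʳ (int (D-real (subst (0ℚ <_) (sym (D-~ h)) Δ>0))) (dmul (cand r)))

      sq : Fin m → ℚ
      sq k = δc k * δc k

      norm-sum : 2ℚ * D′ ≡ Δ * ∑ sq
      norm-sum = begin
        2ℚ * D′ ≡⟨ cong (2ℚ *_) (trans (sym (norm (cand r))) (trans (cong (λ w → E w v) eqv) (trans (E-lincombˡ co v) (∑-scale Δ (λ k → co k * δc k) term)))) ⟩
        2ℚ * (Δ * ∑ (λ k → co k * δc k)) ≡⟨ solve 2 (λ Δ s → c2 :* (Δ :* s) := Δ :* (c2 :* s)) refl Δ (∑ (λ k → co k * δc k)) ⟩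
        Δ * (2ℚ * ∑ (λ k → co k * δc k)) ≡⟨ cong (Δ *_) (a-b≡0⇒a≡b (trans (cong (_- ∑ sq) (sym (∑-* 2ℚ (λ k → co k * δc k)))) diff0)) ⟩
        Δ * ∑ sq ∎
        where
        term : ∀ k → co k * E (Pc k) v ≡ Δ * (co k * δc k)
        term k with j₀ ~? k
        ... | yes h = trans (cong (co k *_) (Δδ h)) (solve 3 (λ c d s → c :* (d :* s) := d :* (c :* s)) refl (co k) Δ (δc k))
        ... | no h = trans (0ˡ (E (Pc k) v) (off h)) (sym (0ʳ Δ (0ˡ (δc k) (off h))))
        c² = λ k → co k * co k
        -- Summation by parts: 2x(x - y) - (x - y)² = x² - y², and the sum of co² is invariant under
        -- π.
        diff0 : ∑ (λ k → 2ℚ * (co k * δc k)) - ∑ sq ≡ 0ℚ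
        diff0 = trans (cong (∑ (λ k → 2ℚ * (co k * δc k)) +_) (sym (neg1 (∑ sq)))) (trans (sym (∑-lin (λ k → 2ℚ * (co k * δc k)) (- 1ℚ) sq (λ k → refl)))
          (trans (∑-lin c² (- 1ℚ) (λ k → c² (π k)) (λ k → solve 2 (λ x y → c2 :* (x :* (x :- y)) :+ (:- c1) :* ((x :- y) :* (x :- y)) := x :* x :+ (:- c1) :* (y :* y)) refl (co k) (co (π k))))
          (trans (cong (λ z → ∑ c² + (- 1ℚ) * z) (∑-permute c² π π⁻¹ π-π⁻¹ π⁻¹-π)) (solve 1 (λ x → x :+ (:- c1) :* x := c0) refl (∑ c²)))))

      sq≥0′ : ∀ k → 0ℚ ≤ sq k
      sq≥0′ k = sq≥0 (δc k)

      sq≥1 : ∀ {k} → δc k ≢ 0ℚ → 1ℚ ≤ sq k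
      sq≥1 {k} p = int>0 (int-* (δ-int′ k) (δ-int′ k)) (≥∧≢⇒> (sq≥0′ k) λ e → p ([ id , id ]′ (*-zero⊎ e)))

      abstract
        some : ∃ λ k → 0ℚ < co k
        some with Finₚ.any? (λ k → 0ℚ ℚₚ.<? co k)
        ... | yes p = p
        ... | no h = ⊥-elim (>⇒≢ D′>0 (trans (sym (norm (cand r))) (trans (cong (λ w → E w v) eqv) (trans (E-lincombˡ co v) (∑-zero λ k → 0ˡ (E (Pc k) v) (ℚₚ.≤-antisym (ℚₚ.≮⇒≥ λ q → h (k , q)) (co≥0 k)))))))

      abstract
        gap : ∃ λ k → j₀ ~ k × k ∉ S
        gap = nonfull-witness {S} {j₀} nf

      i₁ = proj₁ some
      k₀ = proj₁ gap

      k₀-zero : co k₀ ≡ 0ℚ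
      k₀-zero with co k₀ ℚₚ.≟ 0ℚ
      ... | yes e = e
      ... | no p = ⊥-elim (proj₂ (proj₂ gap) (proj₂ (supp k₀) p))

      j₀~i₁ : j₀ ~ i₁
      j₀~i₁ = orb i₁ (>⇒≢ (proj₂ some))

      i₁~k₀ : i₁ ~ k₀
      i₁~k₀ = ~-trans (~-sym j₀~i₁) (proj₁ (proj₂ gap))

      down-from : ∀ {P : Fin m → Set} → (∀ k → Dec (P k)) → ∀ {i} → j₀ ~ i → P i → ¬ P k₀ → ∃ λ j → j₀ ~ j × P j × ¬ P (π j)
      down-from P? h p q = let j , s , r = exit P? (~-trans (~-sym h) (proj₁ (proj₂ gap))) p q in j , ~-trans h s , r

      abstract
        end : ∃ λ j → j₀ ~ j × 0ℚ < co j × ¬ (0ℚ < co (π j))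
        end = down-from (λ k → 0ℚ ℚₚ.<? co k) j₀~i₁ (proj₂ some) (λ p → >⇒≢ p k₀-zero)

      abstract
        start : ∃ λ j → k₀ ~ j × co j ≡ 0ℚ × ¬ (co (π j) ≡ 0ℚ)
        start = exit (λ k → co k ℚₚ.≟ 0ℚ) (~-sym i₁~k₀) k₀-zero (>⇒≢ (proj₂ some))

      e a₁ : Fin m
      e = proj₁ end
      a₁ = proj₁ start

      πe-zero : co (π e) ≡ 0ℚ
      πe-zero = ℚₚ.≤-antisym (ℚₚ.≮⇒≥ (proj₂ (proj₂ (proj₂ end)))) (co≥0 (π e))

      δe>0 : 0ℚ < δc e
      δe>0 = np (proj₁ (proj₂ (proj₂ end))) (trans (cong (λ z → co e - z) πe-zero) (solve 1 (λ x → x :- c0 := x) refl (co e)))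

      δa<0 : 0ℚ < - δc a₁
      δa<0 = np (≥∧≢⇒> (co≥0 (π a₁)) (proj₂ (proj₂ (proj₂ start)))) (trans (cong (λ z → - (z - co (π a₁))) (proj₁ (proj₂ (proj₂ start)))) (solve 1 (λ x → :- (c0 :- x) := x) refl (co (π a₁))))

      e≢a₁ : e ≢ a₁
      e≢a₁ q = <-irr (ℚₚ.<-trans δe>0 (subst (λ k → δc k < 0ℚ) (sym q) (0<-⇒<0 δa<0)))

      j₀~a₁ : j₀ ~ a₁
      j₀~a₁ = ~-trans (proj₁ (proj₂ gap)) (proj₁ (proj₂ start))

      δa≢0 : δc a₁ ≢ 0ℚ
      δa≢0 z = >⇒≢ δa<0 (cong -_ z)

      abstract
        -- Two nonzero integral jumps give Σ δc² ≥ 2, hence D′ ≥ Δ. Conversely Δ times the size of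
        -- either jump is a positive multiple of D′, so 2 Δ D′ = Δ² Σ δc² ≥ 2 D′².
        D≡Δ : D′ ≡ Δ
        D≡Δ = ℚₚ.≤-antisym upper lower
          where
          two : sq e + sq a₁ ≤ ∑ sq
          two = ∑-two sq e a₁ e≢a₁ sq≥0′
          lower : Δ ≤ D′
          lower = by≤ {D′ - Δ} (*-cancel≥0 0<2 (nn (*≥0 (ℚₚ.<⇒≤ Δ>0) (+≥0 (≤⇒0≤ two) (+≥0 (≤⇒0≤ (sq≥1 (>⇒≢ δe>0))) (≤⇒0≤ (sq≥1 δa≢0)))))
            (trans (solve 2 (λ D Δ → c2 :* (D :- Δ) := c2 :* D :- c2 :* Δ) refl D′ Δ) (trans (cong (_- 2ℚ * Δ) norm-sum)
            (solve 4 (λ Δ s x y → Δ :* s :- c2 :* Δ := Δ :* ((s :- (x :+ y)) :+ ((x :- c1) :+ (y :- c1)))) refl Δ (∑ sq) (sq e) (sq a₁)))))) refl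
          big : ∀ {x} → 0ℚ < x → D′ ≤ x → 0ℚ ≤ x * x - D′ * D′
          big {x} p h = nn (*≥0 (≤⇒0≤ h) (+≥0 (ℚₚ.<⇒≤ p) (ℚₚ.<⇒≤ D′>0))) (solve 2 (λ x D → x :* x :- D :* D := (x :- D) :* (x :+ D)) refl x D′)
          Xe : 0ℚ ≤ (Δ * δc e) * (Δ * δc e) - D′ * D′
          Xe = big (*>0 Δ>0 δe>0) (mul>0 D′>0 (δ-mul (proj₁ (proj₂ end))) (*>0 Δ>0 δe>0))
          Xa : 0ℚ ≤ (Δ * (- δc a₁)) * (Δ * (- δc a₁)) - D′ * D′
          Xa = big (*>0 Δ>0 δa<0) (mul>0 D′>0 (subst (Mul D′) (ℚₚ.neg-distribʳ-* Δ (δc a₁)) (mul-neg (δ-mul j₀~a₁))) (*>0 Δ>0 δa<0))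
          upper : D′ ≤ Δ
          upper = by≤ {Δ - D′} (*-cancel≥0 (*>0 0<2 D′>0) (nn (+≥0 (*≥0 (*≥0 (ℚₚ.<⇒≤ Δ>0) (ℚₚ.<⇒≤ Δ>0)) (≤⇒0≤ two)) (+≥0 Xe Xa))
            (trans (solve 2 (λ D Δ → c2 :* D :* (Δ :- D) := Δ :* (c2 :* D) :- c2 :* (D :* D)) refl D′ Δ) (trans (cong (λ z → Δ * z - 2ℚ * (D′ * D′)) norm-sum)
            (solve 5 (λ Δ s x y D → Δ :* (Δ :* s) :- c2 :* (D :* D) := Δ :* Δ :* (s :- (x :* x :+ y :* y)) :+ ((Δ :* x) :* (Δ :* x) :- D :* D :+ ((Δ :* (:- y)) :* (Δ :* (:- y)) :- D :* D))) refl
              Δ (∑ sq) (δc e) (δc a₁) D′))))) refl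

        ∑sq : ∑ sq ≡ 2ℚ
        ∑sq = *-cancelˡ (>⇒≢ Δ>0) (trans (sym norm-sum) (trans (cong (2ℚ *_) D≡Δ) (ℚₚ.*-comm 2ℚ Δ)))

        others : ∀ k → e ≢ k → a₁ ≢ k → δc k ≡ 0ℚ
        others k p q = go (δc k ℚₚ.≟ 0ℚ)
          where
          three : sq e + (sq a₁ + sq k) ≤ ∑ sq
          three = ∑-three sq e a₁ k e≢a₁ p q sq≥0′
          strict : δc k ≢ 0ℚ → ∑ sq < sq e + (sq a₁ + sq k)
          strict z = by< (+>0 0<1 (+≥0 (≤⇒0≤ (sq≥1 (>⇒≢ δe>0))) (+≥0 (≤⇒0≤ (sq≥1 δa≢0)) (≤⇒0≤ (sq≥1 z)))))
              (trans (cong (λ s → sq e + (sq a₁ + sq k) - s) ∑sq) (solve 3 (λ x y z → x :+ (y :+ z) :- c2 := c1 :+ ((x :- c1) :+ ((y :- c1) :+ (z :- c1)))) refl (sq e) (sq a₁) (sq k)))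
          go : Dec (δc k ≡ 0ℚ) → δc k ≡ 0ℚ
          go (yes z) = z
          go (no z) = ⊥-elim (≤<⊥ three (strict z))

        one-of : ∀ {x y} → 1ℚ ≤ x → Int x → 1ℚ ≤ y → x * x + y ≤ 2ℚ → x ≡ 1ℚ
        one-of {x} {y} h i h′ s = ℚₚ.≤-antisym (by≤ {1ℚ - x} (*-cancel≥0 {1ℚ + x} (+>0 0<1 (ℚₚ.≤-trans 0≤1 h)) (nn (+≥0 (≤⇒0≤ s) (≤⇒0≤ h′)) (solve 2 (λ x y → (c1 :+ x) :* (c1 :- x) := c2 :- (x :* x :+ y) :+ (y :- c1)) refl x y))) refl) h

        δe≡1 : δc e ≡ 1ℚ
        δe≡1 = one-of {δc e} {sq a₁} (int>0 (δ-int′ e) δe>0) (δ-int′ e) (sq≥1 δa≢0) (subst (sq e + sq a₁ ≤_) ∑sq (∑-two sq e a₁ e≢a₁ sq≥0′))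

        δa≡-1 : - δc a₁ ≡ 1ℚ
        δa≡-1 = one-of { - δc a₁} {sq e} (int>0 (int-neg (δ-int′ a₁)) δa<0) (int-neg (δ-int′ a₁)) (sq≥1 (>⇒≢ δe>0))
          (subst₂ _≤_ (solve 2 (λ x y → x :* x :+ y :* y := (:- y) :* (:- y) :+ x :* x) refl (δc e) (δc a₁)) ∑sq (∑-two sq e a₁ e≢a₁ sq≥0′))

        jump′ : ∀ k → δc k ≡ unit e k - unit a₁ k
        jump′ k = go (e Fin.≟ k) (a₁ Fin.≟ k)
          where
          go : Dec (e ≡ k) → Dec (a₁ ≡ k) → δc k ≡ unit e k - unit a₁ k
          go (yes p) (yes q) = ⊥-elim (e≢a₁ (trans p (sym q)))
          go (yes p) (no q) = trans (trans (cong δc (sym p)) δe≡1) (sym (trans (cong₂ (λ x y → x - y) (trans (cong (unit e) (sym p)) (unit-same e)) (unit-diff q)) (ℚₚ.+-identityʳ 1ℚ)))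
          go (no p) (yes q) = trans (trans (cong δc (sym q)) (trans (solve 1 (λ x → x := :- (:- x)) refl (δc a₁)) (cong -_ δa≡-1))) (sym (trans (cong₂ (λ x y → x - y) (unit-diff p) (trans (cong (unit a₁) (sym q)) (unit-same a₁))) (ℚₚ.+-identityˡ (- 1ℚ))))
          go (no p) (no q) = trans (others k p q) (sym (trans (cong₂ (λ x y → x - y) (unit-diff p) (unit-diff q)) (ℚₚ.+-inverseʳ 0ℚ)))

        co-int : ∀ {k} → k₀ ~ k → Int (co k)
        co-int (t , q) = go t k₀ (subst Int (sym k₀-zero) int-0) q
          where
          go : ∀ t i → Int (co i) → ∀ {k} → iterF t i ≡ k → Int (co k)
          go zero i h refl = h
          go (suc t) i h q = go t (π i) (subst Int (solve 2 (λ x y → x :- (x :- y) := y) refl (co i) (co (π i))) (int-- h (δ-int′ i))) q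

        δ>0⇒e : ∀ {j} → 0ℚ < δc j → j ≡ e
        δ>0⇒e {j} h = go (e Fin.≟ j) (a₁ Fin.≟ j)
          where
          go : Dec (e ≡ j) → Dec (a₁ ≡ j) → j ≡ e
          go (yes q) _ = sym q
          go (no _) (yes q) = ⊥-elim (<-irr (ℚₚ.<-trans h (subst (λ k → δc k < 0ℚ) q (0<-⇒<0 δa<0))))
          go (no p) (no q) = ⊥-elim (>⇒≢ h (others j p q))

        co-e : co e ≡ 1ℚ
        co-e = trans (solve 2 (λ x y → x := (x :- y) :+ y) refl (co e) (co (π e))) (trans (cong₂ _+_ δe≡1 πe-zero) (ℚₚ.+-identityʳ 1ℚ))

        co≤1 : ∀ {k} → j₀ ~ k → co k ≤ 1ℚ
        co≤1 {k} h = ℚₚ.≮⇒≥ λ p → contra (down-from (λ k → 1ℚ ℚₚ.<? co k) h p (λ q → ≤<⊥ (≡⇒≤ k₀-zero) (ℚₚ.<-trans 0<1 q)))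
          where
          contra : (∃ λ j → j₀ ~ j × 1ℚ < co j × ¬ (1ℚ < co (π j))) → ⊥
          contra (j , _ , p , q) = <-irr (subst (1ℚ <_) (trans (cong co (δ>0⇒e (np (+>0 (<⇒0< p) (≤⇒0≤ (ℚₚ.≮⇒≥ q))) (solve 2 (λ x y → x :- y := x :- c1 :+ (c1 :- y)) refl (co j) (co (π j)))))) co-e) p)

        bit′ : ∀ k → co k ≡ 0ℚ ⊎ co k ≡ 1ℚ
        bit′ k = go (j₀ ~? k) (co k ℚₚ.≟ 0ℚ)
          where
          go : Dec (j₀ ~ k) → Dec (co k ≡ 0ℚ) → co k ≡ 0ℚ ⊎ co k ≡ 1ℚ
          go _ (yes z) = inj₁ z
          go (no h) (no _) = inj₁ (off h)
          go (yes h) (no z) = inj₂ (ℚₚ.≤-antisym (co≤1 h) (int>0 (co-int (~-trans (~-sym (proj₁ (proj₂ gap))) h)) (≥∧≢⇒> (co≥0 k) z)))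

      arc : Arc X
      arc = record { last = e ; prior = a₁ ; last≢prior = e≢a₁ ; bit = bit′ ; jump = jump′ ; D-v = trans (norm (cand r)) D≡Δ }

    -- Combinatorics of two arcs on a cycle.

    open CompatFormula (affine AD)

    -- A proper arc of a c-orbit: e is its last element and a precedes its first.
    record Cyc (S : Subset m) : Set where
      field
        j₀ e a₀ : Fin m
        e∈    : e ∈ S
        πe∉   : π e ∉ S
        a∉    : a₀ ∉ S
        πa∈   : π a₀ ∈ S
        leave : ∀ {k} → k ∈ S → π k ∉ S → k ≡ e
        enter : ∀ {k} → k ∉ S → π k ∈ S → k ≡ a₀
        orbS  : ∀ {k} → k ∈ S → j₀ ~ k

    same-orbit : ∀ {S} → Cyc S → ∀ {i k} → i ∈ S → k ∈ S → i ~ k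
    same-orbit C p q = ~-trans (~-sym (Cyc.orbS C p)) (Cyc.orbS C q)

    private
      _∈?_ = Subₚ._∈?_

      both? : ∀ (S S′ : Subset m) k → Dec (k ∈ S × k ∈ S′)
      both? S S′ k = (k ∈? S) ×-dec (k ∈? S′)

      minus? : ∀ (S S′ : Subset m) k → Dec (k ∈ S × k ∉ S′)
      minus? S S′ k = (k ∈? S) ×-dec ¬? (k ∈? S′)

      by : ∀ {P : Set} → Dec P → ¬ ¬ P → P
      by (yes p) _ = p
      by (no p) h = ⊥-elim (h p)

      subset-by : ∀ {S S′ : Subset m} → (∀ {k} → k ∈ S → k ∉ S′ → ⊥) → S ⊆ S′
      subset-by {S} {S′} h {k} p = by (k ∈? S′) (h p)

    module Two {S S′} (C : Cyc S) (C′ : Cyc S′) where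
      open Cyc C
      open Cyc C′ using () renaming (j₀ to j₀′; e to e′; a₀ to a′; e∈ to e′∈; πe∉ to πe′∉; a∉ to a′∉; πa∈ to πa′∈; leave to leave′; enter to enter′)

      leaving : ∀ {i k} → i ~ k → i ∈ S × i ∉ S′ → ¬ (k ∈ S × k ∉ S′) → ∃ λ j → j ∈ S × j ∉ S′ × (π j ∉ S ⊎ π j ∈ S′)
      leaving h p q = let j , _ , (r , t) , z = exit (minus? S S′) h p q in j , r , t , aux j z (π j ∈? S) (π j ∈? S′)
        where
        aux : ∀ j → ¬ (π j ∈ S × π j ∉ S′) → Dec (π j ∈ S) → Dec (π j ∈ S′) → π j ∉ S ⊎ π j ∈ S′
        aux j z (no x) _ = inj₁ x
        aux j z (yes x) (yes y) = inj₂ y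
        aux j z (yes x) (no y) = ⊥-elim (z (x , y))

      entering : ∀ {i k} → i ~ k → ¬ (i ∈ S × i ∉ S′) → k ∈ S × k ∉ S′ → ∃ λ j → (j ∉ S ⊎ j ∈ S′) × π j ∈ S × π j ∉ S′
      entering h p q = let j , _ , r , z = exit (λ x → ¬? (minus? S S′ x)) h p (λ z → z q) ; x , y = by (minus? S S′ (π j)) z in j , aux j r (j ∈? S) (j ∈? S′) , x , y
        where
        aux : ∀ j → ¬ (j ∈ S × j ∉ S′) → Dec (j ∈ S) → Dec (j ∈ S′) → j ∉ S ⊎ j ∈ S′
        aux j z (no x) _ = inj₁ x
        aux j z (yes x) (yes y) = inj₂ y
        aux j z (yes x) (no y) = ⊥-elim (z (x , y))

      -- Walking forward out of the part of S outside S′, one passes either the end of S or the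
      -- start of S′.
      minus-end : ∀ {k i} → k ∈ S → k ∉ S′ → k ~ i → ¬ (i ∈ S × i ∉ S′) → (e ∉ S′) ⊎ (a′ ∈ S)
      minus-end p q h z = let j , r , t , c = leaving h (p , q) z in
        [ (λ x → inj₁ (subst (_∉ S′) (leave r x) t)) , (λ y → inj₂ (subst (_∈ S) (enter′ t y) r)) ]′ c

      minus-start : ∀ {k i} → k ∈ S → k ∉ S′ → i ~ k → ¬ (i ∈ S × i ∉ S′) → (π a₀ ∉ S′) ⊎ (e′ ∈ S)
      minus-start p q h z = let j , c , r , t = entering h z (p , q) in aux j (j ∈? S) c r t
        where
        aux : ∀ j → Dec (j ∈ S) → (j ∉ S ⊎ j ∈ S′) → π j ∈ S → π j ∉ S′ → (π a₀ ∉ S′) ⊎ (e′ ∈ S)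
        aux j (no x) _ r t = inj₁ (subst (λ z → π z ∉ S′) (enter x r) t)
        aux j (yes x) (inj₁ y) r t = ⊥-elim (y x)
        aux j (yes x) (inj₂ y) r t = inj₂ (subst (_∈ S) (leave′ y t) x)

    module Cases {S S′} (C : Cyc S) (C′ : Cyc S′) where
      open Cyc C
      open Cyc C′ using () renaming (j₀ to j₀′; e to e′; a₀ to a′; e∈ to e′∈; πe∉ to πe′∉; a∉ to a′∉; πa∈ to πa′∈; leave to leave′; enter to enter′)
      private
        module P = Two C C′
        module R = Two C′ C

      a~πa : ∀ {k} → k ∈ S → k ~ a₀
      a~πa p = ~-trans (same-orbit C p πa∈) (π-~)

      disjoint-or-inside : a₀ ∉ S′ → π e ∉ S′ → (∀ {k} → k ∈ S → k ∉ S′) ⊎ S′ ⊆ S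
      disjoint-or-inside a∉′ πe∉′ with Finₚ.any? (both? S S′)
      ... | no h = inj₁ λ {k} p q → h (k , p , q)
      ... | yes (i , p , q) = inj₂ (subset-by λ {k} k∈′ k∉ → contra k∈′ k∉)
        where
        contra : ∀ {k} → k ∈ S′ → k ∉ S → ⊥
        contra {k} k∈′ k∉ = fin (R.minus-end k∈′ k∉ (same-orbit C′ k∈′ q) (λ z → proj₂ z p)) (R.leaving (same-orbit C′ k∈′ q) (k∈′ , k∉) (λ z → proj₂ z p))
          where
          e′∈S : e′ ∈ S
          e′∈S = aux (exit (both? S S′) (same-orbit C′ q k∈′) (p , q) (λ z → k∉ (proj₁ z)))
            where
            aux : (∃ λ j → i ~ j × (j ∈ S × j ∈ S′) × ¬ (π j ∈ S × π j ∈ S′)) → e′ ∈ S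
            aux (j , _ , (x , y) , z) = [ id , (λ u → ⊥-elim u) ]′ (go (π j ∈? S′) (π j ∈? S))
              where
              go : Dec (π j ∈ S′) → Dec (π j ∈ S) → e′ ∈ S ⊎ ⊥
              go (no u) _ = inj₁ (subst (_∈ S) (leave′ y u) x)
              go (yes u) (yes w) = inj₂ (z (w , u))
              go (yes u) (no w) = inj₂ (πe∉′ (subst (λ t → π t ∈ S′) (leave x w) u))
          fin : (e′ ∉ S) ⊎ (a₀ ∈ S′) → (∃ λ j → j ∈ S′ × j ∉ S × (π j ∉ S′ ⊎ π j ∈ S)) → ⊥
          fin (inj₁ u) _ = u e′∈S
          fin (inj₂ u) _ = a∉′ u

      inside-equal : a₀ ∉ S′ → e ∈ S′ → π a₀ ∈ S′ → S ⊆ S′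
      inside-equal a∉′ e∈′ πa∈′ = subset-by λ k∈ k∉′ → [ (λ u → u e∈′) , (λ u → a∉ (subst (_∈ S) (sym (enter′ a∉′ πa∈′)) u)) ]′ (P.minus-end k∈ k∉′ (same-orbit C k∈ e∈) (λ z → proj₂ z e∈′))

      cover-end : a₀ ∈ S′ → π e ∉ S′ → e ∈ S′ → S ⊆ S′
      cover-end a∈′ πe∉′ e∈′ = subset-by λ k∈ k∉′ → [ (λ u → u e∈′) , contra ]′ (P.minus-end k∈ k∉′ (same-orbit C k∈ e∈) (λ z → proj₂ z e∈′))
        where
        contra : ¬ (a′ ∈ S)
        contra a′∈ = aux (R.entering (same-orbit C′ e∈′ a∈′) (λ z → proj₂ z e∈) (a∈′ , a∉))
          where
          aux : (∃ λ j → (j ∉ S′ ⊎ j ∈ S) × π j ∈ S′ × π j ∉ S) → ⊥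
          aux (j , inj₂ x , y , z) = πe∉′ (subst (λ t → π t ∈ S′) (leave x z) y)
          aux (j , inj₁ x , y , z) = πe∉′ (subst (λ t → π t ∈ S′) (leave (subst (_∈ S) (sym (enter′ x y)) a′∈) z) y)

      cover-start : a₀ ∉ S′ → π e ∈ S′ → π a₀ ∈ S′ → S ⊆ S′
      cover-start a∉′ πe∈′ πa∈′ = subset-by λ k∈ k∉′ → [ (λ u → u πa∈′) , contra ]′ (P.minus-start k∈ k∉′ (same-orbit C πa∈ k∈) (λ z → proj₂ z πa∈′))
        where
        contra : ¬ (e′ ∈ S)
        contra e′∈ = [ (λ u → u e′∈) , a∉′ ]′ (R.minus-end πe∈′ πe∉ (same-orbit C′ πe∈′ πa∈′) (λ z → proj₂ z πa∈))

      -- Both outer neighbours of S also lie in S′ when two arcs jointly close up the cycle. A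
      -- vertex outside the union rules this out.
      cover-both : ¬ ComponentFull (S ∪ S′) → a₀ ∈ S′ → π e ∈ S′ → S ⊆ S′
      cover-both nf a∈′ πe∈′ = subset-by λ {k} k∈ k∉′ → contra k∈ k∉′
        where
        contra : ∀ {k} → k ∈ S → k ∉ S′ → ⊥
        contra {k} k∈ k∉′ = with-gap (nonfull-witness nf)
          where
          with-gap : (∃ λ l → j₀ ~ l × l ∉ S ∪ S′) → ⊥
          with-gap (l , j₀~l , l∉) = [ (λ u → a′∉S (subst (_∈ S) (enter′ u πe∈′) e∈)) , a′∉S ]′ (P.minus-end k∈ k∉′ (a~πa k∈) (λ z → proj₂ z a∈′))
            where
            l~k : l ~ k
            l~k = ~-trans (~-sym j₀~l) (orbS k∈)
            a′∉S : a′ ∉ S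
            a′∉S = aux (exit (λ x → ¬? (x ∈? (S ∪ S′))) l~k l∉ (λ z → z (Subₚ.x∈p∪q⁺ (inj₁ k∈))))
              where
              aux : (∃ λ j → l ~ j × j ∉ S ∪ S′ × ¬ (π j ∉ S ∪ S′)) → a′ ∉ S
              aux (j , _ , x , z) = [ (λ y → ⊥-elim (x (Subₚ.x∈p∪q⁺ (inj₂ (subst (_∈ S′) (sym (enter (λ w → x (Subₚ.x∈p∪q⁺ (inj₁ w))) y)) a∈′)))))
                                   , (λ y → subst (_∉ S) (enter′ (λ w → x (Subₚ.x∈p∪q⁺ (inj₂ w))) y) (λ w → x (Subₚ.x∈p∪q⁺ (inj₁ w)))) ]′ (Subₚ.x∈p∪q⁻ S S′ (by (π j ∈? (S ∪ S′)) z))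

    -- The vertices counted by adj are π e and a.
    module Count {S} (C : Cyc S) (S′ : Subset m) where
      open Cyc C

      T : Subset m
      T = ((pull π⁻¹ S ∪ pull π S) ∩ ∁ S) ∩ S′

      T-elim : ∀ {k} → k ∈ T → (k ≡ π e ⊎ k ≡ a₀) × k ∈ S′
      T-elim {k} h = let x , y = Subₚ.x∈p∩q⁻ ((pull π⁻¹ S ∪ pull π S) ∩ ∁ S) S′ h ; u , w = Subₚ.x∈p∩q⁻ (pull π⁻¹ S ∪ pull π S) (∁ S) x ; k∉ = Subₚ.x∈∁p⇒x∉p w in
        [ (λ p → inj₁ (trans (sym (π-π⁻¹ k)) (cong π (leave (∈-pull {π⁻¹} {S} p) (subst (_∉ S) (sym (π-π⁻¹ k)) k∉)))))
        , (λ p → inj₂ (enter k∉ (∈-pull {π} {S} p))) ]′ (Subₚ.x∈p∪q⁻ (pull π⁻¹ S) (pull π S) u) , y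

      πe∈T : π e ∈ S′ → π e ∈ T
      πe∈T h = Subₚ.x∈p∩q⁺ (Subₚ.x∈p∩q⁺ (Subₚ.x∈p∪q⁺ (inj₁ (pull-∈ {π⁻¹} {S} (subst (_∈ S) (sym (π⁻¹-π e)) e∈))) , Subₚ.x∉p⇒x∈∁p πe∉) , h)

      a∈T : a₀ ∈ S′ → a₀ ∈ T
      a∈T h = Subₚ.x∈p∩q⁺ (Subₚ.x∈p∩q⁺ (Subₚ.x∈p∪q⁺ (inj₂ (pull-∈ {π} {S} πa∈)) , Subₚ.x∉p⇒x∈∁p a∉) , h)

      private
        single : ∀ {x} → x ∈ T → (∀ {k} → k ∈ T → k ≡ x) → ℕ→ℚ ∣ T ∣ ≡ 1ℚ
        single {x} p h = cong ℕ→ℚ (trans (cong ∣_∣ (Subₚ.⊆-antisym {i = T} {j = Sub.⁅ x ⁆} (λ q → subst (_∈ Sub.⁅ x ⁆) (sym (h q)) (Subₚ.x∈⁅x⁆ x)) (λ q → subst (_∈ T) (sym (Subₚ.x∈⁅y⁆⇒x≡y x q)) p))) (Subₚ.∣⁅x⁆∣≡1 x))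

      count-0 : π e ∉ S′ → a₀ ∉ S′ → ℕ→ℚ ∣ T ∣ ≡ 0ℚ
      count-0 p q = cong ℕ→ℚ (trans (cong ∣_∣ (Subₚ.⊆-antisym {i = T} {j = Sub.⊥} (λ h → ⊥-elim (none (T-elim h))) (λ h → ⊥-elim (Subₚ.∉⊥ h)))) (Subₚ.∣⊥∣≡0 m))
        where
        none : ∀ {k} → (k ≡ π e ⊎ k ≡ a₀) × k ∈ S′ → ⊥
        none (inj₁ refl , h) = p h
        none (inj₂ refl , h) = q h

      count-e : π e ∈ S′ → a₀ ∉ S′ → ℕ→ℚ ∣ T ∣ ≡ 1ℚ
      count-e p q = single (πe∈T p) (λ h → go (T-elim h))
        where
        go : ∀ {k} → (k ≡ π e ⊎ k ≡ a₀) × k ∈ S′ → k ≡ π e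
        go (inj₁ r , _) = r
        go (inj₂ refl , h) = ⊥-elim (q h)

      count-a : π e ∉ S′ → a₀ ∈ S′ → ℕ→ℚ ∣ T ∣ ≡ 1ℚ
      count-a p q = single (a∈T q) (λ h → go (T-elim h))
        where
        go : ∀ {k} → (k ≡ π e ⊎ k ≡ a₀) × k ∈ S′ → k ≡ a₀
        go (inj₂ r , _) = r
        go (inj₁ refl , h) = ⊥-elim (p h)

    χ : Subset m → Fin m → ℚ
    χ S k = if ⌊ k ∈? S ⌋ then 1ℚ else 0ℚ

    χ-in : ∀ {S k} → k ∈ S → χ S k ≡ 1ℚ
    χ-in {S} {k} p with k ∈? S
    ... | yes _ = refl
    ... | no q = ⊥-elim (q p)

    χ-out : ∀ {S k} → k ∉ S → χ S k ≡ 0ℚ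
    χ-out {S} {k} p with k ∈? S
    ... | yes q = ⊥-elim (p q)
    ... | no _ = refl

    -- The values of the combinatorial compatibility degree, for sets instead of roots.
    CircS : Subset m → Subset m → ℚ → Set
    CircS S S′ q = (S ≡ S′ × q ≡ - 1ℚ) ⊎ (S ≢ S′ × (S ⊂ S′ ⊎ S′ ⊂ S) × q ≡ 0ℚ) ⊎ (S ≢ S′ × ¬ (S ⊂ S′ ⊎ S′ ⊂ S) × q ≡ adj S (pull π⁻¹ S) (pull π S) S′)

    -- What `compatMax` becomes on tube roots: the Euler form against an arc reads off differences
    -- of the other indicator at the two ends of the arc.
    maxform : ∀ {S} → Cyc S → Subset m → ℚ
    maxform C S′ = (χ S′ a₀ - χ S′ e) ⊔ (χ S′ (π e) - χ S′ (π a₀))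
      where open Cyc C

    -- The split is on the outer neighbours a₀ and π e of S first. If both lie in S′, so does S. If
    -- neither does, the arcs are disjoint or S′ lies in S. If just one does, the inner vertex next
    -- to it decides between containment and a proper overlap or adjacency of value 1.
    circ-nonfull : ∀ {S S′} (C : Cyc S) → Cyc S′ → ¬ ComponentFull (S ∪ S′) → CircS S S′ (maxform C S′)
    circ-nonfull {S} {S′} C C′ nf = go (a₀ ∈? S′) (π e ∈? S′) (e ∈? S′) (π a₀ ∈? S′)
      where
      open Cyc C
      open Cases C C′
      open Count C S′
      val4 : ∀ {w x y z} → χ S′ a₀ ≡ w → χ S′ e ≡ x → χ S′ (π e) ≡ y → χ S′ (π a₀) ≡ z → maxform C S′ ≡ (w - x) ⊔ (y - z)
      val4 refl refl refl refl = refl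
      ne-in : ∀ {k} → k ∈ S → k ∉ S′ → S ≢ S′
      ne-in {k} p q r = q (subst (k ∈_) r p)
      ne-out : ∀ {k} → k ∉ S → k ∈ S′ → S ≢ S′
      ne-out {k} p q r = p (subst (k ∈_) (sym r) q)
      incomparable : ∀ {k l} → k ∈ S → k ∉ S′ → l ∉ S → l ∈ S′ → ¬ (S ⊂ S′ ⊎ S′ ⊂ S)
      incomparable p q r t (inj₁ (h , _)) = q (h p)
      incomparable p q r t (inj₂ (h , _)) = r (h t)
      proper : ∀ {k} → S ⊆ S′ → k ∉ S → k ∈ S′ → maxform C S′ ≡ 0ℚ → CircS S S′ (maxform C S′)
      proper {k} h p q e = inj₂ (inj₁ (ne-out p q , inj₁ (h , k , q , p) , e))
      go : Dec (a₀ ∈ S′) → Dec (π e ∈ S′) → Dec (e ∈ S′) → Dec (π a₀ ∈ S′) → CircS S S′ (maxform C S′)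
      go (yes p) (yes q) _ _ = proper h a∉ p (val4 (χ-in p) (χ-in (h e∈)) (χ-in q) (χ-in (h πa∈)))
        where h = cover-both nf p q
      go (yes p) (no q) (yes r) _ = proper h a∉ p (val4 (χ-in p) (χ-in r) (χ-out q) (χ-in (h πa∈)))
        where h = cover-end p q r
      go (yes p) (no q) (no r) (yes t) = inj₂ (inj₂ (ne-in e∈ r , incomparable e∈ r a∉ p , trans (val4 (χ-in p) (χ-out r) (χ-out q) (χ-in t)) (sym (count-a q p))))
      go (yes p) (no q) (no r) (no t) = inj₂ (inj₂ (ne-in e∈ r , incomparable e∈ r a∉ p , trans (val4 (χ-in p) (χ-out r) (χ-out q) (χ-out t)) (sym (count-a q p))))
      go (no p) (yes q) _ (yes t) = proper h πe∉ q (val4 (χ-out p) (χ-in (h e∈)) (χ-in q) (χ-in t))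
        where h = cover-start p q t
      go (no p) (yes q) (yes r) (no t) = inj₂ (inj₂ (ne-in πa∈ t , incomparable πa∈ t πe∉ q , trans (val4 (χ-out p) (χ-in r) (χ-in q) (χ-out t)) (sym (count-e q p))))
      go (no p) (yes q) (no r) (no t) = inj₂ (inj₂ (ne-in πa∈ t , incomparable πa∈ t πe∉ q , trans (val4 (χ-out p) (χ-out r) (χ-in q) (χ-out t)) (sym (count-e q p))))
      go (no p) (no q) dr dt = [ disj , inside ]′ (disjoint-or-inside p q)
        where
        disj : (∀ {k} → k ∈ S → k ∉ S′) → CircS S S′ (maxform C S′)
        disj h = inj₂ (inj₂ (ne-in e∈ (h e∈) , incomparable e∈ (h e∈) (λ w → h w (Cyc.e∈ C′)) (Cyc.e∈ C′) , trans (val4 (χ-out p) (χ-out (h e∈)) (χ-out q) (χ-out (h πa∈))) (sym (count-0 q p))))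
        inside : S′ ⊆ S → CircS S S′ (maxform C S′)
        inside h = sub dr dt
          where
          sub : Dec (e ∈ S′) → Dec (π a₀ ∈ S′) → CircS S S′ (maxform C S′)
          sub (yes r) (yes t) = inj₁ (Subₚ.⊆-antisym (inside-equal p r t) h , val4 (χ-out p) (χ-in r) (χ-out q) (χ-in t))
          sub (no r) (yes t) = inj₂ (inj₁ (ne-in e∈ r , inj₂ (h , e , e∈ , r) , val4 (χ-out p) (χ-out r) (χ-out q) (χ-in t)))
          sub (yes r) (no t) = inj₂ (inj₁ (ne-in πa∈ t , inj₂ (h , π a₀ , πa∈ , t) , val4 (χ-out p) (χ-in r) (χ-out q) (χ-out t)))
          sub (no r) (no t) = inj₂ (inj₁ (ne-in e∈ r , inj₂ (h , e , e∈ , r) , val4 (χ-out p) (χ-out r) (χ-out q) (χ-out t)))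

    -- Tube roots, the members of Φ_c, and uniqueness in affine type.

    open Invariance SD

    κ : Kind
    κ = affine AD

    record Tube (v : V) : Set where
      field
        {D′} : ℚ
        treg : Reg D′ v
        S    : Subset m
        X    : Expansion v S
        nf   : ¬ ComponentFull S

      arc : Arc X
      arc = ToArc.arc treg X nf

    open Tube

    tube : ∀ {v} → InT v → Tube v
    tube (r , p , u , S , t , nf) = record { treg = reg (proj₂ (real⇒cand r)) p (InU⇒def u) ; S = S ; X = expansion t ; nf = nf }

    tube⁻¹ : ∀ {v} → Tube v → InT v
    tube⁻¹ T = cand⇒real SD (cand (treg T)) , posv (treg T) , def⇒InU (def0 (treg T)) , S T , tsupp (X T) , nf T

    tube-cox : ∀ {v} → Tube v → Tube (cox v)
    tube-cox T = record { treg = reg-cox (treg T) ; S = pull π⁻¹ (S T) ; X = expansion-cox (X T) ; nf = nf T ∘ full-pull⁻¹ }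

    tube-cox⁻¹ : ∀ {v} → Tube v → Tube (cox⁻¹ v)
    tube-cox⁻¹ T = record { treg = reg-cox⁻¹ (treg T) ; S = pull π (S T) ; X = expansion-cox⁻¹ (X T) ; nf = nf T ∘ full-pull }

    private
      bits : ∀ {x y} → x ≡ 0ℚ ⊎ x ≡ 1ℚ → y ≡ 0ℚ ⊎ y ≡ 1ℚ → x - y ≡ 1ℚ → x ≡ 1ℚ × y ≡ 0ℚ
      bits (inj₁ refl) (inj₁ refl) ()
      bits (inj₁ refl) (inj₂ refl) ()
      bits (inj₂ refl) (inj₁ refl) _ = refl , refl
      bits (inj₂ refl) (inj₂ refl) ()

      bits′ : ∀ {x y} → x ≡ 0ℚ ⊎ x ≡ 1ℚ → y ≡ 0ℚ ⊎ y ≡ 1ℚ → x - y ≡ - 1ℚ → x ≡ 0ℚ × y ≡ 1ℚ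
      bits′ (inj₁ refl) (inj₁ refl) ()
      bits′ (inj₁ refl) (inj₂ refl) _ = refl , refl
      bits′ (inj₂ refl) (inj₁ refl) ()
      bits′ (inj₂ refl) (inj₂ refl) ()

    module Membership {v} (T : Tube v) where
      open Expansion (X T)
      open Arc (arc T)

      in⇒1 : ∀ {k} → k ∈ S T → co k ≡ 1ℚ
      in⇒1 {k} p = [ (λ z → ⊥-elim (proj₁ (supp k) p z)) , id ]′ (bit k)

      1⇒in : ∀ {k} → co k ≡ 1ℚ → k ∈ S T
      1⇒in {k} e = proj₂ (supp k) (λ z → ℚₚ.1≢0 (trans (sym e) z))

      out⇒0 : ∀ {k} → k ∉ S T → co k ≡ 0ℚ
      out⇒0 {k} p = [ id , (λ e → ⊥-elim (p (1⇒in e))) ]′ (bit k)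

      0⇒out : ∀ {k} → co k ≡ 0ℚ → k ∉ S T
      0⇒out {k} e p = proj₁ (supp k) p e

      χ≡co : ∀ k → χ (S T) k ≡ co k
      χ≡co k = [ (λ z → trans (χ-out (0⇒out z)) (sym z)) , (λ z → trans (χ-in (1⇒in z)) (sym z)) ]′ (bit k)

      at-last : co last ≡ 1ℚ × co (π last) ≡ 0ℚ
      at-last = bits (bit last) (bit (π last)) (trans (jump last) (trans (cong₂ (λ x y → x - y) (unit-same last) (unit-diff (last≢prior ∘ sym))) (ℚₚ.+-identityʳ 1ℚ)))

      at-prior : co prior ≡ 0ℚ × co (π prior) ≡ 1ℚ
      at-prior = bits′ (bit prior) (bit (π prior)) (trans (jump prior) (trans (cong₂ (λ x y → x - y) (unit-diff last≢prior) (unit-same prior)) (ℚₚ.+-identityˡ (- 1ℚ))))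

      only-last : ∀ {k} → co k ≡ 1ℚ → co (π k) ≡ 0ℚ → k ≡ last
      only-last {k} p q = go (last Fin.≟ k)
        where
        go : Dec (last ≡ k) → k ≡ last
        go (yes e) = sym e
        go (no h) = ⊥-elim (≤<⊥ (0≤-⇒≤0 (nn (unit≥0 prior k) (trans (cong -_ (trans (sym (cong₂ (λ x y → x - y) p q)) (trans (jump k) (cong (_- unit prior k) (unit-diff h))))) (solve 1 (λ u → :- (c0 :- u) := u) refl (unit prior k))))) 0<1)

      only-prior : ∀ {k} → co k ≡ 0ℚ → co (π k) ≡ 1ℚ → k ≡ prior
      only-prior {k} p q = go (prior Fin.≟ k)
        where
        go : Dec (prior ≡ k) → k ≡ prior
        go (yes e) = sym e
        go (no h) = ⊥-elim (≤<⊥ (nn (unit≥0 last k) (trans (sym (cong₂ (λ x y → x - y) p q)) (trans (jump k) (trans (cong (λ z → unit last k - z) (unit-diff h)) (solve 1 (λ u → u :- c0 := u) refl (unit last k)))))) (->0 0<1))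

      cyc : Cyc (S T)
      cyc = record { j₀ = j₀ ; e = last ; a₀ = prior ; e∈ = 1⇒in (proj₁ at-last) ; πe∉ = 0⇒out (proj₂ at-last) ; a∉ = 0⇒out (proj₁ at-prior) ; πa∈ = 1⇒in (proj₂ at-prior)
        ; leave = λ p q → only-last (in⇒1 p) (out⇒0 q) ; enter = λ p q → only-prior (out⇒0 p) (in⇒1 q) ; orbS = λ {k} p → orb k (proj₁ (supp k) p) }

      D-last : D last ≡ D′ T
      D-last = trans (D-~ (Cyc.orbS cyc (Cyc.e∈ cyc))) (trans (sym D-v) (norm (cand (treg T))))

      D-prior : D prior ≡ D′ T
      D-prior = trans (sym (D-π prior)) (trans (D-~ (Cyc.orbS cyc (Cyc.πa∈ cyc))) (trans (sym D-v) (norm (cand (treg T)))))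

      -- By `jump`, E(`Pc k`,v) is nonzero only for k = `last` and k = `prior`.
      pairing : ∀ (c : Fin m → ℚ) → ∑ (λ k → c k * E (Pc k) v) ≡ D′ T * (c last - c prior)
      pairing c = trans (∑-lin (λ k → (c k * D k) * unit last k) (- 1ℚ) (λ k → (c k * D k) * unit prior k) (λ k → trans (cong (c k *_) (trans (cong (E (Pc k)) eqv) (trans (E-Pc k co) (cong (D k *_) (jump k)))))
          (solve 4 (λ c d u w → c :* (d :* (u :- w)) := c :* d :* u :+ (:- c1) :* (c :* d :* w)) refl (c k) (D k) (unit last k) (unit prior k))))
        (trans (cong₂ (λ x y → x + (- 1ℚ) * y) (trans (∑-unit (λ k → c k * D k) last) (cong (c last *_) D-last)) (trans (∑-unit (λ k → c k * D k) prior) (cong (c prior *_) D-prior)))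
        (solve 3 (λ x y d → x :* d :+ (:- c1) :* (y :* d) := d :* (x :- y)) refl (c last) (c prior) (D′ T)))

    real≢δ : ∀ {D v} → Cand D v → v ≢ δ
    real≢δ c refl = >⇒≢ (Q-pos c) (Q-δʳ δ)

    real-wt : ∀ {D v} → Cand D v → Wt (inv D) v
    real-wt c = cand-wt κ c (real≢δ c)

    compat-tube : ∀ {α β} (T : Tube α) (T′ : Tube β) → compatMax κ α β ≡ maxform (Membership.cyc T) (S T′)
    compat-tube {α} {β} T T′ = trans (cm-pos (real-wt (cand (treg T))) (inv>0 D>0′) (posv (treg T)) (posv (treg T′))) (cong₂ _⊔_ first second)
      where
      D>0′ = Cand.D>0 (cand (treg T))
      open Expansion (X T′) using () renaming (co to co′; eqv to eqv′)
      open Arc (arc T)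
      χ≡ = Membership.χ≡co T′
      scale : ∀ x → inv (D′ T) * (D′ T * x) ≡ x
      scale x = trans (sym (ℚₚ.*-assoc (inv (D′ T)) (D′ T) x)) (1ˡ x (inv-* (>⇒≢ D>0′)))
      first : inv (D′ T) * (- E β α) ≡ χ (S T′) prior - χ (S T′) last
      first = trans (cong (λ z → inv (D′ T) * (- z)) (trans (cong (λ w → E w α) eqv′) (trans (E-lincombˡ co′ α) (Membership.pairing T co′))))
        (trans (solve 4 (λ r d x y → r :* (:- (d :* (x :- y))) := r :* (d :* (y :- x))) refl (inv (D′ T)) (D′ T) (co′ last) (co′ prior)) (trans (scale (co′ prior - co′ last)) (cong₂ (λ x y → x - y) (sym (χ≡ prior)) (sym (χ≡ last)))))
      -- Serre duality turns -E(α,β) into E(β,c α). Reindexing the expansion of β by π then moves c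
      -- back off α.
      second : inv (D′ T) * (- E α β) ≡ χ (S T′) (π last) - χ (S T′) (π prior)
      second = trans (cong (inv (D′ T) *_) (trans (sym (E-cox α β)) (trans (cong (λ w → E w (cox α)) eqv′) (trans (E-lincombˡ co′ (cox α)) (trans (sym (∑-permute (λ k → co′ k * E (Pc k) (cox α)) π π⁻¹ π-π⁻¹ π⁻¹-π))
          (trans (∑-cong λ k → cong (co′ (π k) *_) (trans (cong (λ w → E w (cox α)) (sym (cox-Pc k))) (E-cox-inv (Pc k) α))) (Membership.pairing T (co′ ∘ π))))))))
        (trans (scale (co′ (π last) - co′ (π prior))) (cong₂ (λ x y → x - y) (sym (χ≡ (π last))) (sym (χ≡ (π prior)))))

    circ-value : ∀ (S S′ : Subset m) → ∃ λ q → CircS S S′ q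
    circ-value S S′ = go (Vecₚ.≡-dec Bool._≟_ S S′) (S Subₚ.⊂? S′) (S′ Subₚ.⊂? S)
      where
      go : Dec (S ≡ S′) → Dec (S ⊂ S′) → Dec (S′ ⊂ S) → ∃ λ q → CircS S S′ q
      go (yes e) _ _ = - 1ℚ , inj₁ (e , refl)
      go (no p) (yes q) _ = 0ℚ , inj₂ (inj₁ (p , inj₁ q , refl))
      go (no p) (no _) (yes q) = 0ℚ , inj₂ (inj₁ (p , inj₂ q , refl))
      go (no p) (no q) (no r) = adj S (pull π⁻¹ S) (pull π S) S′ , inj₂ (inj₂ (p , [ q , r ]′ , refl))

    circ-unique : ∀ {S S′ q q′} → CircS S S′ q → CircS S S′ q′ → q ≡ q′
    circ-unique (inj₁ (e , p)) (inj₁ (_ , q)) = trans p (sym q)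
    circ-unique (inj₁ (e , _)) (inj₂ (inj₁ (h , _))) = ⊥-elim (h e)
    circ-unique (inj₁ (e , _)) (inj₂ (inj₂ (h , _))) = ⊥-elim (h e)
    circ-unique (inj₂ (inj₁ (h , _))) (inj₁ (e , _)) = ⊥-elim (h e)
    circ-unique (inj₂ (inj₂ (h , _))) (inj₁ (e , _)) = ⊥-elim (h e)
    circ-unique (inj₂ (inj₁ (_ , _ , p))) (inj₂ (inj₁ (_ , _ , q))) = trans p (sym q)
    circ-unique (inj₂ (inj₁ (_ , h , _))) (inj₂ (inj₂ (_ , h′ , _))) = ⊥-elim (h′ h)
    circ-unique (inj₂ (inj₂ (_ , h′ , _))) (inj₂ (inj₁ (_ , h , _))) = ⊥-elim (h′ h)
    circ-unique (inj₂ (inj₂ (_ , _ , p))) (inj₂ (inj₂ (_ , _ , q))) = trans p (sym q)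

    private
      bit-value : Bool → ℚ
      bit-value b = if b then 1ℚ else 0ℚ

      card-sum : ∀ {m} (T : Subset m) → ℕ→ℚ ∣ T ∣ ≡ ∑ (λ k → bit-value (lookup T k))
      card-sum Vec.[] = refl
      card-sum (true Vec.∷ T) = trans (ℕ→ℚ-suc ∣ T ∣) (cong (1ℚ +_) (card-sum T))
      card-sum (false Vec.∷ T) = trans (card-sum T) (sym (ℚₚ.+-identityˡ (∑ (λ k → bit-value (lookup T k)))))

      set-ext : ∀ {S S′ : Subset m} → (∀ k → lookup S k ≡ lookup S′ k) → S ≡ S′
      set-ext {S} {S′} h = trans (sym (Vecₚ.tabulate∘lookup S)) (trans (Vecₚ.tabulate-cong h) (Vecₚ.tabulate∘lookup S′))

      pull-! : ∀ p S k → lookup (pull p S) k ≡ lookup S (p k)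
      pull-! p S k = Vecₚ.lookup∘tabulate (λ k → lookup S (p k)) k

      pull-∩ : ∀ p S S′ → pull p (S ∩ S′) ≡ pull p S ∩ pull p S′
      pull-∩ p S S′ = set-ext λ k → trans (pull-! p (S ∩ S′) k) (trans (Vecₚ.lookup-zipWith _∧_ (p k) S S′) (sym (trans (Vecₚ.lookup-zipWith _∧_ k (pull p S) (pull p S′)) (cong₂ _∧_ (pull-! p S k) (pull-! p S′ k)))))

      pull-∪ : ∀ p S S′ → pull p (S ∪ S′) ≡ pull p S ∪ pull p S′
      pull-∪ p S S′ = set-ext λ k → trans (pull-! p (S ∪ S′) k) (trans (Vecₚ.lookup-zipWith Bool._∨_ (p k) S S′) (sym (trans (Vecₚ.lookup-zipWith Bool._∨_ k (pull p S) (pull p S′)) (cong₂ Bool._∨_ (pull-! p S k) (pull-! p S′ k)))))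

      pull-∁ : ∀ p S → pull p (∁ S) ≡ ∁ (pull p S)
      pull-∁ p S = set-ext λ k → trans (pull-! p (∁ S) k) (trans (Vecₚ.lookup-map (p k) not S) (sym (trans (Vecₚ.lookup-map k not (pull p S)) (cong not (pull-! p S k)))))

      pull-inv : ∀ p q S → (∀ k → p (q k) ≡ k) → pull q (pull p S) ≡ S
      pull-inv p q S h = set-ext λ k → trans (pull-! q (pull p S) k) (trans (pull-! p S (q k)) (cong (lookup S) (h k)))

      adj-pull : ∀ S S′ → adj (pull π⁻¹ S) (pull π⁻¹ (pull π⁻¹ S)) (pull π (pull π⁻¹ S)) (pull π⁻¹ S′) ≡ adj S (pull π⁻¹ S) (pull π S) S′
      adj-pull S S′ = trans (cong (λ T → ℕ→ℚ ∣ T ∣) eq) (trans (card-sum (pull π⁻¹ T₀)) (trans (∑-cong λ k → cong bit-value (pull-! π⁻¹ T₀ k))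
          (trans (∑-permute (λ k → bit-value (lookup T₀ k)) π⁻¹ π π⁻¹-π π-π⁻¹) (sym (card-sum T₀)))))
        where
        T₀ = ((pull π⁻¹ S ∪ pull π S) ∩ ∁ S) ∩ S′
        eq : ((pull π⁻¹ (pull π⁻¹ S) ∪ pull π (pull π⁻¹ S)) ∩ ∁ (pull π⁻¹ S)) ∩ pull π⁻¹ S′ ≡ pull π⁻¹ T₀
        eq = sym (trans (pull-∩ π⁻¹ ((pull π⁻¹ S ∪ pull π S) ∩ ∁ S) S′) (cong (_∩ pull π⁻¹ S′) (trans (pull-∩ π⁻¹ (pull π⁻¹ S ∪ pull π S) (∁ S)) (cong₂ _∩_
          (trans (pull-∪ π⁻¹ (pull π⁻¹ S) (pull π S)) (cong (pull π⁻¹ (pull π⁻¹ S) ∪_) (trans (pull-inv π π⁻¹ S π-π⁻¹) (sym (pull-inv π⁻¹ π S π⁻¹-π)))))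
          (pull-∁ π⁻¹ S)))))

      pull-⊂ : ∀ (p q : Fin m → Fin m) {S S′} → (∀ k → p (q k) ≡ k) → S ⊂ S′ → pull p S ⊂ pull p S′
      pull-⊂ p q {S} {S′} h (s , x , x∈ , x∉) = (λ {k} r → pull-∈ {p} {S′} (s (∈-pull {p} {S} r))) , q x , pull-∈ {p} {S′} (subst (_∈ S′) (sym (h x)) x∈) , λ r → x∉ (subst (_∈ S) (h x) (∈-pull {p} {S} r))

    circ-pull : ∀ {S S′ q} → CircS S S′ q → CircS (pull π⁻¹ S) (pull π⁻¹ S′) q
    circ-pull {S} {S′} {q} = go
      where
      back′ : ∀ {S S′} → pull π⁻¹ S ⊂ pull π⁻¹ S′ → S ⊂ S′
      back′ {S} {S′} h = subst₂ _⊂_ (pull-inv π⁻¹ π S π⁻¹-π) (pull-inv π⁻¹ π S′ π⁻¹-π) (pull-⊂ π π⁻¹ π-π⁻¹ h)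
      ne : S ≢ S′ → pull π⁻¹ S ≢ pull π⁻¹ S′
      ne h e = h (trans (sym (pull-inv π⁻¹ π S π⁻¹-π)) (trans (cong (pull π) e) (pull-inv π⁻¹ π S′ π⁻¹-π)))
      go : CircS S S′ q → CircS (pull π⁻¹ S) (pull π⁻¹ S′) q
      go (inj₁ (e , p)) = inj₁ (cong (pull π⁻¹) e , p)
      go (inj₂ (inj₁ (h , r , p))) = inj₂ (inj₁ (ne h , [ inj₁ ∘ pull-⊂ π⁻¹ π π⁻¹-π , inj₂ ∘ pull-⊂ π⁻¹ π π⁻¹-π ]′ r , p))
      go (inj₂ (inj₂ (h , r , p))) = inj₂ (inj₂ (ne h , (λ z → r ([ inj₁ ∘ back′ , inj₂ ∘ back′ ]′ z)) , trans p (sym (adj-pull S S′))))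

    supp-eq : ∀ {α β} (T : Tube α) (T′ : Tube β) → S T ≡ S T′ → α ≡ β
    supp-eq T T′ e = trans (Expansion.eqv (X T)) (trans (lincomb-cong λ k → trans (sym (Membership.χ≡co T k)) (trans (cong (λ S → χ S k) e) (Membership.χ≡co T′ k))) (sym (Expansion.eqv (X T′))))

    eq-supp : ∀ {α β} (T : Tube α) (T′ : Tube β) → α ≡ β → S T ≡ S T′
    eq-supp T T′ refl = supp-unique (cand (treg T)) (X T) (X T′)

    circ⇒compat : ∀ {α β q} (T : Tube α) (T′ : Tube β) → CircS (S T) (S T′) q → CompatCirc α β q
    circ⇒compat T T′ c = S T , S T′ , pull π⁻¹ (S T) , pull π (S T) , tsupp (X T) , tsupp (X T′) , tsupp (expansion-cox (X T)) , tsupp (expansion-cox⁻¹ (X T)) , go c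
      where
      go : ∀ {q} → CircS (S T) (S T′) q → _
      go (inj₁ (e , p)) = inj₁ (supp-eq T T′ e , p)
      go (inj₂ (inj₁ (h , r , p))) = inj₂ (inj₁ (h ∘ eq-supp T T′ , r , p))
      go (inj₂ (inj₂ (h , r , p))) = inj₂ (inj₂ (h ∘ eq-supp T T′ , r , p))

    compat⇒circ : ∀ {α β q} (T : Tube α) (T′ : Tube β) → CompatCirc α β q → CircS (S T) (S T′) q
    compat⇒circ {α} {β} {q} T T′ (Sα , Sβ , Sc , Sc′ , tα , tβ , tc , tc′ , c) = go (supp-unique cα (expansion tα) (X T)) (supp-unique (cand (treg T′)) (expansion tβ) (X T′))
        (supp-unique (cand-cox cα) (expansion tc) (expansion-cox (X T))) (supp-unique (cand-cox⁻¹ cα) (expansion tc′) (expansion-cox⁻¹ (X T))) c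
      where
      cα = cand (treg T)
      go : Sα ≡ S T → Sβ ≡ S T′ → Sc ≡ pull π⁻¹ (S T) → Sc′ ≡ pull π (S T) →
        ((α ≡ β × q ≡ - 1ℚ) ⊎ (α ≢ β × (Sα ⊂ Sβ ⊎ Sβ ⊂ Sα) × q ≡ 0ℚ) ⊎ (α ≢ β × ¬ (Sα ⊂ Sβ ⊎ Sβ ⊂ Sα) × q ≡ adj Sα Sc Sc′ Sβ)) → CircS (S T) (S T′) q
      go refl refl refl refl (inj₁ (e , p)) = inj₁ (eq-supp T T′ e , p)
      go refl refl refl refl (inj₂ (inj₁ (h , r , p))) = inj₂ (inj₁ (h ∘ supp-eq T T′ , r , p))
      go refl refl refl refl (inj₂ (inj₂ (h , r , p))) = inj₂ (inj₂ (h ∘ supp-eq T T′ , r , p))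

    full? : ∀ S → Dec (ComponentFull S)
    full? S with Finₚ.any? (λ j → Finₚ.all? (λ k → (j ~? k) →-dec (k Subₚ.∈? S)))
    ... | yes (j , h) = yes (j , λ k c → h k (Conn⇒~ c))
    ... | no h = no λ (j , g) → h (j , λ k r → g k (Conn-~ r))

    -- If the union of the supports is component-full, neither support contains the other, since
    -- each alone is not full; this leaves the adjacency count. Otherwise `circ-nonfull` and
    -- `compat-tube` compare with the maximum.
    circ⇒Compat : ∀ {α β q} (T : Tube α) (T′ : Tube β) → CircS (S T) (S T′) q → Compat κ α β q
    circ⇒Compat {α} {β} {q} T T′ c = go (full? (S T ∪ S T′))
      where
      union-sub : ∀ {S S′ : Subset m} → S ⊆ S′ → S ∪ S′ ≡ S′
      union-sub {S} {S′} h = Subₚ.⊆-antisym (λ r → [ h , id ]′ (Subₚ.x∈p∪q⁻ S S′ r)) (Subₚ.q⊆p∪q S S′)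
      on-full : ComponentFull (S T ∪ S T′) → CircS (S T) (S T′) q → q ≡ adj (S T) (pull π⁻¹ (S T)) (pull π (S T)) (S T′)
      on-full f (inj₁ (e , _)) = ⊥-elim (nf T′ (subst ComponentFull (union-sub (λ r → subst (_ ∈_) e r)) f))
      on-full f (inj₂ (inj₁ (_ , inj₁ (h , _) , _))) = ⊥-elim (nf T′ (subst ComponentFull (union-sub h) f))
      on-full f (inj₂ (inj₁ (_ , inj₂ (h , _) , _))) = ⊥-elim (nf T (subst ComponentFull (trans (Subₚ.∪-comm (S T) (S T′)) (union-sub h)) f))
      on-full f (inj₂ (inj₂ (_ , _ , p))) = p
      go : Dec (ComponentFull (S T ∪ S T′)) → Compat κ α β q
      go (yes f) = inj₁ (S T , S T′ , pull π⁻¹ (S T) , pull π (S T) , tube⁻¹ T , tube⁻¹ T′ , tsupp (X T) , tsupp (X T′) , tsupp (expansion-cox (X T)) , tsupp (expansion-cox⁻¹ (X T)) , f , on-full f c)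
      go (no f) = inj₂ ((λ (_ , _ , Sα , Sβ , tα , tβ , f′) → f (subst₂ (λ U W → ComponentFull (U ∪ W)) (supp-unique (cand (treg T)) (expansion tα) (X T)) (supp-unique (cand (treg T′)) (expansion tβ) (X T′)) f′))
        , trans (circ-unique c (circ-nonfull (Membership.cyc T) (Membership.cyc T′) f)) (sym (compat-tube T T′)))

    data NonTube : V → Set where
      neg  : ∀ k → NonTube (-V αs k)
      nz   : ∀ {D v} → Cand D v → Pos v → def v ≢ 0ℚ → NonTube v
      null : NonTube δ

    Member : V → Set
    Member v = NonTube v ⊎ Tube v

    null-def : ∀ t → def (t ·V δ) ≡ 0ℚ
    null-def t = trans (E-·ʳ t δ δ) (0ʳ t def-δ)

    member : ∀ {v} → InΦc κ v → Member v
    member (inj₁ (i , refl)) = inj₁ (neg i)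
    member (inj₂ (inj₁ (inj₁ r , p , u))) = inj₁ (nz (proj₂ (real⇒cand r)) p (u ∘ def⇒InU))
    member (inj₂ (inj₁ (inj₂ (k , _ , refl) , p , u))) = ⊥-elim (u (def⇒InU (null-def (ℤ→ℚ k))))
    member (inj₂ (inj₂ (inj₁ t))) = inj₂ (tube t)
    member (inj₂ (inj₂ (inj₂ refl))) = inj₁ null

    member⁻¹ : ∀ {v} → Member v → InΦc κ v
    member⁻¹ (inj₁ (neg k)) = inj₁ (k , refl)
    member⁻¹ (inj₁ (nz c p h)) = inj₂ (inj₁ (inj₁ (cand⇒real SD c) , p , h ∘ InU⇒def))
    member⁻¹ (inj₁ null) = inj₂ (inj₂ (inj₂ refl))
    member⁻¹ (inj₂ T) = inj₂ (inj₂ (inj₁ (tube⁻¹ T)))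

    not-tube : ∀ {v} → NonTube v → ¬ (Pos v × def v ≡ 0ℚ × v ≢ δ)
    not-tube (neg k) (p , _) = pos≢neg p k refl
    not-tube (nz _ _ h) (_ , e , _) = h e
    not-tube null (_ , _ , h) = h refl

    nontube-InT : ∀ {v} → NonTube v → ¬ InT v
    nontube-InT x t = let T = tube t in not-tube x (posv (treg T) , def0 (treg T) , real≢δ (cand (treg T)))

    -- By symmetrizability the vector with coordinates δ^∨_i / d_i lies in the kernel of K, which is
    -- the line through δ.
    δᵛ-scale : ∃ λ t → 0ℚ < t × (∀ i → ℕ→ℚ (δᵛN i) ≡ t * (d i * δ ! i))
    δᵛ-scale = t , t>0 , eq
      where
      u : V
      u = tabulate (λ i → ℕ→ℚ (δᵛN i) * inv (d i))
      u-! : ∀ i → u ! i ≡ ℕ→ℚ (δᵛN i) * inv (d i)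
      u-! i = Vecₚ.lookup∘tabulate (λ i → ℕ→ℚ (δᵛN i) * inv (d i)) i
      du : ∀ i → d i * u ! i ≡ ℕ→ℚ (δᵛN i)
      du i = trans (cong (d i *_) (u-! i)) (trans (solve 3 (λ d x r → d :* (x :* r) := x :* (r :* d)) refl (d i) (ℕ→ℚ (δᵛN i)) (inv (d i))) (1ʳ (ℕ→ℚ (δᵛN i)) (inv-* (>⇒≢ (d-pos i)))))
      Qu : ∀ i → Q (αs i) u ≡ 0ℚ
      Qu i = trans (Q-α i u) (trans (sym (∑-* (d i) (λ j → a i j * u ! j))) (trans (∑-cong λ j → trans (sym (ℚₚ.*-assoc (d i) (a i j) (u ! j))) (trans (cong (_* u ! j) (symm i j))
        (trans (solve 3 (λ d a u → d :* a :* u := a :* (d :* u)) refl (d j) (a j i) (u ! j)) (cong (a j i *_) (du j))))) (δᵛ-ker i)))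
      t = u ! i₀ * inv (δ ! i₀)
      u≡ : u ≡ t ·V δ
      u≡ = kernel u (trans (Q-exp u u) (∑-zero λ i → 0ʳ (u ! i) (Qu i)))
      eq : ∀ i → ℕ→ℚ (δᵛN i) ≡ t * (d i * δ ! i)
      eq i = trans (sym (du i)) (trans (cong (d i *_) (trans (cong (_! i) u≡) (·V-! t δ i))) (solve 3 (λ d t x → d :* (t :* x) := t :* (d :* x)) refl (d i) t (δ ! i)))
      t>0 : 0ℚ < t
      t>0 = *-cancel>0 (*>0 (d-pos i₀) (δ>0 i₀)) (subst (0ℚ <_) (trans (eq i₀) (ℚₚ.*-comm t (d i₀ * δ ! i₀))) (ℤ→ℚ-mono-< {pos 0} {pos (δᵛN i₀)} (ℤ.+<+ (δᵛ-pos i₀))))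

    null-wt : Wt (proj₁ δᵛ-scale) δ
    null-wt i = go (δ ≟V δ) refl
      where
      go : (dec : Dec (δ ≡ δ)) → (δ ≟V δ) ≡ dec → corootC κ δ i ≡ proj₁ δᵛ-scale * (d i * δ ! i)
      go (no h) _ = ⊥-elim (h refl)
      go (yes _) e rewrite e = proj₂ (proj₂ δᵛ-scale) i

    τ-δ : τ δ ≡ δ
    τ-δ = go L
      where
      go : ∀ l → foldr σ δ l ≡ δ
      go [] = refl
      go (k ∷ l) = trans (cong (σ k) (go l)) (trans (σ-pos δ-Pos) (s-0 k (δ-ker k)))

    cox-δ : cox δ ≡ δ
    cox-δ = cl-δ L

    record Next (v : V) : Set where
      field
        {w}  : ℚ
        {v′} : V
        w>0  : 0ℚ < w
        wt   : Wt w v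
        wt′  : Wt w v′
        stepv : Step w v v′
        τv   : τ v ≡ v′

    tube-τ : ∀ {v} → Tube v → τ v ≡ cox v
    tube-τ T = τ-regular (cand (treg T)) (posv (treg T)) (≡⇒≤ (sym (def0 (treg T))))

    next-tube : ∀ {v} → Tube v → Next v
    next-tube {v} T = record { w>0 = inv>0 (Cand.D>0 (cand (treg T))) ; wt = real-wt (cand (treg T)) ; wt′ = real-wt (cand (treg (tube-cox T)))
      ; stepv = Step.move (posv (treg T)) (posv (treg (tube-cox T))) ; τv = tube-τ T }

    el-of : ∀ {v} → NonTube v → v ≡ δ ⊎ (∃ λ D → El D v)
    el-of (neg k) = inj₂ (d k , neg k)
    el-of (nz c p _) = inj₂ (_ , pos c p)
    el-of null = inj₁ refl

    next-nontube : ∀ {v} → NonTube v → Next v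
    next-nontube {v} x = [ (λ { refl → record { w>0 = proj₁ (proj₂ δᵛ-scale) ; wt = null-wt ; wt′ = subst (Wt (proj₁ δᵛ-scale)) (sym cox-δ) null-wt
          ; stepv = Step.move δ-Pos (subst Pos (sym cox-δ) δ-Pos) ; τv = trans τ-δ (sym cox-δ) } })
      , (λ (D′ , x′) → let v′ , s , e , y = next x′ in record { w>0 = inv>0 (Cand.D>0 (el-cand x′)) ; wt = real-wt (el-cand x′) ; wt′ = real-wt (el-cand y) ; stepv = s ; τv = e }) ]′ (el-of x)

    τ-nontube : ∀ {v} → NonTube v → NonTube (τ v)
    τ-nontube (neg k) = let l₁ , l₂ , sp = split-at k in subst NonTube (sym (τ-negα sp)) (nz (cand-cl l₁ (cand-α k)) (proj-pos sp) (>⇒≢ (def-p sp)))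
    τ-nontube (nz {v = v} c p h) = [ (λ (e , q) → subst NonTube (sym e) (nz (cand-cox c) q (λ z → h (trans (sym (def-cox v)) z))))
      , (λ (_ , k , _ , _ , _ , e) → subst NonTube (sym e) (neg k)) ]′ (τ-pos c p)
    τ-nontube null = subst NonTube (sym τ-δ) null

    τ-tube : ∀ {v} → Tube v → Tube (τ v)
    τ-tube T = subst Tube (sym (tube-τ T)) (tube-cox T)

    τ-member : ∀ {v} → Member v → Member (τ v)
    τ-member = [ inj₁ ∘ τ-nontube , inj₂ ∘ τ-tube ]′

    closed : ∀ {v} → InΦc κ v → InΦc κ (τ v)
    closed = member⁻¹ ∘ τ-member ∘ member

    private
      el-nontube : ∀ {D u v} → El D u → τ u ≡ v → NonTube v → NonTube u
      el-nontube (neg k) _ _ = neg k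
      el-nontube {u = u} (pos c p) refl x = go (def u ℚₚ.≟ 0ℚ)
        where
        go : Dec (def u ≡ 0ℚ) → NonTube u
        go (no h) = nz c p h
        go (yes e) = ⊥-elim (not-tube x (subst (λ w → Pos w × def w ≡ 0ℚ × w ≢ δ) (sym (τ-regular c p (≡⇒≤ (sym e))))
          (cox-pos c p (≡⇒≤ (sym e)) , trans (def-cox u) e , real≢δ (cand-cox c))))

      surj-nontube : ∀ {v} → NonTube v → ∃ λ u → Member u × τ u ≡ v
      surj-nontube x = [ (λ { refl → δ , inj₁ null , τ-δ }) , (λ (_ , y) → let u , z , e = prev y in u , inj₁ (el-nontube z e x) , e) ]′ (el-of x)

      surj-tube : ∀ {v} → Tube v → ∃ λ u → Member u × τ u ≡ v
      surj-tube {v} T = cox⁻¹ v , inj₂ (tube-cox⁻¹ T) , trans (tube-τ (tube-cox⁻¹ T)) (cox-cox⁻¹ v)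

    surj : ∀ {v} → InΦc κ v → ∃ λ u → InΦc κ u × τ u ≡ v
    surj φ = let u , x , e = [ surj-nontube , surj-tube ]′ (member φ) in u , member⁻¹ x , e

    compat-τ : ∀ {α β} → Next α → Next β → compatMax κ α β ≡ compatMax κ (τ α) (τ β)
    compat-τ N N′ = trans (invariant (Next.w>0 N) (Next.wt N) (Next.wt′ N) (Next.stepv N) (Next.stepv N′)) (sym (cong₂ (compatMax κ) (Next.τv N) (Next.τv N′)))

    next-member : ∀ {v} → Member v → Next v
    next-member = [ next-nontube , next-tube ]′

    compat-P6 : P6 κ (compatMax κ)
    compat-P6 α β φα φβ = compat-τ (next-member (member φα)) (next-member (member φβ))

    compat-P1 : P1 κ (compatMax κ)
    compat-P1 i β _ = cm-neg {inv (d i)} β (real-wt (cand-neg (cand-α i))) (inv-d i)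

    compat-P2 : P2 κ (compatMax κ)
    compat-P2 i β _ = cm-negʳ i β

    private
      compat-zero : ∀ {w α β} → Wt w α → 0ℚ < w → Pos α → Pos β → E β α ≡ 0ℚ → E α β ≡ 0ℚ → compatMax κ α β ≡ 0ℚ
      compat-zero {w} wt w>0 pα pβ e e′ = trans (cm-pos wt w>0 pα pβ) (trans (cong₂ (λ x y → (w * (- x)) ⊔ (w * (- y))) e e′)
        (trans (ℚₚ.⊔-idem (w * (- 0ℚ))) (solve 1 (λ w → w :* (:- c0) := c0) refl w)))

      E-δ0 : ∀ {v} → def v ≡ 0ℚ → E v δ ≡ 0ℚ
      E-δ0 {v} e = trans (E-δʳ v) (cong -_ e)

    compat-P4 : ∀ {α} → Tube α ⊎ α ≡ δ → compatMax κ δ α ≡ 0ℚ × compatMax κ α δ ≡ 0ℚ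
    compat-P4 (inj₁ T) = compat-zero null-wt (proj₁ (proj₂ δᵛ-scale)) δ-Pos (posv (treg T)) (E-δ0 (def0 (treg T))) (def0 (treg T))
      , compat-zero (real-wt (cand (treg T))) (inv>0 (Cand.D>0 (cand (treg T)))) (posv (treg T)) δ-Pos (def0 (treg T)) (E-δ0 (def0 (treg T)))
    compat-P4 (inj₂ refl) = z , z
      where z = compat-zero null-wt (proj₁ (proj₂ δᵛ-scale)) δ-Pos δ-Pos def-δ def-δ

    reach : ∀ {D v} → Cand D v → Pos v → def v ≢ 0ℚ → Reach (InΦc κ) v
    reach {D} {v} c p h with ℚₚ.<-cmp (def v) 0ℚ
    ... | tri< lt _ _ = let t , np′ = escape-cox v lt in reach-fwd t c p np′
    ... | tri≈ _ e _ = ⊥-elim (h e)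
    ... | tri> _ _ gt = let t , np′ = escape-cox⁻¹ v gt in
          reach-bwd (λ v → 0ℚ < def v) (λ k → member⁻¹ (inj₁ (neg k))) (λ c p h → member⁻¹ (inj₁ (nz c p (>⇒≢ h)))) (λ u h → subst (0ℚ <_) (def-cox u) h) t c p gt np′

    reach-nontube : ∀ {v} → NonTube v → Reach (InΦc κ) v ⊎ v ≡ δ
    reach-nontube (neg k) = inj₁ (base k)
    reach-nontube (nz c p h) = inj₁ (reach c p h)
    reach-nontube null = inj₂ refl

    -- `Left` carries the first argument to -Π and `Right` the second. If neither can be carried
    -- there, both are tube roots or δ, and their values are prescribed by `P3` and `P4`.
    unique : ∀ f → Props κ f → AgreesWithCompat κ f
    unique f (p1 , p2 , p3 , p4 , p6) α β φα φβ = go (member φα) (member φβ)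
      where
      module Left = Unique (InΦc κ) closed surj f (compatMax κ) (λ k v φ → trans (p1 k v φ) (sym (compat-P1 k v φ))) p6 compat-P6
      module Right = Unique (InΦc κ) closed surj (λ u v → f v u) (λ u v → compatMax κ v u) (λ k v φ → trans (p2 k v φ) (sym (compat-P2 k v φ))) (λ u v φ ψ → p6 v u ψ φ) (λ u v φ ψ → compat-P6 v u ψ φ)
      P4δ : ∀ {v} → Tube v ⊎ v ≡ δ → (f δ v ≡ 0ℚ) × (f v δ ≡ 0ℚ)
      P4δ (inj₁ T) = p4 _ (inj₁ (tube⁻¹ T))
      P4δ (inj₂ e) = p4 _ (inj₂ e)
      δ-left : Tube β ⊎ β ≡ δ → α ≡ δ → f α β ≡ compatMax κ α β
      δ-left x refl = trans (proj₁ (P4δ x)) (sym (proj₁ (compat-P4 x)))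
      δ-right : Tube α ⊎ α ≡ δ → β ≡ δ → f α β ≡ compatMax κ α β
      δ-right x refl = trans (proj₂ (P4δ x)) (sym (proj₂ (compat-P4 x)))
      go : Member α → Member β → Compat κ α β (f α β)
      go (inj₂ T) (inj₂ T′) = circ⇒Compat T T′ (compat⇒circ T T′ (p3 α β (tube⁻¹ T) (tube⁻¹ T′)))
      go (inj₁ x) (inj₁ y) = inj₂ ((λ (t , _) → nontube-InT x t) ,
        [ (λ r → Left.reach-agree r φα β φβ) , (λ e → [ (λ r → Right.reach-agree r φβ α φα) , (λ e′ → δ-left (inj₂ e′) e) ]′ (reach-nontube y)) ]′ (reach-nontube x))
      go (inj₁ x) (inj₂ T′) = inj₂ ((λ (t , _) → nontube-InT x t) , [ (λ r → Left.reach-agree r φα β φβ) , δ-left (inj₁ T′) ]′ (reach-nontube x))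
      go (inj₂ T) (inj₁ y) = inj₂ ((λ (_ , t , _) → nontube-InT y t) , [ (λ r → Right.reach-agree r φβ α φα) , δ-right (inj₁ T) ]′ (reach-nontube y))

    -- Existence: the support of a root in a tube can be found by a finite search.

    Found : V → Subset m → Set
    Found v S = v ≡ lincomb (χ S) × ∃ λ j → ∀ k → k ∈ S → j ~ k

    -- Consists of decidable conditions only. They hold for tube roots and fail for all other
    -- members of Φ_c, which is the distinction `degree` has to make.
    Candidate : V → Set
    Candidate v = (Pos v × def v ≡ 0ℚ × v ≢ δ) × ∃ λ S → Found v S

    abstract
      find : ∀ v → Dec (Candidate v)
      find v = (Finₚ.all? (λ i → 0ℚ ℚₚ.≤? v ! i) ×-dec (def v ℚₚ.≟ 0ℚ ×-dec ¬? (v ≟V δ)))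
        ×-dec Subₚ.anySubset? (λ S → (v ≟V lincomb (χ S)) ×-dec Finₚ.any? (λ j → Finₚ.all? (λ k → (k Subₚ.∈? S) →-dec (j ~? k))))

    found-expansion : ∀ {v S} → Found v S → Expansion v S
    found-expansion {v} {S} (e , j , h) = record { j₀ = j ; co = χ S ; orb = λ k p → h k (in-χ k p) ; eqv = e ; supp = λ k → (λ p z → ℚₚ.1≢0 (trans (sym (χ-in p)) z)) , in-χ k }
      where
      in-χ : ∀ k → χ S k ≢ 0ℚ → k ∈ S
      in-χ k p with k Subₚ.∈? S
      ... | yes q = q
      ... | no q = ⊥-elim (p refl)

    tube-candidate : ∀ {v} → Tube v → Candidate v
    tube-candidate T = (posv (treg T) , def0 (treg T) , real≢δ (cand (treg T))) , S T ,
      trans (Expansion.eqv (X T)) (lincomb-cong λ k → sym (Membership.χ≡co T k)) , Expansion.j₀ (X T) , λ k p → Expansion.orb (X T) k (proj₁ (Expansion.supp (X T) k) p)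

    value : ∀ {α β} → Dec (Candidate α) → Dec (Candidate β) → ℚ
    value (yes (_ , S , _)) (yes (_ , S′ , _)) = proj₁ (circ-value S S′)
    value {α} {β} _ _ = compatMax κ α β

    degree : V → V → ℚ
    degree α β = value (find α) (find β)

    degree-tubes : ∀ {α β} (T : Tube α) (T′ : Tube β) → CircS (S T) (S T′) (degree α β)
    degree-tubes {α} {β} T T′ = go (find α) (find β)
      where
      go : (x : Dec (Candidate α)) (y : Dec (Candidate β)) → CircS (S T) (S T′) (value x y)
      go (no h) _ = ⊥-elim (h (tube-candidate T))
      go (yes _) (no h) = ⊥-elim (h (tube-candidate T′))
      go (yes (_ , S₁ , F)) (yes (_ , S₂ , F′)) = subst₂ (λ U W → CircS U W (proj₁ (circ-value S₁ S₂))) (supp-unique (cand (treg T)) (found-expansion F) (X T)) (supp-unique (cand (treg T′)) (found-expansion F′) (X T′)) (proj₂ (circ-value S₁ S₂))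

    degree-left : ∀ {α} → NonTube α → ∀ β → degree α β ≡ compatMax κ α β
    degree-left {α} x β = go (find α) (find β)
      where
      go : (x′ : Dec (Candidate α)) (y : Dec (Candidate β)) → value x′ y ≡ compatMax κ α β
      go (yes (c , _)) _ = ⊥-elim (not-tube x c)
      go (no _) _ = refl

    degree-right : ∀ {β} → NonTube β → ∀ α → degree α β ≡ compatMax κ α β
    degree-right {β} y α = go (find α) (find β)
      where
      go : (x : Dec (Candidate α)) (y′ : Dec (Candidate β)) → value x y′ ≡ compatMax κ α β
      go (no _) _ = refl
      go (yes _) (yes (c , _)) = ⊥-elim (not-tube y c)
      go (yes _) (no _) = refl

    degree-P6 : P6 κ degree
    degree-P6 α β φα φβ = go (member φα) (member φβ)
      where
      max-inv = compat-P6 α β φα φβ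
      go : Member α → Member β → degree α β ≡ degree (τ α) (τ β)
      go (inj₁ x) _ = trans (degree-left x β) (trans max-inv (sym (degree-left (τ-nontube x) (τ β))))
      go (inj₂ _) (inj₁ y) = trans (degree-right y α) (trans max-inv (sym (degree-right (τ-nontube y) (τ α))))
      go (inj₂ T) (inj₂ T′) = trans (circ-unique (circ-pull (degree-tubes T T′)) (degree-tubes (tube-cox T) (tube-cox T′))) (sym (cong₂ degree (tube-τ T) (tube-τ T′)))

    degree-props : Props κ degree
    degree-props = (λ i β φ → trans (degree-left (neg i) β) (compat-P1 i β φ)) , (λ i β φ → trans (degree-right (neg i) β) (compat-P2 i β φ))
      , (λ α β t t′ → circ⇒compat (tube t) (tube t′) (degree-tubes (tube t) (tube t′)))
      , (λ α x → let z , z′ = compat-P4 (lift x) in trans (degree-left null α) z , trans (degree-right null α) z′)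
      , degree-P6
      where
      lift : ∀ {α} → InT α ⊎ α ≡ δ → Tube α ⊎ α ≡ δ
      lift = [ inj₁ ∘ tube , inj₂ ]′

    result : (∃ λ f → Props κ f × AgreesWithCompat κ f) × (∀ f → Props κ f → AgreesWithCompat κ f)
    result = (degree , degree-props , unique degree degree-props) , unique

theorem4p6 : (n : ℕ) (A : Fin n → Fin n → ℤ) (d : Fin n → ℚ) →
    Setup.IsSymmetrizableCartan n A d →
    (κ : Setup.Kind n A d) → Setup.Valid n A d κ →
    (∃ λ (f : Setup.V n A d → Setup.V n A d → ℚ) →
        Setup.Props n A d κ f × Setup.AgreesWithCompat n A d κ f) ×
    (∀ (f : Setup.V n A d → Setup.V n A d → ℚ) →
        Setup.Props n A d κ f → Setup.AgreesWithCompat n A d κ f)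
theorem4p6 n A d IC Setup.finite FT = Cartan.FiniteType.result n A d IC FT
theorem4p6 n A d IC (Setup.affine D) (AT , val) = Cartan.AffineType.result n A d IC D AT val
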